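{- For every even integer $k\ge 4$, every integer $d$ with $k/2\le d\le k-1$ and every $\epsilon>0$ there exist $\gamma>0$ and $n_1$ such that for every $k$-graph $\mathcal{H}$ on $n\ge n_1$ vertices with $n\in \frac k2\mathbb N$ the following holds. If $\mathcal{H}$ is not $\epsilon$-close to any $\mathcal{B}_{n,k}$ or $\overline \mathcal{B}_{n,k}$ and $\delta_{d}(\mathcal{H}) \ge (\frac 12-\gamma) \binom{n-d}{k-d}$, then $\mathcal{H}$ contains a Hamilton $(k/2)$-cycle.
   Context: A $k$-graph has vertex set $V$ and edge set $E\subseteq\binom{V}{k}$; $\delta_d$ is the minimum number of edges containing a $d$-set, over all $d$-sets. A Hamilton $\ell$-cycle is a spanning subhypergraph whose vertices can be ordered cyclically so that each edge consists of $k$ consecutive vertices and consecutive edges share exactly $\ell$ vertices. For a partition $V=A\cup B$, a set is odd/even according to the parity of $|S\cap A|$; $\mathcal{B}_{n,k}(A,B)$ has as edges all odd $k$-subsets of $V$ and $\overline{\mathcal{B}}_{n,k}(A,B)$ all even $k$-subsets. We write $\mathcal{B}_{n,k}$ and $\overline{\mathcal{B}}_{n,k}$ for these hypergraphs with respect to some partition $V=A\cup B$ in which $|A|$ and $|B|$ differ by at most one (equal sizes). For $\epsilon>0$ and two $k$-graphs $\mathcal{H},\mathcal{H}'$ on $n$ vertices, $\mathcal{H}$ is $\epsilon$-close to $\mathcal{H}'$ if $\mathcal{H}$ can be made a copy of $\mathcal{H}'$ by adding and deleting at most $\epsilon n^k$ edges. -}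

module Defs where

open import Data.Nat as ℕ using (ℕ; zero; suc; _+_; _*_; _∸_; _^_; _≤_; _<_; _≡ᵇ_; _%_; NonZero)
import Data.Bool
open import Data.Bool using (Bool; true; false; _∧_; _∨_; _xor_; not; if_then_else_)
open import Data.Fin using (Fin; toℕ; fromℕ<)
open import Data.Fin.Subset using (Subset; ∣_∣; ⁅_⁆; _∩_; _∪_; ⊥)
open import Data.Fin.Permutation using (Permutation′; _⟨$⟩ʳ_; _⟨$⟩ˡ_)
open import Data.Vec using (Vec; []; _∷_; tabulate; lookup)
open import Data.List using (List; []; _∷_; map; _++_; length; filter)
open import Data.Product using (Σ; ∃; _×_; _,_)
open import Data.Integer using (+_)
open import Data.Rational using (ℚ; _/_) renaming (_≤_ to _≤ℚ_; _*_ to _*ℚ_)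
open import Relation.Binary.PropositionalEquality using (_≡_; subst; sym)
open import Data.Bool using (T)
open import Data.Unit using (tt)
import Data.Empty as Empty
open import Data.Nat.Properties using (≡ᵇ⇒≡)
open import Data.Nat.DivMod using (m%n<n)
open import Relation.Nullary using (¬_)
open import Function.Definitions using (Injective)

toℚ : ℕ → ℚ
toℚ m = + m / 1

allSubsets : (n : ℕ) → List (Subset n)
allSubsets zero = [] ∷ []
allSubsets (suc n) = map (true ∷_) (allSubsets n) ++ map (false ∷_) (allSubsets n)

countSets : {n : ℕ} → (Subset n → Bool) → ℕ
countSets {n} P = length (filter (λ S → P S Data.Bool.≟ true) (allSubsets n))

subsetB : {n : ℕ} → Subset n → Subset n → Bool
subsetB [] [] = true
subsetB (true ∷ D) (false ∷ S) = false
subsetB (_ ∷ D) (_ ∷ S) = subsetB D S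

record KGraph (n k : ℕ) : Set where
  field
    edge    : Subset n → Bool
    uniform : ∀ S → edge S ≡ true → ∣ S ∣ ≡ k
open KGraph public

degree : {n k : ℕ} → KGraph n k → Subset n → ℕ
degree H D = countSets (λ S → edge H S ∧ subsetB D S)

minDegAtLeast : {n k : ℕ} → KGraph n k → ℕ → ℚ → Set
minDegAtLeast {n} H d x = (D : Subset n) → ∣ D ∣ ≡ d → x ≤ℚ toℚ (degree H D)

image : {n : ℕ} → Permutation′ n → Subset n → Subset n
image π S = tabulate (λ v → lookup S (π ⟨$⟩ˡ v))

-- H is ε-close to H': H can be turned into a copy of H' by adding and deleting
-- at most ε n^k edges, i.e. there is a relabelling π of the vertices such that
-- H and π(H') differ in at most ε n^k edges.
εClose : {n k : ℕ} → ℚ → KGraph n k → KGraph n k → Set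
εClose {n} {k} ε H H' =
  ∃ λ (π : Permutation′ n) →
    toℚ (countSets (λ S → edge H S xor edge H' (image π S))) ≤ℚ (ε *ℚ toℚ (n ^ k))

oddB : ℕ → Bool
oddB zero = false
oddB (suc m) = not (oddB m)

sizeTest : (m k : ℕ) (b : Bool) → ((m ≡ᵇ k) ∧ b) ≡ true → m ≡ k
sizeTest m k b e with m ≡ᵇ k in eq
... | true = ≡ᵇ⇒≡ m k (subst T (sym eq) tt)
sizeTest m k b () | false

kSetsWith : (n k : ℕ) → (Subset n → Bool) → KGraph n k
kSetsWith n k P = record
  { edge = λ S → (∣ S ∣ ≡ᵇ k) ∧ P S
  ; uniform = λ S e → sizeTest ∣ S ∣ k (P S) e }

-- B_{n,k}(A, B), B = V ∖ A: all odd k-sets (|S ∩ A| odd)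
Bodd : (n k : ℕ) → Subset n → KGraph n k
Bodd n k A = kSetsWith n k (λ S → oddB ∣ S ∩ A ∣)

Beven : (n k : ℕ) → Subset n → KGraph n k
Beven n k A = kSetsWith n k (λ S → not (oddB ∣ S ∩ A ∣))

balanced : {n : ℕ} → Subset n → Set
balanced {n} A = (∣ A ∣ ≤ (n ∸ ∣ A ∣) + 1) × ((n ∸ ∣ A ∣) ≤ ∣ A ∣ + 1)

segment : {n : ℕ} .{{_ : NonZero n}} → (Fin n → Fin n) → ℕ → ℕ → Subset n
segment σ p zero = ⊥
segment {n} σ p (suc j) = ⁅ σ (fromℕ< (m%n<n (p + j) n)) ⁆ ∪ segment σ p j

HamiltonCycle : {n k : ℕ} → ℕ → KGraph n k → Set
HamiltonCycle {zero} ℓ H = Empty.⊥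
HamiltonCycle {n@(suc _)} {k} ℓ H =
  Σ ℕ λ m → (suc m * (k ∸ ℓ) ≡ n) ×
  Σ (Fin n → Fin n) λ σ → Injective _≡_ _≡_ σ ×
  ((i : ℕ) → i < suc m →
     (edge H (E σ i) ≡ true) ×
     (∣ E σ i ∩ E σ (suc i % suc m) ∣ ≡ ℓ))
  where
  E : (Fin n → Fin n) → ℕ → Subset n
  E σ i = segment σ (i * (k ∸ ℓ)) k

{-# OPTIONS --safe #-}

-- Blocks are ℓ-tuples of vertices, ℓ = k/2, adjacent when their union is an edge. A Hamilton ℓ-cycle is a cyclic order
-- of the vertices into consecutively adjacent blocks, and by the degree condition every block of distinct vertices is
-- adjacent to nearly half of all blocks. If two blocks S, T have few common walks S ~ X₁ ~ X₂ ~ X₃ ~ T, then adjacency is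
-- nearly the equality of two Boolean labels; being a symmetric function of 2ℓ vertices, it is then nearly the parity of
-- the number of vertices in some A, where |A| is nearly n/2, and H is close to B or its complement. So every two blocks
-- have many common walks, and a greedy choice with multiplicative weights yields a short path of disjoint gadgets, each
-- able to release three of its blocks, in which every pair S, T is bridged by the released blocks of many gadgets.
-- The other vertices are ordered into blocks with few non-adjacent consecutive pairs, each then repaired by its own
-- gadget. If neighbourhoods expand, random matchings between windows of blocks are improved two mismatches at a time.
-- Otherwise neighbours and non-neighbours of some S form a nearly complete bipartite graph, and blocks of the two kinds
-- can alternate after exchanges of vertices have made the kinds equally frequent.
module Submission where

module Development where

 open import Data.Nat.Base using (ℕ; zero; suc; _+_; _*_; _∸_; _^_; _≤_; _<_; _≤ᵇ_; z≤n; s≤s; s≤s⁻¹; NonZero; >-nonZero; _/_; _%_; _!; ∣_-_∣; _⊔_; _⊓_; ⌊_/2⌋; ⌈_/2⌉)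
 open import Data.Nat.Properties hiding (_≟_)
 open import Data.Nat.Tactic.RingSolver using (solve-∀)
 open import Data.Integer.Base as ℤ using (ℤ)
 import Data.Integer.Properties as ℤₚ
 import Data.Integer.Tactic.RingSolver as ℤSolver
 open import Data.Bool.Base using (Bool; true; false; _∧_; _∨_; _xor_; not; T; if_then_else_)
 import Data.Bool.Properties as Boolₚ
 open import Data.Fin.Base as Fin using (Fin; toℕ; fromℕ<)
 import Data.Fin.Properties as Finₚ
 open import Data.List.Base using (List; []; _∷_; _++_; length; map; concat; concatMap; allFin; cartesianProductWith; cartesianProduct; filterᵇ; tabulate; take; drop; zip)
 import Data.List.Properties as Listₚ
 open import Data.List.Membership.Propositional using (_∈_; _∉_)
 import Data.List.Membership.Propositional.Properties as Memₚ
 open import Data.List.Relation.Unary.Any using (here; there)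
 open import Data.List.Relation.Unary.All as All using (All; []; _∷_)
 import Data.List.Relation.Unary.All.Properties as Allₚ
 open import Data.List.Relation.Binary.Permutation.Propositional using (_↭_; ↭-refl; ↭-sym; ↭-trans; ↭-reflexive; prep; swap)
 import Data.List.Relation.Binary.Permutation.Propositional as Perm
 import Data.List.Relation.Binary.Permutation.Propositional.Properties as Permₚ
 open import Data.Product.Base using (∃-syntax; _×_; _,_; proj₁; proj₂)
 open import Data.Sum.Base using (_⊎_; inj₁; inj₂)
 open import Data.Empty using (⊥; ⊥-elim)
 open import Data.Unit.Base using (⊤; tt)
 open import Function.Base using (_∘_; id)
 open import Relation.Nullary using (¬_; Dec; yes; no; contradiction)
 open import Relation.Nullary.Decidable using (⌊_⌋)
 open import Relation.Binary.PropositionalEquality using (_≡_; _≢_; refl; sym; trans; cong; cong₂; subst; subst₂; _≗_; module ≡-Reasoning)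
 open import Data.Fin.Subset as Subset using (Subset; ∣_∣; ⁅_⁆; _∪_; _∩_)
 import Data.Fin.Subset.Properties as Subsetₚ
 open import Data.Vec.Base as Vec using (Vec; lookup)
 import Data.Vec.Properties as Vecₚ
 import Defs
 import Data.Bool
 import Data.Nat.Combinatorics as Comb
 open import Data.Nat.DivMod using (m%n<n; m<n⇒m%n≡m; [m+n]%n≡m%n; n%n≡0; m≡m%n+[m/n]*n; m/n*n≡m)
 open import Data.Nat.Divisibility using (_∣_; divides)
 open import Data.Fin.Permutation using () renaming (id to idₚ)
 open import Data.Rational.Base as ℚ using (ℚ; mkℚ; 0ℚ; ½)
 import Data.Rational.Properties as ℚₚ
 open import Data.Rational.Unnormalised.Base as ℚᵘ using (ℚᵘ; mkℚᵘ; *≤*)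
 import Data.Rational.Unnormalised.Properties as ℚᵘₚ
 open Defs using (subsetB; allSubsets; toℚ; HamiltonCycle; KGraph; image; balanced; segment; εClose; Bodd; Beven; minDegAtLeast)
 open Listₚ using (length-++; length-map; ++-assoc; take++drop≡id; ++-identityʳ; concat-++; length-tabulate; map-∘)
 open Permₚ using (++⁺ˡ; ++⁺ʳ; ++-comm; ∈-resp-↭; ↭-length; shifts; All-resp-↭)
 open Memₚ using (∈-map⁻; ∈-map⁺; ∈-cartesianProduct⁻; ∈-cartesianProduct⁺; ∈-cartesianProductWith⁻; ∈-filter⁺; ∈-++⁺ʳ; ∈-++⁺ˡ)

 ι : Bool → ℕ
 ι true = 1
 ι false = 0

 ι≤1 : ∀ b → ι b ≤ 1
 ι≤1 true = ≤-refl
 ι≤1 false = z≤n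

 ι-∧ : ∀ a b → ι (a ∧ b) ≡ ι a * ι b
 ι-∧ true b = sym (+-identityʳ _)
 ι-∧ false b = refl

 ι-true : ∀ {b} → b ≡ true → 1 ≤ ι b
 ι-true refl = ≤-refl

 true-ι : ∀ {b} → 0 < ι b → b ≡ true
 true-ι {true} _ = refl

 ∧-true : ∀ {a b} → a ∧ b ≡ true → a ≡ true × b ≡ true
 ∧-true {true} {true} _ = refl , refl

 _∧ₜ_ : ∀ {a b} → a ≡ true → b ≡ true → a ∧ b ≡ true
 refl ∧ₜ refl = refl

 not-true : ∀ {b} → not b ≡ true → b ≡ false
 not-true {false} _ = refl

 not-false : ∀ {b} → b ≡ false → not b ≡ true
 not-false refl = refl

 T⇒≡ : ∀ {b} → T b → b ≡ true
 T⇒≡ {true} _ = refl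

 Bool^_⇒ℕ : ℕ → Set
 Bool^ zero ⇒ℕ = ℕ
 Bool^ suc m ⇒ℕ = Bool → Bool^ m ⇒ℕ

 everywhere≤ᵇ : ∀ m → Bool^ m ⇒ℕ → Bool^ m ⇒ℕ → Bool
 everywhere≤ᵇ zero f g = f ≤ᵇ g
 everywhere≤ᵇ (suc m) f g = everywhere≤ᵇ m (f true) (g true) ∧ everywhere≤ᵇ m (f false) (g false)

 Everywhere≤ : ∀ m → Bool^ m ⇒ℕ → Bool^ m ⇒ℕ → Set
 Everywhere≤ zero f g = f ≤ g
 Everywhere≤ (suc m) f g = ∀ b → Everywhere≤ m (f b) (g b)

 truth-table : ∀ m f g → T (everywhere≤ᵇ m f g) → Everywhere≤ m f g
 truth-table zero f g t = ≤ᵇ⇒≤ f g t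
 truth-table (suc m) f g t b with everywhere≤ᵇ m (f true) (g true) in e
 truth-table (suc m) f g t true | true = truth-table m (f true) (g true) (subst T (sym e) tt)
 truth-table (suc m) f g t false | true = truth-table m (f false) (g false) t

 -- A multiple A ≤ B of the hypotheses and a slack s reduce L ≤ R to a semiring equation.
 linear : ∀ {L R A B} s → A ≤ B → L + B + s ≡ R + A → L ≤ R
 linear {L} {R} {A} {B} s A≤B e = +-cancelʳ-≤ B L R (begin
  L + B ≤⟨ m≤m+n _ s ⟩
  L + B + s ≡⟨ e ⟩
  R + A ≤⟨ +-monoʳ-≤ R A≤B ⟩
  R + B ∎)
  where open ≤-Reasoning

 ≤-≡-trans : ∀ {a b c} → a ≤ b → b ≡ c → a ≤ c
 ≤-≡-trans h refl = h

 ≡-≤-trans : ∀ {a b c} → a ≡ b → b ≤ c → a ≤ c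
 ≡-≤-trans refl h = h

 *-exchange : ∀ a b c → a * (b * c) ≡ b * (a * c)
 *-exchange = solve-∀

 *-pos : ∀ {a b} → 0 < a → 0 < b → 0 < a * b
 *-pos {suc a} {suc b} _ _ = s≤s z≤n

 ^-pos : ∀ {a} j → 0 < a → 0 < a ^ j
 ^-pos zero _ = s≤s z≤n
 ^-pos (suc j) p = *-pos p (^-pos j p)

 *-cancelˡ-pos : ∀ c {a b} → 0 < c → c * a ≤ c * b → a ≤ b
 *-cancelˡ-pos (suc c) _ = *-cancelˡ-≤ (suc c)

 module _ {A : Set} where

  ∑ : List A → (A → ℕ) → ℕ
  ∑ [] f = 0
  ∑ (x ∷ xs) f = f x + ∑ xs f

  ∑-cong : ∀ xs {f g : A → ℕ} → f ≗ g → ∑ xs f ≡ ∑ xs g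
  ∑-cong [] e = refl
  ∑-cong (x ∷ xs) e = cong₂ _+_ (e x) (∑-cong xs e)

  ∑-cong∈ : ∀ xs {f g : A → ℕ} → (∀ {x} → x ∈ xs → f x ≡ g x) → ∑ xs f ≡ ∑ xs g
  ∑-cong∈ [] e = refl
  ∑-cong∈ (x ∷ xs) e = cong₂ _+_ (e (here refl)) (∑-cong∈ xs (e ∘ there))

  ∑-mono : ∀ xs {f g : A → ℕ} → (∀ x → f x ≤ g x) → ∑ xs f ≤ ∑ xs g
  ∑-mono [] e = z≤n
  ∑-mono (x ∷ xs) e = +-mono-≤ (e x) (∑-mono xs e)

  ∑-mono∈ : ∀ xs {f g : A → ℕ} → (∀ {x} → x ∈ xs → f x ≤ g x) → ∑ xs f ≤ ∑ xs g
  ∑-mono∈ [] e = z≤n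
  ∑-mono∈ (x ∷ xs) e = +-mono-≤ (e (here refl)) (∑-mono∈ xs (e ∘ there))

  ∑-+ : ∀ xs (f g : A → ℕ) → ∑ xs (λ x → f x + g x) ≡ ∑ xs f + ∑ xs g
  ∑-+ [] f g = refl
  ∑-+ (x ∷ xs) f g = trans (cong (f x + g x +_) (∑-+ xs f g)) (interchange (f x) (g x) (∑ xs f) (∑ xs g))
   where
   interchange : ∀ a b c d → a + b + (c + d) ≡ a + c + (b + d)
   interchange = solve-∀

  ∑-*ˡ : ∀ xs c (f : A → ℕ) → ∑ xs (λ x → c * f x) ≡ c * ∑ xs f
  ∑-*ˡ [] c f = sym (*-zeroʳ c)
  ∑-*ˡ (x ∷ xs) c f = trans (cong (c * f x +_) (∑-*ˡ xs c f)) (sym (*-distribˡ-+ c (f x) _))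

  ∑-*ʳ : ∀ xs c (f : A → ℕ) → ∑ xs (λ x → f x * c) ≡ ∑ xs f * c
  ∑-*ʳ xs c f = trans (∑-cong xs (λ x → *-comm (f x) c)) (trans (∑-*ˡ xs c f) (*-comm c _))

  ∑-const : ∀ (xs : List A) c → ∑ xs (λ _ → c) ≡ length xs * c
  ∑-const [] c = refl
  ∑-const (x ∷ xs) c = cong (c +_) (∑-const xs c)

  ∑-1 : ∀ (xs : List A) → ∑ xs (λ _ → 1) ≡ length xs
  ∑-1 xs = trans (∑-const xs 1) (*-identityʳ _)

  ∑-0 : ∀ (xs : List A) → ∑ xs (λ _ → 0) ≡ 0
  ∑-0 xs = trans (∑-const xs 0) (*-zeroʳ (length xs))

  ∑-++ : ∀ xs ys (f : A → ℕ) → ∑ (xs ++ ys) f ≡ ∑ xs f + ∑ ys f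
  ∑-++ [] ys f = refl
  ∑-++ (x ∷ xs) ys f = trans (cong (f x +_) (∑-++ xs ys f)) (sym (+-assoc (f x) _ _))

  ∑-↭ : ∀ {xs ys} (f : A → ℕ) → xs ↭ ys → ∑ xs f ≡ ∑ ys f
  ∑-↭ f Perm.refl = refl
  ∑-↭ f (prep x p) = cong (f x +_) (∑-↭ f p)
  ∑-↭ f (swap {xs} {ys} x y p) = trans (cong (λ s → f x + (f y + s)) (∑-↭ f p)) (exchange (f x) (f y) (∑ ys f))
   where
   exchange : ∀ a b c → a + (b + c) ≡ b + (a + c)
   exchange = solve-∀
  ∑-↭ f (Perm.trans p q) = trans (∑-↭ f p) (∑-↭ f q)

  ∑-≤-const : ∀ xs {f : A → ℕ} c → (∀ x → f x ≤ c) → ∑ xs f ≤ length xs * c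
  ∑-≤-const xs c h = ≤-≡-trans (∑-mono xs h) (∑-const xs c)

  ∈⇒≤∑ : ∀ {xs x} (f : A → ℕ) → x ∈ xs → f x ≤ ∑ xs f
  ∈⇒≤∑ f (here refl) = m≤m+n _ _
  ∈⇒≤∑ f (there p) = ≤-trans (∈⇒≤∑ f p) (m≤n+m _ _)

  ∑-positive : ∀ xs (f : A → ℕ) → 0 < ∑ xs f → ∃[ x ] x ∈ xs × 0 < f x
  ∑-positive (x ∷ xs) f p with f x in e
  ... | suc m = x , here refl , subst (0 <_) (sym e) (s≤s z≤n)
  ... | zero with ∑-positive xs f p
  ... | y , y∈ , q = y , there y∈ , q

  average : ∀ xs (w f : A → ℕ) c → 0 < ∑ xs w → ∑ xs (λ x → w x * f x) ≤ c * ∑ xs w →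
       ∃[ x ] x ∈ xs × 0 < w x × f x ≤ c
  average (x ∷ xs) w f c pos h with w x in e
  ... | zero with average xs w f c pos h
  ... | y , y∈ , p , q = y , there y∈ , p , q
  average (x ∷ xs) w f c pos h | suc m with f x ≤? c
  ... | yes q = x , here refl , subst (0 <_) (sym e) (s≤s z≤n) , q
  ... | no ¬q with average xs w f c (proj₁ rest) (proj₂ rest)
   where
   S = ∑ xs (λ x → w x * f x)
   W = ∑ xs w
   strict : suc m + S ≤ c * W
   strict = linear 0 (≤-trans (+-monoˡ-≤ S (*-monoʳ-≤ (suc m) (≰⇒> ¬q))) h) (ring m c S W)
    where
    ring : ∀ m c S W → suc m + S + c * (suc m + W) + 0 ≡ c * W + (suc m * suc c + S)
    ring = solve-∀
   rest : 0 < W × S ≤ c * W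
   rest = positive W strict , ≤-trans (m≤n+m S (suc m)) strict
    where
    positive : ∀ W → suc m + S ≤ c * W → 0 < W
    positive (suc _) _ = s≤s z≤n
    positive zero p with () ← ≤-≡-trans p (*-zeroʳ c)
  ... | y , y∈ , p , q = y , there y∈ , p , q

  minimum : ∀ xs (f : A → ℕ) c → 0 < length xs → ∑ xs f ≤ c * length xs → ∃[ x ] x ∈ xs × f x ≤ c
  minimum xs f c pos h with average xs (λ _ → 1) f c
   (subst (0 <_) (sym (∑-1 xs)) pos)
   (subst₂ _≤_ (∑-cong xs (λ x → sym (+-identityʳ (f x)))) (cong (c *_) (sym (∑-1 xs))) h)
  ... | x , x∈ , _ , q = x , x∈ , q

  maximum : ∀ xs (f : A → ℕ) c → 0 < length xs → c * length xs ≤ ∑ xs f → ∃[ x ] x ∈ xs × c ≤ f x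
  maximum (x ∷ xs) f c pos h with c ≤? f x
  ... | yes q = x , here refl , q
  maximum (x ∷ []) f c pos h | no ¬q =
   ⊥-elim (¬q (subst₂ _≤_ (*-identityʳ c) (+-identityʳ _) h))
  maximum (x ∷ x′ ∷ xs) f c pos h | no ¬q
   with maximum (x′ ∷ xs) f c (s≤s z≤n)
       (linear 0 (+-mono-≤ h (≰⇒≥ ¬q)) (ring c (length xs) (f x) (∑ (x′ ∷ xs) f)))
   where
   ring : ∀ c l a b → c * suc l + (a + b + c) + 0 ≡ b + (c * suc (suc l) + a)
   ring = solve-∀
  ... | y , y∈ , q = y , there y∈ , q

  pick : ∀ {x : A} {xs} → x ∈ xs → ∃[ ys ] xs ↭ x ∷ ys
  pick {x} {xs} p with Memₚ.∈-∃++ p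
  ... | as , bs , refl = as ++ bs , Permₚ.shift x as bs

  pick-other : ∀ {x y : A} {xs ys} → xs ↭ x ∷ ys → y ∈ xs → y ≢ x → ∃[ zs ] ys ↭ y ∷ zs
  pick-other p y∈ y≢x with ∈-resp-↭ p y∈
  ... | here e = ⊥-elim (y≢x e)
  ... | there y∈′ = pick y∈′

 module _ {A B : Set} where

  ∑-swap : ∀ xs ys (f : A → B → ℕ) →
       ∑ xs (λ x → ∑ ys (f x)) ≡ ∑ ys (λ y → ∑ xs (λ x → f x y))
  ∑-swap [] ys f = sym (∑-0 ys)
  ∑-swap (x ∷ xs) ys f = trans (cong (∑ ys (f x) +_) (∑-swap xs ys f))
                 (sym (∑-+ ys (f x) (λ y → ∑ xs (λ x → f x y))))

  ∑-map : ∀ (g : A → B) xs f → ∑ (map g xs) f ≡ ∑ xs (f ∘ g)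
  ∑-map g [] f = refl
  ∑-map g (x ∷ xs) f = cong (f (g x) +_) (∑-map g xs f)

 ∑-cart : ∀ {A B C : Set} (c : A → B → C) xs ys f →
      ∑ (cartesianProductWith c xs ys) f ≡ ∑ xs (λ x → ∑ ys (λ y → f (c x y)))
 ∑-cart c [] ys f = refl
 ∑-cart c (x ∷ xs) ys f =
  trans (∑-++ (map (c x) ys) _ f) (cong₂ _+_ (∑-map (c x) ys f) (∑-cart c xs ys f))

 module _ {A : Set} where

  tuples : List A → ℕ → List (List A)
  tuples xs zero = [] ∷ []
  tuples xs (suc j) = cartesianProductWith _∷_ xs (tuples xs j)

  ∑-tuples-suc : ∀ xs j (f : List A → ℕ) →
          ∑ (tuples xs (suc j)) f ≡ ∑ xs (λ x → ∑ (tuples xs j) (λ t → f (x ∷ t)))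
  ∑-tuples-suc xs j f = ∑-cart _∷_ xs (tuples xs j) f

  ∑-tuples-+ : ∀ xs i j (f : List A → ℕ) →
         ∑ (tuples xs (i + j)) f ≡ ∑ (tuples xs i) (λ s → ∑ (tuples xs j) (λ t → f (s ++ t)))
  ∑-tuples-+ xs zero j f = sym (+-identityʳ _)
  ∑-tuples-+ xs (suc i) j f = begin
   ∑ (tuples xs (suc (i + j))) f ≡⟨ ∑-tuples-suc xs (i + j) f ⟩
   ∑ xs (λ x → ∑ (tuples xs (i + j)) (λ t → f (x ∷ t))) ≡⟨ ∑-cong xs (λ x → ∑-tuples-+ xs i j (λ t → f (x ∷ t))) ⟩
   ∑ xs (λ x → ∑ (tuples xs i) (λ s → ∑ (tuples xs j) (λ t → f (x ∷ s ++ t)))) ≡⟨ ∑-tuples-suc xs i _ ⟨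
   ∑ (tuples xs (suc i)) (λ s → ∑ (tuples xs j) (λ t → f (s ++ t))) ∎
   where open ≡-Reasoning

  ∑-tuples-1 : ∀ xs (f : List A → ℕ) → ∑ (tuples xs 1) f ≡ ∑ xs (λ x → f (x ∷ []))
  ∑-tuples-1 xs f = trans (∑-tuples-suc xs 0 f) (∑-cong xs (λ x → +-identityʳ _))

  length-tuples : ∀ xs j → length (tuples xs j) ≡ length xs ^ j
  length-tuples xs zero = refl
  length-tuples xs (suc j) = begin
   length (tuples xs (suc j)) ≡⟨ ∑-1 (tuples xs (suc j)) ⟨
   ∑ (tuples xs (suc j)) (λ _ → 1) ≡⟨ ∑-tuples-suc xs j _ ⟩
   ∑ xs (λ _ → ∑ (tuples xs j) (λ _ → 1)) ≡⟨ ∑-const xs _ ⟩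
   length xs * ∑ (tuples xs j) (λ _ → 1) ≡⟨ cong (length xs *_) (trans (∑-1 (tuples xs j)) (length-tuples xs j)) ⟩
   length xs * length xs ^ j ∎
   where open ≡-Reasoning

  ∈-tuples⁻ : ∀ xs j {t} → t ∈ tuples xs j → length t ≡ j × All (_∈ xs) t
  ∈-tuples⁻ xs zero (here refl) = refl , []
  ∈-tuples⁻ xs (suc j) t∈ with ∈-cartesianProductWith⁻ _∷_ xs (tuples xs j) t∈
  ... | x , s , x∈ , s∈ , refl with ∈-tuples⁻ xs j s∈
  ... | e , a = cong suc e , x∈ ∷ a

  tuple-length : ∀ xs j {t} → t ∈ tuples xs j → length t ≡ j
  tuple-length xs j t∈ = proj₁ (∈-tuples⁻ xs j t∈)

  ∈-tuples⁺ : ∀ xs {t} → All (_∈ xs) t → t ∈ tuples xs (length t)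
  ∈-tuples⁺ xs [] = here refl
  ∈-tuples⁺ xs (x∈ ∷ a) = Memₚ.∈-cartesianProductWith⁺ _∷_ x∈ (∈-tuples⁺ xs a)

  ∑-tuples-const : ∀ xs j c → ∑ (tuples xs j) (λ _ → c) ≡ length xs ^ j * c
  ∑-tuples-const xs j c = trans (∑-const (tuples xs j) c) (cong (_* c) (length-tuples xs j))

 falling : ℕ → ℕ → ℕ
 falling m zero = 1
 falling zero (suc j) = 0
 falling (suc m) (suc j) = suc m * falling m j

 falling-+ : ∀ i j m → falling (i + m) (i + j) ≡ falling (i + m) i * falling m j
 falling-+ zero j m = sym (+-identityʳ _)
 falling-+ (suc i) j m = trans (cong (suc (i + m) *_) (falling-+ i j m)) (sym (*-assoc (suc (i + m)) (falling (i + m) i) (falling m j)))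

 falling-pos : ∀ j m → 0 < falling (j + m) j
 falling-pos zero m = s≤s z≤n
 falling-pos (suc j) m = *-pos {suc (j + m)} (s≤s z≤n) (falling-pos j m)

 module _ {n : ℕ} where

  eqᵇ : Fin n → Fin n → Bool
  eqᵇ v w = ⌊ v Finₚ.≟ w ⌋

  eqᵇ-refl : ∀ v → eqᵇ v v ≡ true
  eqᵇ-refl v with v Finₚ.≟ v
  ... | yes _ = refl
  ... | no ¬e = ⊥-elim (¬e refl)

  eqᵇ-sym : ∀ v w → eqᵇ v w ≡ eqᵇ w v
  eqᵇ-sym v w with v Finₚ.≟ w | w Finₚ.≟ v
  ... | yes _ | yes _ = refl
  ... | no _ | no _ = refl
  ... | yes e | no ¬e = ⊥-elim (¬e (sym e))
  ... | no ¬e | yes e = ⊥-elim (¬e (sym e))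

  eqᵇ⇒≡ : ∀ {v w} → eqᵇ v w ≡ true → v ≡ w
  eqᵇ⇒≡ {v} {w} e with v Finₚ.≟ w
  ... | yes p = p

  fresh : Fin n → List (Fin n) → Bool
  fresh v [] = true
  fresh v (x ∷ xs) = not (eqᵇ v x) ∧ fresh v xs

  uniq : List (Fin n) → Bool
  uniq [] = true
  uniq (x ∷ xs) = fresh x xs ∧ uniq xs

  fresh⇒∉ : ∀ {v} xs → fresh v xs ≡ true → v ∉ xs
  fresh⇒∉ {v} (x ∷ xs) f (here refl) with () ← trans (sym (proj₁ (∧-true f))) (cong not (eqᵇ-refl v))
  fresh⇒∉ (x ∷ xs) f (there p) = fresh⇒∉ xs (proj₂ (∧-true {not (eqᵇ _ x)} f)) p

  ∉⇒fresh : ∀ {v} xs → v ∉ xs → fresh v xs ≡ true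
  ∉⇒fresh [] _ = refl
  ∉⇒fresh {v} (x ∷ xs) v∉ with v Finₚ.≟ x
  ... | yes e = ⊥-elim (v∉ (here e))
  ... | no _ = ∉⇒fresh xs (v∉ ∘ there)

  fresh-++ : ∀ v xs ys → fresh v (xs ++ ys) ≡ fresh v xs ∧ fresh v ys
  fresh-++ v [] ys = refl
  fresh-++ v (x ∷ xs) ys = trans (cong (not (eqᵇ v x) ∧_) (fresh-++ v xs ys))
                  (sym (Boolₚ.∧-assoc (not (eqᵇ v x)) _ _))

  fresh-↭ : ∀ v {xs ys} → xs ↭ ys → fresh v xs ≡ fresh v ys
  fresh-↭ v Perm.refl = refl
  fresh-↭ v (prep x p) = cong (not (eqᵇ v x) ∧_) (fresh-↭ v p)
  fresh-↭ v (swap x y p) rewrite fresh-↭ v p with not (eqᵇ v x) | not (eqᵇ v y)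
  ... | true | true = refl
  ... | true | false = refl
  ... | false | true = refl
  ... | false | false = refl
  fresh-↭ v (Perm.trans p q) = trans (fresh-↭ v p) (fresh-↭ v q)

  uniq-↭ : ∀ {xs ys} → xs ↭ ys → uniq xs ≡ uniq ys
  uniq-↭ Perm.refl = refl
  uniq-↭ (prep x p) = cong₂ _∧_ (fresh-↭ x p) (uniq-↭ p)
  uniq-↭ (swap {xs} {ys} x y p) rewrite fresh-↭ x p | fresh-↭ y p | uniq-↭ p | eqᵇ-sym x y
   with eqᵇ y x | fresh x ys | fresh y ys
  ... | true | true | true = refl
  ... | true | true | false = refl
  ... | true | false | true = refl
  ... | true | false | false = refl
  ... | false | true | true = refl
  ... | false | true | false = refl
  ... | false | false | true = refl
  ... | false | false | false = refl
  uniq-↭ (Perm.trans p q) = trans (uniq-↭ p) (uniq-↭ q)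

  uniq-++⁻ʳ : ∀ xs {ys} → uniq (xs ++ ys) ≡ true → uniq ys ≡ true
  uniq-++⁻ʳ [] u = u
  uniq-++⁻ʳ (x ∷ xs) {ys} u = uniq-++⁻ʳ xs (proj₂ (∧-true {fresh x (xs ++ ys)} u))

  uniq-++⁻ˡ : ∀ xs {ys} → uniq (xs ++ ys) ≡ true → uniq xs ≡ true
  uniq-++⁻ˡ xs {ys} u = uniq-++⁻ʳ ys (trans (uniq-↭ (++-comm ys xs)) u)

  ∑-eqᵇ≤1 : ∀ R v → uniq R ≡ true → ∑ R (λ x → ι (eqᵇ x v)) ≤ 1
  ∑-eqᵇ≤1 [] v u = z≤n
  ∑-eqᵇ≤1 (x ∷ R) v u with x Finₚ.≟ v
  ... | no _ = ∑-eqᵇ≤1 R v (proj₂ (∧-true {fresh x R} u))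
  ... | yes refl = ≤-reflexive (cong suc (trans (∑-cong∈ R absent) (∑-0 R)))
   where
   absent : ∀ {y} → y ∈ R → ι (eqᵇ y x) ≡ 0
   absent {y} y∈ with y Finₚ.≟ x
   ... | yes refl = ⊥-elim (fresh⇒∉ R (proj₁ (∧-true u)) y∈)
   ... | no _ = refl

  ∑-eqᵇ≡1 : ∀ R v → uniq R ≡ true → v ∈ R → ∑ R (λ x → ι (eqᵇ x v)) ≡ 1
  ∑-eqᵇ≡1 R v u v∈ = ≤-antisym (∑-eqᵇ≤1 R v u)
   (≤-trans (ι-true (eqᵇ-refl v)) (∈⇒≤∑ (λ x → ι (eqᵇ x v)) v∈))

  ∑-stale≤ : ∀ R P → uniq R ≡ true → ∑ R (λ v → ι (not (fresh v P))) ≤ length P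
  ∑-stale≤ R [] u = ≤-reflexive (∑-0 R)
  ∑-stale≤ R (p ∷ P) u = begin
   ∑ R (λ v → ι (not (fresh v (p ∷ P)))) ≤⟨ ∑-mono R (λ v → truth-table 2 (λ a b → ι (not (not a ∧ b))) (λ a b → ι a + ι (not b)) tt (eqᵇ v p) (fresh v P)) ⟩
   ∑ R (λ v → ι (eqᵇ v p) + ι (not (fresh v P))) ≡⟨ ∑-+ R _ _ ⟩
   ∑ R (λ v → ι (eqᵇ v p)) + ∑ R (λ v → ι (not (fresh v P))) ≤⟨ +-mono-≤ (∑-eqᵇ≤1 R p u) (∑-stale≤ R P u) ⟩
   suc (length P) ∎
   where open ≤-Reasoning

  ∑-fresh : ∀ R P → uniq R ≡ true → uniq P ≡ true → All (_∈ R) P →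
       ∑ R (λ v → ι (fresh v P)) + length P ≡ length R
  ∑-fresh R [] uR uP _ = trans (+-identityʳ _) (∑-1 R)
  ∑-fresh R (p ∷ P) uR uP (p∈ ∷ P⊆R) = begin
   ∑ R (λ v → ι (fresh v (p ∷ P))) + suc (length P) ≡⟨ +-suc _ _ ⟩
   suc (∑ R (λ v → ι (fresh v (p ∷ P))) + length P) ≡⟨ cong (_+ length P) step ⟨
   ∑ R (λ v → ι (fresh v P)) + length P ≡⟨ ∑-fresh R P uR (proj₂ (∧-true {fresh p P} uP)) P⊆R ⟩
   length R ∎
   where
   open ≡-Reasoning
   split : ∀ v → ι (fresh v P) ≡ ι (eqᵇ v p) + ι (fresh v (p ∷ P))
   split v with v Finₚ.≟ p
   ... | yes refl rewrite proj₁ (∧-true {fresh p P} uP) = refl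
   ... | no _ = refl
   step : ∑ R (λ v → ι (fresh v P)) ≡ suc (∑ R (λ v → ι (fresh v (p ∷ P))))
   step = trans (∑-cong R split) (trans (∑-+ R _ _) (cong (_+ ∑ R (λ v → ι (fresh v (p ∷ P)))) (∑-eqᵇ≡1 R p uR p∈)))

  extends : List (Fin n) → List (Fin n) → Bool
  extends P [] = true
  extends P (v ∷ t) = fresh v P ∧ extends (v ∷ P) t

  extends≡uniq : ∀ P t → uniq P ≡ true → extends P t ≡ uniq (t ++ P)
  extends≡uniq P [] u = sym u
  extends≡uniq P (v ∷ t) u with fresh v P in e
  ... | true = begin
   extends (v ∷ P) t ≡⟨ extends≡uniq (v ∷ P) t (e ∧ₜ u) ⟩
   uniq (t ++ v ∷ P) ≡⟨ uniq-↭ (Permₚ.shift v t P) ⟩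
   uniq (v ∷ t ++ P) ∎
   where open ≡-Reasoning
  ... | false = sym (trans (cong (_∧ uniq (t ++ P)) (trans (fresh-++ v t P) (trans (cong (fresh v t ∧_) e) (Boolₚ.∧-zeroʳ _)))) refl)

  ∑-¬extends : ∀ R P j → uniq R ≡ true →
         ∑ (tuples R j) (λ t → ι (not (extends P t))) * length R ≤ j * (j + length P) * length R ^ j
  ∑-¬extends R P zero u = z≤n
  ∑-¬extends R P (suc j) u = begin
   ∑ (tuples R (suc j)) (λ t → ι (not (extends P t))) * r
    ≡⟨ cong (_* r) (∑-tuples-suc R j _) ⟩
   ∑ R (λ v → ∑ (tuples R j) (λ t → ι (not (fresh v P ∧ extends (v ∷ P) t)))) * r
    ≤⟨ *-monoˡ-≤ r (∑-mono R (λ v → ∑-mono (tuples R j) (λ t →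
       truth-table 2 (λ a b → ι (not (a ∧ b))) (λ a b → ι (not a) + ι (not b)) tt (fresh v P) (extends (v ∷ P) t)))) ⟩
   ∑ R (λ v → ∑ (tuples R j) (λ t → ι (not (fresh v P)) + ι (not (extends (v ∷ P) t)))) * r
    ≡⟨ trans (cong (_* r) (∑-cong R (λ v → trans (∑-+ (tuples R j) _ _) (cong (_+ ∑ (tuples R j) (λ t → ι (not (extends (v ∷ P) t)))) (∑-tuples-const R j (ι (not (fresh v P)))))))) (sym (∑-*ʳ R r _)) ⟩
   ∑ R (λ v → (r ^ j * ι (not (fresh v P)) + ∑ (tuples R j) (λ t → ι (not (extends (v ∷ P) t)))) * r)
    ≤⟨ ∑-mono R (λ v → ≡-≤-trans (*-distribʳ-+ r (r ^ j * ι (not (fresh v P))) _) (+-monoʳ-≤ _ (∑-¬extends R (v ∷ P) j u))) ⟩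
   ∑ R (λ v → r ^ j * ι (not (fresh v P)) * r + j * (j + suc p) * r ^ j)
    ≡⟨ trans (∑-+ R _ _) (cong₂ _+_ (trans (∑-*ʳ R r _) (cong (_* r) (∑-*ˡ R (r ^ j) _))) (∑-const R _)) ⟩
   r ^ j * ∑ R (λ v → ι (not (fresh v P))) * r + r * (j * (j + suc p) * r ^ j)
    ≤⟨ +-monoˡ-≤ _ (*-monoˡ-≤ r (*-monoʳ-≤ (r ^ j) (∑-stale≤ R P u))) ⟩
   r ^ j * p * r + r * (j * (j + suc p) * r ^ j)
    ≤⟨ ≤-≡-trans (m≤m+n _ (suc j * (r * r ^ j))) (ring (r ^ j) p r j) ⟩
   suc j * (suc j + p) * (r * r ^ j) ∎
   where
   open ≤-Reasoning
   r = length R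
   p = length P
   ring : ∀ x p r j → x * p * r + r * (j * (j + suc p) * x) + suc j * (r * x) ≡ suc j * (suc j + p) * (r * x)
   ring = solve-∀

  ∑-extends : ∀ R P j m → uniq R ≡ true → uniq P ≡ true → All (_∈ R) P → m + length P ≡ length R →
        ∑ (tuples R j) (λ t → ι (extends P t)) ≡ falling m j
  ∑-extends R P zero m uR uP P⊆R e = refl
  ∑-extends R P (suc j) m uR uP P⊆R e = begin
   ∑ (tuples R (suc j)) (λ t → ι (extends P t)) ≡⟨ ∑-tuples-suc R j _ ⟩
   ∑ R (λ v → ∑ (tuples R j) (λ t → ι (fresh v P ∧ extends (v ∷ P) t))) ≡⟨ ∑-cong∈ R inner ⟩
   ∑ R (λ v → ι (fresh v P) * falling (m ∸ 1) j) ≡⟨ ∑-*ʳ R _ _ ⟩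
   ∑ R (λ v → ι (fresh v P)) * falling (m ∸ 1) j ≡⟨ cong (_* falling (m ∸ 1) j) count ⟩
   m * falling (m ∸ 1) j ≡⟨ unfold m ⟩
   falling m (suc j) ∎
   where
   open ≡-Reasoning
   count : ∑ R (λ v → ι (fresh v P)) ≡ m
   count = +-cancelʳ-≡ (length P) _ _ (trans (∑-fresh R P uR uP P⊆R) (sym e))
   unfold : ∀ m → m * falling (m ∸ 1) j ≡ falling m (suc j)
   unfold zero = refl
   unfold (suc m) = refl
   inner : ∀ {v} → v ∈ R → ∑ (tuples R j) (λ t → ι (fresh v P ∧ extends (v ∷ P) t)) ≡ ι (fresh v P) * falling (m ∸ 1) j
   inner {v} v∈ with fresh v P in f
   ... | false = ∑-0 (tuples R j)
   ... | true = trans (∑-extends R (v ∷ P) j (m ∸ 1) uR (f ∧ₜ uP) (v∈ ∷ P⊆R) (shift m e)) (sym (+-identityʳ _))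
    where
    shift : ∀ m → m + length P ≡ length R → m ∸ 1 + suc (length P) ≡ length R
    shift (suc m) e = trans (+-suc m _) e
    shift zero e = ⊥-elim (1+n≢0 (trans (sym count′) (trans count (m≡0 e))))
     where
     m≡0 : zero + length P ≡ length R → m ≡ 0
     m≡0 e′ = trans (sym count) (+-cancelʳ-≡ (length P) _ 0 (trans (∑-fresh R P uR uP P⊆R) (sym e′)))
     count′ : ∑ R (λ v → ι (fresh v P)) ≡ suc (∑ R (λ v → ι (fresh v P)) ∸ 1)
     count′ with ∑ R (λ v → ι (fresh v P)) | ≤-trans (ι-true f) (∈⇒≤∑ (λ v → ι (fresh v P)) v∈)
     ... | suc _ | _ = refl

  uniq-full : ∀ xs R → uniq xs ≡ true → All (_∈ R) xs → length xs ≡ length R → xs ↭ R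
  uniq-full [] [] u a e = ↭-refl
  uniq-full (x ∷ xs) R u (x∈ ∷ a) e with pick x∈
  ... | R′ , p = ↭-trans (prep x (uniq-full xs R′ (proj₂ (∧-true {fresh x xs} u)) (All.tabulate inside) len)) (↭-sym p)
   where
   inside : ∀ {y} → y ∈ xs → y ∈ R′
   inside {y} y∈ with ∈-resp-↭ p (All.lookup a y∈)
   ... | here refl = ⊥-elim (fresh⇒∉ xs (proj₁ (∧-true u)) y∈)
   ... | there q = q
   len : length xs ≡ length R′
   len = suc-injective (trans e (↭-length p))

  uniq-allFin : uniq (allFin n) ≡ true
  uniq-allFin = tabulated n id id
   where
   tabulated : ∀ m (f : Fin m → Fin n) → (∀ {i j} → f i ≡ f j → i ≡ j) → uniq (tabulate f) ≡ true
   tabulated zero f inj = refl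
   tabulated (suc m) f inj = ∉⇒fresh _ absent ∧ₜ tabulated m (f ∘ Fin.suc) (Finₚ.suc-injective ∘ inj)
    where
    absent : f Fin.zero ∉ tabulate (f ∘ Fin.suc)
    absent p with Memₚ.∈-tabulate⁻ p
    ... | i , e with () ← inj e

 module _ {A : Set} where

  take-++ : ∀ {L} (s t : List A) → length s ≡ L → take L (s ++ t) ≡ s
  take-++ [] t refl = refl
  take-++ (x ∷ s) t refl = cong (x ∷_) (take-++ s t refl)

  drop-++ : ∀ {L} (s t : List A) → length s ≡ L → drop L (s ++ t) ≡ t
  drop-++ [] t refl = refl
  drop-++ (x ∷ s) t refl = drop-++ s t refl

  length-take : ∀ L k {t : List A} → length t ≡ L + k → length (take L t) ≡ L
  length-take L k {t} e = trans (Listₚ.length-take L t) (trans (cong (L ⊓_) e) (m≤n⇒m⊓n≡m (m≤m+n L k)))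

  length-drop : ∀ L k {t : List A} → length t ≡ L + k → length (drop L t) ≡ k
  length-drop L k {t} e = trans (Listₚ.length-drop L t) (trans (cong (_∸ L) e) (m+n∸m≡n L k))

  chop : ℕ → ℕ → List A → List (List A)
  chop ℓ zero t = []
  chop ℓ (suc c) t = take ℓ t ∷ chop ℓ c (drop ℓ t)

  concat-chop : ∀ ℓ c t → length t ≡ c * ℓ → concat (chop ℓ c t) ≡ t
  concat-chop ℓ zero [] e = refl
  concat-chop ℓ (suc c) t e =
   trans (cong (take ℓ t ++_) (concat-chop ℓ c (drop ℓ t) (length-drop ℓ (c * ℓ) e))) (take++drop≡id ℓ t)

  chop-lengths : ∀ ℓ c t → length t ≡ c * ℓ → All (λ B → length B ≡ ℓ) (chop ℓ c t)
  chop-lengths ℓ zero t e = []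
  chop-lengths ℓ (suc c) t e = length-take ℓ (c * ℓ) e ∷ chop-lengths ℓ c (drop ℓ t) (length-drop ℓ (c * ℓ) e)

  length-chop : ∀ ℓ c (t : List A) → length (chop ℓ c t) ≡ c
  length-chop ℓ zero t = refl
  length-chop ℓ (suc c) t = cong suc (length-chop ℓ c (drop ℓ t))

 module _ {n : ℕ} where

  extends-++ : ∀ (P s t : List (Fin n)) → uniq P ≡ true →
         extends P (s ++ t) ≡ extends P s ∧ extends (s ++ P) t
  extends-++ P s t u with extends P s in e
  ... | true = begin
   extends P (s ++ t) ≡⟨ extends≡uniq P (s ++ t) u ⟩
   uniq ((s ++ t) ++ P) ≡⟨ uniq-↭ (↭-trans (↭-reflexive (++-assoc s t P)) (shifts s t)) ⟩
   uniq (t ++ s ++ P) ≡⟨ extends≡uniq (s ++ P) t (trans (sym (extends≡uniq P s u)) e) ⟨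
   extends (s ++ P) t ∎
   where open ≡-Reasoning
  ... | false with extends P (s ++ t) in f
  ... | false = refl
  ... | true with () ← trans (sym e) (trans (extends≡uniq P s u) (uniq-++⁻ʳ t (trans (sym (uniq-↭
       (↭-trans (↭-reflexive (++-assoc s t P)) (shifts s t)))) (trans (sym (extends≡uniq P (s ++ t) u)) f))))

  ι-swap : ∀ (P s w : List (Fin n)) → uniq P ≡ true →
       ι (extends P s) * ι (extends (s ++ P) w) ≡ ι (extends P w) * ι (extends (w ++ P) s)
  ι-swap P s w u = begin
   ι (extends P s) * ι (extends (s ++ P) w) ≡⟨ ι-∧ (extends P s) _ ⟨
   ι (extends P s ∧ extends (s ++ P) w) ≡⟨ cong ι (extends-++ P s w u) ⟨
   ι (extends P (s ++ w)) ≡⟨ cong ι (extends≡uniq P (s ++ w) u) ⟩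
   ι (uniq ((s ++ w) ++ P)) ≡⟨ cong ι (uniq-↭ (++⁺ʳ P (++-comm s w))) ⟩
   ι (uniq ((w ++ s) ++ P)) ≡⟨ cong ι (extends≡uniq P (w ++ s) u) ⟨
   ι (extends P (w ++ s)) ≡⟨ cong ι (extends-++ P w s u) ⟩
   ι (extends P w ∧ extends (w ++ P) s) ≡⟨ ι-∧ (extends P w) _ ⟩
   ι (extends P w) * ι (extends (w ++ P) s) ∎
   where open ≡-Reasoning

  module Windows (R : List (Fin n)) (uR : uniq R ≡ true) (L e : ℕ) (bad : List (Fin n) → Bool) where

   private r = length R

   badCount : ℕ → List (Fin n) → ℕ
   badCount zero t = 0
   badCount (suc q) t = ι (bad (take L t)) + badCount q (drop L t)

   private
    β : List (Fin n) → ℕ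
    β P = ∑ (tuples R L) (λ w → ι (extends P w) * ι (bad w))

    total : List (Fin n) → ℕ → ℕ
    total P q = ∑ (tuples R (q * L + e)) (λ t → ι (extends P t) * badCount q t)

    extended : ∀ P s j → All (_∈ R) P → s ∈ tuples R j → All (_∈ R) (s ++ P)
    extended P s j a s∈ = Allₚ.++⁺ (proj₂ (∈-tuples⁻ R j s∈)) a

    ∑-β : ∀ P m → uniq P ≡ true → All (_∈ R) P → L + m + length P ≡ r →
       ∑ (tuples R L) (λ s → ι (extends P s) * β (s ++ P)) ≡ β P * falling m L
    ∑-β P m uP P⊆R len = begin
     ∑ (tuples R L) (λ s → ι (extends P s) * β (s ++ P))
      ≡⟨ ∑-cong (tuples R L) (λ s → sym (∑-*ˡ (tuples R L) (ι (extends P s)) _)) ⟩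
     ∑ (tuples R L) (λ s → ∑ (tuples R L) (λ w → ι (extends P s) * (ι (extends (s ++ P) w) * ι (bad w))))
      ≡⟨ ∑-cong (tuples R L) (λ s → ∑-cong (tuples R L) (λ w → exchange s w)) ⟩
     ∑ (tuples R L) (λ s → ∑ (tuples R L) (λ w → ι (extends P w) * ι (bad w) * ι (extends (w ++ P) s)))
      ≡⟨ ∑-swap (tuples R L) (tuples R L) _ ⟩
     ∑ (tuples R L) (λ w → ∑ (tuples R L) (λ s → ι (extends P w) * ι (bad w) * ι (extends (w ++ P) s)))
      ≡⟨ ∑-cong∈ (tuples R L) (λ {w} w∈ → trans (∑-*ˡ (tuples R L) (ι (extends P w) * ι (bad w)) _) (inner w w∈)) ⟩
     ∑ (tuples R L) (λ w → ι (extends P w) * ι (bad w) * falling m L)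
      ≡⟨ ∑-*ʳ (tuples R L) (falling m L) _ ⟩
     β P * falling m L ∎
     where
     open ≡-Reasoning
     reorder : ∀ a b c → a * b * c ≡ a * c * b
     reorder = solve-∀
     exchange : ∀ s w → ι (extends P s) * (ι (extends (s ++ P) w) * ι (bad w)) ≡ ι (extends P w) * ι (bad w) * ι (extends (w ++ P) s)
     exchange s w = trans (sym (*-assoc (ι (extends P s)) _ _)) (trans (cong (_* ι (bad w)) (ι-swap P s w uP))
      (reorder (ι (extends P w)) (ι (extends (w ++ P) s)) (ι (bad w))))
     shuffle : ∀ a b c → a + (b + c) ≡ b + a + c
     shuffle = solve-∀
     inner : ∀ w → w ∈ tuples R L → ι (extends P w) * ι (bad w) * ∑ (tuples R L) (λ s → ι (extends (w ++ P) s)) ≡ ι (extends P w) * ι (bad w) * falling m L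
     inner w w∈ with extends P w in x
     ... | false = refl
     ... | true = cong (1 * ι (bad w) *_) (∑-extends R (w ++ P) L m uR (trans (sym (extends≡uniq P w uP)) x) (extended P w L P⊆R w∈)
        (trans (cong (_+_ m) (length-++ w)) (trans (cong (λ z → m + (z + length P)) (tuple-length R L w∈)) (trans (shuffle m L (length P)) len))))

    total-suc : ∀ q P → uniq P ≡ true → All (_∈ R) P → L + (q * L + e) + length P ≡ r →
          total P (suc q) ≡ β P * falling (q * L + e) (q * L + e) + ∑ (tuples R L) (λ s → ι (extends P s) * total (s ++ P) q)
    total-suc q P uP P⊆R len = begin
     total P (suc q)
      ≡⟨ cong (λ k → ∑ (tuples R k) (λ t → ι (extends P t) * badCount (suc q) t)) (+-assoc L (q * L) e) ⟩
     ∑ (tuples R (L + m)) (λ t → ι (extends P t) * badCount (suc q) t)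
      ≡⟨ ∑-tuples-+ R L m _ ⟩
     ∑ (tuples R L) (λ s → ∑ (tuples R m) (λ t → ι (extends P (s ++ t)) * badCount (suc q) (s ++ t)))
      ≡⟨ ∑-cong∈ (tuples R L) inner ⟩
     ∑ (tuples R L) (λ s → ι (extends P s) * ι (bad s) * falling m m + ι (extends P s) * total (s ++ P) q)
      ≡⟨ ∑-+ (tuples R L) _ _ ⟩
     ∑ (tuples R L) (λ s → ι (extends P s) * ι (bad s) * falling m m) + ∑ (tuples R L) (λ s → ι (extends P s) * total (s ++ P) q)
      ≡⟨ cong (_+ ∑ (tuples R L) (λ s → ι (extends P s) * total (s ++ P) q)) (∑-*ʳ (tuples R L) (falling m m) _) ⟩
     β P * falling m m + ∑ (tuples R L) (λ s → ι (extends P s) * total (s ++ P) q) ∎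
     where
     open ≡-Reasoning
     m = q * L + e
     shuffle : ∀ a b c → a + (b + c) ≡ b + a + c
     shuffle = solve-∀
     expand : ∀ a x y → a * (x + y) ≡ x * a + a * y
     expand = solve-∀
     inner : ∀ {s} → s ∈ tuples R L → ∑ (tuples R m) (λ t → ι (extends P (s ++ t)) * badCount (suc q) (s ++ t)) ≡ ι (extends P s) * ι (bad s) * falling m m + ι (extends P s) * total (s ++ P) q
     inner {s} s∈ with extends P s in x
     ... | false = trans (∑-cong (tuples R m) (λ t → cong (λ b → ι b * badCount (suc q) (s ++ t)) (trans (extends-++ P s t uP) (cong (_∧ extends (s ++ P) t) x)))) (∑-0 (tuples R m))
     ... | true = begin
      ∑ (tuples R m) (λ t → ι (extends P (s ++ t)) * badCount (suc q) (s ++ t))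
       ≡⟨ ∑-cong (tuples R m) (λ t → cong₂ _*_ (cong ι (trans (extends-++ P s t uP) (cong (_∧ extends (s ++ P) t) x)))
          (cong₂ _+_ (cong (ι ∘ bad) (take-++ s t len-s)) (cong (badCount q) (drop-++ s t len-s)))) ⟩
      ∑ (tuples R m) (λ t → ι (extends (s ++ P) t) * (ι (bad s) + badCount q t))
       ≡⟨ ∑-cong (tuples R m) (λ t → expand (ι (extends (s ++ P) t)) (ι (bad s)) (badCount q t)) ⟩
      ∑ (tuples R m) (λ t → ι (bad s) * ι (extends (s ++ P) t) + ι (extends (s ++ P) t) * badCount q t)
       ≡⟨ trans (∑-+ (tuples R m) _ _) (cong (_+ total (s ++ P) q) (∑-*ˡ (tuples R m) (ι (bad s)) _)) ⟩
      ι (bad s) * ∑ (tuples R m) (λ t → ι (extends (s ++ P) t)) + total (s ++ P) q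
       ≡⟨ cong₂ _+_ (cong₂ _*_ (sym (+-identityʳ (ι (bad s)))) complete) (sym (+-identityʳ (total (s ++ P) q))) ⟩
      1 * ι (bad s) * falling m m + 1 * total (s ++ P) q ∎
      where
      len-s : length s ≡ L
      len-s = tuple-length R L s∈
      complete : ∑ (tuples R m) (λ t → ι (extends (s ++ P) t)) ≡ falling m m
      complete = ∑-extends R (s ++ P) m m uR (trans (sym (extends≡uniq P s uP)) x) (extended P s L P⊆R s∈)
       (trans (cong (_+_ m) (length-++ s)) (trans (cong (λ z → m + (z + length P)) len-s) (trans (shuffle m L (length P)) len)))

    total≡ : ∀ q P → uniq P ≡ true → All (_∈ R) P → L + (q * L + e) + length P ≡ r →
         total P (suc q) ≡ suc q * β P * falling (q * L + e) (q * L + e)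
    total≡ zero P uP P⊆R len = trans (total-suc 0 P uP P⊆R len) (begin
     β P * falling e e + ∑ (tuples R L) (λ s → ι (extends P s) * total (s ++ P) 0)
      ≡⟨ cong (_+_ (β P * falling e e)) (trans (∑-cong (tuples R L) (λ s → trans (cong (ι (extends P s) *_)
         (trans (∑-cong (tuples R e) (λ t → *-zeroʳ (ι (extends (s ++ P) t)))) (∑-0 (tuples R e)))) (*-zeroʳ (ι (extends P s))))) (∑-0 (tuples R L))) ⟩
     β P * falling e e + 0
      ≡⟨ ring (β P) (falling e e) ⟩
     1 * β P * falling e e ∎)
     where
     open ≡-Reasoning
     ring : ∀ a b → a * b + 0 ≡ 1 * a * b
     ring = solve-∀
    total≡ (suc q) P uP P⊆R len = trans (total-suc (suc q) P uP P⊆R len) (begin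
     β P * falling m′ m′ + ∑ (tuples R L) (λ s → ι (extends P s) * total (s ++ P) (suc q))
      ≡⟨ cong (_+_ (β P * falling m′ m′)) (∑-cong∈ (tuples R L) step) ⟩
     β P * falling m′ m′ + ∑ (tuples R L) (λ s → ι (extends P s) * β (s ++ P) * (suc q * falling m m))
      ≡⟨ cong (_+_ (β P * falling m′ m′)) (trans (∑-*ʳ (tuples R L) (suc q * falling m m) _) (cong (_* (suc q * falling m m)) (∑-β P m′ uP P⊆R len))) ⟩
     β P * falling m′ m′ + β P * falling m′ L * (suc q * falling m m)
      ≡⟨ cong (_+_ (β P * falling m′ m′)) (trans (ring₁ (β P) (falling m′ L) (suc q) (falling m m)) (cong (λ z → suc q * β P * z) unfold)) ⟩
     β P * falling m′ m′ + suc q * β P * falling m′ m′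
      ≡⟨ ring₂ (β P) (suc q) (falling m′ m′) ⟩
     suc (suc q) * β P * falling m′ m′ ∎)
     where
     open ≡-Reasoning
     m = q * L + e
     m′ = suc q * L + e
     ring₁ : ∀ b f q g → b * f * (q * g) ≡ q * b * (f * g)
     ring₁ = solve-∀
     ring₂ : ∀ b q f → b * f + q * b * f ≡ suc q * b * f
     ring₂ = solve-∀
     m′≡ : m′ ≡ L + m
     m′≡ = +-assoc L (q * L) e
     unfold : falling m′ L * falling m m ≡ falling m′ m′
     unfold = subst (λ z → falling z L * falling m m ≡ falling z z) (sym m′≡) (sym (falling-+ L m m))
     shuffle : ∀ a b c → a + (b + c) ≡ b + a + c
     shuffle = solve-∀
     len′ : ∀ {s} → s ∈ tuples R L → L + m + length (s ++ P) ≡ r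
     len′ {s} s∈ = trans (cong (_+_ (L + m)) (trans (length-++ s) (cong (_+ length P) (tuple-length R L s∈))))
      (trans (shuffle (L + m) L (length P)) (trans (cong (λ z → L + z + length P) (sym m′≡)) len))
     reorder : ∀ a q b f → a * (q * b * f) ≡ a * b * (q * f)
     reorder = solve-∀
     step : ∀ {s} → s ∈ tuples R L → ι (extends P s) * total (s ++ P) (suc q) ≡ ι (extends P s) * β (s ++ P) * (suc q * falling m m)
     step {s} s∈ with extends P s in x
     ... | false = refl
     ... | true = trans (cong (1 *_) (total≡ q (s ++ P) (trans (sym (extends≡uniq P s uP)) x) (extended P s L P⊆R s∈) (len′ s∈)))
        (reorder 1 (suc q) (β (s ++ P)) (falling m m))

   pow≤falling : 2 * (L * L) ≤ r → 0 < r → r ^ L ≤ 2 * falling r L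
   pow≤falling big pos = subst (_≤ 2 * falling r L) split
    (*-cancelˡ-pos r pos (linear 0 (+-mono-≤ (*-monoʳ-≤ 2 few) (*-monoˡ-≤ (falling r L + N) big)) (ring r (falling r L) N (L * L))))
    where
    N = ∑ (tuples R L) (λ t → ι (not (extends [] t)))
    split : falling r L + N ≡ r ^ L
    split = begin
     falling r L + N ≡⟨ cong (_+ N) (∑-extends R [] L r uR refl [] (+-identityʳ r)) ⟨
     ∑ (tuples R L) (λ t → ι (extends [] t)) + N ≡⟨ ∑-+ (tuples R L) _ _ ⟨
     ∑ (tuples R L) (λ t → ι (extends [] t) + ι (not (extends [] t))) ≡⟨ ∑-cong (tuples R L) (λ t → complement (extends [] t)) ⟩
     ∑ (tuples R L) (λ _ → 1) ≡⟨ trans (∑-1 (tuples R L)) (length-tuples R L) ⟩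
     r ^ L ∎
     where
     open ≡-Reasoning
     complement : ∀ b → ι b + ι (not b) ≡ 1
     complement true = refl
     complement false = refl
    few : N * r ≤ L * L * (falling r L + N)
    few = subst₂ (λ z p → N * r ≤ L * z * p) (+-identityʳ L) (sym split) (∑-¬extends R [] L uR)
    ring : ∀ r f N l → r * (f + N) + (2 * (l * (f + N)) + r * (f + N)) + 0 ≡ r * (2 * f) + (2 * (N * r) + 2 * l * (f + N))
    ring = solve-∀

   arrangement : ∀ q D → suc q * L + e ≡ r → 2 * (L * L) ≤ r → 0 < r →
          D * ∑ (tuples R L) (λ w → ι (bad w)) ≤ r ^ L →
          ∃[ t ] length t ≡ suc q * L + e × uniq t ≡ true × t ↭ R × D * badCount (suc q) t ≤ 2 * suc q
   arrangement q D len big pos rare = finish (average (tuples R r) (λ t → ι (extends [] t)) (λ t → D * badCount (suc q) t) (2 * suc q)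
    (subst (0 <_) (sym count) positive) (subst (λ k → ∑ (tuples R k) (λ t → ι (extends [] t) * (D * badCount (suc q) t)) ≤ 2 * suc q * ∑ (tuples R k) (λ t → ι (extends [] t))) len bound))
    where
    m = q * L + e
    lenʳ : L + m ≡ r
    lenʳ = trans (sym (+-assoc L (q * L) e)) len
    count : ∑ (tuples R r) (λ t → ι (extends [] t)) ≡ falling r r
    count = ∑-extends R [] r r uR refl [] (+-identityʳ r)
    positive : 0 < falling r r
    positive = subst (λ z → 0 < falling z r) (+-identityʳ r) (falling-pos r 0)
    falling-split : falling r r ≡ falling r L * falling m m
    falling-split = subst (λ z → falling z z ≡ falling z L * falling m m) lenʳ (falling-+ L m m)
    fewBad : D * β [] ≤ 2 * falling r L
    fewBad = ≤-trans (*-monoʳ-≤ D (∑-mono (tuples R L) (λ w → ≤-≡-trans (*-monoˡ-≤ (ι (bad w)) (ι≤1 (extends [] w))) (+-identityʳ _))))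
             (≤-trans rare (pow≤falling big pos))
    bound : ∑ (tuples R (suc q * L + e)) (λ t → ι (extends [] t) * (D * badCount (suc q) t)) ≤ 2 * suc q * ∑ (tuples R (suc q * L + e)) (λ t → ι (extends [] t))
    bound = begin
     ∑ (tuples R (suc q * L + e)) (λ t → ι (extends [] t) * (D * badCount (suc q) t))
      ≡⟨ ∑-cong (tuples R (suc q * L + e)) (λ t → *-exchange (ι (extends [] t)) D (badCount (suc q) t)) ⟩
     ∑ (tuples R (suc q * L + e)) (λ t → D * (ι (extends [] t) * badCount (suc q) t))
      ≡⟨ ∑-*ˡ (tuples R (suc q * L + e)) D _ ⟩
     D * total [] (suc q)
      ≡⟨ cong (D *_) (total≡ q [] refl [] (trans (+-identityʳ _) lenʳ)) ⟩
     D * (suc q * β [] * falling m m)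
      ≡⟨ ring D (suc q) (β []) (falling m m) ⟩
     suc q * (D * β []) * falling m m
      ≤⟨ *-monoˡ-≤ (falling m m) (*-monoʳ-≤ (suc q) fewBad) ⟩
     suc q * (2 * falling r L) * falling m m
      ≡⟨ trans (ring′ (suc q) (falling r L) (falling m m)) (cong (2 * suc q *_) (sym falling-split)) ⟩
     2 * suc q * falling r r
      ≡⟨ cong (2 * suc q *_) (trans (cong (λ k → ∑ (tuples R k) (λ t → ι (extends [] t))) len) count) ⟨
     2 * suc q * ∑ (tuples R (suc q * L + e)) (λ t → ι (extends [] t)) ∎
     where
     open ≤-Reasoning
     ring : ∀ d q b f → d * (q * b * f) ≡ q * (d * b) * f
     ring = solve-∀
     ring′ : ∀ q f g → q * (2 * f) * g ≡ 2 * q * (f * g)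
     ring′ = solve-∀
    finish : (∃[ t ] t ∈ tuples R r × 0 < ι (extends [] t) × D * badCount (suc q) t ≤ 2 * suc q) →
         ∃[ t ] length t ≡ suc q * L + e × uniq t ≡ true × t ↭ R × D * badCount (suc q) t ≤ 2 * suc q
    finish (t , t∈ , ext , few) = t , trans lent (sym len) , ut , uniq-full t R ut (proj₂ (∈-tuples⁻ R r t∈)) lent , few
     where
     lent : length t ≡ r
     lent = tuple-length R r t∈
     ut : uniq t ≡ true
     ut = trans (cong uniq (sym (++-identityʳ t))) (trans (sym (extends≡uniq [] t refl)) (true-ι ext))

 Relation : ℕ → Set
 Relation n = List (Fin n) → List (Fin n) → Bool

 Symmetric : ∀ {n} → Relation n → Set
 Symmetric adj = ∀ S T → adj S T ≡ adj T S

 module Covers {n : ℕ} (adj : Relation n) (ℓ : ℕ) where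

  breaks : List (List (Fin n)) → ℕ
  breaks [] = 0
  breaks (B ∷ []) = 0
  breaks (B ∷ C ∷ Bs) = ι (not (adj B C)) + breaks (C ∷ Bs)

  breaks-++ : ∀ Bs Cs → breaks (Bs ++ Cs) ≤ breaks Bs + 1 + breaks Cs
  breaks-++ [] Cs = n≤1+n _
  breaks-++ (B ∷ []) [] = z≤n
  breaks-++ (B ∷ []) (C ∷ Cs) = +-monoˡ-≤ _ (ι≤1 _)
  breaks-++ (B ∷ C ∷ Bs) Cs = ≤-≡-trans (+-monoʳ-≤ b (breaks-++ (C ∷ Bs) Cs)) (assoc b (breaks (C ∷ Bs)) (breaks Cs))
   where
   b = ι (not (adj B C))
   assoc : ∀ a x y → a + (x + 1 + y) ≡ a + x + 1 + y
   assoc = solve-∀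

  breaks≤length : ∀ Bs → breaks Bs ≤ length Bs
  breaks≤length [] = z≤n
  breaks≤length (B ∷ []) = z≤n
  breaks≤length (B ∷ C ∷ Bs) = +-mono-≤ (ι≤1 (not (adj B C))) (breaks≤length (C ∷ Bs))

  Cover : List (Fin n) → ℕ → Set
  Cover R b = ∃[ Bs ] concat Bs ↭ R × All (λ B → length B ≡ ℓ) Bs × breaks Bs ≤ b

  cover-++ : ∀ {R S b c} → Cover R b → Cover S c → Cover (R ++ S) (b + 1 + c)
  cover-++ (Bs , p , a , h) (Cs , p′ , a′ , h′) =
   Bs ++ Cs , ↭-trans (↭-reflexive (sym (concat-++ Bs Cs))) (Permₚ.++⁺ p p′) , Allₚ.++⁺ a a′ ,
   ≤-trans (breaks-++ Bs Cs) (+-mono-≤ (+-monoˡ-≤ 1 h) h′)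

  cover-↭ : ∀ {R S b c} → R ↭ S → b ≤ c → Cover R b → Cover S c
  cover-↭ p b≤c (Bs , q , a , h) = Bs , ↭-trans q p , a , ≤-trans h b≤c

  cover-chop : ∀ c R → length R ≡ c * ℓ → Cover R c
  cover-chop c R len = chop ℓ c R , ↭-reflexive (concat-chop ℓ c R len) , chop-lengths ℓ c R len ,
   ≤-≡-trans (breaks≤length (chop ℓ c R)) (length-chop ℓ c R)

  cover-windows : ∀ (R : List (Fin n)) (uR : uniq R ≡ true) c e b (bad : List (Fin n) → Bool) →
          (∀ w → length w ≡ c * ℓ → uniq w ≡ true → bad w ≡ false → Cover w b) →
          ∀ q t → length t ≡ q * (c * ℓ) + e * ℓ → uniq t ≡ true →
          Cover t (q * (b + 1) + Windows.badCount R uR (c * ℓ) (e * ℓ) bad q t * c + e)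
  cover-windows R uR c e b bad good zero t len u = cover-chop e t len
  cover-windows R uR c e b bad good (suc q) t len u =
   cover-↭ (↭-reflexive split) (≤-reflexive (total (bad w) refl)) (cover-++ (first (bad w) refl) rest)
   where
   L = c * ℓ
   w = take L t
   s = drop L t
   split : w ++ s ≡ t
   split = take++drop≡id L t
   len′ : length t ≡ L + (q * L + e * ℓ)
   len′ = trans len (+-assoc L (q * L) (e * ℓ))
   count = Windows.badCount R uR (c * ℓ) (e * ℓ) bad q s
   rest = cover-windows R uR c e b bad good q s (length-drop L _ len′) (uniq-++⁻ʳ w (trans (cong uniq split) u))
   first : ∀ x → bad w ≡ x → Cover w (ι x * c + b)
   first true _ = cover-↭ ↭-refl (≤-trans (m≤m+n c 0) (m≤m+n _ b)) (cover-chop c w (length-take L _ len′))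
   first false x = good w (length-take L _ len′) (uniq-++⁻ˡ w (trans (cong uniq split) u)) x
   total : ∀ x → bad w ≡ x → ι x * c + b + 1 + (q * (b + 1) + count * c + e) ≡ suc q * (b + 1) + (ι (bad w) + count) * c + e
   total x refl = ring (ι x) c b q count e
    where
    ring : ∀ i c b q k e → i * c + b + 1 + (q * (b + 1) + k * c + e) ≡ suc q * (b + 1) + (i + k) * c + e
    ring = solve-∀

 module _ {A : Set} where

  ∑ℤ : List A → (A → ℤ) → ℤ
  ∑ℤ [] f = ℤ.0ℤ
  ∑ℤ (x ∷ xs) f = f x ℤ.+ ∑ℤ xs f

  ∑ℤ-cong : ∀ xs {f g : A → ℤ} → f ≗ g → ∑ℤ xs f ≡ ∑ℤ xs g
  ∑ℤ-cong [] e = refl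
  ∑ℤ-cong (x ∷ xs) e = cong₂ ℤ._+_ (e x) (∑ℤ-cong xs e)

  ∑ℤ-+ : ∀ xs (f g : A → ℤ) → ∑ℤ xs (λ x → f x ℤ.+ g x) ≡ ∑ℤ xs f ℤ.+ ∑ℤ xs g
  ∑ℤ-+ [] f g = refl
  ∑ℤ-+ (x ∷ xs) f g = trans (cong (ℤ._+_ (f x ℤ.+ g x)) (∑ℤ-+ xs f g)) (interchange (f x) (g x) (∑ℤ xs f) (∑ℤ xs g))
   where
   interchange : ∀ a b c d → (a ℤ.+ b) ℤ.+ (c ℤ.+ d) ≡ (a ℤ.+ c) ℤ.+ (b ℤ.+ d)
   interchange = ℤSolver.solve-∀

  ∑ℤ-*ˡ : ∀ xs c (f : A → ℤ) → ∑ℤ xs (λ x → c ℤ.* f x) ≡ c ℤ.* ∑ℤ xs f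
  ∑ℤ-*ˡ [] c f = sym (ℤₚ.*-zeroʳ c)
  ∑ℤ-*ˡ (x ∷ xs) c f = trans (cong (ℤ._+_ (c ℤ.* f x)) (∑ℤ-*ˡ xs c f)) (sym (ℤₚ.*-distribˡ-+ c (f x) _))

  ∑ℤ-*ʳ : ∀ xs c (f : A → ℤ) → ∑ℤ xs (λ x → f x ℤ.* c) ≡ ∑ℤ xs f ℤ.* c
  ∑ℤ-*ʳ xs c f = trans (∑ℤ-cong xs (λ x → ℤₚ.*-comm (f x) c)) (trans (∑ℤ-*ˡ xs c f) (ℤₚ.*-comm c _))

  ∑ℤ-pos : ∀ xs (f : A → ℕ) → ∑ℤ xs (λ x → ℤ.+ f x) ≡ ℤ.+ ∑ xs f
  ∑ℤ-pos [] f = refl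
  ∑ℤ-pos (x ∷ xs) f = trans (cong (ℤ._+_ (ℤ.+ f x)) (∑ℤ-pos xs f)) (sym (ℤₚ.pos-+ (f x) _))

  ∑ℤ-const : ∀ (xs : List A) c → ∑ℤ xs (λ _ → c) ≡ ℤ.+ length xs ℤ.* c
  ∑ℤ-const [] c = sym (ℤₚ.*-zeroˡ c)
  ∑ℤ-const (x ∷ xs) c = trans (cong (ℤ._+_ c) (∑ℤ-const xs c)) (sym (ℤₚ.suc-* (ℤ.+ length xs) c))

  ∑ℤ-++ : ∀ xs ys (f : A → ℤ) → ∑ℤ (xs ++ ys) f ≡ ∑ℤ xs f ℤ.+ ∑ℤ ys f
  ∑ℤ-++ [] ys f = sym (ℤₚ.+-identityˡ _)
  ∑ℤ-++ (x ∷ xs) ys f = trans (cong (ℤ._+_ (f x)) (∑ℤ-++ xs ys f)) (sym (ℤₚ.+-assoc (f x) _ _))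

 ∑ℤ-map : ∀ {A B : Set} (g : A → B) xs f → ∑ℤ (map g xs) f ≡ ∑ℤ xs (f ∘ g)
 ∑ℤ-map g [] f = refl
 ∑ℤ-map g (x ∷ xs) f = cong (ℤ._+_ (f (g x))) (∑ℤ-map g xs f)

 ∑ℤ-tuples-suc : ∀ {A : Set} (xs : List A) j (f : List A → ℤ) →
         ∑ℤ (tuples xs (suc j)) f ≡ ∑ℤ xs (λ x → ∑ℤ (tuples xs j) (λ t → f (x ∷ t)))
 ∑ℤ-tuples-suc xs j f = cart xs
  where
  cart : ∀ ys → ∑ℤ (cartesianProductWith _∷_ ys (tuples xs j)) f ≡ ∑ℤ ys (λ x → ∑ℤ (tuples xs j) (λ t → f (x ∷ t)))
  cart [] = refl
  cart (y ∷ ys) = trans (∑ℤ-++ (map (y ∷_) (tuples xs j)) _ f) (cong₂ ℤ._+_ (∑ℤ-map (y ∷_) (tuples xs j) f) (cart ys))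

 square-abs : ∀ i → i ℤ.* i ≡ ℤ.+ (ℤ.∣ i ∣ * ℤ.∣ i ∣)
 square-abs (ℤ.+ k) = sym (ℤₚ.pos-* k k)
 square-abs ℤ.-[1+ k ] = refl

 ∑-square-abs : ∀ {A : Set} (xs : List A) (f : A → ℤ) → ℤ.+ ∑ xs (λ x → ℤ.∣ f x ∣ * ℤ.∣ f x ∣) ≡ ∑ℤ xs (λ x → f x ℤ.* f x)
 ∑-square-abs [] f = refl
 ∑-square-abs (x ∷ xs) f = trans (ℤₚ.pos-+ (ℤ.∣ f x ∣ * ℤ.∣ f x ∣) _) (cong₂ ℤ._+_ (sym (square-abs (f x))) (∑-square-abs xs f))

 module _ {A : Set} (X : List A) where

  private a = length X

  variance : (A → ℤ) → ℕ → ℤ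
  variance ψ M = ∑ℤ (tuples X M) (λ W → ∑ℤ W ψ ℤ.* ∑ℤ W ψ)

  variance≡ : ∀ ψ M → ∑ℤ X ψ ≡ ℤ.0ℤ →
        ℤ.+ a ℤ.* variance ψ M ≡ ℤ.+ M ℤ.* (ℤ.+ (a ^ M) ℤ.* ∑ℤ X (λ x → ψ x ℤ.* ψ x))
  variance≡ ψ zero centred = ℤₚ.*-zeroʳ (ℤ.+ a)
  variance≡ ψ (suc M) centred = begin
   ℤ.+ a ℤ.* variance ψ (suc M)
    ≡⟨ cong (ℤ.+ a ℤ.*_) step ⟩
   ℤ.+ a ℤ.* (p ℤ.* Q ℤ.+ ℤ.+ a ℤ.* variance ψ M)
    ≡⟨ cong (λ z → ℤ.+ a ℤ.* (p ℤ.* Q ℤ.+ z)) (variance≡ ψ M centred) ⟩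
   ℤ.+ a ℤ.* (p ℤ.* Q ℤ.+ ℤ.+ M ℤ.* (p ℤ.* Q))
    ≡⟨ ring (ℤ.+ a) p Q (ℤ.+ M) ⟩
   (ℤ.1ℤ ℤ.+ ℤ.+ M) ℤ.* (ℤ.+ a ℤ.* p ℤ.* Q)
    ≡⟨ cong (λ z → ℤ.+ suc M ℤ.* (z ℤ.* Q)) (sym (ℤₚ.pos-* a (a ^ M))) ⟩
   ℤ.+ suc M ℤ.* (ℤ.+ (a ^ suc M) ℤ.* Q) ∎
   where
   open ≡-Reasoning
   Q = ∑ℤ X (λ x → ψ x ℤ.* ψ x)
   p = ℤ.+ (a ^ M)
   Ts = tuples X M
   Ψ = ∑ℤ Ts (λ W → ∑ℤ W ψ)
   ring : ∀ a p Q m → a ℤ.* (p ℤ.* Q ℤ.+ m ℤ.* (p ℤ.* Q)) ≡ (ℤ.1ℤ ℤ.+ m) ℤ.* (a ℤ.* p ℤ.* Q)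
   ring = ℤSolver.solve-∀
   expand : ∀ u v → (u ℤ.+ v) ℤ.* (u ℤ.+ v) ≡ u ℤ.* u ℤ.+ ((u ℤ.+ u) ℤ.* v ℤ.+ v ℤ.* v)
   expand = ℤSolver.solve-∀
   collect : ∀ x → ∑ℤ Ts (λ W → (ψ x ℤ.+ ∑ℤ W ψ) ℤ.* (ψ x ℤ.+ ∑ℤ W ψ)) ≡
        p ℤ.* (ψ x ℤ.* ψ x) ℤ.+ ((ψ x ℤ.+ ψ x) ℤ.* Ψ ℤ.+ variance ψ M)
   collect x = begin
    ∑ℤ Ts (λ W → (ψ x ℤ.+ ∑ℤ W ψ) ℤ.* (ψ x ℤ.+ ∑ℤ W ψ))
     ≡⟨ ∑ℤ-cong Ts (λ W → expand (ψ x) (∑ℤ W ψ)) ⟩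
    ∑ℤ Ts (λ W → ψ x ℤ.* ψ x ℤ.+ ((ψ x ℤ.+ ψ x) ℤ.* ∑ℤ W ψ ℤ.+ ∑ℤ W ψ ℤ.* ∑ℤ W ψ))
     ≡⟨ trans (∑ℤ-+ Ts _ _) (cong₂ ℤ._+_ (∑ℤ-const Ts _) (trans (∑ℤ-+ Ts _ _) (cong (ℤ._+ variance ψ M) (∑ℤ-*ˡ Ts (ψ x ℤ.+ ψ x) _)))) ⟩
    ℤ.+ length Ts ℤ.* (ψ x ℤ.* ψ x) ℤ.+ ((ψ x ℤ.+ ψ x) ℤ.* Ψ ℤ.+ variance ψ M)
     ≡⟨ cong (λ k → ℤ.+ k ℤ.* (ψ x ℤ.* ψ x) ℤ.+ ((ψ x ℤ.+ ψ x) ℤ.* Ψ ℤ.+ variance ψ M)) (length-tuples X M) ⟩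
    p ℤ.* (ψ x ℤ.* ψ x) ℤ.+ ((ψ x ℤ.+ ψ x) ℤ.* Ψ ℤ.+ variance ψ M) ∎
   vanish : ∀ T → (ℤ.0ℤ ℤ.+ ℤ.0ℤ) ℤ.* T ≡ ℤ.0ℤ
   vanish = ℤSolver.solve-∀
   step : variance ψ (suc M) ≡ p ℤ.* Q ℤ.+ ℤ.+ a ℤ.* variance ψ M
   step = begin
    variance ψ (suc M)
     ≡⟨ trans (∑ℤ-tuples-suc X M _) (∑ℤ-cong X collect) ⟩
    ∑ℤ X (λ x → p ℤ.* (ψ x ℤ.* ψ x) ℤ.+ ((ψ x ℤ.+ ψ x) ℤ.* Ψ ℤ.+ variance ψ M))
     ≡⟨ trans (∑ℤ-+ X _ _) (cong₂ ℤ._+_ (∑ℤ-*ˡ X p _) (trans (∑ℤ-+ X _ _) (cong₂ ℤ._+_ (trans (∑ℤ-*ʳ X Ψ _) (cong (ℤ._* Ψ) (∑ℤ-+ X ψ ψ))) (∑ℤ-const X _)))) ⟩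
    p ℤ.* Q ℤ.+ ((∑ℤ X ψ ℤ.+ ∑ℤ X ψ) ℤ.* Ψ ℤ.+ ℤ.+ a ℤ.* variance ψ M)
     ≡⟨ cong (λ z → p ℤ.* Q ℤ.+ (z ℤ.+ ℤ.+ a ℤ.* variance ψ M)) (trans (cong (λ z → (z ℤ.+ z) ℤ.* Ψ) centred) (vanish Ψ)) ⟩
    p ℤ.* Q ℤ.+ (ℤ.0ℤ ℤ.+ ℤ.+ a ℤ.* variance ψ M)
     ≡⟨ cong (ℤ._+_ (p ℤ.* Q)) (ℤₚ.+-identityˡ _) ⟩
    p ℤ.* Q ℤ.+ ℤ.+ a ℤ.* variance ψ M ∎

  chebyshev : ∀ (z : A → ℕ) q C M → 0 < a → (∀ x → z x ≤ C) → suc (2 * q) * a ≤ q * ∑ X z → 0 < M → 8 * q ≤ M →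
        ∑ (tuples X M) (λ W → ι (∑ W z ≤ᵇ 2 * M + 4)) * M ≤ 4 * (q * q) * (C * C) * a ^ M
  chebyshev z q C M a>0 z≤C mean M>0 M≥8q = *-cancelˡ-pos (a * a * a * M) (*-pos (*-pos (*-pos a>0 a>0) a>0) M>0) (begin
   a * a * a * M * (E * M)
    ≡⟨ ring₁ a M E ⟩
   a * ((a * M) * (a * M) * E)
    ≤⟨ *-monoʳ-≤ a small ⟩
   a * (4 * (q * q) * ∑ (tuples X M) (λ W → ℤ.∣ Ψ W ∣ * ℤ.∣ Ψ W ∣))
    ≡⟨ *-exchange a (4 * (q * q)) _ ⟩
   4 * (q * q) * (a * ∑ (tuples X M) (λ W → ℤ.∣ Ψ W ∣ * ℤ.∣ Ψ W ∣))
    ≡⟨ cong (4 * (q * q) *_) (ℤₚ.+-injective secondMoment) ⟩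
   4 * (q * q) * (M * (a ^ M * ∑ X (λ x → ℤ.∣ ψ x ∣ * ℤ.∣ ψ x ∣)))
    ≤⟨ *-monoʳ-≤ (4 * (q * q)) (*-monoʳ-≤ M (*-monoʳ-≤ (a ^ M) (∑-≤-const X (a * C * (a * C)) (λ x → *-mono-≤ (ψ≤ x) (ψ≤ x))))) ⟩
   4 * (q * q) * (M * (a ^ M * (a * (a * C * (a * C)))))
    ≡⟨ ring₃ (q * q) M (a ^ M) a C ⟩
   a * a * a * M * (4 * (q * q) * (C * C) * a ^ M) ∎)
   where
   open ≤-Reasoning
   s = ∑ X z
   E = ∑ (tuples X M) (λ W → ι (∑ W z ≤ᵇ 2 * M + 4))
   ψ : A → ℤ
   ψ x = s ℤ.⊖ a * z x
   Ψ : List A → ℤ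
   Ψ W = ∑ℤ W ψ
   ring₁ : ∀ a M E → a * a * a * M * (E * M) ≡ a * ((a * M) * (a * M) * E)
   ring₁ = solve-∀
   ring₃ : ∀ qq M p a C → 4 * qq * (M * (p * (a * (a * C * (a * C))))) ≡ a * a * a * M * (4 * qq * (C * C) * p)
   ring₃ = solve-∀
   Ψ≡ : ∀ W → Ψ W ≡ (length W * s) ℤ.⊖ a * ∑ W z
   Ψ≡ [] = sym (trans (cong (0 ℤ.⊖_) (*-zeroʳ a)) refl)
   Ψ≡ (x ∷ W) = trans (cong (ℤ._+_ (ψ x)) (Ψ≡ W)) (trans (ℤₚ.+-comm (ψ x) _) (trans (add (length W * s) (a * ∑ W z) s (a * z x))
     (cong₂ ℤ._⊖_ (+-comm (length W * s) s) (trans (+-comm (a * ∑ W z) (a * z x)) (sym (*-distribˡ-+ a (z x) _))))))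
    where
    add : ∀ m k m′ k′ → (m ℤ.⊖ k) ℤ.+ (m′ ℤ.⊖ k′) ≡ (m + m′) ℤ.⊖ (k + k′)
    add m k m′ k′ = trans (cong₂ ℤ._+_ (sym (ℤₚ.m-n≡m⊖n m k)) (sym (ℤₚ.m-n≡m⊖n m′ k′)))
     (trans (ring (ℤ.+ m) (ℤ.+ k) (ℤ.+ m′) (ℤ.+ k′))
     (trans (cong₂ ℤ._-_ (sym (ℤₚ.pos-+ m m′)) (sym (ℤₚ.pos-+ k k′))) (ℤₚ.m-n≡m⊖n (m + m′) (k + k′))))
     where
     ring : ∀ a b c d → (a ℤ.- b) ℤ.+ (c ℤ.- d) ≡ (a ℤ.+ c) ℤ.- (b ℤ.+ d)
     ring = ℤSolver.solve-∀
   s≤ : s ≤ a * C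
   s≤ = ∑-≤-const X C z≤C
   ψ≤ : ∀ x → ℤ.∣ ψ x ∣ ≤ a * C
   ψ≤ x = ≤-trans (ℤₚ.∣m⊝n∣≤m⊔n s (a * z x)) (⊔-lub s≤ (*-monoʳ-≤ a (z≤C x)))
   centred : ∑ℤ X ψ ≡ ℤ.0ℤ
   centred = trans (Ψ≡ X) (ℤₚ.n⊖n≡0 (a * s))
   secondMoment : ℤ.+ (a * ∑ (tuples X M) (λ W → ℤ.∣ Ψ W ∣ * ℤ.∣ Ψ W ∣)) ≡ ℤ.+ (M * (a ^ M * ∑ X (λ x → ℤ.∣ ψ x ∣ * ℤ.∣ ψ x ∣)))
   secondMoment = trans (ℤₚ.pos-* a _) (trans (cong (ℤ.+ a ℤ.*_) (∑-square-abs (tuples X M) Ψ)) (trans (variance≡ ψ M centred)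
    (sym (trans (ℤₚ.pos-* M _) (cong (ℤ.+ M ℤ.*_) (trans (ℤₚ.pos-* (a ^ M) _) (cong (ℤ.+ (a ^ M) ℤ.*_) (∑-square-abs X ψ))))))))
   deviation : ∀ {W} → length W ≡ M → ∑ W z ≤ 2 * M + 4 → a * M ≤ 2 * q * ℤ.∣ Ψ W ∣
   deviation {W} len low = subst (λ i → a * M ≤ 2 * q * ℤ.∣ i ∣) (sym (trans (Ψ≡ W) (trans (cong (λ k → (k * s) ℤ.⊖ a * Z) len) (ℤₚ.⊖-≥ aZ≤Ms)))) gap
    where
    Z = ∑ W z
    gap : a * M ≤ 2 * q * (M * s ∸ a * Z)
    gap = linear 0
     (+-mono-≤ (*-monoʳ-≤ (2 * M) mean) (+-mono-≤ (*-monoʳ-≤ a M≥8q) (+-mono-≤ (*-monoʳ-≤ (2 * q * a) low) (*-monoʳ-≤ (2 * q) (m≤n+m∸n (M * s) (a * Z))))))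
     (certificate a M q s Z (M * s ∸ a * Z))
     where
     certificate : ∀ a M q s Z d → a * M + (2 * M * (q * s) + (a * M + (2 * q * a * (2 * M + 4) + 2 * q * (a * Z + d)))) + 0 ≡ 2 * q * d + (2 * M * (suc (2 * q) * a) + (a * (8 * q) + (2 * q * a * Z + 2 * q * (M * s))))
     certificate = solve-∀
    q>0 : ∀ q → suc (2 * q) * a ≤ q * s → 0 < q
    q>0 (suc _) _ = s≤s z≤n
    q>0 zero h = ≤-trans a>0 (≤-trans (m≤m+n a 0) h)
    aZ≤Ms : a * Z ≤ M * s
    aZ≤Ms = *-cancelˡ-pos q (q>0 q mean) (linear (4 * q * a) (+-mono-≤ (*-monoʳ-≤ (q * a) low) (+-mono-≤ (*-monoʳ-≤ M mean) (*-monoʳ-≤ a M≥8q)))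
     (certificate a M q s Z))
     where
     certificate : ∀ a M q s Z → q * (a * Z) + (q * a * (2 * M + 4) + (M * (q * s) + a * M)) + 4 * q * a ≡ q * (M * s) + (q * a * Z + (M * (suc (2 * q) * a) + a * (8 * q)))
     certificate = solve-∀
   small : (a * M) * (a * M) * E ≤ 4 * (q * q) * ∑ (tuples X M) (λ W → ℤ.∣ Ψ W ∣ * ℤ.∣ Ψ W ∣)
   small = subst₂ _≤_ (∑-*ˡ (tuples X M) (a * M * (a * M)) _) (∑-*ˡ (tuples X M) (4 * (q * q)) _) (∑-mono∈ (tuples X M) pointwise)
    where
    pointwise : ∀ {W} → W ∈ tuples X M → a * M * (a * M) * ι (∑ W z ≤ᵇ 2 * M + 4) ≤ 4 * (q * q) * (ℤ.∣ Ψ W ∣ * ℤ.∣ Ψ W ∣)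
    pointwise {W} W∈ with ∑ W z ≤ᵇ 2 * M + 4 in e
    ... | false = ≡-≤-trans (*-zeroʳ (a * M * (a * M))) z≤n
    ... | true = ≡-≤-trans (*-identityʳ _) (≤-≡-trans (*-mono-≤ dev dev) (squares q ℤ.∣ Ψ W ∣))
     where
     dev = deviation {W} (tuple-length X M W∈) (≤ᵇ⇒≤ _ _ (subst T (sym e) tt))
     squares : ∀ q d → 2 * q * d * (2 * q * d) ≡ 4 * (q * q) * (d * d)
     squares = solve-∀

 markov : ∀ {A : Set} (X : List A) (f : A → ℕ) t D E → 0 < t → E * (D * ∑ X f) ≤ length X * t →
      E * ∑ X (λ x → ι (not (D * f x ≤ᵇ t))) ≤ length X
 markov X f t D E t>0 h = *-cancelˡ-pos t t>0 (begin
  t * (E * ∑ X (λ x → ι (not (D * f x ≤ᵇ t)))) ≡⟨ *-exchange t E _ ⟩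
  E * (t * ∑ X (λ x → ι (not (D * f x ≤ᵇ t)))) ≡⟨ cong (E *_) (∑-*ˡ X t _) ⟨
  E * ∑ X (λ x → t * ι (not (D * f x ≤ᵇ t))) ≤⟨ *-monoʳ-≤ E (∑-mono X pointwise) ⟩
  E * ∑ X (λ x → D * f x) ≡⟨ cong (E *_) (∑-*ˡ X D f) ⟩
  E * (D * ∑ X f) ≤⟨ h ⟩
  length X * t ≡⟨ *-comm _ t ⟩
  t * length X ∎)
  where
  open ≤-Reasoning
  pointwise : ∀ x → t * ι (not (D * f x ≤ᵇ t)) ≤ D * f x
  pointwise x with D * f x ≤ᵇ t in e
  ... | true = ≡-≤-trans (*-zeroʳ t) z≤n
  ... | false = ≡-≤-trans (*-identityʳ t) (≰⇒≥ (λ h → subst T e (≤⇒≤ᵇ h)))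

 module _ {A : Set} where

  picks : List A → List (A × List A)
  picks [] = []
  picks (x ∷ W) = (x , W) ∷ map (λ (y , r) → y , x ∷ r) (picks W)

  ∑-picks-cons : ∀ (x : A) W f → ∑ (picks (x ∷ W)) f ≡ f (x , W) + ∑ (picks W) (λ (y , r) → f (y , x ∷ r))
  ∑-picks-cons x W f = cong (f (x , W) +_) (∑-map _ (picks W) f)

  ∑-picks : ∀ W (f : A → ℕ) → ∑ (picks W) (f ∘ proj₁) ≡ ∑ W f
  ∑-picks [] f = refl
  ∑-picks (x ∷ W) f = trans (∑-picks-cons x W (f ∘ proj₁)) (cong (f x +_) (∑-picks W f))

  picks-split : ∀ W {x r} → (x , r) ∈ picks W → ∀ f → ∑ W f ≡ f x + ∑ r f
  picks-split (y ∷ W) (here refl) f = refl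
  picks-split (y ∷ W) (there p) f with ∈-map⁻ _ p
  ... | (x , r) , q , refl = trans (cong (f y +_) (picks-split W q f)) (exchange (f y) (f x) (∑ r f))
   where
   exchange : ∀ a b c → a + (b + c) ≡ b + (a + c)
   exchange = solve-∀

  ∑-tuples-picks : ∀ (X : List A) M (h : A → List A → ℕ) →
   ∑ (tuples X (suc M)) (λ W → ∑ (picks W) (λ (x , r) → h x r)) ≡ suc M * ∑ X (λ x → ∑ (tuples X M) (h x))
  ∑-tuples-picks X zero h = trans (∑-tuples-1 X _) (sym (+-identityʳ _))
  ∑-tuples-picks X (suc M) h = begin
   ∑ (tuples X (suc (suc M))) (λ W → ∑ (picks W) (λ (x , r) → h x r))
    ≡⟨ ∑-tuples-suc X (suc M) _ ⟩
   ∑ X (λ x → ∑ (tuples X (suc M)) (λ W → ∑ (picks (x ∷ W)) (λ (y , r) → h y r)))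
    ≡⟨ ∑-cong X (λ x → trans (∑-cong (tuples X (suc M)) (λ W → ∑-picks-cons x W _))
       (trans (∑-+ (tuples X (suc M)) _ _) (cong (∑ (tuples X (suc M)) (h x) +_) (∑-tuples-picks X M (λ y r → h y (x ∷ r)))))) ⟩
   ∑ X (λ x → ∑ (tuples X (suc M)) (h x) + suc M * ∑ X (λ y → ∑ (tuples X M) (λ r → h y (x ∷ r))))
    ≡⟨ trans (∑-+ X _ _) (cong (H +_) (∑-*ˡ X (suc M) _)) ⟩
   H + suc M * ∑ X (λ x → ∑ X (λ y → ∑ (tuples X M) (λ r → h y (x ∷ r))))
    ≡⟨ cong (λ k → H + suc M * k) (trans (∑-swap X X _) (∑-cong X (λ y → sym (∑-tuples-suc X M (h y))))) ⟩
   H + suc M * H ∎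
   where
   open ≡-Reasoning
   H = ∑ X (λ x → ∑ (tuples X (suc M)) (h x))

  ∑-tuples-picks² : ∀ (X : List A) M (h : A → A → List A → ℕ) →
   ∑ (tuples X (2 + M)) (λ W → ∑ (picks W) (λ (x , r) → ∑ (picks r) (λ (y , r′) → h x y r′))) ≡
   (2 + M) * ((1 + M) * ∑ X (λ x → ∑ X (λ y → ∑ (tuples X M) (h x y))))
  ∑-tuples-picks² X M h = trans (∑-tuples-picks X (suc M) _)
   (cong ((2 + M) *_) (trans (∑-cong X (λ x → ∑-tuples-picks X M (h x))) (∑-*ˡ X (1 + M) _)))

  ∑²-picks : ∀ W (f : A → A → ℕ) → ∑ W (λ x → ∑ W (f x)) ≡ ∑ W (λ x → f x x) + ∑ (picks W) (λ (x , r) → ∑ (picks r) (λ (y , _) → f x y))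
  ∑²-picks W f = begin
   ∑ W (λ x → ∑ W (f x))
    ≡⟨ ∑-picks W (λ x → ∑ W (f x)) ⟨
   ∑ (picks W) (λ (x , r) → ∑ W (f x))
    ≡⟨ ∑-cong∈ (picks W) (λ {p} p∈ → trans (picks-split W p∈ (f (proj₁ p))) (cong (f (proj₁ p) (proj₁ p) +_) (sym (∑-picks (proj₂ p) (f (proj₁ p)))))) ⟩
   ∑ (picks W) (λ (x , r) → f x x + ∑ (picks r) (λ (y , _) → f x y))
    ≡⟨ trans (∑-+ (picks W) _ _) (cong (_+ ∑ (picks W) (λ (x , r) → ∑ (picks r) (λ (y , _) → f x y))) (∑-picks W (λ x → f x x))) ⟩
   ∑ W (λ x → f x x) + ∑ (picks W) (λ (x , r) → ∑ (picks r) (λ (y , _) → f x y)) ∎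
   where open ≡-Reasoning

  failures : (A → A → A → ℕ) → List A → ℕ
  failures z W = ∑ W (λ x → ∑ W (λ y → ι (∑ W (z x y) ≤ᵇ 2 * length W)))

  sampling : ∀ (X : List A) (z : A → A → A → ℕ) q C D E M → 0 < length X →
        (∀ x y w → z x y w ≤ C) → (∀ {x y} → x ∈ X → y ∈ X → suc (2 * q) * length X ≤ q * ∑ X (z x y)) →
        0 < M → 8 * q ≤ M → E * D * suc (4 * (q * q) * (C * C)) ≤ M →
        E * ∑ (tuples X (2 + M)) (λ W → ι (not (D * failures z W ≤ᵇ (2 + M) * (2 + M)))) ≤ length X ^ (2 + M)
  sampling X z q C D E M a>0 z≤C mean M>0 M≥8q big =
   subst (E * ∑ (tuples X (2 + M)) _ ≤_) (length-tuples X (2 + M)) (markov (tuples X (2 + M)) (failures z) ((2 + M) * (2 + M)) D E (s≤s z≤n)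
    (subst (λ k → E * (D * ∑ (tuples X (2 + M)) (failures z)) ≤ k * ((2 + M) * (2 + M))) (sym (length-tuples X (2 + M))) main))
   where
   open ≤-Reasoning
   a = length X
   K = 4 * (q * q) * (C * C)
   low : A → A → List A → ℕ
   low x y r = ι (∑ r (z x y) ≤ᵇ 2 * M + 4)
   few : ∀ {x y} → x ∈ X → y ∈ X → ∑ (tuples X M) (low x y) * M ≤ K * a ^ M
   few {x} {y} x∈ y∈ = chebyshev X (z x y) q C M a>0 (z≤C x y) (mean x∈ y∈) M>0 M≥8q
   ι-mono : ∀ {m k m′ k′} → m ≤ m′ → k′ ≤ k → ι (m′ ≤ᵇ k′) ≤ ι (m ≤ᵇ k)
   ι-mono {m} {k} {m′} {k′} h h′ with m′ ≤ᵇ k′ in e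
   ... | false = z≤n
   ... | true = ι-true (T⇒≡ (≤⇒≤ᵇ (≤-trans h (≤-trans (≤ᵇ⇒≤ _ _ (subst T (sym e) tt)) h′))))
   pointwise : ∀ {W} → W ∈ tuples X (2 + M) → failures z W ≤ (2 + M) + ∑ (picks W) (λ (x , r) → ∑ (picks r) (λ (y , r′) → low x y r′))
   pointwise {W} W∈ = ≡-≤-trans (∑²-picks W _) (+-mono-≤
    (≤-≡-trans (∑-≤-const W 1 (λ x → ι≤1 _)) (trans (*-identityʳ _) len))
    (∑-mono∈ (picks W) (λ {p} p∈ → ∑-mono∈ (picks (proj₂ p)) (λ {p′} p′∈ → ι-mono
     (≤-trans (m≤n+m _ (z (proj₁ p) (proj₁ p′) (proj₁ p′))) (≡-≤-trans (sym (picks-split (proj₂ p) p′∈ (z (proj₁ p) (proj₁ p′))))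
      (≤-≡-trans (m≤n+m _ (z (proj₁ p) (proj₁ p′) (proj₁ p))) (sym (picks-split W p∈ (z (proj₁ p) (proj₁ p′)))))))
     (≤-reflexive (trans (cong (2 *_) len) (double M)))))))
    where
    len = tuple-length X (2 + M) W∈
    double : ∀ M → 2 * (2 + M) ≡ 2 * M + 4
    double = solve-∀
   total : ∑ (tuples X (2 + M)) (failures z) * M ≤ (2 + M) * (2 + M) * (suc K * (a * (a * a ^ M)))
   total = begin
    ∑ (tuples X (2 + M)) (failures z) * M
     ≤⟨ *-monoˡ-≤ M (≤-trans (∑-mono∈ (tuples X (2 + M)) pointwise) (≤-reflexive (trans (∑-+ (tuples X (2 + M)) _ _)
        (cong₂ _+_ (∑-tuples-const X (2 + M) (2 + M)) (∑-tuples-picks² X M low))))) ⟩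
    (a ^ (2 + M) * (2 + M) + (2 + M) * ((1 + M) * S)) * M
     ≡⟨ rearrange (a ^ (2 + M)) M S ⟩
    a ^ (2 + M) * ((2 + M) * M) + (2 + M) * (1 + M) * (S * M)
     ≤⟨ +-mono-≤ (*-monoʳ-≤ (a ^ (2 + M)) (*-monoʳ-≤ (2 + M) (m≤n+m M 2))) (*-mono-≤ (*-monoʳ-≤ (2 + M) (n≤1+n (1 + M))) S≤) ⟩
    a ^ (2 + M) * ((2 + M) * (2 + M)) + (2 + M) * (2 + M) * (a * (a * (K * a ^ M)))
     ≡⟨ collect a (a ^ M) (2 + M) K ⟩
    (2 + M) * (2 + M) * (suc K * (a * (a * a ^ M))) ∎
    where
    S = ∑ X (λ x → ∑ X (λ y → ∑ (tuples X M) (low x y)))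
    rearrange : ∀ p M S → (p * (2 + M) + (2 + M) * ((1 + M) * S)) * M ≡ p * ((2 + M) * M) + (2 + M) * (1 + M) * (S * M)
    rearrange = solve-∀
    collect : ∀ a p m K → a * (a * p) * (m * m) + m * m * (a * (a * (K * p))) ≡ m * m * (suc K * (a * (a * p)))
    collect = solve-∀
    S≤ : S * M ≤ a * (a * (K * a ^ M))
    S≤ = begin
     S * M ≡⟨ trans (sym (∑-*ʳ X M _)) (∑-cong X (λ x → sym (∑-*ʳ X M _))) ⟩
     ∑ X (λ x → ∑ X (λ y → ∑ (tuples X M) (low x y) * M)) ≤⟨ ∑-mono∈ X (λ x∈ → ∑-mono∈ X (λ y∈ → few x∈ y∈)) ⟩
     ∑ X (λ x → ∑ X (λ y → K * a ^ M)) ≡⟨ trans (∑-const X _) (cong (a *_) (∑-const X _)) ⟩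
     a * (a * (K * a ^ M)) ∎
   main : E * (D * ∑ (tuples X (2 + M)) (failures z)) ≤ a ^ (2 + M) * ((2 + M) * (2 + M))
   main = *-cancelˡ-pos M M>0 (begin
    M * (E * (D * F)) ≡⟨ ring M E D F ⟩
    E * D * (F * M) ≤⟨ *-monoʳ-≤ (E * D) total ⟩
    E * D * ((2 + M) * (2 + M) * (suc K * (a * (a * a ^ M)))) ≡⟨ ring′ (E * D) ((2 + M) * (2 + M)) (suc K) (a * (a * a ^ M)) ⟩
    E * D * suc K * (a * (a * a ^ M) * ((2 + M) * (2 + M))) ≤⟨ *-monoˡ-≤ _ big ⟩
    M * (a ^ (2 + M) * ((2 + M) * (2 + M))) ∎)
    where
    F = ∑ (tuples X (2 + M)) (failures z)
    ring : ∀ M E D F → M * (E * (D * F)) ≡ E * D * (F * M)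
    ring = solve-∀
    ring′ : ∀ u v k p → u * (v * (k * p)) ≡ u * k * (p * v)
    ring′ = solve-∀

 picks-↭ : ∀ {A : Set} (W : List A) {x r} → (x , r) ∈ picks W → W ↭ x ∷ r
 picks-↭ (y ∷ W) (here refl) = ↭-refl
 picks-↭ (y ∷ W) (there p) with ∈-map⁻ _ p
 ... | (x , r) , q , refl = ↭-trans (prep y (picks-↭ W q)) (swap y x ↭-refl)

 ≟0 : ∀ m → m ≡ 0 ⊎ 0 < m
 ≟0 zero = inj₁ refl
 ≟0 (suc m) = inj₂ (s≤s z≤n)

 -- A matching of two lists of equal length, as a list of pairs; a mismatch is a non-adjacent pair.
 module Matching {A : Set} (_≟_ : (a b : A) → Dec (a ≡ b)) (adj : A → A → Bool) where

  open import Data.List.Membership.DecPropositional _≟_ using (_∈?_)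

  mismatches : List (A × A) → ℕ
  mismatches L = ∑ L (λ p → ι (not (adj (proj₁ p) (proj₂ p))))

  Rematches : List (A × A) → List (A × A) → Set
  Rematches L O = map proj₁ L ↭ map proj₁ O × map proj₂ L ↭ map proj₂ O

  gain : A → A → A × A → ℕ
  gain S T p = 2 * ι (adj S (proj₂ p)) + 2 * ι (adj (proj₁ p) T)
        + ι (adj (proj₁ p) (proj₂ p) ∧ not (adj S (proj₂ p)) ∧ not (adj (proj₁ p) T))

  gain≤5 : ∀ S T p → gain S T p ≤ 5
  gain≤5 S T p = truth-table 3 (λ x y w → 2 * ι x + 2 * ι y + ι (w ∧ not x ∧ not y)) (λ _ _ _ → 5) tt
   (adj S (proj₂ p)) (adj (proj₁ p) T) (adj (proj₁ p) (proj₂ p))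

  module _ (O : List (A × A)) where

   improve : ∀ L S b₀ a₀ T rest → Rematches L O → L ↭ (S , b₀) ∷ (a₀ , T) ∷ rest →
        adj S b₀ ≡ false → adj a₀ T ≡ false → 2 * length O < ∑ O (gain S T) →
        ∃[ L′ ] Rematches L′ O × mismatches L′ < mismatches L
   improve L S b₀ a₀ T rest (m₁ , m₂) p badS badT big = byST (adj S T) refl
    where
    mism : ∀ {K} → L ↭ K → mismatches L ≡ mismatches K
    mism = ∑-↭ _
    Result = ∃[ L′ ] Rematches L′ O × mismatches L′ < mismatches L

    replace : ∀ old new r → L ↭ old ++ r → map proj₁ new ↭ map proj₁ old → map proj₂ new ↭ map proj₂ old →
         mismatches new < mismatches old → Result
    replace old new r q e₁ e₂ less = new ++ r , (side proj₁ e₁ m₁ , side proj₂ e₂ m₂) ,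
     subst₂ _<_ (sym (∑-++ new r _)) (sym (trans (mism q) (∑-++ old r _))) (+-monoˡ-< (mismatches r) less)
     where
     side : ∀ (f : A × A → A) → map f new ↭ map f old → map f L ↭ map f O → map f (new ++ r) ↭ map f O
     side f e m = ↭-trans (↭-reflexive (Listₚ.map-++ f new r)) (↭-trans (++⁺ʳ (map f r) e)
      (↭-trans (↭-reflexive (sym (Listₚ.map-++ f old r))) (↭-trans (Permₚ.map⁺ f (↭-sym q)) m)))

    one : ∀ {x} → adj S b₀ ≡ false → x ≤ 1 → suc x ≤ ι (not (adj S b₀)) + 1
    one e h rewrite e = s≤s h

    fewer : ∀ {c} k → c ≤ k + 1 → c < ι (not (adj S b₀)) + (ι (not (adj a₀ T)) + k)
    fewer k h rewrite badS | badT = s≤s (≤-≡-trans h (+-comm k 1))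

    goodPair : ∀ {a b k c} → adj a b ≡ true → c ≤ k → ι (not (adj a b)) + c ≤ k
    goodPair e h rewrite e = h

    lastPair : ∀ a b k → ι (not (adj a b)) + 0 ≤ k + 1
    lastPair a b k = ≡-≤-trans (+-identityʳ _) (≤-trans (ι≤1 _) (m≤n+m 1 k))

    meet : A × A → Bool
    meet q = adj S (proj₂ q) ∧ adj (proj₁ q) T

    bridge : A × A → A × A → Bool
    bridge q q′ = adj S (proj₂ q) ∧ (adj (proj₁ q′) T ∧ (adj (proj₁ q) (proj₂ q′) ∧ not (adj (proj₁ q) T)))

    byBridge : adj S T ≡ false → ∑ rest (λ q → ι (meet q)) ≡ 0 → (∑ rest (λ q → ∑ rest (λ q′ → ι (bridge q q′)))) ≡ 0 → ⊥
    byBridge ST no-meet no-bridge = <⇒≱ big (begin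
     ∑ O (gain S T)
      ≡⟨ trans (∑-+ O _ _) (cong₂ _+_ (trans (∑-+ O _ _) (cong₂ _+_ (∑-*ˡ O 2 _) (∑-*ˡ O 2 _))) refl) ⟩
     2 * ∑ O (λ q → ι (adj S (proj₂ q))) + 2 * ∑ O (λ q → ι (adj (proj₁ q) T)) + ∑ O (λ q → ι (adj (proj₁ q) (proj₂ q) ∧ not (adj S (proj₂ q)) ∧ not (adj (proj₁ q) T)))
      ≤⟨ +-mono-≤ (≤-reflexive (cong₂ _+_ (cong (2 *_) (transfer₂ (λ b → ι (adj S b)))) (cong (2 *_) (transfer₁ (λ a → ι (adj a T)))))) edges ⟩
     2 * J + 2 * J′ + (K + K)
      ≡⟨ ring J J′ K ⟩
     2 * (J + (J′ + K))
      ≡⟨ cong (2 *_) (trans (cong (J +_) (sym (∑-+ L _ _))) (sym (∑-+ L _ _))) ⟩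
     2 * ∑ L (λ q → ι (adj S (proj₂ q)) + (ι (adj (proj₁ q) T) + ι (not (adj (proj₁ q) T) ∧ not (adj S (proj₂ q)))))
      ≤⟨ *-monoʳ-≤ 2 (∑-mono∈ L (λ {q} q∈ → partition (adj S (proj₂ q)) (adj (proj₁ q) T) (not-both q∈))) ⟩
     2 * ∑ L (λ _ → 1)
      ≡⟨ cong (2 *_) (trans (∑-1 L) lengths) ⟩
     2 * length O ∎)
     where
     open ≤-Reasoning
     J = ∑ L (λ q → ι (adj S (proj₂ q)))
     J′ = ∑ L (λ q → ι (adj (proj₁ q) T))
     K = ∑ L (λ q → ι (not (adj (proj₁ q) T) ∧ not (adj S (proj₂ q))))
     ring : ∀ J J′ K → 2 * J + 2 * J′ + (K + K) ≡ 2 * (J + (J′ + K))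
     ring = solve-∀
     lengths : length L ≡ length O
     lengths = trans (sym (length-map proj₁ L)) (trans (↭-length m₁) (length-map proj₁ O))
     transfer₁ : ∀ (f : A → ℕ) → ∑ O (f ∘ proj₁) ≡ ∑ L (f ∘ proj₁)
     transfer₁ f = trans (sym (∑-map proj₁ O f)) (trans (∑-↭ f (↭-sym m₁)) (∑-map proj₁ L f))
     transfer₂ : ∀ (f : A → ℕ) → ∑ O (f ∘ proj₂) ≡ ∑ L (f ∘ proj₂)
     transfer₂ f = trans (sym (∑-map proj₂ O f)) (trans (∑-↭ f (↭-sym m₂)) (∑-map proj₂ L f))
     partition : ∀ x y → x ∧ y ≡ false → ι x + (ι y + ι (not y ∧ not x)) ≤ 1
     partition true false _ = ≤-refl
     partition false true _ = ≤-refl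
     partition false false _ = ≤-refl
     zero-term : ∀ {B : Set} {xs : List B} {x} (f : B → Bool) → ∑ xs (λ x → ι (f x)) ≡ 0 → x ∈ xs → f x ≡ false
     zero-term {x = x} f e x∈ with f x in fx
     ... | false = refl
     ... | true with () ← ≤-trans (ι-true fx) (≤-≡-trans (∈⇒≤∑ (λ x → ι (f x)) x∈) e)
     not-both : ∀ {q} → q ∈ L → meet q ≡ false
     not-both q∈ with ∈-resp-↭ p q∈
     ... | here refl = cong (_∧ adj S T) badS
     ... | there (here refl) = cong (_∧ adj a₀ T) ST
     ... | there (there r) = zero-term meet no-meet r
     starts = map proj₁ (filterᵇ (λ q → adj S (proj₂ q)) rest)
     ends = map proj₂ (filterᵇ (λ q → adj (proj₁ q) T) rest)
     keep : ∀ {B : Set} (f : B → Bool) {xs x} → x ∈ xs → f x ≡ true → x ∈ filterᵇ f xs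
     keep f {y ∷ xs} (here refl) e rewrite e = here refl
     keep f {y ∷ xs} (there p) e with f y
     ... | true = there (keep f p e)
     ... | false = keep f p e
     kept : ∀ {B : Set} (f : B → Bool) xs {x} → x ∈ filterᵇ f xs → x ∈ xs × f x ≡ true
     kept f (y ∷ xs) p with f y in e
     kept f (y ∷ xs) (here refl) | true = here refl , e
     kept f (y ∷ xs) (there p) | true = there (proj₁ (kept f xs p)) , proj₂ (kept f xs p)
     ... | false = there (proj₁ (kept f xs p)) , proj₂ (kept f xs p)
     impossible : ∀ a b → adj a b ≡ true → adj a T ≡ false → a ∈ starts → b ∈ ends → ⊥
     impossible a b ab aT a∈ b∈ with ∈-map⁻ proj₁ a∈ | ∈-map⁻ proj₂ b∈
     ... | q , q∈ , refl | q′ , q′∈ , refl with kept _ rest q∈ | kept _ rest q′∈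
     ... | r , e | r′ , e′ with () ← trans (sym (e ∧ₜ (e′ ∧ₜ (ab ∧ₜ not-false aT))))
         (zero-term (bridge q) (n≤0⇒n≡0 (≤-≡-trans (∈⇒≤∑ (λ q → ∑ rest (λ q′ → ι (bridge q q′))) r) no-bridge)) r′)
     edges : ∑ O (λ q → ι (adj (proj₁ q) (proj₂ q) ∧ not (adj S (proj₂ q)) ∧ not (adj (proj₁ q) T))) ≤ K + K
     edges = begin
      ∑ O (λ q → ι (adj (proj₁ q) (proj₂ q) ∧ not (adj S (proj₂ q)) ∧ not (adj (proj₁ q) T)))
       ≤⟨ ∑-mono O unreachable ⟩
      ∑ O (λ q → ι (not (adj (proj₁ q) T) ∧ not ⌊ proj₁ q ∈? starts ⌋) + ι (not (adj S (proj₂ q)) ∧ not ⌊ proj₂ q ∈? ends ⌋))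
       ≡⟨ trans (∑-+ O _ _) (cong₂ _+_ (transfer₁ (λ a → ι (not (adj a T) ∧ not ⌊ a ∈? starts ⌋))) (transfer₂ (λ b → ι (not (adj S b) ∧ not ⌊ b ∈? ends ⌋)))) ⟩
      ∑ L (λ q → ι (not (adj (proj₁ q) T) ∧ not ⌊ proj₁ q ∈? starts ⌋)) + ∑ L (λ q → ι (not (adj S (proj₂ q)) ∧ not ⌊ proj₂ q ∈? ends ⌋))
       ≤⟨ +-mono-≤ (∑-mono∈ L from-start) (∑-mono∈ L from-end) ⟩
      K + K ∎
      where
      unreachable : ∀ q → ι (adj (proj₁ q) (proj₂ q) ∧ not (adj S (proj₂ q)) ∧ not (adj (proj₁ q) T)) ≤ ι (not (adj (proj₁ q) T) ∧ not ⌊ proj₁ q ∈? starts ⌋) + ι (not (adj S (proj₂ q)) ∧ not ⌊ proj₂ q ∈? ends ⌋)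
      unreachable (a , b) with adj a b in e | adj S b | adj a T in e′ | a ∈? starts | b ∈? ends
      ... | false | _ | _ | _ | _ = z≤n
      ... | true | true | _ | _ | _ = z≤n
      ... | true | false | true | _ | _ = z≤n
      ... | true | false | false | no _ | _ = s≤s z≤n
      ... | true | false | false | yes _ | no _ = s≤s z≤n
      ... | true | false | false | yes s | yes t = ⊥-elim (impossible a b e e′ s t)
      from-start : ∀ {q} → q ∈ L → ι (not (adj (proj₁ q) T) ∧ not ⌊ proj₁ q ∈? starts ⌋) ≤ ι (not (adj (proj₁ q) T) ∧ not (adj S (proj₂ q)))
      from-start {a , b} q∈ with adj a T | adj S b in e | a ∈? starts
      ... | true | _ | _ = z≤n
      ... | false | _ | yes _ = z≤n
      ... | false | false | no _ = ≤-refl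
      ... | false | true | no ¬s with ∈-resp-↭ p q∈
      ... | here refl with () ← trans (sym badS) e
      ... | there (here refl) with () ← trans (sym ST) e
      ... | there (there r) = ⊥-elim (¬s (∈-map⁺ proj₁ (keep _ r e)))
      from-end : ∀ {q} → q ∈ L → ι (not (adj S (proj₂ q)) ∧ not ⌊ proj₂ q ∈? ends ⌋) ≤ ι (not (adj (proj₁ q) T) ∧ not (adj S (proj₂ q)))
      from-end {a , b} q∈ with adj a T in e | adj S b | b ∈? ends
      ... | _ | true | yes _ = z≤n
      ... | _ | true | no _ = z≤n
      ... | _ | false | yes _ = z≤n
      ... | false | false | no _ = ≤-refl
      ... | true | false | no ¬s with ∈-resp-↭ p q∈
      ... | here refl with () ← trans (sym ST) e
      ... | there (here refl) with () ← trans (sym badT) e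
      ... | there (there r) = ⊥-elim (¬s (∈-map⁺ proj₂ (keep _ r e)))

    useMeet : ∀ q → q ∈ rest → meet q ≡ true → Result
    useMeet (a , b) q∈ e with pick q∈ | ∧-true e
    ... | r , pr | Sb , aT = replace ((S , b₀) ∷ (a₀ , T) ∷ (a , b) ∷ []) ((S , b) ∷ (a , T) ∷ (a₀ , b₀) ∷ []) r
     (↭-trans p (prep _ (prep _ pr))) (prep S (swap a a₀ ↭-refl)) (↭-trans (Permₚ.∷↭∷ʳ b (T ∷ b₀ ∷ [])) (swap T b₀ ↭-refl))
     (fewer (ι (not (adj a b)) + 0) (goodPair Sb (goodPair aT (lastPair a₀ b₀ (ι (not (adj a b)) + 0)))))

    useBridge : ∀ q q′ → q ∈ rest → q′ ∈ rest → bridge q q′ ≡ true → Result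
    useBridge (a , b) (a′ , b′) q∈ q′∈ e with ∧-true e
    ... | Sb , e₁ with ∧-true {adj a′ T} e₁
    ... | a′T , e₂ with ∧-true {adj a b′} e₂
    ... | ab′ , ¬aT with pick q∈
    ... | r , pr with pick-other pr q′∈ (λ { refl → contradiction (trans (sym (not-true ¬aT)) a′T) λ () })
    ... | r′ , pr′ = replace ((S , b₀) ∷ (a₀ , T) ∷ (a , b) ∷ (a′ , b′) ∷ []) ((S , b) ∷ (a , b′) ∷ (a′ , T) ∷ (a₀ , b₀) ∷ []) r′
     (↭-trans p (prep _ (prep _ (↭-trans pr (prep _ pr′)))))
     (prep S (↭-sym (Permₚ.∷↭∷ʳ a₀ (a ∷ a′ ∷ []))))
     (↭-trans (↭-trans (prep b (prep b′ (swap T b₀ ↭-refl))) (++-comm (b ∷ b′ ∷ []) (b₀ ∷ T ∷ []))) ↭-refl)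
     (fewer (ι (not (adj a b)) + (ι (not (adj a′ b′)) + 0)) (goodPair Sb (goodPair ab′ (goodPair a′T (lastPair a₀ b₀ _)))))

    byST : ∀ x → adj S T ≡ x → Result
    byST true ST = replace ((S , b₀) ∷ (a₀ , T) ∷ []) ((S , T) ∷ (a₀ , b₀) ∷ []) rest p ↭-refl (swap T b₀ ↭-refl)
     (fewer 0 (goodPair ST (lastPair a₀ b₀ 0)))
    byST false ST with ≟0 (∑ rest (λ q → ι (meet q)))
    ... | inj₂ pos with ∑-positive rest _ pos
    ... | q , q∈ , h = useMeet q q∈ (true-ι h)
    byST false ST | inj₁ no-meet with ≟0 (∑ rest (λ q → ∑ rest (λ q′ → ι (bridge q q′))))
    ... | inj₁ no-bridge = ⊥-elim (byBridge ST no-meet no-bridge)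
    ... | inj₂ pos with ∑-positive rest _ pos
    ... | q , q∈ , h with ∑-positive rest _ h
    ... | q′ , q′∈ , h′ = useBridge q q′ q∈ q′∈ (true-ι h′)

   private
    F = failures (λ x y → gain (proj₁ x) (proj₂ y)) O

   rematch : ∃[ L ] Rematches L O × mismatches L * mismatches L ≤ F + mismatches L
   rematch = search (mismatches O) O (↭-refl , ↭-refl) ≤-refl
    where
    fail : A → A → ℕ
    fail S T = ι (∑ O (gain S T) ≤ᵇ 2 * length O)
    bad : A × A → ℕ
    bad q = ι (not (adj (proj₁ q) (proj₂ q)))
    search : ∀ k L → Rematches L O → mismatches L ≤ k → ∃[ L ] Rematches L O × mismatches L * mismatches L ≤ F + mismatches L
    search k L m h with mismatches L * mismatches L ≤? F + mismatches L
    ... | yes q = L , m , q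
    ... | no ¬q with ≟0 (∑ (picks L) (λ (x , r) → ∑ (picks r) (λ (y , _) → bad x * bad y * ι (not (∑ O (gain (proj₁ x) (proj₂ y)) ≤ᵇ 2 * length O)))))
    ... | inj₁ none = ⊥-elim (¬q (begin
      mismatches L * mismatches L
       ≡⟨ trans (sym (∑-*ʳ L (mismatches L) bad)) (∑-cong L (λ x → sym (∑-*ˡ L (bad x) bad))) ⟩
      ∑ L (λ x → ∑ L (λ y → bad x * bad y))
       ≡⟨ ∑²-picks L _ ⟩
      ∑ L (λ x → bad x * bad x) + ∑ (picks L) (λ (x , r) → ∑ (picks r) (λ (y , _) → bad x * bad y))
       ≤⟨ +-mono-≤ (∑-mono L (λ x → ι-square (not (adj (proj₁ x) (proj₂ x))))) (∑-mono (picks L) (λ (x , r) → ∑-mono (picks r) (λ (y , _) →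
          either (not (adj (proj₁ x) (proj₂ x))) (not (adj (proj₁ y) (proj₂ y))) (∑ O (gain (proj₁ x) (proj₂ y)) ≤ᵇ 2 * length O)))) ⟩
      mismatches L + ∑ (picks L) (λ (x , r) → ∑ (picks r) (λ (y , _) → bad x * bad y * ι (not (∑ O (gain (proj₁ x) (proj₂ y)) ≤ᵇ 2 * length O)) + fail (proj₁ x) (proj₂ y)))
       ≡⟨ cong (mismatches L +_) (trans (∑-cong (picks L) (λ (x , r) → ∑-+ (picks r) _ _)) (trans (∑-+ (picks L) _ _) (cong (_+ ∑ (picks L) (λ (x , r) → ∑ (picks r) (λ (y , _) → fail (proj₁ x) (proj₂ y)))) none))) ⟩
      mismatches L + ∑ (picks L) (λ (x , r) → ∑ (picks r) (λ (y , _) → fail (proj₁ x) (proj₂ y)))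
       ≤⟨ +-monoʳ-≤ (mismatches L) (m≤n+m _ (∑ L (λ x → fail (proj₁ x) (proj₂ x)))) ⟩
      mismatches L + (∑ L (λ x → fail (proj₁ x) (proj₂ x)) + ∑ (picks L) (λ (x , r) → ∑ (picks r) (λ (y , _) → fail (proj₁ x) (proj₂ y))))
       ≡⟨ cong (mismatches L +_) (sym (∑²-picks L (λ x y → fail (proj₁ x) (proj₂ y)))) ⟩
      mismatches L + ∑ L (λ x → ∑ L (λ y → fail (proj₁ x) (proj₂ y)))
       ≡⟨ cong (mismatches L +_) (trans (transfer proj₁ (proj₁ m) (λ a → ∑ L (λ y → fail a (proj₂ y)))) (∑-cong O (λ x → transfer proj₂ (proj₂ m) (fail (proj₁ x))))) ⟩
      mismatches L + F
       ≡⟨ +-comm _ F ⟩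
      F + mismatches L ∎))
     where
     open ≤-Reasoning
     ι-square : ∀ b → ι b * ι b ≤ ι b
     ι-square true = ≤-refl
     ι-square false = z≤n
     either : ∀ b c f → ι b * ι c ≤ ι b * ι c * ι (not f) + ι f
     either = truth-table 3 (λ b c f → ι b * ι c) (λ b c f → ι b * ι c * ι (not f) + ι f) tt
     transfer : ∀ (s : A × A → A) → map s L ↭ map s O → ∀ (f : A → ℕ) → ∑ L (f ∘ s) ≡ ∑ O (f ∘ s)
     transfer s e f = trans (sym (∑-map s L f)) (trans (∑-↭ f e) (∑-map s O f))
    ... | inj₂ some with ∑-positive (picks L) _ some
    ... | (x , r) , x∈ , h₁ with ∑-positive (picks r) _ h₁
    ... | (y , r′) , y∈ , h₂ = continue (positive (not (adj (proj₁ x) (proj₂ x))) (not (adj (proj₁ y) (proj₂ y))) _ h₂)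
     where
     positive : ∀ b c f → 0 < ι b * ι c * ι f → b ≡ true × c ≡ true × f ≡ true
     positive true true true _ = refl , refl , refl
     continue : _ → _
     continue (bx , by , ok) with improve L (proj₁ x) (proj₂ x) (proj₁ y) (proj₂ y) r′ m
       (↭-trans (picks-↭ L x∈) (prep x (picks-↭ r y∈))) (not-true bx) (not-true by) (≰⇒> (λ le → T-false (not-true ok) (≤⇒≤ᵇ le)))
      where
      T-false : ∀ {b} → b ≡ false → ¬ T b
      T-false refl ()
     ... | L′ , m′ , less = descend k h
      where
      descend : ∀ k → mismatches L ≤ k → ∃[ L ] Rematches L O × mismatches L * mismatches L ≤ F + mismatches L
      descend zero h = ⊥-elim (n≮0 (≤-trans less h))
      descend (suc k) h = search k L′ m′ (s≤s⁻¹ (≤-trans less h))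

   few-mismatches : ∀ h → 0 < h → h ≤ length O → 2 * (h * h) * F ≤ length O * length O →
            ∃[ L ] Rematches L O × h * mismatches L ≤ length O
   few-mismatches h h>0 h≤ few with rematch
   ... | L , m , q = L , m , bound (mismatches L) q
    where
    M = length O
    bound : ∀ p → p * p ≤ F + p → h * p ≤ M
    bound zero q = ≡-≤-trans (*-zeroʳ h) z≤n
    bound (suc zero) q = ≡-≤-trans (*-identityʳ h) h≤
    bound (suc (suc p)) q with h * suc (suc p) ≤? M
    ... | yes r = r
    ... | no ¬r = ⊥-elim (n≮0 {0} (linear (h * h * (p * p + 2 * p) + 2 * M)
     (+-mono-≤ few (+-mono-≤ (*-monoʳ-≤ (2 * (h * h)) q) (*-mono-≤ (≰⇒> ¬r) (≰⇒> ¬r)))) (certificate h M F p)))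
     where
     certificate : ∀ h M F p → 1 + (M * M + (2 * (h * h) * (F + suc (suc p)) + h * suc (suc p) * (h * suc (suc p)))) + (h * h * (p * p + 2 * p) + 2 * M)
            ≡ 0 + (2 * (h * h) * F + (2 * (h * h) * (suc (suc p) * suc (suc p)) + suc M * suc M))
     certificate = solve-∀

 ^-distrib-* : ∀ a b k → (a * b) ^ k ≡ a ^ k * b ^ k
 ^-distrib-* a b zero = refl
 ^-distrib-* a b (suc k) = trans (cong (a * b *_) (^-distrib-* a b k)) (interchange a b (a ^ k) (b ^ k))
  where
  interchange : ∀ a b c d → a * b * (c * d) ≡ a * c * (b * d)
  interchange = solve-∀

 ∑-tuples-chop : ∀ {A : Set} (R : List A) c M (f : List (List A) → ℕ) →
         ∑ (tuples R (M * c)) (λ w → f (chop c M w)) ≡ ∑ (tuples (tuples R c) M) f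
 ∑-tuples-chop R c zero f = refl
 ∑-tuples-chop R c (suc M) f = begin
  ∑ (tuples R (c + M * c)) (λ w → f (chop c (suc M) w))
   ≡⟨ ∑-tuples-+ R c (M * c) _ ⟩
  ∑ (tuples R c) (λ s → ∑ (tuples R (M * c)) (λ t → f (take c (s ++ t) ∷ chop c M (drop c (s ++ t)))))
   ≡⟨ ∑-cong∈ (tuples R c) (λ {s} s∈ → ∑-cong (tuples R (M * c)) (λ t → cong₂ (λ u v → f (u ∷ chop c M v))
      (take-++ s t (tuple-length R c s∈)) (drop-++ s t (tuple-length R c s∈)))) ⟩
  ∑ (tuples R c) (λ s → ∑ (tuples R (M * c)) (λ t → f (s ∷ chop c M t)))
   ≡⟨ ∑-cong (tuples R c) (λ s → ∑-tuples-chop R c M (λ W → f (s ∷ W))) ⟩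
  ∑ (tuples R c) (λ s → ∑ (tuples (tuples R c) M) (λ W → f (s ∷ W)))
   ≡⟨ ∑-tuples-suc (tuples R c) M f ⟨
  ∑ (tuples (tuples R c) (suc M)) f ∎
  where open ≡-Reasoning

 ∑-tuples-map : ∀ {A B : Set} (X : List A) (Y : List B) (φ : A → B) k → (∀ g → ∑ X (g ∘ φ) ≡ k * ∑ Y g) →
         ∀ M (f : List B → ℕ) → ∑ (tuples X M) (f ∘ map φ) ≡ k ^ M * ∑ (tuples Y M) f
 ∑-tuples-map X Y φ k e zero f = sym (+-identityʳ _)
 ∑-tuples-map X Y φ k e (suc M) f = begin
  ∑ (tuples X (suc M)) (f ∘ map φ) ≡⟨ ∑-tuples-suc X M _ ⟩
  ∑ X (λ x → ∑ (tuples X M) (λ W → f (φ x ∷ map φ W))) ≡⟨ ∑-cong X (λ x → ∑-tuples-map X Y φ k e M (λ W → f (φ x ∷ W))) ⟩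
  ∑ X (λ x → k ^ M * ∑ (tuples Y M) (λ W → f (φ x ∷ W))) ≡⟨ ∑-*ˡ X (k ^ M) _ ⟩
  k ^ M * ∑ X (λ x → ∑ (tuples Y M) (λ W → f (φ x ∷ W))) ≡⟨ cong (k ^ M *_) (e (λ y → ∑ (tuples Y M) (λ W → f (y ∷ W)))) ⟩
  k ^ M * (k * ∑ Y (λ y → ∑ (tuples Y M) (λ W → f (y ∷ W)))) ≡⟨ trans (sym (*-assoc (k ^ M) k _)) (cong₂ _*_ (*-comm (k ^ M) k) (sym (∑-tuples-suc Y M f))) ⟩
  k ^ suc M * ∑ (tuples Y (suc M)) f ∎
  where open ≡-Reasoning

 hd : ∀ {A : Set} → List (List A) → List A
 hd [] = []
 hd (B ∷ _) = B

 tl : ∀ {A : Set} → List (List A) → List (List A)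
 tl [] = []
 tl (_ ∷ Bs) = Bs

 concat² : ∀ {A : Set} (W : List (List (List A))) → concat (map concat W) ≡ concat (concat W)
 concat² W = Listₚ.concat-concat W

 concat-↭ : ∀ {A : Set} {Bs Cs : List (List A)} → Bs ↭ Cs → concat Bs ↭ concat Cs
 concat-↭ Perm.refl = ↭-refl
 concat-↭ (prep B p) = ++⁺ˡ B (concat-↭ p)
 concat-↭ (swap B C p) = ↭-trans (shifts B C) (++⁺ˡ C (++⁺ˡ B (concat-↭ p)))
 concat-↭ (Perm.trans p q) = ↭-trans (concat-↭ p) (concat-↭ q)

 module _ {n : ℕ} where

  _≟ᴮ_ : (a b : List (Fin n)) → Dec (a ≡ b)
  _≟ᴮ_ = Listₚ.≡-dec Finₚ._≟_

 module ColumnMatching {n : ℕ} (adj : Relation n) (ℓ : ℕ) where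

  open Matching (_≟ᴮ_ {n}) adj
  open Covers adj ℓ

  private Block = List (Fin n)

  -- The gain statistic, set to its maximum on degenerate blocks so that its mean is large everywhere.
  gain⁺ : Block → Block → Block × Block → ℕ
  gain⁺ S T p with uniq S ∧ uniq T
  ... | true = gain S T p
  ... | false = 5

  gain⁺≤5 : ∀ S T p → gain⁺ S T p ≤ 5
  gain⁺≤5 S T p with uniq S ∧ uniq T
  ... | true = gain≤5 S T p
  ... | false = ≤-refl

  gain⁺≡gain : ∀ S T p → uniq S ≡ true → uniq T ≡ true → gain⁺ S T p ≡ gain S T p
  gain⁺≡gain S T p u v rewrite u | v = refl

  firstTwo : List Block → Block × Block
  firstTwo x = hd x , hd (tl x)

  columnGain : List Block → List Block → List Block → ℕ
  columnGain x y w = gain⁺ (hd x) (hd (tl y)) (firstTwo w)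

  typical : ℕ → ℕ → List (List Block) → Bool
  typical D zero W = true
  typical D (suc K) W = (D * failures columnGain W ≤ᵇ length W * length W) ∧ typical D K (map tl W)

  module _ (R : List (Fin n)) (q : ℕ) (q>0 : 0 < q) (R>0 : 0 < length R)
       (mean : ∀ {S T} → S ∈ tuples R ℓ → T ∈ tuples R ℓ → uniq S ≡ true → uniq T ≡ true →
           suc (2 * q) * (length R ^ ℓ * length R ^ ℓ) ≤ q * ∑ (tuples R ℓ) (λ a → ∑ (tuples R ℓ) (λ b → gain S T (a , b)))) where

   private
    Bs = tuples R ℓ
    N = length R ^ ℓ
    rows : ℕ → List (List Block)
    rows K = tuples Bs (suc K)

    N>0 : 0 < N
    N>0 = ^-pos ℓ R>0

    length-rows : ∀ K → length (rows K) ≡ N ^ suc K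
    length-rows K = trans (length-tuples Bs (suc K)) (cong (_^ suc K) (length-tuples R ℓ))

    constant : suc (2 * q) * (N * N) ≤ q * ∑ Bs (λ a → ∑ Bs (λ b → 5))
    constant = begin
     suc (2 * q) * (N * N) ≤⟨ *-monoˡ-≤ (N * N) (linear {suc (2 * q)} {q * 5} (2 * q) q>0 (certificate q)) ⟩
     q * 5 * (N * N) ≡⟨ ring q N ⟩
     q * (N * (N * 5)) ≡⟨ cong (q *_) (trans (∑-const Bs _) (cong₂ _*_ (length-tuples R ℓ) (trans (∑-const Bs 5) (cong (_* 5) (length-tuples R ℓ))))) ⟨
     q * ∑ Bs (λ a → ∑ Bs (λ b → 5)) ∎
     where
     open ≤-Reasoning
     certificate : ∀ q → suc (2 * q) + q + 2 * q ≡ q * 5 + 1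
     certificate = solve-∀
     ring : ∀ q N → q * 5 * (N * N) ≡ q * (N * (N * 5))
     ring = solve-∀

    mean⁺ : ∀ {S T} → S ∈ Bs → T ∈ Bs → suc (2 * q) * (N * N) ≤ q * ∑ Bs (λ a → ∑ Bs (λ b → gain⁺ S T (a , b)))
    mean⁺ {S} {T} S∈ T∈ with uniq S in u | uniq T in v
    ... | true | true = mean S∈ T∈ u v
    ... | true | false = constant
    ... | false | _ = constant

    mean-rows : ∀ K {x y} → x ∈ rows (suc K) → y ∈ rows (suc K) → suc (2 * q) * length (rows (suc K)) ≤ q * ∑ (rows (suc K)) (columnGain x y)
    mean-rows K {x} {y} x∈ y∈ = subst₂ _≤_ (sym (trans (cong (suc (2 * q) *_) (length-rows (suc K))) (ring₁ (suc (2 * q)) N (N ^ K))))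
      (trans (ring₂ q _ (N ^ K)) (cong (q *_) (sym total)))
      (*-monoˡ-≤ (N ^ K) (mean⁺ (first x x∈) (second y y∈)))
     where
     ring₁ : ∀ c N p → c * (N * (N * p)) ≡ c * (N * N) * p
     ring₁ = solve-∀
     ring₂ : ∀ q s p → q * s * p ≡ q * (s * p)
     ring₂ = solve-∀
     first : ∀ x → x ∈ rows (suc K) → hd x ∈ Bs
     first x x∈ with ∈-tuples⁻ Bs (suc (suc K)) x∈
     first (_ ∷ _) x∈ | _ , b ∷ _ = b
     second : ∀ x → x ∈ rows (suc K) → hd (tl x) ∈ Bs
     second x x∈ with ∈-tuples⁻ Bs (suc (suc K)) x∈
     second (_ ∷ _ ∷ _) x∈ | _ , _ ∷ b ∷ _ = b
     g : Block → Block → ℕ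
     g a b = gain⁺ (hd x) (hd (tl y)) (a , b)
     total : ∑ (rows (suc K)) (columnGain x y) ≡ ∑ Bs (λ a → ∑ Bs (g a)) * N ^ K
     total = begin
      ∑ (rows (suc K)) (columnGain x y)
       ≡⟨ trans (∑-tuples-suc Bs (suc K) _) (∑-cong Bs (λ a → ∑-tuples-suc Bs K _)) ⟩
      ∑ Bs (λ a → ∑ Bs (λ b → ∑ (tuples Bs K) (λ _ → g a b)))
       ≡⟨ ∑-cong Bs (λ a → ∑-cong Bs (λ b → trans (∑-tuples-const Bs K (g a b)) (trans (*-comm (length Bs ^ K) (g a b)) (cong (λ k → g a b * k ^ K) (length-tuples R ℓ))))) ⟩
      ∑ Bs (λ a → ∑ Bs (λ b → g a b * N ^ K))
       ≡⟨ trans (∑-cong Bs (λ a → ∑-*ʳ Bs (N ^ K) (g a))) (∑-*ʳ Bs (N ^ K) _) ⟩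
      ∑ Bs (λ a → ∑ Bs (g a)) * N ^ K ∎
      where open ≡-Reasoning

   atypical : ∀ D E M → 0 < M → 8 * q ≤ M → E * D * suc (4 * (q * q) * 25) ≤ M → ∀ K →
         E * ∑ (tuples (rows K) (2 + M)) (λ W → ι (not (typical D K W))) ≤ K * (N ^ suc K) ^ (2 + M)
   atypical D E M M>0 M≥ big zero = ≡-≤-trans (trans (cong (E *_) (∑-0 (tuples (rows 0) (2 + M)))) (*-zeroʳ E)) z≤n
   atypical D E M M>0 M≥ big (suc K) = begin
    E * ∑ Ws (λ W → ι (not (typical D (suc K) W)))
     ≤⟨ *-monoʳ-≤ E (∑-mono∈ Ws split) ⟩
    E * ∑ Ws (λ W → ι (not (D * failures columnGain W ≤ᵇ m * m)) + ι (not (typical D K (map tl W))))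
     ≡⟨ trans (cong (E *_) (∑-+ Ws _ _)) (*-distribˡ-+ E _ _) ⟩
    E * ∑ Ws (λ W → ι (not (D * failures columnGain W ≤ᵇ m * m))) + E * ∑ Ws (λ W → ι (not (typical D K (map tl W))))
     ≤⟨ +-mono-≤ (subst (λ k → E * ∑ Ws _ ≤ k ^ m) (length-rows (suc K)) (sampling (rows (suc K)) columnGain q 5 D E M rows>0 (λ x y w → gain⁺≤5 (hd x) (hd (tl y)) (firstTwo w)) (mean-rows K) M>0 M≥ big))
           (≡-≤-trans (trans (cong (E *_) (∑-tuples-map (rows (suc K)) (rows K) tl N tails m _)) (*-exchange E (N ^ m) _)) (*-monoʳ-≤ (N ^ m) (atypical D E M M>0 M≥ big K))) ⟩
    (N ^ suc (suc K)) ^ m + N ^ m * (K * (N ^ suc K) ^ m)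
     ≡⟨ cong₂ _+_ refl (trans (*-exchange (N ^ m) K ((N ^ suc K) ^ m)) (cong (K *_) (sym (^-distrib-* N (N ^ suc K) m)))) ⟩
    suc K * (N ^ suc (suc K)) ^ m ∎
    where
    open ≤-Reasoning
    m = 2 + M
    Ws = tuples (rows (suc K)) m
    rows>0 : 0 < length (rows (suc K))
    rows>0 = subst (0 <_) (sym (length-rows (suc K))) (^-pos (suc (suc K)) N>0)
    tails : ∀ g → ∑ (rows (suc K)) (g ∘ tl) ≡ N * ∑ (rows K) g
    tails g = trans (∑-tuples-suc Bs (suc K) _) (trans (∑-const Bs _) (cong (_* ∑ (rows K) g) (length-tuples R ℓ)))
    split : ∀ {W} → W ∈ Ws → ι (not (typical D (suc K) W)) ≤ ι (not (D * failures columnGain W ≤ᵇ m * m)) + ι (not (typical D K (map tl W)))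
    split {W} W∈ = subst (λ k → ι (not ((D * failures columnGain W ≤ᵇ k * k) ∧ typical D K (map tl W))) ≤ ι (not (D * failures columnGain W ≤ᵇ m * m)) + ι (not (typical D K (map tl W))))
     (sym (proj₁ (∈-tuples⁻ (rows (suc K)) m W∈)))
     (truth-table 2 (λ a b → ι (not (a ∧ b))) (λ a b → ι (not a) + ι (not b)) tt (D * failures columnGain W ≤ᵇ m * m) (typical D K (map tl W)))

  aligned : ∀ h → 0 < h → ∀ K W → All (λ x → length x ≡ suc K × All (λ B → uniq B ≡ true) x) W → h ≤ length W →
       typical (2 * (h * h)) K W ≡ true →
       ∃[ W′ ] map hd W′ ↭ map hd W × concat W′ ↭ concat W × All (λ x → length x ≡ suc K) W′ × h * ∑ W′ breaks ≤ K * length W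
  aligned h h>0 zero W shape h≤ typ = W , ↭-refl , ↭-refl , All.map proj₁ shape ,
   ≤-reflexive (trans (cong (h *_) (trans (∑-cong∈ W (λ {x} x∈ → single x (proj₁ (All.lookup shape x∈)))) (∑-0 W))) (*-zeroʳ h))
   where
   single : ∀ x → length x ≡ 1 → breaks x ≡ 0
   single (B ∷ []) _ = refl
  aligned h h>0 (suc K) W shape h≤ typ
   with aligned h h>0 K (map tl W) (Allₚ.map⁺ (All.map (λ {x} → tail x) shape)) (subst (h ≤_) (sym (length-map tl W)) h≤) (proj₂ (∧-true {2 * (h * h) * failures columnGain W ≤ᵇ length W * length W} typ))
     | few-mismatches (map firstTwo W) h h>0 (subst (h ≤_) (sym (length-map firstTwo W)) h≤) few
   where
   tail : ∀ x → length x ≡ suc (suc K) × All (λ B → uniq B ≡ true) x → length (tl x) ≡ suc K × All (λ B → uniq B ≡ true) (tl x)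
   tail (_ ∷ _) (e , _ ∷ u) = suc-injective e , u
   unique₁ : ∀ {x} → x ∈ W → uniq (hd x) ≡ true × uniq (hd (tl x)) ≡ true
   unique₁ {x} x∈ with All.lookup shape x∈
   unique₁ {_ ∷ _ ∷ _} x∈ | _ , u ∷ v ∷ _ = u , v
   failures≡ : failures (λ x y → gain (proj₁ x) (proj₂ y)) (map firstTwo W) ≡ failures columnGain W
   failures≡ = trans (∑-map firstTwo W _) (∑-cong∈ W (λ {x} x∈ → trans (∑-map firstTwo W _) (∑-cong∈ W (λ {y} y∈ →
    cong₂ (λ s k → ι (s ≤ᵇ 2 * k)) (trans (∑-map firstTwo W _) (∑-cong W (λ w → sym (gain⁺≡gain (hd x) (hd (tl y)) (firstTwo w) (proj₁ (unique₁ x∈)) (proj₂ (unique₁ y∈))))))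
     (length-map firstTwo W)))))
   few : 2 * (h * h) * failures (λ x y → gain (proj₁ x) (proj₂ y)) (map firstTwo W) ≤ length (map firstTwo W) * length (map firstTwo W)
   few = subst₂ (λ f k → 2 * (h * h) * f ≤ k * k) (sym failures≡) (sym (length-map firstTwo W))
    (≤ᵇ⇒≤ _ _ (subst T (sym (proj₁ (∧-true typ))) tt))
  ... | W₁ , heads , contents , lengths , cost | L , (m₁ , m₂) , mism
   with Permₚ.↭-map-inv hd (↭-trans heads (↭-trans (↭-reflexive (trans (sym (map-∘ W)) (map-∘ W))) (↭-sym m₂)))
  ... | W₂ , eq , perm = joined L W₂ , heads′ , contents′ , lengths′ , cost′
   where
   joined : List (Block × Block) → List (List Block) → List (List Block)
   joined ((a , _) ∷ L) (x ∷ W) = (a ∷ x) ∷ joined L W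
   joined _ _ = []
   joined-heads : ∀ L W → map proj₂ L ≡ map hd W → map hd (joined L W) ≡ map proj₁ L
   joined-heads [] W e = refl
   joined-heads (p ∷ L) (x ∷ W) e = cong (proj₁ p ∷_) (joined-heads L W (Listₚ.∷-injectiveʳ e))
   joined-contents : ∀ L W → map proj₂ L ≡ map hd W → concat (joined L W) ↭ map proj₁ L ++ concat W
   joined-contents [] [] e = ↭-refl
   joined-contents (p ∷ L) (x ∷ W) e = prep (proj₁ p) (↭-trans (++⁺ˡ x (joined-contents L W (Listₚ.∷-injectiveʳ e))) (shifts x (map proj₁ L)))
   lengths₂ : All (λ x → length x ≡ suc K) W₂
   lengths₂ = All-resp-↭ perm lengths
   joined-lengths : ∀ L W → map proj₂ L ≡ map hd W → All (λ x → length x ≡ suc K) W → All (λ x → length x ≡ suc (suc K)) (joined L W)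
   joined-lengths [] W e _ = []
   joined-lengths (p ∷ L) (x ∷ W) e (l ∷ a) = cong suc l ∷ joined-lengths L W (Listₚ.∷-injectiveʳ e) a
   joined-breaks : ∀ L W → map proj₂ L ≡ map hd W → All (λ x → length x ≡ suc K) W → ∑ (joined L W) breaks ≡ mismatches L + ∑ W breaks
   joined-breaks [] [] e _ = refl
   joined-breaks ((a , b) ∷ L) ((c ∷ x) ∷ W) e (l ∷ al) with Listₚ.∷-injective e
   ... | refl , e′ = trans (cong (_+_ (ι (not (adj a c)) + breaks (c ∷ x))) (joined-breaks L W e′ al)) (interchange (ι (not (adj a c))) (breaks (c ∷ x)) (mismatches L) (∑ W breaks))
    where
    interchange : ∀ a b c d → a + b + (c + d) ≡ a + c + (b + d)
    interchange = solve-∀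
   rebuild : ∀ W → All (λ x → length x ≡ suc (suc K) × All (λ B → uniq B ≡ true) x) W → map hd W ++ concat (map tl W) ↭ concat W
   rebuild [] _ = ↭-refl
   rebuild ((B ∷ x) ∷ W) (_ ∷ a) = prep B (↭-trans (shifts (map hd W) x) (++⁺ˡ x (rebuild W a)))
   heads′ : map hd (joined L W₂) ↭ map hd W
   heads′ = ↭-trans (↭-reflexive (joined-heads L W₂ eq)) (↭-trans m₁ (↭-reflexive (sym (map-∘ W))))
   contents′ : concat (joined L W₂) ↭ concat W
   contents′ = ↭-trans (joined-contents L W₂ eq) (↭-trans (Permₚ.++⁺ (↭-trans m₁ (↭-reflexive (sym (map-∘ W)))) (↭-trans (concat-↭ (↭-sym perm)) contents)) (rebuild W shape))
   lengths′ : All (λ x → length x ≡ suc (suc K)) (joined L W₂)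
   lengths′ = joined-lengths L W₂ eq lengths₂
   cost′ : h * ∑ (joined L W₂) breaks ≤ suc K * length W
   cost′ = begin
    h * ∑ (joined L W₂) breaks ≡⟨ cong (h *_) (joined-breaks L W₂ eq lengths₂) ⟩
    h * (mismatches L + ∑ W₂ breaks) ≡⟨ *-distribˡ-+ h _ _ ⟩
    h * mismatches L + h * ∑ W₂ breaks ≤⟨ +-mono-≤ mism (≡-≤-trans (cong (h *_) (∑-↭ breaks (↭-sym perm))) cost) ⟩
    length (map firstTwo W) + K * length (map tl W) ≡⟨ cong₂ (λ a b → a + K * b) (length-map firstTwo W) (length-map tl W) ⟩
    suc K * length W ∎
    where open ≤-Reasoning

 uniq-concat : ∀ {n} (Bs : List (List (Fin n))) → uniq (concat Bs) ≡ true → All (λ B → uniq B ≡ true) Bs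
 uniq-concat [] u = []
 uniq-concat (B ∷ Bs) u = uniq-++⁻ˡ B u ∷ uniq-concat Bs (uniq-++⁻ʳ B u)

 grid : ∀ {A : Set} (h ℓ M : ℕ) → List A → List (List (List A))
 grid h ℓ M w = map (chop ℓ h) (chop (h * ℓ) M w)

 length-grid : ∀ {A : Set} h ℓ M (w : List A) → length (grid h ℓ M w) ≡ M
 length-grid h ℓ M w = trans (length-map (chop ℓ h) (chop (h * ℓ) M w)) (length-chop (h * ℓ) M w)

 concat-grid : ∀ {A : Set} h ℓ M (w : List A) → length w ≡ M * (h * ℓ) → concat (concat (grid h ℓ M w)) ≡ w
 concat-grid {A} h ℓ M w len = begin
  concat (concat (grid h ℓ M w)) ≡⟨ concat² (grid h ℓ M w) ⟨
  concat (map concat (grid h ℓ M w)) ≡⟨ cong concat (refold (chop (h * ℓ) M w) (chop-lengths (h * ℓ) M w len)) ⟩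
  concat (chop (h * ℓ) M w) ≡⟨ concat-chop (h * ℓ) M w len ⟩
  w ∎
  where
  open ≡-Reasoning
  refold : (V : List (List A)) → All (λ v → length v ≡ h * ℓ) V → map concat (map (chop ℓ h) V) ≡ V
  refold [] _ = refl
  refold (v ∷ V) (e ∷ a) = cong₂ _∷_ (concat-chop ℓ h v e) (refold V a)

 -- The parameters of the tiling: windows of M × h blocks, each atypical with frequency at most 1 / (16 D).
 module TilingNumerics (D h M Q e β b : ℕ) (D>0 : 0 < D) where

  tiling-bound : 16 * D ≤ h → 0 < M → b ≤ 2 * M → 16 * D * β ≤ 2 * Q → e ≤ M * h → 4 * D ≤ Q →
          D * (Q * (b + 1) + β * (M * h) + e) ≤ Q * (M * h) + e
  tiling-bound h≥ M>0 b≤ β≤ e≤ Q≥ = ≤-trans main (m≤m+n _ e)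
   where
   main : D * (Q * (b + 1) + β * (M * h) + e) ≤ Q * (M * h)
   main = *-cancelˡ-pos 16 (s≤s z≤n) (linear (5 * (Q * (M * h)) + 2 * (Q * (M * h)))
    (+-mono-≤ (*-monoʳ-≤ (16 * (D * Q)) (+-mono-≤ b≤ M>0)) (+-mono-≤ (*-monoʳ-≤ (3 * (Q * M)) h≥)
     (+-mono-≤ (*-monoʳ-≤ (M * h) β≤) (+-mono-≤ (*-monoʳ-≤ (16 * D) e≤) (*-monoʳ-≤ (4 * (M * h)) Q≥)))))
    (certificate D Q b β M h e))
    where
    certificate : ∀ D Q b β M h e →
     16 * (D * (Q * (b + 1) + β * (M * h) + e)) + (16 * (D * Q) * (2 * M + M) + (3 * (Q * M) * h + (M * h * (2 * Q) + (16 * D * (M * h) + 4 * (M * h) * Q)))) + (5 * (Q * (M * h)) + 2 * (Q * (M * h)))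
     ≡ 16 * (Q * (M * h)) + (16 * (D * Q) * (b + 1) + (3 * (Q * M) * (16 * D) + (M * h * (16 * D * β) + (16 * D * e + 4 * (M * h) * (4 * D)))))
    certificate = solve-∀

 tile : ∀ {n} (adj : Relation n) ℓ D h M → 0 < ℓ → 0 < D → 16 * D ≤ h → 0 < M →
     ∀ R m → uniq R ≡ true → length R ≡ m * ℓ → suc (2 * (M * h * ℓ * (M * h * ℓ)) + 4 * D * (M * h * ℓ)) ≤ length R →
     (bad : List (Fin n) → Bool) →
     (∀ w → length w ≡ M * h * ℓ → uniq w ≡ true → bad w ≡ false → Covers.Cover adj ℓ w (2 * M)) →
     16 * D * ∑ (tuples R (M * h * ℓ)) (λ w → ι (bad w)) ≤ length R ^ (M * h * ℓ) →
     ∃[ b ] Covers.Cover adj ℓ R b × D * b ≤ m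
 tile adj ℓ D h M ℓ>0 D>0 h≥ M>0 R m uR len big bad good rare = split (m / c) (m % c) m≡ (<⇒≤ (m%n<n m c)) enough
  where
  open import Data.Nat.DivMod using (m≡m%n+[m/n]*n; m%n<n; m*n/n≡m; /-monoˡ-≤)
  c = M * h
  instance
   c≢0 : NonZero c
   c≢0 = >-nonZero (*-pos M>0 (≤-trans (*-pos {16} (s≤s z≤n) D>0) h≥))
   ℓ≢0 : NonZero ℓ
   ℓ≢0 = >-nonZero ℓ>0
  m≡ : m ≡ m / c * c + m % c
  m≡ = trans (m≡m%n+[m/n]*n m c) (+-comm (m % c) _)
  enough : 4 * D ≤ m / c
  enough = ≡-≤-trans (sym (m*n/n≡m (4 * D) c)) (/-monoˡ-≤ c (*-cancelʳ-≤ (4 * D * c) m ℓ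
   (≡-≤-trans (*-assoc (4 * D) c ℓ) (≤-trans (m≤n+m _ (2 * (c * ℓ * (c * ℓ)))) (≤-trans (n≤1+n _) (≤-≡-trans big len))))))
  split : ∀ Q e → m ≡ Q * c + e → e ≤ c → 4 * D ≤ Q → ∃[ b ] Covers.Cover adj ℓ R b × D * b ≤ m
  split zero e m≡ e≤ Q≥ = ⊥-elim (n≮0 (≤-trans (*-pos {4} (s≤s z≤n) D>0) Q≥))
  split (suc Q) e m≡ e≤ Q≥ = finish (Windows.arrangement R uR (c * ℓ) (e * ℓ) bad Q (16 * D) len′ (≤-trans (m≤m+n _ _) (≤-trans (n≤1+n _) big)) (≤-trans (s≤s z≤n) big) rare)
   where
   ring : ∀ Q c ℓ e → Q * (c * ℓ) + e * ℓ ≡ (Q * c + e) * ℓ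
   ring = solve-∀
   len′ : suc Q * (c * ℓ) + e * ℓ ≡ length R
   len′ = trans (ring (suc Q) c ℓ e) (trans (cong (_* ℓ) (sym m≡)) (sym len))
   finish : (∃[ t ] length t ≡ suc Q * (c * ℓ) + e * ℓ × uniq t ≡ true × t ↭ R × 16 * D * Windows.badCount R uR (c * ℓ) (e * ℓ) bad (suc Q) t ≤ 2 * suc Q) →
        ∃[ b ] Covers.Cover adj ℓ R b × D * b ≤ m
   finish (t , lent , ut , t↭R , β≤) = _ , Covers.cover-↭ adj ℓ t↭R ≤-refl (Covers.cover-windows adj ℓ R uR c e (2 * M) bad good (suc Q) t lent ut) ,
    ≤-≡-trans (TilingNumerics.tiling-bound D h M (suc Q) e (Windows.badCount R uR (c * ℓ) (e * ℓ) bad (suc Q) t) (2 * M) D>0 h≥ M>0 ≤-refl β≤ e≤ Q≥) (sym m≡)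

 module ExpandingCover {n : ℕ} (adj : Relation n) (ℓ D q : ℕ) (ℓ>0 : 0 < ℓ) (D>0 : 0 < D) (q>0 : 0 < q) where

  open Matching (_≟ᴮ_ {n}) adj
  open Covers adj ℓ
  open ColumnMatching adj ℓ

  module Tiling (K M₀ : ℕ) (h≥ : 16 * D ≤ suc K) (M₀>0 : 0 < M₀) (M₀≥q : 8 * q ≤ M₀) (M₀≥h : suc K ≤ M₀)
         (M₀≥ : suc K * (16 * D) * (2 * (suc K * suc K)) * suc (4 * (q * q) * 25) ≤ M₀)
         (R : List (Fin n)) (uR : uniq R ≡ true) (R>0 : 0 < length R)
         (mean : ∀ {S T} → S ∈ tuples R ℓ → T ∈ tuples R ℓ → uniq S ≡ true → uniq T ≡ true →
           suc (2 * q) * (length R ^ ℓ * length R ^ ℓ) ≤ q * ∑ (tuples R ℓ) (λ a → ∑ (tuples R ℓ) (λ b → gain S T (a , b)))) where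

   private
    h = suc K
    M = 2 + M₀
    Dₛ = 2 * (h * h)
    r = length R
    P = λ W → not (typical Dₛ K W)

   bad : List (Fin n) → Bool
   bad w = P (grid h ℓ M w)

   rare : 16 * D * ∑ (tuples R (M * h * ℓ)) (λ w → ι (bad w)) ≤ r ^ (M * h * ℓ)
   rare = *-cancelˡ-pos h (s≤s z≤n) (begin
    h * (16 * D * ∑ (tuples R (M * h * ℓ)) (λ w → ι (bad w)))
     ≡⟨ trans (sym (*-assoc h (16 * D) _)) (cong (h * (16 * D) *_) count) ⟩
    h * (16 * D) * ∑ (tuples (tuples (tuples R ℓ) h) M) (ι ∘ P)
     ≤⟨ atypical R q q>0 R>0 mean Dₛ (h * (16 * D)) M₀ M₀>0 M₀≥q M₀≥ K ⟩
    K * ((r ^ ℓ) ^ h) ^ M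
     ≤⟨ *-monoˡ-≤ (((r ^ ℓ) ^ h) ^ M) (n≤1+n K) ⟩
    h * ((r ^ ℓ) ^ h) ^ M
     ≡⟨ cong (h *_) powers ⟩
    h * r ^ (M * h * ℓ) ∎)
    where
    open ≤-Reasoning
    powers : ((r ^ ℓ) ^ h) ^ M ≡ r ^ (M * h * ℓ)
    powers = trans (cong (_^ M) (^-*-assoc r ℓ h)) (trans (^-*-assoc r (ℓ * h) M) (cong (r ^_) (reorder ℓ h M)))
     where
     reorder : ∀ ℓ h M → ℓ * h * M ≡ M * h * ℓ
     reorder = solve-∀
    rechop : ∀ g → ∑ (tuples R (h * ℓ)) (g ∘ chop ℓ h) ≡ 1 * ∑ (tuples (tuples R ℓ) h) g
    rechop g = trans (∑-tuples-chop R ℓ h g) (sym (+-identityʳ _))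
    count : ∑ (tuples R (M * h * ℓ)) (λ w → ι (bad w)) ≡ ∑ (tuples (tuples (tuples R ℓ) h) M) (ι ∘ P)
    count = begin-equality
     ∑ (tuples R (M * h * ℓ)) (λ w → ι (bad w))
      ≡⟨ cong (λ k → ∑ (tuples R k) (λ w → ι (bad w))) (*-assoc M h ℓ) ⟩
     ∑ (tuples R (M * (h * ℓ))) (λ w → ι (bad w))
      ≡⟨ ∑-tuples-chop R (h * ℓ) M (λ V → ι (P (map (chop ℓ h) V))) ⟩
     ∑ (tuples (tuples R (h * ℓ)) M) (λ V → ι (P (map (chop ℓ h) V)))
      ≡⟨ ∑-tuples-map (tuples R (h * ℓ)) (tuples (tuples R ℓ) h) (chop ℓ h) 1 rechop M (ι ∘ P) ⟩
     1 ^ M * ∑ (tuples (tuples (tuples R ℓ) h) M) (ι ∘ P)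
      ≡⟨ trans (cong (_* ∑ (tuples (tuples (tuples R ℓ) h) M) (ι ∘ P)) (^-zeroˡ M)) (+-identityʳ _) ⟩
     ∑ (tuples (tuples (tuples R ℓ) h) M) (ι ∘ P) ∎

   good : ∀ w → length w ≡ M * h * ℓ → uniq w ≡ true → bad w ≡ false → Cover w (2 * M)
   good w len u ok with aligned h (s≤s z≤n) K (grid h ℓ M w) shapes (≤-trans M₀≥h (≤-≡-trans (m≤n+m M₀ 2) (sym rows≡))) (trans (sym (Boolₚ.not-involutive _)) (cong not ok))
    where
    len′ : length w ≡ M * (h * ℓ)
    len′ = trans len (*-assoc M h ℓ)
    rows≡ = length-grid h ℓ M w
    flat = concat-grid h ℓ M w len′
    uniqs : All (λ B → uniq B ≡ true) (concat (grid h ℓ M w))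
    uniqs = uniq-concat (concat (grid h ℓ M w)) (trans (cong uniq flat) u)
    shapes : All (λ x → length x ≡ h × All (λ B → uniq B ≡ true) x) (grid h ℓ M w)
    shapes = All.zip (Allₚ.map⁺ (All.tabulate (λ {v} _ → length-chop ℓ h v)) , Allₚ.concat⁻ uniqs)
   ... | W′ , heads , contents , _ , cost = concat W′ , ↭-trans (concat-↭ contents) (↭-reflexive flat) , All-resp-↭ (↭-sym contents) lengths ,
     ≤-trans (breaks-concat W′) (≤-≡-trans (+-mono-≤ few (≤-reflexive rows′)) (cong (M +_) (sym (+-identityʳ M))))
    where
    len′ : length w ≡ M * (h * ℓ)
    len′ = trans len (*-assoc M h ℓ)
    rows≡ = length-grid h ℓ M w
    flat = concat-grid h ℓ M w len′
    lengths : All (λ B → length B ≡ ℓ) (concat (grid h ℓ M w))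
    lengths = Allₚ.concat⁺ (Allₚ.map⁺ (All.map (λ {v} e → chop-lengths ℓ h v e) (chop-lengths (h * ℓ) M w len′)))
    rows′ : length W′ ≡ M
    rows′ = trans (sym (length-map hd W′)) (trans (↭-length heads) (trans (length-map hd (grid h ℓ M w)) rows≡))
    few : ∑ W′ breaks ≤ M
    few = *-cancelˡ-pos h (s≤s z≤n) (≤-trans cost (≤-≡-trans (*-monoˡ-≤ (length (grid h ℓ M w)) (n≤1+n K)) (cong (h *_) rows≡)))
    breaks-concat : ∀ W → breaks (concat W) ≤ ∑ W breaks + length W
    breaks-concat [] = z≤n
    breaks-concat (x ∷ W) = ≤-trans (breaks-++ x (concat W)) (≤-≡-trans (+-monoʳ-≤ (breaks x + 1) (breaks-concat W)) (regroup (breaks x) (∑ W breaks) (length W)))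
     where
     regroup : ∀ a b c → a + 1 + (b + c) ≡ a + b + suc c
     regroup = solve-∀

 ExpandingCovers : ℕ → ℕ → ℕ → ℕ → Set
 ExpandingCovers ℓ D q t =
  ∀ {n} (adj : Relation n) R m → uniq R ≡ true → length R ≡ m * ℓ → t ≤ length R →
  (∀ {S T} → S ∈ tuples R ℓ → T ∈ tuples R ℓ → uniq S ≡ true → uniq T ≡ true →
    suc (2 * q) * (length R ^ ℓ * length R ^ ℓ) ≤ q * ∑ (tuples R ℓ) (λ a → ∑ (tuples R ℓ) (λ b → Matching.gain (_≟ᴮ_ {n}) adj S T (a , b)))) →
  ∃[ b ] Covers.Cover adj ℓ R b × D * b ≤ m

 expanding-cover : ∀ ℓ D q → 0 < ℓ → 0 < D → 0 < q → ∃[ t ] ExpandingCovers ℓ D q t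
 expanding-cover ℓ D q ℓ>0 D>0 q>0 = choose (16 * D) _ (n≤1+n _) (s≤s z≤n)
  (≤-trans (m≤m+n _ _) (n≤1+n _))
  (≤-trans (≤-trans (m≤m+n _ _) (m≤n+m _ (8 * q))) (n≤1+n _))
  (≤-trans (≤-trans (m≤n+m _ (suc (16 * D))) (m≤n+m _ (8 * q))) (n≤1+n _))
  where
  choose : ∀ K M₀ → 16 * D ≤ suc K → 0 < M₀ → 8 * q ≤ M₀ → suc K ≤ M₀ →
       suc K * (16 * D) * (2 * (suc K * suc K)) * suc (4 * (q * q) * 25) ≤ M₀ → ∃[ t ] ExpandingCovers ℓ D q t
  choose K M₀ h₁ h₂ h₃ h₄ h₅ = _ , λ adj R m uR len big mean →
   let module Tl = ExpandingCover.Tiling adj ℓ D q ℓ>0 D>0 q>0 K M₀ h₁ h₂ h₃ h₄ h₅ R uR (≤-trans (s≤s z≤n) big) mean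
   in tile adj ℓ D (suc K) (2 + M₀) ℓ>0 D>0 h₁ (s≤s z≤n) R m uR len big Tl.bad Tl.good Tl.rare

 xor-false : ∀ {a} → a xor a ≡ false
 xor-false {true} = refl
 xor-false {false} = refl

 module Hybrid {A : Set} (R : List A) (E : List A → Bool) (E-↭ : ∀ {s t} → s ↭ t → E s ≡ E t) where

  private r = length R

  separated : ℕ → ℕ
  separated k = ∑ (tuples R k) (λ s → ∑ (tuples R k) (λ t → ι (E s xor E t)))

  sensitivity : ℕ → ℕ
  sensitivity k = ∑ R (λ v → ∑ R (λ v′ → ∑ (tuples R k) (λ w → ι (E (v ∷ w) xor E (v′ ∷ w)))))

  private
   agreeing : ℕ → ℕ → ℕ
   agreeing j i = ∑ (tuples R j) (λ p → ∑ (tuples R j) (λ p′ → ∑ (tuples R i) (λ w → ι (E (p ++ w) xor E (p′ ++ w)))))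

   step : ∀ j i → agreeing (suc j) i ≤ r * agreeing j (suc i) + r ^ j * sensitivity (j + i)
   step j i = begin
    agreeing (suc j) i
     ≡⟨ trans (∑-tuples-suc R j _) (∑-cong R (λ v → ∑-cong Tj (λ p → ∑-tuples-suc R j _))) ⟩
    ∑ R (λ v → ∑ Tj (λ p → ∑ R (λ v′ → ∑ Tj (λ p′ → ∑ Ti (λ w → ι (E (v ∷ p ++ w) xor E (v′ ∷ p′ ++ w)))))))
     ≤⟨ ∑-mono R (λ v → ∑-mono Tj (λ p → ∑-mono R (λ v′ → ∑-mono Tj (λ p′ → ∑-mono Ti (λ w →
        truth-table 3 (λ a b c → ι (a xor c)) (λ a b c → ι (a xor b) + ι (b xor c)) tt (E (v ∷ p ++ w)) (E (v ∷ p′ ++ w)) (E (v′ ∷ p′ ++ w))))))) ⟩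
    ∑ R (λ v → ∑ Tj (λ p → ∑ R (λ v′ → ∑ Tj (λ p′ → ∑ Ti (λ w → ι (E (v ∷ p ++ w) xor E (v ∷ p′ ++ w)) + ι (E (v ∷ p′ ++ w) xor E (v′ ∷ p′ ++ w)))))))
     ≡⟨ distribute ⟩
    ∑ R (λ v → ∑ Tj (λ p → ∑ R (λ v′ → ∑ Tj (λ p′ → ∑ Ti (λ w → ι (E (v ∷ p ++ w) xor E (v ∷ p′ ++ w))))))) +
    ∑ R (λ v → ∑ Tj (λ p → ∑ R (λ v′ → ∑ Tj (λ p′ → ∑ Ti (λ w → ι (E (v ∷ p′ ++ w) xor E (v′ ∷ p′ ++ w)))))))
     ≡⟨ cong₂ _+_ first second ⟩
    r * agreeing j (suc i) + r ^ j * sensitivity (j + i) ∎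
    where
    open ≤-Reasoning
    Tj = tuples R j
    Ti = tuples R i
    distribute = trans (∑-cong R (λ v → trans (∑-cong Tj (λ p → trans (∑-cong R (λ v′ → trans (∑-cong Tj (λ p′ → ∑-+ Ti _ _)) (∑-+ Tj _ _))) (∑-+ R _ _))) (∑-+ Tj _ _))) (∑-+ R _ _)
    first : ∑ R (λ v → ∑ Tj (λ p → ∑ R (λ v′ → ∑ Tj (λ p′ → ∑ Ti (λ w → ι (E (v ∷ p ++ w) xor E (v ∷ p′ ++ w))))))) ≡ r * agreeing j (suc i)
    first = begin-equality
     ∑ R (λ v → ∑ Tj (λ p → ∑ R (λ v′ → G v p)))
      ≡⟨ ∑-cong R (λ v → trans (∑-cong Tj (λ p → ∑-const R (G v p))) (∑-*ˡ Tj r _)) ⟩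
     ∑ R (λ v → r * ∑ Tj (G v))
      ≡⟨ ∑-*ˡ R r _ ⟩
     r * ∑ R (λ v → ∑ Tj (λ p → G v p))
      ≡⟨ cong (r *_) (trans (∑-swap R Tj G) (∑-cong Tj (λ p → trans (∑-swap R Tj _) (∑-cong Tj (λ p′ →
         trans (∑-cong R (λ v → ∑-cong Ti (λ w → cong ι (cong₂ _xor_ (E-↭ (move v p w)) (E-↭ (move v p′ w)))))) (sym (∑-tuples-suc R i _))))))) ⟩
     r * agreeing j (suc i) ∎
     where
     G : A → List A → ℕ
     G v p = ∑ Tj (λ p′ → ∑ Ti (λ w → ι (E (v ∷ p ++ w) xor E (v ∷ p′ ++ w))))
     move : ∀ v p w → v ∷ p ++ w ↭ p ++ v ∷ w
     move v p w = ↭-sym (Permₚ.shift v p w)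
    second : ∑ R (λ v → ∑ Tj (λ p → ∑ R (λ v′ → ∑ Tj (λ p′ → ∑ Ti (λ w → ι (E (v ∷ p′ ++ w) xor E (v′ ∷ p′ ++ w))))))) ≡ r ^ j * sensitivity (j + i)
    second = trans (∑-cong R (λ v → trans (∑-tuples-const R j _) (cong (r ^ j *_) (∑-cong R (λ v′ → sym (∑-tuples-+ R j i (λ w → ι (E (v ∷ w) xor E (v′ ∷ w)))))))))
            (∑-*ˡ R (r ^ j) _)

   telescope : ∀ j i → r * agreeing j i ≤ j * r ^ j * sensitivity (j + i ∸ 1)
   telescope zero i = ≡-≤-trans (trans (cong (r *_) (trans (+-identityʳ _) (trans (+-identityʳ _) (trans (∑-cong (tuples R i) (λ w → cong ι (xor-false {E w}))) (∑-0 (tuples R i)))))) (*-zeroʳ r)) z≤n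
   telescope (suc j) i = begin
    r * agreeing (suc j) i
     ≤⟨ *-monoʳ-≤ r (step j i) ⟩
    r * (r * agreeing j (suc i) + r ^ j * sensitivity (j + i))
     ≤⟨ *-monoʳ-≤ r (+-monoˡ-≤ _ (≤-≡-trans (telescope j (suc i)) (cong (λ k → j * r ^ j * sensitivity (k ∸ 1)) (+-suc j i)))) ⟩
    r * (j * r ^ j * sensitivity (j + i) + r ^ j * sensitivity (j + i))
     ≡⟨ ring r j (r ^ j) (sensitivity (j + i)) ⟩
    suc j * r ^ suc j * sensitivity (j + i) ∎
    where
    open ≤-Reasoning
    ring : ∀ r j p s → r * (j * p * s + p * s) ≡ suc j * (r * p) * s
    ring = solve-∀

  separated≤ : ∀ k → r * separated (suc k) ≤ suc k * r ^ suc k * sensitivity k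
  separated≤ k = subst₂ (λ a b → r * a ≤ suc k * r ^ suc k * sensitivity b)
   (∑-cong (tuples R (suc k)) (λ s → ∑-cong (tuples R (suc k)) (λ t → trans (+-identityʳ _) (cong₂ (λ a b → ι (E a xor E b)) (++-identityʳ s) (++-identityʳ t)))))
   (+-identityʳ k) (telescope (suc k) 0)

 module Exchange {A : Set} (R : List A) (f : List A → Bool) (f-↭ : ∀ {s t} → s ↭ t → f s ≡ f t) (k : ℕ) where

  private
   r = length R
   ℓ = suc (suc k)
   S₁ = tuples R (suc k)
   S₂ = tuples R k
   N = r ^ ℓ
   open Hybrid R f f-↭

  drops : A → A → List A → Bool
  drops x y s = f (x ∷ s) ∧ not (f (y ∷ s))

  increases : A → List A → A → List A → Bool
  increases x s y t = not (ι (f (y ∷ s)) + ι (f (x ∷ t)) ≤ᵇ ι (f (x ∷ s)) + ι (f (y ∷ t)))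

  dropping : ℕ
  dropping = ∑ R (λ x → ∑ R (λ y → ∑ S₁ (λ s → ι (drops x y s))))

  increasing : ℕ
  increasing = ∑ R (λ x → ∑ R (λ y → ∑ S₁ (λ s → ∑ S₁ (λ t → ι (increases x s y t)))))

  density : ℕ
  density = ∑ (tuples R ℓ) (λ B → ι (f B))

  sensitivity≡ : sensitivity (suc k) ≡ 2 * dropping
  sensitivity≡ = begin
   sensitivity (suc k)
    ≡⟨ ∑-cong R (λ x → ∑-cong R (λ y → ∑-cong S₁ (λ s → split (f (x ∷ s)) (f (y ∷ s))))) ⟩
   ∑ R (λ x → ∑ R (λ y → ∑ S₁ (λ s → ι (drops x y s) + ι (drops y x s))))
    ≡⟨ trans (∑-cong R (λ x → trans (∑-cong R (λ y → ∑-+ S₁ _ _)) (∑-+ R _ _))) (∑-+ R _ _) ⟩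
   dropping + ∑ R (λ x → ∑ R (λ y → ∑ S₁ (λ s → ι (drops y x s))))
    ≡⟨ cong (dropping +_) (trans (∑-swap R R _) (sym (+-identityʳ dropping))) ⟩
   2 * dropping ∎
   where
   open ≡-Reasoning
   split : ∀ a b → ι (a xor b) ≡ ι (a ∧ not b) + ι (b ∧ not a)
   split true true = refl
   split true false = refl
   split false true = refl
   split false false = refl

  separated≡ : separated ℓ + 2 * (density * density) ≡ 2 * (N * density)
  separated≡ = begin
   separated ℓ + 2 * (density * density)
    ≡⟨ cong (separated ℓ +_) (sym product) ⟩
   separated ℓ + ∑ Bs (λ s → ∑ Bs (λ t → 2 * (ι (f s) * ι (f t))))
    ≡⟨ trans (sym (∑-+ Bs _ _)) (∑-cong Bs (λ s → sym (∑-+ Bs _ _))) ⟩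
   ∑ Bs (λ s → ∑ Bs (λ t → ι (f s xor f t) + 2 * (ι (f s) * ι (f t))))
    ≡⟨ ∑-cong Bs (λ s → ∑-cong Bs (λ t → split (f s) (f t))) ⟩
   ∑ Bs (λ s → ∑ Bs (λ t → ι (f s) + ι (f t)))
    ≡⟨ ∑-cong Bs (λ s → trans (∑-+ Bs _ _) (cong (_+ density) (∑-tuples-const R ℓ (ι (f s))))) ⟩
   ∑ Bs (λ s → N * ι (f s) + density)
    ≡⟨ trans (∑-+ Bs _ _) (cong₂ _+_ (∑-*ˡ Bs N _) (∑-tuples-const R ℓ density)) ⟩
   N * density + N * density
    ≡⟨ cong (_+_ (N * density)) (sym (+-identityʳ _)) ⟩
   2 * (N * density) ∎
   where
   open ≡-Reasoning
   Bs = tuples R ℓ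
   split : ∀ a b → ι (a xor b) + 2 * (ι a * ι b) ≡ ι a + ι b
   split true true = refl
   split true false = refl
   split false true = refl
   split false false = refl
   product : ∑ Bs (λ s → ∑ Bs (λ t → 2 * (ι (f s) * ι (f t)))) ≡ 2 * (density * density)
   product = trans (∑-cong Bs (λ s → trans (∑-*ˡ Bs 2 _) (cong (2 *_) (∑-*ˡ Bs (ι (f s)) _)))) (trans (∑-*ˡ Bs 2 _) (cong (2 *_) (∑-*ʳ Bs density _)))

  dropping²≤ : 0 < r → dropping * dropping ≤ 2 * (r * r) * increasing
  dropping²≤ r>0 = *-cancelˡ-pos (r ^ k) (^-pos k r>0) (begin
   r ^ k * (dropping * dropping)
    ≡⟨ cong (r ^ k *_) squared ⟩
   r ^ k * ∑⁴ (λ x y x′ y′ → ∑ S₁ (λ t → ∑ S₁ (λ t′ → ι (drops x y t) * ι (drops x′ y′ t′))))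
    ≡⟨ ∑-tuples-const R k _ ⟨
   ∑ S₂ (λ _ → ∑⁴ (λ x y x′ y′ → ∑ S₁ (λ t → ∑ S₁ (λ t′ → ι (drops x y t) * ι (drops x′ y′ t′)))))
    ≤⟨ ∑-mono S₂ (λ s → ∑-mono R (λ x → ∑-mono R (λ y → ∑-mono R (λ x′ → ∑-mono R (λ y′ → ∑-mono S₁ (λ t → ∑-mono S₁ (λ t′ → pointwise x y x′ y′ s t t′))))))) ⟩
   ∑ S₂ (λ s → ∑⁴ (λ x y x′ y′ → ∑ S₁ (λ t → ∑ S₁ (λ t′ → ι (increases x (y′ ∷ s) y t) + ι (increases x′ (x ∷ s) y′ t′)))))
    ≡⟨ distribute ⟩
   ∑ S₂ (λ s → ∑⁴ (λ x y x′ y′ → ∑ S₁ (λ t → ∑ S₁ (λ t′ → ι (increases x (y′ ∷ s) y t))))) +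
   ∑ S₂ (λ s → ∑⁴ (λ x y x′ y′ → ∑ S₁ (λ t → ∑ S₁ (λ t′ → ι (increases x′ (x ∷ s) y′ t′)))))
    ≡⟨ cong₂ _+_ first second ⟩
   r * (r * r ^ k) * increasing + r * (r * r ^ k) * increasing
    ≡⟨ ring r (r ^ k) increasing ⟩
   r ^ k * (2 * (r * r) * increasing) ∎)
   where
   open ≤-Reasoning
   ∑⁴ : (A → A → A → A → ℕ) → ℕ
   ∑⁴ g = ∑ R (λ x → ∑ R (λ y → ∑ R (λ x′ → ∑ R (λ y′ → g x y x′ y′))))
   ∑⁴-cong : ∀ {g h} → (∀ x y x′ y′ → g x y x′ y′ ≡ h x y x′ y′) → ∑⁴ g ≡ ∑⁴ h
   ∑⁴-cong e = ∑-cong R (λ x → ∑-cong R (λ y → ∑-cong R (λ x′ → ∑-cong R (λ y′ → e x y x′ y′))))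
   ∑⁴-+ : ∀ g h → ∑⁴ (λ x y x′ y′ → g x y x′ y′ + h x y x′ y′) ≡ ∑⁴ g + ∑⁴ h
   ∑⁴-+ g h = trans (∑-cong R (λ x → trans (∑-cong R (λ y → trans (∑-cong R (λ x′ → ∑-+ R _ _)) (∑-+ R _ _))) (∑-+ R _ _))) (∑-+ R _ _)
   ring : ∀ r p i → r * (r * p) * i + r * (r * p) * i ≡ p * (2 * (r * r) * i)
   ring = solve-∀
   d : A → A → ℕ
   d x y = ∑ S₁ (λ t → ι (drops x y t))
   squared : dropping * dropping ≡ ∑⁴ (λ x y x′ y′ → ∑ S₁ (λ t → ∑ S₁ (λ t′ → ι (drops x y t) * ι (drops x′ y′ t′))))
   squared = begin-equality
    dropping * dropping
     ≡⟨ trans (sym (∑-*ʳ R dropping _)) (∑-cong R (λ x → sym (∑-*ʳ R dropping _))) ⟩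
    ∑ R (λ x → ∑ R (λ y → d x y * dropping))
     ≡⟨ ∑-cong R (λ x → ∑-cong R (λ y → trans (sym (∑-*ˡ R (d x y) _)) (∑-cong R (λ x′ → sym (∑-*ˡ R (d x y) _))))) ⟩
    ∑⁴ (λ x y x′ y′ → d x y * d x′ y′)
     ≡⟨ ∑⁴-cong (λ x y x′ y′ → trans (sym (∑-*ʳ S₁ (d x′ y′) _)) (∑-cong S₁ (λ t → sym (∑-*ˡ S₁ (ι (drops x y t)) _)))) ⟩
    ∑⁴ (λ x y x′ y′ → ∑ S₁ (λ t → ∑ S₁ (λ t′ → ι (drops x y t) * ι (drops x′ y′ t′)))) ∎
   pointwise : ∀ x y x′ y′ s t t′ → ι (drops x y t) * ι (drops x′ y′ t′) ≤ ι (increases x (y′ ∷ s) y t) + ι (increases x′ (x ∷ s) y′ t′)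
   pointwise x y x′ y′ s t t′ rewrite f-↭ (swap y′ x (↭-refl {x = s})) = truth-table 7
    (λ xt yt x′t′ y′t′ xy′ yy′ x′x → ι (xt ∧ not yt) * ι (x′t′ ∧ not y′t′))
    (λ xt yt x′t′ y′t′ xy′ yy′ x′x → ι (not (ι yy′ + ι xt ≤ᵇ ι xy′ + ι yt)) + ι (not (ι xy′ + ι x′t′ ≤ᵇ ι x′x + ι y′t′))) tt
    (f (x ∷ t)) (f (y ∷ t)) (f (x′ ∷ t′)) (f (y′ ∷ t′)) (f (x ∷ y′ ∷ s)) (f (y ∷ y′ ∷ s)) (f (x′ ∷ x ∷ s))
   distribute = trans (∑-cong S₂ (λ s → trans (∑⁴-cong (λ x y x′ y′ → trans (∑-cong S₁ (λ t → ∑-+ S₁ _ _)) (∑-+ S₁ _ _))) (∑⁴-+ _ _))) (∑-+ S₂ _ _)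
   first : ∑ S₂ (λ s → ∑⁴ (λ x y x′ y′ → ∑ S₁ (λ t → ∑ S₁ (λ t′ → ι (increases x (y′ ∷ s) y t))))) ≡ r * (r * r ^ k) * increasing
   first = begin-equality
    ∑ S₂ (λ s → ∑⁴ (λ x y x′ y′ → ∑ S₁ (λ t → ∑ S₁ (λ t′ → ι (increases x (y′ ∷ s) y t)))))
     ≡⟨ ∑-cong S₂ (λ s → ∑-cong R (λ x → ∑-cong R (λ y → trans (∑-const R _) (cong (r *_) (∑-cong R (λ y′ → trans (∑-cong S₁ (λ t → ∑-tuples-const R (suc k) _)) (∑-*ˡ S₁ (r * r ^ k) _))))))) ⟩
    ∑ S₂ (λ s → ∑ R (λ x → ∑ R (λ y → r * ∑ R (λ y′ → r * r ^ k * g x y (y′ ∷ s)))))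
     ≡⟨ ∑-cong S₂ (λ s → ∑-cong R (λ x → ∑-cong R (λ y → trans (cong (r *_) (∑-*ˡ R (r * r ^ k) _)) (sym (*-assoc r (r * r ^ k) _))))) ⟩
    ∑ S₂ (λ s → ∑ R (λ x → ∑ R (λ y → c * ∑ R (λ y′ → g x y (y′ ∷ s)))))
     ≡⟨ trans (∑-cong S₂ (λ s → trans (∑-cong R (λ x → ∑-*ˡ R c _)) (∑-*ˡ R c _))) (∑-*ˡ S₂ c _) ⟩
    c * ∑ S₂ (λ s → ∑ R (λ x → ∑ R (λ y → ∑ R (λ y′ → g x y (y′ ∷ s)))))
     ≡⟨ cong (c *_) (trans (∑-swap S₂ R _) (∑-cong R (λ x → trans (∑-swap S₂ R _) (∑-cong R (λ y → trans (∑-swap S₂ R _) (sym (∑-tuples-suc R k (g x y)))))))) ⟩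
    c * increasing ∎
    where
    c = r * (r * r ^ k)
    g : A → A → List A → ℕ
    g x y s = ∑ S₁ (λ t → ι (increases x s y t))
   second : ∑ S₂ (λ s → ∑⁴ (λ x y x′ y′ → ∑ S₁ (λ t → ∑ S₁ (λ t′ → ι (increases x′ (x ∷ s) y′ t′))))) ≡ r * (r * r ^ k) * increasing
   second = begin-equality
    ∑ S₂ (λ s → ∑⁴ (λ x y x′ y′ → ∑ S₁ (λ t → ∑ S₁ (λ t′ → ι (increases x′ (x ∷ s) y′ t′)))))
     ≡⟨ ∑-cong S₂ (λ s → ∑-cong R (λ x → trans (∑-const R _) (cong (r *_) (∑-cong R (λ x′ → trans (∑-cong R (λ y′ → ∑-tuples-const R (suc k) (g x′ y′ (x ∷ s)))) (∑-*ˡ R (r * r ^ k) _)))))) ⟩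
    ∑ S₂ (λ s → ∑ R (λ x → r * ∑ R (λ x′ → r * r ^ k * ∑ R (λ y′ → g x′ y′ (x ∷ s)))))
     ≡⟨ ∑-cong S₂ (λ s → ∑-cong R (λ x → trans (cong (r *_) (∑-*ˡ R (r * r ^ k) _)) (sym (*-assoc r (r * r ^ k) _)))) ⟩
    ∑ S₂ (λ s → ∑ R (λ x → c * ∑ R (λ x′ → ∑ R (λ y′ → g x′ y′ (x ∷ s)))))
     ≡⟨ trans (∑-cong S₂ (λ s → ∑-*ˡ R c _)) (∑-*ˡ S₂ c _) ⟩
    c * ∑ S₂ (λ s → ∑ R (λ x → ∑ R (λ x′ → ∑ R (λ y′ → g x′ y′ (x ∷ s)))))
     ≡⟨ cong (c *_) (trans (∑-swap S₂ R _) (trans (sym (∑-tuples-suc R k (λ s → ∑ R (λ x′ → ∑ R (λ y′ → g x′ y′ s))))) (trans (∑-swap S₁ R _) (∑-cong R (λ x′ → ∑-swap S₁ R _))))) ⟩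
    c * increasing ∎
    where
    c = r * (r * r ^ k)
    g : A → A → List A → ℕ
    g x y s = ∑ S₁ (λ t → ι (increases x s y t))

  increasing-large : 0 < r → 2 * N ≤ 5 * density → 5 * density ≤ 3 * N → 36 * (N * N) ≤ 1250 * (ℓ * ℓ) * increasing
  increasing-large r>0 low high = *-cancelˡ-pos (r * r) (*-pos r>0 r>0) (begin
   r * r * (36 * (N * N)) ≡⟨ ring₁ r N ⟩
   6 * (r * N) * (6 * (r * N)) ≤⟨ *-mono-≤ many many ⟩
   25 * (ℓ * dropping) * (25 * (ℓ * dropping)) ≡⟨ ring₂ ℓ dropping ⟩
   625 * (ℓ * ℓ) * (dropping * dropping) ≤⟨ *-monoʳ-≤ (625 * (ℓ * ℓ)) (dropping²≤ r>0) ⟩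
   625 * (ℓ * ℓ) * (2 * (r * r) * increasing) ≡⟨ ring₃ (ℓ * ℓ) (r * r) increasing ⟩
   r * r * (1250 * (ℓ * ℓ) * increasing) ∎)
   where
   open ≤-Reasoning
   ring₁ : ∀ r N → r * r * (36 * (N * N)) ≡ 6 * (r * N) * (6 * (r * N))
   ring₁ = solve-∀
   ring₂ : ∀ l d → 25 * (l * d) * (25 * (l * d)) ≡ 625 * (l * l) * (d * d)
   ring₂ = solve-∀
   ring₃ : ∀ l r i → 625 * l * (2 * r * i) ≡ r * (1250 * l * i)
   ring₃ = solve-∀
   N>0 : 0 < N
   N>0 = ^-pos ℓ r>0
   spread : 6 * (N * N) + 25 * (density * density) ≤ 25 * (N * density)
   spread = product (m≤n⇒∃[o]m+o≡n low) (m≤n⇒∃[o]m+o≡n high)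
    where
    product : (∃[ u ] 2 * N + u ≡ 5 * density) → (∃[ v ] 5 * density + v ≡ 3 * N) → 6 * (N * N) + 25 * (density * density) ≤ 25 * (N * density)
    product (u , e) (v , e′) = subst₂ _≤_ (cong (_+_ (6 * (N * N))) (trans (cong₂ _*_ e e) (square density))) (trans (cong (5 * N *_) e) (scale N density))
     (≤-≡-trans (m≤m+n _ (u * v)) (certificate N u v (+-cancelˡ-≡ (2 * N) _ _ (trans (sym (+-assoc (2 * N) u v)) (trans (cong (_+ v) e) (trans e′ (three N)))))))
     where
     square : ∀ x → 5 * x * (5 * x) ≡ 25 * (x * x)
     square = solve-∀
     scale : ∀ N x → 5 * N * (5 * x) ≡ 25 * (N * x)
     scale = solve-∀
     three : ∀ N → 3 * N ≡ 2 * N + N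
     three = solve-∀
     certificate : ∀ N u v → u + v ≡ N → 6 * (N * N) + (2 * N + u) * (2 * N + u) + u * v ≡ 5 * N * (2 * N + u)
     certificate N u v refl = poly u v
      where
      poly : ∀ u v → 6 * ((u + v) * (u + v)) + (2 * (u + v) + u) * (2 * (u + v) + u) + u * v ≡ 5 * (u + v) * (2 * (u + v) + u)
      poly = solve-∀
   many : 6 * (r * N) ≤ 25 * (ℓ * dropping)
   many = *-cancelˡ-pos (2 * N) (*-pos {2} (s≤s z≤n) N>0) (linear 0
    (+-mono-≤ (*-monoʳ-≤ 25 (separated≤ (suc k))) (+-mono-≤ (*-monoʳ-≤ (2 * r) spread) (≤-reflexive (cong (25 * r *_) (sym separated≡)))))
    (trans (cong (λ s → 2 * N * (6 * (r * N)) + (25 * (ℓ * N * s) + (2 * r * (25 * (N * density)) + 25 * r * (separated ℓ + 2 * (density * density)))) + 0) sensitivity≡)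
     (certificate N r ℓ dropping density (separated ℓ))))
    where
    certificate : ∀ N r ℓ p d s → 2 * N * (6 * (r * N)) + (25 * (ℓ * N * (2 * p)) + (2 * r * (25 * (N * d)) + 25 * r * (s + 2 * (d * d)))) + 0
     ≡ 2 * N * (25 * (ℓ * p)) + (25 * (r * s) + (2 * r * (6 * (N * N) + 25 * (d * d)) + 25 * r * (2 * (N * d))))
    certificate = solve-∀

 module _ {A : Set} where

  ∑-filterᵇ : ∀ (P : A → Bool) xs f → ∑ (filterᵇ P xs) f ≡ ∑ xs (λ x → ι (P x) * f x)
  ∑-filterᵇ P [] f = refl
  ∑-filterᵇ P (x ∷ xs) f with P x
  ... | true = cong₂ _+_ (sym (+-identityʳ (f x))) (∑-filterᵇ P xs f)
  ... | false = ∑-filterᵇ P xs f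

  length-filterᵇ : ∀ (P : A → Bool) xs → length (filterᵇ P xs) ≡ ∑ xs (λ x → ι (P x))
  length-filterᵇ P xs = trans (sym (∑-1 (filterᵇ P xs))) (trans (∑-filterᵇ P xs (λ _ → 1)) (∑-cong xs (λ x → *-identityʳ _)))

  partition-↭ : ∀ (P : A → Bool) xs → filterᵇ (not ∘ P) xs ++ filterᵇ P xs ↭ xs
  partition-↭ P [] = ↭-refl
  partition-↭ P (x ∷ xs) with P x
  ... | true = ↭-trans (Permₚ.shift x (filterᵇ (not ∘ P) xs) (filterᵇ P xs)) (prep x (partition-↭ P xs))
  ... | false = prep x (partition-↭ P xs)

 module Assignment {A B : Set} (c : A → B → ℕ) where

  cost : List (A × B) → ℕ
  cost L = ∑ L (λ p → c (proj₁ p) (proj₂ p))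

  cheap : ∀ O → ∃[ L ] map proj₁ L ↭ map proj₁ O × map proj₂ L ↭ map proj₂ O ×
         length L * cost L ≤ ∑ (map proj₁ O) (λ a → ∑ (map proj₂ O) (c a))
  cheap O = search (cost O) O ↭-refl ↭-refl ≤-refl
   where
   Result = ∃[ L ] map proj₁ L ↭ map proj₁ O × map proj₂ L ↭ map proj₂ O × length L * cost L ≤ ∑ (map proj₁ O) (λ a → ∑ (map proj₂ O) (c a))
   crossed straight : A × B → A × B → ℕ
   crossed x y = c (proj₁ x) (proj₂ y) + c (proj₁ y) (proj₂ x)
   straight x y = c (proj₁ x) (proj₂ x) + c (proj₁ y) (proj₂ y)
   search : ∀ k L → map proj₁ L ↭ map proj₁ O → map proj₂ L ↭ map proj₂ O → cost L ≤ k → Result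
   search k L m₁ m₂ h with ≟0 (∑ (picks L) (λ (x , r) → ∑ (picks r) (λ (y , _) → ι (not (straight x y ≤ᵇ crossed x y)))))
   ... | inj₁ none = L , m₁ , m₂ , *-cancelˡ-pos 2 (s≤s z≤n) (begin
    2 * (length L * cost L)
     ≡⟨ ring (length L) (cost L) ⟩
    length L * cost L + length L * cost L
     ≡⟨ cong₂ _+_ (trans (sym (∑-*ˡ L (length L) _)) (∑-cong L (λ x → sym (∑-const L _)))) (sym (∑-const L (cost L))) ⟩
    ∑ L (λ x → ∑ L (λ y → c (proj₁ x) (proj₂ x))) + ∑ L (λ x → ∑ L (λ y → c (proj₁ y) (proj₂ y)))
     ≡⟨ trans (∑-cong L (λ x → ∑-+ L _ _)) (∑-+ L _ _) ⟨
    ∑ L (λ x → ∑ L (λ y → straight x y))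
     ≡⟨ ∑²-picks L straight ⟩
    ∑ L (λ x → straight x x) + ∑ (picks L) (λ (x , r) → ∑ (picks r) (λ (y , _) → straight x y))
     ≤⟨ +-monoʳ-≤ (∑ L (λ x → straight x x)) (∑-mono∈ (picks L) (λ p∈ → ∑-mono∈ (picks _) (λ q∈ → optimal p∈ q∈))) ⟩
    ∑ L (λ x → straight x x) + ∑ (picks L) (λ (x , r) → ∑ (picks r) (λ (y , _) → crossed x y))
     ≡⟨ ∑²-picks L crossed ⟨
    ∑ L (λ x → ∑ L (λ y → crossed x y))
     ≡⟨ trans (∑-cong L (λ x → ∑-+ L _ _)) (∑-+ L _ _) ⟩
    S + ∑ L (λ x → ∑ L (λ y → c (proj₁ y) (proj₂ x)))
     ≡⟨ cong (S +_) (trans (∑-swap L L _) (sym (+-identityʳ S))) ⟩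
    2 * S
     ≡⟨ cong (2 *_) total ⟩
    2 * ∑ (map proj₁ O) (λ a → ∑ (map proj₂ O) (c a)) ∎)
    where
    open ≤-Reasoning
    S = ∑ L (λ x → ∑ L (λ y → c (proj₁ x) (proj₂ y)))
    ring : ∀ l k → 2 * (l * k) ≡ l * k + l * k
    ring = solve-∀
    total : S ≡ ∑ (map proj₁ O) (λ a → ∑ (map proj₂ O) (c a))
    total = trans (∑-cong L (λ x → trans (sym (∑-map proj₂ L (c (proj₁ x)))) (∑-↭ (c (proj₁ x)) m₂)))
     (trans (sym (∑-map proj₁ L (λ a → ∑ (map proj₂ O) (c a)))) (∑-↭ (λ a → ∑ (map proj₂ O) (c a)) m₁))
    optimal : ∀ {p} → p ∈ picks L → ∀ {p′} → p′ ∈ picks (proj₂ p) → straight (proj₁ p) (proj₁ p′) ≤ crossed (proj₁ p) (proj₁ p′)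
    optimal {x , r} p∈ {y , _} q∈ with straight x y ≤ᵇ crossed x y in e
    ... | true = ≤ᵇ⇒≤ _ _ (subst T (sym e) tt)
    ... | false with () ← ≤-trans (≤-trans (≤-trans (ι-true (cong not e)) (∈⇒≤∑ (λ (y , _) → ι (not (straight x y ≤ᵇ crossed x y))) q∈))
        (∈⇒≤∑ (λ (x , r) → ∑ (picks r) (λ (y , _) → ι (not (straight x y ≤ᵇ crossed x y)))) p∈)) (≤-reflexive none)
   ... | inj₂ some with ∑-positive (picks L) _ some
   ... | (x , r) , x∈ , h₁ with ∑-positive (picks r) _ h₁
   ... | (y , r′) , y∈ , h₂ = descend k h
    where
    perm : L ↭ x ∷ y ∷ r′
    perm = ↭-trans (picks-↭ L x∈) (prep x (picks-↭ r y∈))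
    L′ = (proj₁ x , proj₂ y) ∷ (proj₁ y , proj₂ x) ∷ r′
    less : cost L′ < cost L
    less = subst₂ _≤_ (cong suc (+-assoc (c (proj₁ x) (proj₂ y)) _ _)) (trans (+-assoc (c (proj₁ x) (proj₂ x)) _ _) (sym (∑-↭ _ perm)))
     (+-monoˡ-< (cost r′) (≰⇒> λ le → contradiction (trans (sym (true-ι h₂)) (cong not (T⇒≡ (≤⇒≤ᵇ le)))) λ ()))
    descend : ∀ k → cost L ≤ k → Result
    descend zero h = ⊥-elim (n≮0 (≤-trans less h))
    descend (suc k) h = search k L′ (↭-trans (↭-sym (Permₚ.map⁺ proj₁ perm)) m₁)
     (↭-trans (swap (proj₂ y) (proj₂ x) ↭-refl) (↭-trans (↭-sym (Permₚ.map⁺ proj₂ perm)) m₂)) (s≤s⁻¹ (≤-trans less h))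

 module Alternating {n : ℕ} (adj : Relation n) (adj-sym : Symmetric adj) (ℓ : ℕ) where

  open Covers adj ℓ
  private Block = List (Fin n)

  private
   cost₁ : Block × Block → Block → ℕ
   cost₁ (x , x′) Y = ι (not (adj x Y)) + ι (not (adj Y x′))
   open Assignment cost₁

   slots : List Block → List (Block × Block)
   slots [] = []
   slots (x ∷ []) = (x , x) ∷ []
   slots (x ∷ x′ ∷ xs) = (x , x′) ∷ slots (x′ ∷ xs)

   length-slots : ∀ xs → length (slots xs) ≡ length xs
   length-slots [] = refl
   length-slots (x ∷ []) = refl
   length-slots (x ∷ x′ ∷ xs) = cong suc (length-slots (x′ ∷ xs))

   alternate : List Block → List ((Block × Block) × Block) → List Block
   alternate (x ∷ xs) (p ∷ L) = x ∷ proj₂ p ∷ alternate xs L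
   alternate _ _ = []

   alternate-breaks : ∀ xs L → map proj₁ L ≡ slots xs → breaks (alternate xs L) ≤ cost L
   alternate-breaks [] L e = z≤n
   alternate-breaks (x ∷ xs) [] e = z≤n
   alternate-breaks (x ∷ []) (p ∷ []) e = ≤-trans (+-monoˡ-≤ 0 (m≤m+n _ (ι (not (adj (proj₂ p) x)))))
    (≤-reflexive (cong (λ s → cost₁ s (proj₂ p) + 0) (sym (Listₚ.∷-injectiveˡ e))))
   alternate-breaks (x ∷ x′ ∷ xs) (p ∷ []) e with () ← trans (suc-injective (cong length e)) (length-slots (x′ ∷ xs))
   alternate-breaks (x ∷ []) (p ∷ q ∷ L) e with () ← suc-injective (cong length e)
   alternate-breaks (x ∷ x′ ∷ xs) (p ∷ q ∷ L) e = ≡-≤-trans (sym (+-assoc (ι (not (adj x (proj₂ p)))) _ _))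
    (+-mono-≤ (≤-reflexive (cong (λ s → cost₁ s (proj₂ p)) (sym (Listₚ.∷-injectiveˡ e)))) (alternate-breaks (x′ ∷ xs) (q ∷ L) (Listₚ.∷-injectiveʳ e)))

   alternate-↭ : ∀ xs L → length L ≡ length xs → alternate xs L ↭ xs ++ map proj₂ L
   alternate-↭ [] [] e = ↭-refl
   alternate-↭ (x ∷ xs) (p ∷ L) e = prep x (↭-trans (prep (proj₂ p) (alternate-↭ xs L (suc-injective e))) (↭-sym (Permₚ.shift (proj₂ p) xs (map proj₂ L))))

   slots-cost : ∀ (g : Block → ℕ) x xs → ∑ (slots (x ∷ xs)) (λ s → g (proj₁ s) + g (proj₂ s)) + g x ≤ 3 * ∑ (x ∷ xs) g
   slots-cost g x [] = ≤-reflexive (ring (g x))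
    where
    ring : ∀ a → a + a + 0 + a ≡ 3 * (a + 0)
    ring = solve-∀
   slots-cost g x (x′ ∷ xs) = linear (g x) (slots-cost g x′ xs) (ring (g x) (g x′) (∑ (slots (x′ ∷ xs)) (λ s → g (proj₁ s) + g (proj₂ s))) (∑ xs g))
    where
    ring : ∀ a b s t → a + b + s + a + 3 * (b + t) + a ≡ 3 * (a + (b + t)) + (s + b)
    ring = solve-∀

  alternating : ∀ Xs Ys → length Xs ≡ length Ys → ∃[ Bs ] Bs ↭ Xs ++ Ys ×
         length Xs * breaks Bs ≤ 3 * ∑ Xs (λ x → ∑ Ys (λ y → ι (not (adj x y))))
  alternating [] [] e = [] , ↭-refl , z≤n
  alternating Xs@(x ∷ xs) Ys e with cheap (zip (slots Xs) Ys)
  ... | L , m₁ , m₂ , small with Permₚ.↭-map-inv proj₁ m₁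
  ... | L′ , eq , perm = alternate Xs L′ , ↭-trans (alternate-↭ Xs L′ len′) (++⁺ˡ Xs (↭-trans (↭-sym (Permₚ.map⁺ proj₂ perm)) (↭-trans m₂ (↭-reflexive unzip₂)))) , (begin
    length Xs * breaks (alternate Xs L′)
     ≤⟨ *-monoʳ-≤ (length Xs) (alternate-breaks Xs L′ (trans (sym eq) unzip₁)) ⟩
    length Xs * cost L′
     ≡⟨ cong₂ _*_ (trans (sym len′) (sym (↭-length perm))) (∑-↭ _ (↭-sym perm)) ⟩
    length L * cost L
     ≤⟨ small ⟩
    ∑ (map proj₁ O) (λ a → ∑ (map proj₂ O) (cost₁ a))
     ≡⟨ cong₂ (λ as bs → ∑ as (λ a → ∑ bs (cost₁ a))) unzip₁ unzip₂ ⟩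
    ∑ (slots Xs) (λ s → ∑ Ys (cost₁ s))
     ≡⟨ ∑-cong (slots Xs) (λ s → trans (∑-+ Ys _ _) (cong (g (proj₁ s) +_) (∑-cong Ys (λ y → cong (ι ∘ not) (adj-sym y (proj₂ s)))))) ⟩
    ∑ (slots Xs) (λ s → g (proj₁ s) + g (proj₂ s))
     ≤⟨ ≤-trans (m≤m+n _ (g x)) (slots-cost g x xs) ⟩
    3 * ∑ Xs g ∎)
   where
   open ≤-Reasoning
   O = zip (slots Xs) Ys
   g : Block → ℕ
   g x = ∑ Ys (λ y → ι (not (adj x y)))
   zip₁ : ∀ {A B : Set} (as : List A) (bs : List B) → length as ≡ length bs → map proj₁ (zip as bs) ≡ as
   zip₁ [] [] e = refl
   zip₁ (a ∷ as) (b ∷ bs) e = cong (a ∷_) (zip₁ as bs (suc-injective e))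
   zip₂ : ∀ {A B : Set} (as : List A) (bs : List B) → length as ≡ length bs → map proj₂ (zip as bs) ≡ bs
   zip₂ [] [] e = refl
   zip₂ (a ∷ as) (b ∷ bs) e = cong (b ∷_) (zip₂ as bs (suc-injective e))
   unzip₁ : map proj₁ O ≡ slots Xs
   unzip₁ = zip₁ (slots Xs) Ys (trans (length-slots Xs) e)
   unzip₂ : map proj₂ O ≡ Ys
   unzip₂ = zip₂ (slots Xs) Ys (trans (length-slots Xs) e)
   len′ : length L′ ≡ length Xs
   len′ = trans (sym (length-map proj₁ L′)) (trans (cong length (sym eq)) (trans (cong length unzip₁) (length-slots Xs)))

  exchangeHeads : Block × Block → Block × Block
  exchangeHeads (x ∷ s , y ∷ t) = y ∷ s , x ∷ t
  exchangeHeads p = p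

  both : Block × Block → List Block
  both p = proj₁ p ∷ proj₂ p ∷ []

  versions : Block × Block → List Block
  versions p = both p ++ both (exchangeHeads p)

  data Versions : List (Block × Block) → List (Block × Block) → Set where
   [] : Versions [] []
   keep : ∀ {W V} p → Versions W V → Versions (p ∷ W) (p ∷ V)
   exchange : ∀ {W V} p → Versions W V → Versions (p ∷ W) (exchangeHeads p ∷ V)

  exchangeHeads-↭ : ∀ p → concat (both (exchangeHeads p)) ↭ concat (both p)
  exchangeHeads-↭ ([] , t) = ↭-refl
  exchangeHeads-↭ (x ∷ s , []) = ↭-refl
  exchangeHeads-↭ (x ∷ s , y ∷ t) = ↭-trans (prep y (Permₚ.shift x s (t ++ []))) (↭-trans (swap y x ↭-refl) (prep x (↭-sym (Permₚ.shift y s (t ++ [])))))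

  exchangeHeads-lengths : ∀ p → All (λ B → length B ≡ ℓ) (both p) → All (λ B → length B ≡ ℓ) (both (exchangeHeads p))
  exchangeHeads-lengths ([] , t) a = a
  exchangeHeads-lengths (x ∷ s , []) a = a
  exchangeHeads-lengths (x ∷ s , y ∷ t) (e ∷ e′ ∷ []) = e ∷ e′ ∷ []

  versions-↭ : ∀ {W V} → Versions W V → concat (concatMap both V) ↭ concat (concatMap both W)
  versions-↭ [] = ↭-refl
  versions-↭ (keep p v) = ++⁺ˡ (proj₁ p) (++⁺ˡ (proj₂ p) (versions-↭ v))
  versions-↭ {p ∷ W} {_ ∷ V} (exchange p v) = ↭-trans (↭-reflexive (sym (concat-++ (both (exchangeHeads p)) (concatMap both V))))
   (↭-trans (Permₚ.++⁺ (exchangeHeads-↭ p) (versions-↭ v)) (↭-reflexive (concat-++ (both p) (concatMap both W))))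

  versions-lengths : ∀ {W V} → Versions W V → All (λ B → length B ≡ ℓ) (concatMap both W) → All (λ B → length B ≡ ℓ) (concatMap both V)
  versions-lengths [] a = a
  versions-lengths (keep p v) (e ∷ e′ ∷ a) = e ∷ e′ ∷ versions-lengths v a
  versions-lengths (exchange p v) (e ∷ e′ ∷ a) = Allₚ.++⁺ (exchangeHeads-lengths p (e ∷ e′ ∷ [])) (versions-lengths v a)

  versions-length : ∀ {W V} → Versions W V → length (concatMap both V) ≡ 2 * length W
  versions-length [] = refl
  versions-length {p ∷ W} (keep p v) = trans (cong (suc ∘ suc) (versions-length v)) (sym (*-suc 2 (length W)))
  versions-length {p ∷ W} (exchange p v) = trans (cong (suc ∘ suc) (versions-length v)) (sym (*-suc 2 (length W)))

  versions-∑ : ∀ {W V} → Versions W V → ∀ (g : Block → ℕ) → ∑ (concatMap both V) g ≤ ∑ W (λ p → ∑ (versions p) g)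
  versions-∑ [] g = z≤n
  versions-∑ {p ∷ W} {_ ∷ V} (keep p v) g = ≡-≤-trans (∑-++ (both p) (concatMap both V) g)
   (+-mono-≤ (≤-≡-trans (m≤m+n (∑ (both p) g) (∑ (both (exchangeHeads p)) g)) (sym (∑-++ (both p) (both (exchangeHeads p)) g))) (versions-∑ v g))
  versions-∑ {p ∷ W} {_ ∷ V} (exchange p v) g = ≡-≤-trans (∑-++ (both (exchangeHeads p)) (concatMap both V) g)
   (+-mono-≤ (≤-≡-trans (m≤n+m (∑ (both (exchangeHeads p)) g) (∑ (both p) g)) (sym (∑-++ (both p) (both (exchangeHeads p)) g))) (versions-∑ v g))

  module _ (f : Block → Bool) where

   hits : Block × Block → ℕ
   hits p = ι (f (proj₁ p)) + ι (f (proj₂ p))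

   most least : Block × Block → ℕ
   most p = hits p ⊔ hits (exchangeHeads p)
   least p = hits p ⊓ hits (exchangeHeads p)

   private
    hits≤2 : ∀ p → hits p ≤ 2
    hits≤2 p = +-mono-≤ (ι≤1 (f (proj₁ p))) (ι≤1 (f (proj₂ p)))

    choose : ∀ {W V} p → Versions W V → (op : ℕ → ℕ → ℕ) → (op (hits p) (hits (exchangeHeads p)) ≡ hits p ⊎ op (hits p) (hits (exchangeHeads p)) ≡ hits (exchangeHeads p)) →
         ∃[ p′ ] Versions (p ∷ W) (p′ ∷ V) × hits p′ ≡ op (hits p) (hits (exchangeHeads p))
    choose p v op (inj₁ e) = p , keep p v , sym e
    choose p v op (inj₂ e) = exchangeHeads p , exchange p v , sym e

    maximal : ∀ W → ∃[ V ] Versions W V × ∑ V hits ≡ ∑ W most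
    maximal [] = [] , [] , refl
    maximal (p ∷ W) with maximal W
    ... | V , v , e with choose p v _⊔_ (⊔-sel _ _)
    ... | p′ , v′ , e′ = p′ ∷ V , v′ , cong₂ _+_ e′ e

   steer : ∀ W t → ∑ W least ≤ t → t ≤ ∑ W most → ∃[ V ] Versions W V × t ≤ ∑ V hits × ∑ V hits ≤ suc t
   steer [] zero lo hi = [] , [] , z≤n , z≤n
   steer (p ∷ W) t lo hi with t ≤? least p + ∑ W most
   ... | yes le with steer W (t ∸ least p) (≡-≤-trans (sym (m+n∸m≡n (least p) _)) (∸-monoˡ-≤ (least p) lo))
            (≤-≡-trans (∸-monoˡ-≤ (least p) le) (m+n∸m≡n (least p) _))
   ... | V , v , h₁ , h₂ with choose p v _⊓_ (⊓-sel _ _)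
   ... | p′ , v′ , e′ = p′ ∷ V , v′ ,
        subst₂ _≤_ refl (cong (_+ ∑ V hits) (sym e′)) (≡-≤-trans (sym (m+[n∸m]≡n least≤t)) (+-monoʳ-≤ (least p) h₁)) ,
        subst₂ _≤_ (cong (_+ ∑ V hits) (sym e′)) refl (≤-≡-trans (+-monoʳ-≤ (least p) h₂) (trans (+-suc (least p) _) (cong suc (m+[n∸m]≡n least≤t))))
    where
    least≤t : least p ≤ t
    least≤t = ≤-trans (m≤m+n _ _) lo
   steer (p ∷ W) t lo hi | no ¬le with maximal (p ∷ W)
   ... | V , v , e = V , v , ≤-≡-trans hi (sym e) , ≡-≤-trans e (linear (least p) (+-mono-≤ (≰⇒> ¬le) most≤2) (ring (most p) (∑ W most) t (least p)))
    where
    most≤2 : most p ≤ 2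
    most≤2 = ⊔-lub (hits≤2 p) (hits≤2 (exchangeHeads p))
    ring : ∀ m S t l → m + S + (t + 2) + l ≡ suc t + (suc (l + S) + m)
    ring = solve-∀

   clash : Block → Block → ℕ
   clash B C = ι (not (f B) ∧ f C ∧ not (adj B C))

   clashes : Block × Block → Block × Block → ℕ
   clashes p p′ = ∑ (versions p) (λ B → ∑ (versions p′) (clash B))

   balanced-cover : ∀ W t → length W ≡ t → All (λ B → length B ≡ ℓ) (concatMap both W) →
            ∑ W least ≤ t → t ≤ ∑ W most →
            ∃[ x ] ∃[ b ] t ≤ suc x × Cover (concat (concatMap both W)) (b + 3) × x * b ≤ 3 * ∑ W (λ p → ∑ W (clashes p))
   balanced-cover W t len lengths lo hi with steer W t lo hi
   ... | V , v , h₁ , h₂ = use (alternating Xs Ys₁ (sym lenYs₁))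
    where
    Bs = concatMap both V
    Xs = filterᵇ (not ∘ f) Bs
    Ys = filterᵇ f Bs
    Ys₁ = take (length Xs) Ys
    Ys₂ = drop (length Xs) Ys
    lenYs : length Ys ≡ ∑ V hits
    lenYs = trans (length-filterᵇ f Bs) (count V)
     where
     count : ∀ V → ∑ (concatMap both V) (λ B → ι (f B)) ≡ ∑ V hits
     count [] = refl
     count (p ∷ V) = trans (sym (+-assoc (ι (f (proj₁ p))) _ _)) (cong (hits p +_) (count V))
    lenXsYs : length Xs + length Ys ≡ 2 * t
    lenXsYs = trans (sym (length-++ Xs)) (trans (↭-length (partition-↭ f Bs)) (trans (versions-length v) (cong (2 *_) len)))
    Ys≥ : t ≤ length Ys
    Ys≥ = subst (t ≤_) (sym lenYs) h₁
    Ys≤ : length Ys ≤ suc t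
    Ys≤ = subst (_≤ suc t) (sym lenYs) h₂
    Xs≤ : length Xs ≤ t
    Xs≤ = linear 0 (+-mono-≤ Ys≥ (≤-reflexive lenXsYs)) (ring (length Xs) (length Ys) t)
     where
     ring : ∀ x y t → x + (y + 2 * t) + 0 ≡ t + (t + (x + y))
     ring = solve-∀
    Xs≥ : t ≤ suc (length Xs)
    Xs≥ = linear 0 (+-mono-≤ Ys≤ (≤-reflexive (sym lenXsYs))) (ring (length Xs) (length Ys) t)
     where
     ring : ∀ x y t → t + (suc t + (x + y)) + 0 ≡ suc x + (y + 2 * t)
     ring = solve-∀
    lenYs₁ : length Ys₁ ≡ length Xs
    lenYs₁ = trans (Listₚ.length-take (length Xs) Ys) (m≤n⇒m⊓n≡m (≤-trans Xs≤ Ys≥))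
    lenYs₂ : length Ys₂ ≤ 2
    lenYs₂ = ≡-≤-trans (Listₚ.length-drop (length Xs) Ys) (≤-≡-trans (∸-monoˡ-≤ (length Xs) (≤-trans Ys≤ (s≤s Xs≥))) (m+n∸n≡m 2 (length Xs)))
    clash-total : ∑ Xs (λ x → ∑ Ys₁ (λ y → ι (not (adj x y)))) ≤ ∑ W (λ p → ∑ W (clashes p))
    clash-total = begin
     ∑ Xs (λ x → ∑ Ys₁ (λ y → ι (not (adj x y))))
      ≤⟨ ∑-mono Xs (λ x → ≤-≡-trans (m≤m+n _ _) (trans (sym (∑-++ Ys₁ Ys₂ _)) (cong (λ l → ∑ l (λ y → ι (not (adj x y)))) (take++drop≡id (length Xs) Ys)))) ⟩
     ∑ Xs (λ x → ∑ Ys (λ y → ι (not (adj x y))))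
      ≡⟨ trans (∑-filterᵇ (not ∘ f) Bs _) (∑-cong Bs (λ x → trans (cong (ι (not (f x)) *_) (∑-filterᵇ f Bs _)) (trans (sym (∑-*ˡ Bs (ι (not (f x))) _))
         (∑-cong Bs (λ y → sym (trans (ι-∧ (not (f x)) _) (cong (ι (not (f x)) *_) (ι-∧ (f y) _)))))))) ⟩
     ∑ Bs (λ B → ∑ Bs (clash B))
      ≤⟨ ∑-mono Bs (λ B → versions-∑ v (clash B)) ⟩
     ∑ Bs (λ B → ∑ W (λ p′ → ∑ (versions p′) (clash B)))
      ≤⟨ versions-∑ v (λ B → ∑ W (λ p′ → ∑ (versions p′) (clash B))) ⟩
     ∑ W (λ p → ∑ (versions p) (λ B → ∑ W (λ p′ → ∑ (versions p′) (clash B))))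
      ≡⟨ ∑-cong W (λ p → ∑-swap (versions p) W (λ B p′ → ∑ (versions p′) (clash B))) ⟩
     ∑ W (λ p → ∑ W (clashes p)) ∎
     where open ≤-Reasoning
    use : (∃[ Cs ] Cs ↭ Xs ++ Ys₁ × length Xs * breaks Cs ≤ 3 * ∑ Xs (λ x → ∑ Ys₁ (λ y → ι (not (adj x y))))) → _
    use (Cs , perm , small) = length Xs , breaks Cs , Xs≥ ,
     (Cs ++ Ys₂ , ↭-trans (concat-↭ all-blocks) (versions-↭ v) , All-resp-↭ (↭-sym all-blocks) (versions-lengths v lengths) ,
      ≤-trans (breaks-++ Cs Ys₂) (≤-≡-trans (+-monoʳ-≤ (breaks Cs + 1) (≤-trans (breaks≤length Ys₂) lenYs₂)) (+-assoc (breaks Cs) 1 2))) ,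
     ≤-trans small (*-monoʳ-≤ 3 clash-total)
     where
     all-blocks : Cs ++ Ys₂ ↭ Bs
     all-blocks = ↭-trans (++⁺ʳ Ys₂ perm) (↭-trans (↭-reflexive (trans (++-assoc Xs Ys₁ Ys₂) (cong (Xs ++_) (take++drop≡id (length Xs) Ys)))) (partition-↭ f Bs))

 pair-sampling : ∀ {A : Set} (X : List A) (g : A → A → ℕ) C D₁ D₂ E M → (∀ x y → g x y ≤ C) →
  D₂ * ∑ X (λ x → ∑ X (g x)) ≤ length X * length X → C * D₂ ≤ 2 + M → 2 * (E * D₁) ≤ D₂ →
  E * ∑ (tuples X (2 + M)) (λ W → ι (not (D₁ * ∑ W (λ x → ∑ W (g x)) ≤ᵇ (2 + M) * (2 + M)))) ≤ length X ^ (2 + M)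
 pair-sampling X g C D₁ D₂ E M g≤C few C≤ D≤ =
  (λ h → ≤-≡-trans h (length-tuples X m)) (markov Ws (λ W → ∑ W (λ x → ∑ W (g x))) (m * m) D₁ E (s≤s z≤n)
   (subst (λ l → E * (D₁ * G) ≤ l * (m * m)) (sym (length-tuples X m)) (*-cancelˡ-pos 2 (s≤s z≤n) (begin
    2 * (E * (D₁ * G)) ≡⟨ ring₁ E D₁ G ⟩
    2 * (E * D₁) * G ≤⟨ *-monoˡ-≤ G D≤ ⟩
    D₂ * G ≤⟨ *-monoʳ-≤ D₂ expand ⟩
    D₂ * (a ^ m * (C * m) + m * ((1 + M) * (a ^ M * S))) ≡⟨ ring₂ D₂ (a ^ m) C m (1 + M) (a ^ M) S ⟩
    a ^ m * m * (C * D₂) + m * (1 + M) * a ^ M * (D₂ * S) ≤⟨ +-mono-≤ (*-monoʳ-≤ (a ^ m * m) C≤) (*-mono-≤ (*-monoˡ-≤ (a ^ M) (*-monoʳ-≤ m (n≤1+n (1 + M)))) few) ⟩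
    a ^ m * m * m + m * m * a ^ M * (a * a) ≡⟨ ring₃ a (a ^ M) m ⟩
    2 * (a ^ m * (m * m)) ∎))))
  where
  open ≤-Reasoning
  a = length X
  m = 2 + M
  Ws = tuples X m
  G = ∑ Ws (λ W → ∑ W (λ x → ∑ W (g x)))
  S = ∑ X (λ x → ∑ X (g x))
  ring₁ : ∀ E D G → 2 * (E * (D * G)) ≡ 2 * (E * D) * G
  ring₁ = solve-∀
  ring₂ : ∀ D p C m k q S → D * (p * (C * m) + m * (k * (q * S))) ≡ p * m * (C * D) + m * k * q * (D * S)
  ring₂ = solve-∀
  ring₃ : ∀ a p m → a * (a * p) * m * m + m * m * p * (a * a) ≡ 2 * (a * (a * p) * (m * m))
  ring₃ = solve-∀
  expand : G ≤ a ^ m * (C * m) + m * ((1 + M) * (a ^ M * S))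
  expand = begin
   G
    ≤⟨ ∑-mono∈ Ws (λ {W} W∈ → ≡-≤-trans (∑²-picks W g) (+-monoˡ-≤ (∑ (picks W) (λ (x , r) → ∑ (picks r) (λ (y , _) → g x y)))
       (≤-≡-trans (∑-≤-const W C (λ x → g≤C x x)) (trans (cong (_* C) (tuple-length X m W∈)) (*-comm m C))))) ⟩
   ∑ Ws (λ W → C * m + ∑ (picks W) (λ (x , r) → ∑ (picks r) (λ (y , _) → g x y)))
    ≡⟨ trans (∑-+ Ws _ _) (cong₂ _+_ (∑-tuples-const X m (C * m)) (∑-tuples-picks² X M (λ x y _ → g x y))) ⟩
   a ^ m * (C * m) + m * ((1 + M) * ∑ X (λ x → ∑ X (λ y → ∑ (tuples X M) (λ _ → g x y))))
    ≡⟨ cong (λ z → a ^ m * (C * m) + m * ((1 + M) * z)) (trans (∑-cong X (λ x → trans (∑-cong X (λ y → ∑-tuples-const X M (g x y))) (∑-*ˡ X (a ^ M) _))) (∑-*ˡ X (a ^ M) _)) ⟩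
   a ^ m * (C * m) + m * ((1 + M) * (a ^ M * S)) ∎

 module BalancedCover {n : ℕ} (adj : Relation n) (adj-sym : Symmetric adj) (k : ℕ)
            (f : List (Fin n) → Bool) (f-↭ : ∀ {s t} → s ↭ t → f s ≡ f t)
            (R : List (Fin n)) (R>0 : 0 < length R) where

  private
   ℓ = 2 + k
   q = 40 * (ℓ * ℓ)
   κ = 200 * (ℓ * ℓ)
   Block = List (Fin n)
   Bs = tuples R ℓ
   X = tuples Bs 2
   S₁ = tuples R (suc k)
   r = length R
   N = r ^ ℓ

  open Alternating adj adj-sym ℓ
  open Covers adj ℓ
  open ColumnMatching adj ℓ using (firstTwo)

  length-X : length X ≡ N * N
  length-X = trans (length-tuples Bs 2) (trans (cong (_^ 2) (length-tuples R ℓ)) (cong (N *_) (*-identityʳ N)))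

  N>0 : 0 < N
  N>0 = ^-pos ℓ R>0

  ∑-rows : ∀ (g : Block × Block → ℕ) → ∑ X (g ∘ firstTwo) ≡ ∑ Bs (λ a → ∑ Bs (λ b → g (a , b)))
  ∑-rows g = trans (∑-tuples-suc Bs 1 _) (∑-cong Bs (λ a → ∑-tuples-1 Bs _))

  ∑-heads : ∀ (g : Block × Block → ℕ) → ∑ Bs (λ a → ∑ Bs (λ b → g (a , b))) ≡ ∑ R (λ x → ∑ R (λ y → ∑ S₁ (λ s → ∑ S₁ (λ t → g (x ∷ s , y ∷ t)))))
  ∑-heads g = trans (∑-tuples-suc R (suc k) _) (∑-cong R (λ x → trans (∑-cong S₁ (λ s → ∑-tuples-suc R (suc k) _)) (∑-swap S₁ R _)))

  ∑-firsts : ∀ (h : Block → ℕ) → ∑ Bs (λ a → ∑ Bs (λ b → h a)) ≡ N * ∑ Bs h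
  ∑-firsts h = trans (∑-cong Bs (λ a → ∑-tuples-const R ℓ (h a))) (∑-*ˡ Bs N h)

  ∑-seconds : ∀ (h : Block → ℕ) → ∑ Bs (λ a → ∑ Bs h) ≡ N * ∑ Bs h
  ∑-seconds h = ∑-tuples-const R ℓ (∑ Bs h)

  ∑-versions : ∀ (h : Block → ℕ) → ∑ X (λ x → ∑ (versions (firstTwo x)) h) ≡ 4 * N * ∑ Bs h
  ∑-versions h = begin
   ∑ X (λ x → ∑ (versions (firstTwo x)) h)
    ≡⟨ ∑-cong X (λ x → four (firstTwo x)) ⟩
   ∑ X (λ x → pair (firstTwo x) + pair (exchangeHeads (firstTwo x)))
    ≡⟨ ∑-+ X _ _ ⟩
   ∑ X (pair ∘ firstTwo) + ∑ X (pair ∘ exchangeHeads ∘ firstTwo)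
    ≡⟨ cong₂ _+_ (∑-rows pair) (trans (∑-rows (pair ∘ exchangeHeads)) (trans (∑-heads (pair ∘ exchangeHeads)) (trans (∑-swap R R _) (sym (∑-heads pair))))) ⟩
   P + P
    ≡⟨ cong (λ z → z + z) (trans (∑-cong Bs (λ a → ∑-+ Bs _ _)) (trans (∑-+ Bs _ _) (cong₂ _+_ (∑-firsts h) (∑-seconds h)))) ⟩
   N * H + N * H + (N * H + N * H)
    ≡⟨ ring N H ⟩
   4 * N * H ∎
   where
   open ≡-Reasoning
   H = ∑ Bs h
   pair : Block × Block → ℕ
   pair p = h (proj₁ p) + h (proj₂ p)
   P = ∑ Bs (λ a → ∑ Bs (λ b → pair (a , b)))
   four : ∀ p → ∑ (versions p) h ≡ pair p + pair (exchangeHeads p)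
   four p = assoc (h (proj₁ p)) (h (proj₂ p)) (h (proj₁ (exchangeHeads p))) (h (proj₂ (exchangeHeads p)))
    where
    assoc : ∀ a b c d → a + (b + (c + (d + 0))) ≡ a + b + (c + d)
    assoc = solve-∀
   ring : ∀ N H → N * H + N * H + (N * H + N * H) ≡ 4 * N * H
   ring = solve-∀

  ∑-clashes : ∑ X (λ x → ∑ X (λ y → clashes f (firstTwo x) (firstTwo y))) ≡ 16 * (N * N) * ∑ Bs (λ B → ∑ Bs (clash f B))
  ∑-clashes = begin
   ∑ X (λ x → ∑ X (λ y → ∑ (versions (firstTwo x)) (λ B → ∑ (versions (firstTwo y)) (clash f B))))
    ≡⟨ ∑-cong X (λ x → trans (∑-swap X (versions (firstTwo x)) (λ y B → ∑ (versions (firstTwo y)) (clash f B))) (∑-cong (versions (firstTwo x)) (λ B → ∑-versions (clash f B)))) ⟩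
   ∑ X (λ x → ∑ (versions (firstTwo x)) (λ B → 4 * N * ∑ Bs (clash f B)))
    ≡⟨ ∑-versions (λ B → 4 * N * ∑ Bs (clash f B)) ⟩
   4 * N * ∑ Bs (λ B → 4 * N * ∑ Bs (clash f B))
    ≡⟨ cong (4 * N *_) (∑-*ˡ Bs (4 * N) _) ⟩
   4 * N * (4 * N * ∑ Bs (λ B → ∑ Bs (clash f B)))
    ≡⟨ ring N (∑ Bs (λ B → ∑ Bs (clash f B))) ⟩
   16 * (N * N) * ∑ Bs (λ B → ∑ Bs (clash f B)) ∎
   where
   open ≡-Reasoning
   ring : ∀ N c → 4 * N * (4 * N * c) ≡ 16 * (N * N) * c
   ring = solve-∀

  clashes≤16 : ∀ p p′ → clashes f p p′ ≤ 16
  clashes≤16 p p′ = ∑-≤-const (versions p) 4 (λ B → ∑-≤-const (versions p′) 1 (λ C → ι≤1 (not (f B) ∧ f C ∧ not (adj B C))))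

  module _ (g : Block → Bool) (g-↭ : ∀ {s t} → s ↭ t → g s ≡ g t)
       (lower : κ * N ≤ 2 * κ * ∑ Bs (λ B → ι (g B)) + N) (upper : 2 * κ * ∑ Bs (λ B → ι (g B)) ≤ κ * N + N) where

   private
    d = ∑ Bs (λ B → ι (g B))
    open Exchange R g g-↭ k using (increasing; increases; increasing-large)

   most-mean : suc (2 * q) * length X ≤ q * ∑ X (λ x → 2 * most g (firstTwo x))
   most-mean = begin
    suc (2 * q) * length X ≡⟨ cong (suc (2 * q) *_) length-X ⟩
    suc (2 * q) * (N * N) ≤⟨ *-cancelˡ-pos 125 (s≤s z≤n) (linear (113 * (N * N)) (+-mono-≤ (*-monoʳ-≤ (50 * N) lower) (*-monoʳ-≤ 8 large)) (certificate N (ℓ * ℓ) d increasing)) ⟩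
    q * (2 * (2 * (N * d) + increasing)) ≤⟨ *-monoʳ-≤ q (*-monoʳ-≤ 2 gained) ⟩
    q * (2 * ∑ X (λ x → most g (firstTwo x))) ≡⟨ cong (q *_) (∑-*ˡ X 2 _) ⟨
    q * ∑ X (λ x → 2 * most g (firstTwo x)) ∎
    where
    open ≤-Reasoning
    certificate : ∀ N l d i → 125 * (suc (2 * (40 * l)) * (N * N)) + (50 * N * (2 * (200 * l) * d + N) + 8 * (1250 * l * i)) + 113 * (N * N)
     ≡ 125 * (40 * l * (2 * (2 * (N * d) + i))) + (50 * N * (200 * l * N) + 8 * (36 * (N * N)))
    certificate = solve-∀
    κ≥5 : 5 ≤ κ
    κ≥5 = ≤-trans (≤ᵇ⇒≤ 5 200 tt) (*-monoʳ-≤ 200 {1} {ℓ * ℓ} (s≤s z≤n))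
    low : 2 * N ≤ 5 * d
    low = *-cancelˡ-pos (2 * κ) (*-pos {2} (s≤s z≤n) (≤-trans (s≤s z≤n) κ≥5)) (linear 0 (+-mono-≤ (*-monoʳ-≤ 5 lower) (*-monoʳ-≤ N κ≥5)) (ring κ N d))
     where
     ring : ∀ κ N d → 2 * κ * (2 * N) + (5 * (2 * κ * d + N) + N * κ) + 0 ≡ 2 * κ * (5 * d) + (5 * (κ * N) + N * 5)
     ring = solve-∀
    high : 5 * d ≤ 3 * N
    high = *-cancelˡ-pos (2 * κ) (*-pos {2} (s≤s z≤n) (≤-trans (s≤s z≤n) κ≥5)) (linear 0 (+-mono-≤ (*-monoʳ-≤ 5 upper) (*-monoʳ-≤ N κ≥5)) (ring κ N d))
     where
     ring : ∀ κ N d → 2 * κ * (5 * d) + (5 * (κ * N + N) + N * κ) + 0 ≡ 2 * κ * (3 * N) + (5 * (2 * κ * d) + N * 5)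
     ring = solve-∀
    large : 36 * (N * N) ≤ 1250 * (ℓ * ℓ) * increasing
    large = increasing-large R>0 low high
    gained : 2 * (N * d) + increasing ≤ ∑ X (λ x → most g (firstTwo x))
    gained = begin
     2 * (N * d) + increasing
      ≡⟨ cong₂ _+_ (trans (cong (N * d +_) (+-identityʳ (N * d))) (sym (trans (∑-cong Bs (λ a → ∑-+ Bs _ _)) (trans (∑-+ Bs _ _) (cong₂ _+_ (∑-firsts (ι ∘ g)) (∑-seconds (ι ∘ g))))))) refl ⟩
     ∑ Bs (λ a → ∑ Bs (λ b → hits g (a , b))) + increasing
      ≡⟨ cong (_+ increasing) (∑-heads (hits g)) ⟩
     ∑ R (λ x → ∑ R (λ y → ∑ S₁ (λ s → ∑ S₁ (λ t → hits g (x ∷ s , y ∷ t))))) + increasing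
      ≡⟨ trans (∑-cong R (λ x → trans (∑-cong R (λ y → trans (∑-cong S₁ (λ s → ∑-+ S₁ _ _)) (∑-+ S₁ _ _))) (∑-+ R _ _))) (∑-+ R _ _) ⟨
     ∑ R (λ x → ∑ R (λ y → ∑ S₁ (λ s → ∑ S₁ (λ t → hits g (x ∷ s , y ∷ t) + ι (increases x s y t)))))
      ≤⟨ ∑-mono R (λ x → ∑-mono R (λ y → ∑-mono S₁ (λ s → ∑-mono S₁ (λ t → improves (hits g (x ∷ s , y ∷ t)) (hits g (y ∷ s , x ∷ t)))))) ⟩
     ∑ R (λ x → ∑ R (λ y → ∑ S₁ (λ s → ∑ S₁ (λ t → most g (x ∷ s , y ∷ t)))))
      ≡⟨ trans (∑-rows (most g)) (∑-heads (most g)) ⟨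
     ∑ X (λ x → most g (firstTwo x)) ∎
     where
     improves : ∀ a b → a + ι (not (b ≤ᵇ a)) ≤ a ⊔ b
     improves a b with b ≤ᵇ a in e
     ... | true = ≡-≤-trans (+-identityʳ a) (m≤m⊔n a b)
     ... | false = ≡-≤-trans (+-comm a 1) (≤-trans (≰⇒> (λ le → contradiction (trans (sym (T⇒≡ (≤⇒≤ᵇ le))) e) λ ())) (m≤n⊔m a b))

   steerable : List (List Block) → Bool
   steerable W = 2 * failures (λ _ _ x → 2 * most g (firstTwo x)) W ≤ᵇ length W * length W

   steerable⇒ : ∀ W → 0 < length W → steerable W ≡ true → length W ≤ ∑ (map firstTwo W) (most g)
   steerable⇒ W pos ok = *-cancelˡ-pos 2 (s≤s z≤n) (<⇒≤ (≰⇒> low))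
    where
    m = length W
    low : 2 * ∑ (map firstTwo W) (most g) ≤ 2 * m → ⊥
    low le = <⇒≱ (linear {1} {0} 0 (+-mono-≤ (*-mono-≤ pos pos) all-fail) (ring (m * m))) z≤n
     where
     ring : ∀ x → 1 + (x + x) + 0 ≡ 0 + (1 + 2 * x)
     ring = solve-∀
     all-fail : 2 * (m * m) ≤ m * m
     all-fail = subst (λ z → 2 * z ≤ m * m) (trans (∑-cong W (λ x → trans (∑-cong W (λ y → cong ι (T⇒≡ (≤⇒≤ᵇ
       (≡-≤-trans (trans (∑-*ˡ W 2 _) (cong (2 *_) (sym (∑-map firstTwo W (most g))))) le))))) (∑-1 W))) (∑-const W m))
      (≤ᵇ⇒≤ _ _ (subst T (sym ok) tt))

   unsteerable : ∀ E M → 0 < M → 8 * q ≤ M → E * 2 * suc (4 * (q * q) * 16) ≤ M →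
          E * ∑ (tuples X (2 + M)) (λ W → ι (not (steerable W))) ≤ (N * N) ^ (2 + M)
   unsteerable E M M>0 M≥ big = (λ h → ≤-≡-trans h (cong (_^ (2 + M)) length-X)) (≤-trans (*-monoʳ-≤ E (≤-reflexive (∑-cong∈ (tuples X (2 + M)) (λ {W} W∈ →
     cong (λ l → ι (not (2 * failures (λ _ _ x → 2 * most g (firstTwo x)) W ≤ᵇ l * l))) (tuple-length X (2 + M) W∈)))))
    (sampling X (λ _ _ x → 2 * most g (firstTwo x)) q 4 2 E M (subst (0 <_) (sym length-X) (*-pos N>0 N>0))
     (λ _ _ x → *-monoʳ-≤ 2 (most≤2 (firstTwo x))) (λ _ _ → most-mean) M>0 M≥ big))
    where
    most≤2 : ∀ p → most g p ≤ 2
    most≤2 p = ⊔-lub (+-mono-≤ (ι≤1 (g (proj₁ p))) (ι≤1 (g (proj₂ p)))) (+-mono-≤ (ι≤1 (g (proj₁ (exchangeHeads p)))) (ι≤1 (g (proj₂ (exchangeHeads p)))))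

  module _ (lower : κ * N ≤ 2 * κ * ∑ Bs (λ B → ι (f B)) + N) (upper : 2 * κ * ∑ Bs (λ B → ι (f B)) ≤ κ * N + N)
       (D M m₀ δ : ℕ) (D>0 : 0 < D) (M≥3 : 3 ≤ M) (m≡ : 2 + m₀ ≡ 8 * D * M) (m₀>0 : 0 < m₀) (m₀≥q : 8 * q ≤ m₀)
       (m₀≥ : 48 * D * 2 * suc (4 * (q * q) * 16) ≤ m₀) (δ≥ : 2 * (48 * D * (48 * D)) ≤ δ) (δ≤ : 16 * δ ≤ 2 + m₀)
       (few : 16 * δ * ∑ Bs (λ B → ∑ Bs (clash f B)) ≤ N * N) where

   private
    m = 2 + m₀

   nf-↭ : ∀ {s t} → s ↭ t → not (f s) ≡ not (f t)
   nf-↭ p = cong not (f-↭ p)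

   complement : ∑ Bs (λ B → ι (f B)) + ∑ Bs (λ B → ι (not (f B))) ≡ N
   complement = trans (sym (∑-+ Bs _ _)) (trans (∑-cong Bs (λ B → one (f B))) (trans (∑-1 Bs) (length-tuples R ℓ)))
    where
    one : ∀ b → ι b + ι (not b) ≡ 1
    one true = refl
    one false = refl

   lower′ : κ * N ≤ 2 * κ * ∑ Bs (λ B → ι (not (f B))) + N
   lower′ = linear 0 upper (trans (cong (λ z → κ * z + (κ * z + z) + 0) (sym complement)) (trans (ring κ (∑ Bs (λ B → ι (f B))) (∑ Bs (λ B → ι (not (f B)))))
    (cong (λ z → 2 * κ * ∑ Bs (λ B → ι (not (f B))) + z + 2 * κ * ∑ Bs (λ B → ι (f B))) complement)))
    where
    ring : ∀ κ d e → κ * (d + e) + (κ * (d + e) + (d + e)) + 0 ≡ 2 * κ * e + (d + e) + 2 * κ * d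
    ring = solve-∀

   upper′ : 2 * κ * ∑ Bs (λ B → ι (not (f B))) ≤ κ * N + N
   upper′ = linear 0 lower (trans (cong (λ z → 2 * κ * e + (2 * κ * d + z) + 0) (sym complement)) (trans (ring κ d e)
    (cong (λ z → κ * z + z + κ * z) complement)))
    where
    d = ∑ Bs (λ B → ι (f B))
    e = ∑ Bs (λ B → ι (not (f B)))
    ring : ∀ κ d e → 2 * κ * e + (2 * κ * d + (d + e)) + 0 ≡ κ * (d + e) + (d + e) + κ * (d + e)
    ring = solve-∀

   sparse : List (List Block) → Bool
   sparse W = 48 * D * ∑ W (λ x → ∑ W (λ y → clashes f (firstTwo x) (firstTwo y))) ≤ᵇ length W * length W

   typicalᵇ : List (List Block) → Bool
   typicalᵇ W = steerable f f-↭ lower upper W ∧ steerable (not ∘ f) nf-↭ lower′ upper′ W ∧ sparse W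

   dense : 48 * D * ∑ (tuples X m) (λ W → ι (not (sparse W))) ≤ (N * N) ^ m
   dense = (λ h → ≤-≡-trans h (cong (_^ m) length-X)) (≤-trans (*-monoʳ-≤ (48 * D) (≤-reflexive (∑-cong∈ (tuples X m) (λ {W} W∈ →
     cong (λ l → ι (not (48 * D * ∑ W (λ x → ∑ W (λ y → clashes f (firstTwo x) (firstTwo y))) ≤ᵇ l * l))) (tuple-length X m W∈)))))
    (pair-sampling X (λ x y → clashes f (firstTwo x) (firstTwo y)) 16 (48 * D) δ (48 * D) m₀ (λ x y → clashes≤16 (firstTwo x) (firstTwo y))
     (subst₂ _≤_ (cong (δ *_) (sym ∑-clashes)) (sym (cong₂ _*_ length-X length-X))
      (≡-≤-trans (ring δ (N * N) (∑ Bs (λ B → ∑ Bs (clash f B)))) (*-monoʳ-≤ (N * N) few))) δ≤ δ≥))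
    where
    ring : ∀ d n c → d * (16 * n * c) ≡ n * (16 * d * c)
    ring = solve-∀

   atypical-rare : 16 * D * ∑ (tuples X m) (λ W → ι (not (typicalᵇ W))) ≤ (N * N) ^ m
   atypical-rare = *-cancelˡ-pos 3 (s≤s z≤n) (begin
    3 * (16 * D * ∑ Ws (λ W → ι (not (typicalᵇ W))))
     ≤⟨ *-monoʳ-≤ 3 (*-monoʳ-≤ (16 * D) (≤-trans (∑-mono Ws (λ W → truth-table 3 (λ a b c → ι (not (a ∧ b ∧ c))) (λ a b c → ι (not a) + (ι (not b) + ι (not c))) tt
        (steerable f f-↭ lower upper W) (steerable (not ∘ f) nf-↭ lower′ upper′ W) (sparse W)))
        (≤-reflexive (trans (∑-+ Ws _ _) (cong (s₁ +_) (∑-+ Ws _ _)))))) ⟩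
    3 * (16 * D * (s₁ + (s₂ + s₃)))
     ≡⟨ ring D s₁ s₂ s₃ ⟩
    48 * D * s₁ + (48 * D * s₂ + 48 * D * s₃)
     ≤⟨ +-mono-≤ (unsteerable f f-↭ lower upper (48 * D) m₀ m₀>0 m₀≥q m₀≥) (+-mono-≤ (unsteerable (not ∘ f) nf-↭ lower′ upper′ (48 * D) m₀ m₀>0 m₀≥q m₀≥) dense) ⟩
    (N * N) ^ m + ((N * N) ^ m + (N * N) ^ m)
     ≡⟨ ring′ ((N * N) ^ m) ⟩
    3 * (N * N) ^ m ∎)
    where
    open ≤-Reasoning
    Ws = tuples X m
    s₁ = ∑ Ws (λ W → ι (not (steerable f f-↭ lower upper W)))
    s₂ = ∑ Ws (λ W → ι (not (steerable (not ∘ f) nf-↭ lower′ upper′ W)))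
    s₃ = ∑ Ws (λ W → ι (not (sparse W)))
    ring : ∀ D a b c → 3 * (16 * D * (a + (b + c))) ≡ 48 * D * a + (48 * D * b + 48 * D * c)
    ring = solve-∀
    ring′ : ∀ a → a + (a + a) ≡ 3 * a
    ring′ = solve-∀

   bad : List (Fin n) → Bool
   bad w = not (typicalᵇ (grid 2 ℓ m w))

   rare : 16 * D * ∑ (tuples R (M * (16 * D) * ℓ)) (λ w → ι (bad w)) ≤ r ^ (M * (16 * D) * ℓ)
   rare = subst₂ (λ u v → 16 * D * u ≤ v) (sym count) powers atypical-rare
    where
    open ≡-Reasoning
    reorder : ∀ M D ℓ → M * (16 * D) * ℓ ≡ 8 * D * M * (2 * ℓ)
    reorder = solve-∀
    len≡ : M * (16 * D) * ℓ ≡ m * (2 * ℓ)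
    len≡ = trans (reorder M D ℓ) (cong (_* (2 * ℓ)) (sym m≡))
    rechop : ∀ g → ∑ (tuples R (2 * ℓ)) (g ∘ chop ℓ 2) ≡ 1 * ∑ X g
    rechop g = trans (∑-tuples-chop R ℓ 2 g) (sym (+-identityʳ _))
    count : ∑ (tuples R (M * (16 * D) * ℓ)) (λ w → ι (bad w)) ≡ ∑ (tuples X m) (λ W → ι (not (typicalᵇ W)))
    count = begin
     ∑ (tuples R (M * (16 * D) * ℓ)) (λ w → ι (bad w))
      ≡⟨ cong (λ l → ∑ (tuples R l) (λ w → ι (bad w))) len≡ ⟩
     ∑ (tuples R (m * (2 * ℓ))) (λ w → ι (bad w))
      ≡⟨ ∑-tuples-chop R (2 * ℓ) m (λ V → ι (not (typicalᵇ (map (chop ℓ 2) V)))) ⟩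
     ∑ (tuples (tuples R (2 * ℓ)) m) (λ V → ι (not (typicalᵇ (map (chop ℓ 2) V))))
      ≡⟨ ∑-tuples-map (tuples R (2 * ℓ)) X (chop ℓ 2) 1 rechop m (λ W → ι (not (typicalᵇ W))) ⟩
     1 ^ m * ∑ (tuples X m) (λ W → ι (not (typicalᵇ W)))
      ≡⟨ trans (cong (_* ∑ (tuples X m) (λ W → ι (not (typicalᵇ W)))) (^-zeroˡ m)) (+-identityʳ _) ⟩
     ∑ (tuples X m) (λ W → ι (not (typicalᵇ W))) ∎
    powers : (N * N) ^ m ≡ r ^ (M * (16 * D) * ℓ)
    powers = trans (cong (_^ m) (sym (^-distribˡ-+-* r ℓ ℓ))) (trans (^-*-assoc r (ℓ + ℓ) m) (cong (r ^_) (trans (cong (λ z → (ℓ + z) * m) (sym (+-identityʳ ℓ))) (trans (*-comm (2 * ℓ) m) (sym len≡)))))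

   good : ∀ w → length w ≡ M * (16 * D) * ℓ → uniq w ≡ true → bad w ≡ false → Cover w (2 * M)
   good w len u ok = finish (balanced-cover f (map firstTwo W) m (trans (length-map firstTwo W) rows≡) (subst (All (λ B → length B ≡ ℓ)) (sym (unpair W two)) lengths)
     below (subst (_≤ ∑ (map firstTwo W) (most f)) rows≡ (steerable⇒ f f-↭ lower upper W W>0 (proj₁ typ))))
    where
    W = grid 2 ℓ m w
    reorder : ∀ M D ℓ → M * (16 * D) * ℓ ≡ 8 * D * M * (2 * ℓ)
    reorder = solve-∀
    len′ : length w ≡ m * (2 * ℓ)
    len′ = trans len (trans (reorder M D ℓ) (cong (_* (2 * ℓ)) (sym m≡)))
    rows≡ : length W ≡ m
    rows≡ = length-grid 2 ℓ m w
    W>0 : 0 < length W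
    W>0 = subst (0 <_) (sym rows≡) (s≤s z≤n)
    typ′ : typicalᵇ W ≡ true
    typ′ = trans (sym (Boolₚ.not-involutive _)) (cong not ok)
    typ : _ × _
    typ = ∧-true typ′
    typ₂ : steerable (not ∘ f) nf-↭ lower′ upper′ W ≡ true × sparse W ≡ true
    typ₂ = ∧-true (proj₂ typ)
    two : All (λ x → length x ≡ 2) W
    two = Allₚ.map⁺ (All.tabulate (λ {v} _ → length-chop ℓ 2 v))
    lengths : All (λ B → length B ≡ ℓ) (concat W)
    lengths = Allₚ.concat⁺ (Allₚ.map⁺ (All.map (λ {v} e → chop-lengths ℓ 2 v e) (chop-lengths (2 * ℓ) m w len′)))
    unpair : ∀ W → All (λ x → length x ≡ 2) W → concatMap both (map firstTwo W) ≡ concat W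
    unpair [] _ = refl
    unpair ((a ∷ b ∷ []) ∷ W) (_ ∷ t) = cong (λ l → a ∷ b ∷ l) (unpair W t)
    below : ∑ (map firstTwo W) (least f) ≤ m
    below = linear 0 (+-mono-≤ (≤-reflexive (trans opposite (cong (2 *_) (trans (length-map firstTwo W) rows≡)))) (subst (_≤ ∑ (map firstTwo W) (most (not ∘ f))) rows≡ (steerable⇒ (not ∘ f) nf-↭ lower′ upper′ W W>0 (proj₁ typ₂))))
     (ring (∑ (map firstTwo W) (least f)) (∑ (map firstTwo W) (most (not ∘ f))) m)
     where
     ring : ∀ a b m → a + (2 * m + b) + 0 ≡ m + (a + b + m)
     ring = solve-∀
     opposite : ∑ (map firstTwo W) (least f) + ∑ (map firstTwo W) (most (not ∘ f)) ≡ 2 * length (map firstTwo W)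
     opposite = trans (sym (∑-+ (map firstTwo W) (least f) (most (not ∘ f)))) (trans (∑-cong (map firstTwo W) (λ p → table (f (proj₁ p)) (f (proj₂ p)) (f (proj₁ (exchangeHeads p))) (f (proj₂ (exchangeHeads p))))) (trans (∑-const (map firstTwo W) 2) (*-comm (length (map firstTwo W)) 2)))
      where
      table : ∀ a b c d → (ι a + ι b) ⊓ (ι c + ι d) + ((ι (not a) + ι (not b)) ⊔ (ι (not c) + ι (not d))) ≡ 2
      table true true true true = refl
      table true true true false = refl
      table true true false true = refl
      table true true false false = refl
      table true false true true = refl
      table true false true false = refl
      table true false false true = refl
      table true false false false = refl
      table false true true true = refl
      table false true true false = refl
      table false true false true = refl
      table false true false false = refl
      table false false true true = refl
      table false false true false = refl
      table false false false true = refl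
      table false false false false = refl
    finish : (∃[ x ] ∃[ b ] m ≤ suc x × Cover (concat (concatMap both (map firstTwo W))) (b + 3) × x * b ≤ 3 * ∑ (map firstTwo W) (λ p → ∑ (map firstTwo W) (clashes f p))) → Cover w (2 * M)
    finish (x , b , x≥ , cov , cost) = cover-↭ (↭-reflexive (trans (cong concat (unpair W two)) (concat-grid 2 ℓ m w len′)))
      (≤-≡-trans (+-mono-≤ small M≥3) (cong (_+_ M) (sym (+-identityʳ M)))) cov
     where
     c = ∑ (map firstTwo W) (λ p → ∑ (map firstTwo W) (clashes f p))
     c≤ : 48 * D * c ≤ 8 * D * M * (8 * D * M)
     c≤ = subst₂ (λ a l → 48 * D * a ≤ l * l) (sym (trans (∑-map firstTwo W (λ p → ∑ (map firstTwo W) (clashes f p))) (∑-cong W (λ x → ∑-map firstTwo W (clashes f (firstTwo x)))))) (trans rows≡ m≡) (≤ᵇ⇒≤ _ _ (subst T (sym (proj₂ typ₂)) tt))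
     small : b ≤ M
     small = ≮⇒≥ (λ b> → n≮0 {0} (linear (64 * (D * D) * (M * M) + 95 * (D * D * M))
       (+-mono-≤ (*-monoʳ-≤ (16 * D * x) b>) (+-mono-≤ (*-monoʳ-≤ (16 * D * suc M) (subst (_≤ suc x) m≡ x≥)) (+-mono-≤ (*-monoʳ-≤ (16 * D) cost) (+-mono-≤ c≤
        (+-mono-≤ (*-monoʳ-≤ (16 * D) (*-pos D>0 M>0)) (+-mono-≤ (*-monoʳ-≤ (16 * D * M) D>0) (*-pos (*-pos D>0 D>0) M>0)))))))
       (certificate D M x b c)))
      where
      M>0 : 0 < M
      M>0 = ≤-trans (s≤s z≤n) M≥3
      certificate : ∀ D M x b c →
       1 + (16 * D * x * b + (16 * D * suc M * suc x + (16 * D * (3 * c) + (8 * D * M * (8 * D * M) + (16 * D * (D * M) + (16 * D * M * D + D * D * M)))))) + (64 * (D * D) * (M * M) + 95 * (D * D * M))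
       ≡ 0 + (16 * D * x * suc M + (16 * D * suc M * (8 * D * M) + (16 * D * (x * b) + (48 * D * c + (16 * D * 1 + (16 * D * M * 1 + 1))))))
      certificate = solve-∀

   cover : ∀ mᴿ → uniq R ≡ true → length R ≡ mᴿ * ℓ → suc (2 * (M * (16 * D) * ℓ * (M * (16 * D) * ℓ)) + 4 * D * (M * (16 * D) * ℓ)) ≤ length R →
       ∃[ b ] Cover R b × D * b ≤ mᴿ
   cover mᴿ uR len big = tile adj ℓ D (16 * D) M (s≤s z≤n) D>0 ≤-refl (≤-trans (s≤s z≤n) M≥3) R mᴿ uR len big bad good rare

 BalancedCovers : ℕ → ℕ → ℕ → ℕ → Set
 BalancedCovers k D δ t =
  ∀ {n} (adj : Relation n) → (∀ S T → adj S T ≡ adj T S) →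
  (f : List (Fin n) → Bool) → (∀ {S T} → S ↭ T → f S ≡ f T) →
  ∀ R m → uniq R ≡ true → length R ≡ m * (2 + k) → t ≤ length R →
  let N = length R ^ (2 + k); κ = 200 * ((2 + k) * (2 + k)); Bs = tuples R (2 + k); d = ∑ Bs (λ B → ι (f B)) in
  κ * N ≤ 2 * κ * d + N → 2 * κ * d ≤ κ * N + N →
  δ * ∑ Bs (λ B → ∑ Bs (λ C → ι (not (f B) ∧ f C ∧ not (adj B C)))) ≤ N * N →
  ∃[ b ] Covers.Cover adj (2 + k) R b × D * b ≤ m

 balanced-cover : ∀ k D → 0 < D → ∃[ δ ] ∃[ t ] BalancedCovers k D δ t
 balanced-cover k D D>0 = choose (3 + Y) (2 * (48 * D * (48 * D))) ≤-refl (m≤m+n 3 Y) (m≤n+m Y 3)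
  where
  ℓ = 2 + k
  q = 40 * (ℓ * ℓ)
  Z = 48 * D * 2 * suc (4 * (q * q) * 16)
  Y = 3 + (8 * q + (Z + 16 * (2 * (48 * D * (48 * D)))))
  choose : ∀ M δ → 2 * (48 * D * (48 * D)) ≤ δ → 3 ≤ M → 3 + (8 * q + (Z + 16 * δ)) ≤ M → ∃[ δ ] ∃[ t ] BalancedCovers k D δ t
  choose M δ δ≥ M≥3 M≥ = 16 * δ , _ , λ adj adj-sym f f-↭ R m uR len big lower upper few →
   BalancedCover.cover adj adj-sym k f f-↭ R (≤-trans (s≤s z≤n) big) lower upper D M m₀ δ D>0 M≥3 m≡ (≤-trans (s≤s z≤n) (below 1 (m≤m+n 1 _)))
    (below (8 * q) (m≤n⇒m≤1+n (m≤m+n (8 * q) _))) (below Z (m≤n⇒m≤1+n (≤-trans (m≤m+n Z _) (m≤n+m _ (8 * q))))) δ≥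
    (≤-trans (below (16 * δ) (m≤n⇒m≤1+n (≤-trans (m≤n+m (16 * δ) Z) (m≤n+m _ (8 * q))))) (m≤n+m m₀ 2)) few m uR len big
   where
   m₀ = 8 * D * M ∸ 2
   M≤ : M ≤ 8 * D * M
   M≤ = ≡-≤-trans (sym (+-identityʳ M)) (*-monoˡ-≤ M {1} {8 * D} (*-pos {8} (s≤s z≤n) D>0))
   m≡ : 2 + m₀ ≡ 8 * D * M
   m≡ = m+[n∸m]≡n (≤-trans (≤-trans (s≤s (s≤s z≤n)) M≥3) M≤)
   below : ∀ y → y ≤ 1 + (8 * q + (Z + 16 * δ)) → y ≤ m₀
   below y h = ≤-trans h (≡-≤-trans (sym (m+n∸m≡n 2 _)) (∸-monoˡ-≤ 2 (≤-trans M≥ M≤)))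

 scale-down : ∀ D Q N d → D ≤ Q → Q * N ≤ 2 * Q * d + N → D * N ≤ 2 * D * d + N
 scale-down D Q N d D≤Q h with N ≤? 2 * d
 ... | yes le = ≤-trans (≤-≡-trans (*-monoʳ-≤ D le) (reorder D d)) (m≤m+n _ N)
  where
  reorder : ∀ D d → D * (2 * d) ≡ 2 * D * d
  reorder = solve-∀
 ... | no ¬le with m≤n⇒∃[o]m+o≡n (≰⇒≥ ¬le)
 ... | e , refl = linear 0 (+-mono-≤ h (*-monoˡ-≤ e D≤Q)) (ring D Q d e)
  where
  ring : ∀ D Q d e → D * (2 * d + e) + (2 * Q * d + (2 * d + e) + Q * e) + 0 ≡ 2 * D * d + (2 * d + e) + (Q * (2 * d + e) + D * e)
  ring = solve-∀

 module SplitArithmetic (D q Q N : ℕ) (q>0 : 0 < q) (Q>0 : 0 < Q) (N>0 : 0 < N) (Q≥ : 8 * D ≤ Q) (q≥ : 228 * D ≤ q) where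

  error-bound : ∀ e Φ → Q * e ≤ 4 * (N * N) + 6 * (Q * Φ) → q * Φ ≤ 19 * (N * N) → D * e ≤ N * N
  error-bound e Φ err≤ light = *-cancelˡ-pos (2 * (q * Q)) (*-pos {2} (s≤s z≤n) (*-pos q>0 Q>0)) (linear 0
   (+-mono-≤ (*-monoʳ-≤ (2 * (D * q)) err≤) (+-mono-≤ (*-monoʳ-≤ (12 * (D * Q)) light) (+-mono-≤ (*-monoʳ-≤ (q * (N * N)) Q≥) (*-monoʳ-≤ (Q * (N * N)) q≥)))) (ring D q Q N e Φ))
   where
   ring : ∀ D q Q N e Φ → 2 * (q * Q) * (D * e) + (2 * (D * q) * (4 * (N * N) + 6 * (Q * Φ)) + (12 * (D * Q) * (19 * (N * N)) + (q * (N * N) * Q + Q * (N * N) * q))) + 0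
    ≡ 2 * (q * Q) * (N * N) + (2 * (D * q) * (Q * e) + (12 * (D * Q) * (q * Φ) + (q * (N * N) * (8 * D) + Q * (N * N) * (228 * D))))
   ring = solve-∀

  degree-bound : ∀ dp dr c → dp + dr ≤ N + c → Q * N ≤ 2 * Q * dr + N → q * (N * c) ≤ 19 * (N * N) → 2 * D * dp ≤ D * N + N
  degree-bound dp dr c table e₀ light = *-cancelˡ-pos (2 * (q * Q) * N) (*-pos (*-pos {2} (s≤s z≤n) (*-pos q>0 Q>0)) N>0) (linear (6 * (D * q) * (N * N) + 152 * (D * Q) * (N * N))
   (+-mono-≤ (*-monoʳ-≤ (2 * (q * D * N)) (*-monoʳ-≤ (2 * Q) table)) (+-mono-≤ (*-monoʳ-≤ (2 * (q * D * N)) e₀) (+-mono-≤ (*-monoʳ-≤ (4 * (Q * D)) light) (+-mono-≤ (*-monoʳ-≤ (q * (N * N)) Q≥) (*-monoʳ-≤ (Q * (N * N)) q≥)))))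
   (ring D q Q N dp dr c))
   where
   ring : ∀ D q Q N dp dr c → 2 * (q * Q) * N * (2 * D * dp) + (2 * (q * D * N) * (2 * Q * (N + c)) + (2 * (q * D * N) * (2 * Q * dr + N) + (4 * (Q * D) * (19 * (N * N)) + (q * (N * N) * Q + Q * (N * N) * q)))) + (6 * (D * q) * (N * N) + 152 * (D * Q) * (N * N))
    ≡ 2 * (q * Q) * N * (D * N + N) + (2 * (q * D * N) * (2 * Q * (dp + dr)) + (2 * (q * D * N) * (Q * N) + (4 * (Q * D) * (q * (N * c)) + (q * (N * N) * (8 * D) + Q * (N * N) * (228 * D)))))
   ring = solve-∀

 centre-arithmetic : ∀ N x → 4 * (N * N) ≤ 25 * x → 3 * N * (N * N * N) ≤ 19 * (N * N) * x
 centre-arithmetic N x h = *-cancelˡ-pos 25 (s≤s z≤n) (linear (N * N * (N * N)) (*-monoʳ-≤ (19 * (N * N)) h) (ring N x))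
  where
  ring : ∀ N x → 25 * (3 * N * (N * N * N)) + 19 * (N * N) * (25 * x) + N * N * (N * N) ≡ 25 * (19 * (N * N) * x) + 19 * (N * N) * (4 * (N * N))
  ring = solve-∀

 DistinctNeighbours : ∀ {n} → List (Fin n) → ℕ → Relation n → Set
 DistinctNeighbours R ℓ adj = ∀ {S T} → S ∈ tuples R ℓ → T ∈ tuples R ℓ → adj S T ≡ true → uniq S ≡ true

 module Structure {n : ℕ} (R : List (Fin n)) (ℓ : ℕ) (adj : Relation n)
          (adj-sym : Symmetric adj)
          (adj-uniq : DistinctNeighbours R ℓ adj) where

  private
   Block = List (Fin n)

  Bs : List Block
  Bs = tuples R ℓ

  N : ℕ
  N = length R ^ ℓ

  deg : Block → ℕ
  deg S = ∑ Bs (λ T → ι (adj S T))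

  common : Block → Block → ℕ
  common p q = ∑ Bs (λ X → ι (adj p X ∧ adj q X))

  walks : Block → Block → ℕ
  walks S T = ∑ Bs (λ p → ∑ Bs (λ q → ι (adj S p) * ι (adj T q) * common p q))

  disagreements : (Block → Bool) → (Block → Bool) → ℕ
  disagreements a b = ∑ Bs (λ B → ∑ Bs (λ C → ι (adj B C xor not (a B xor b C))))

  -- Adjacency of S and T is, up to few exceptions, the equality of a S and b T, where b is nearly balanced.
  Splits : ℕ → Set
  Splits D = ∃[ a ] ∃[ b ] D * disagreements a b ≤ N * N × D * N ≤ 2 * D * ∑ Bs (λ B → ι (b B)) + N × 2 * D * ∑ Bs (λ B → ι (b B)) ≤ D * N + N

  ∑-N : ∀ c → ∑ Bs (λ _ → c) ≡ N * c
  ∑-N c = ∑-tuples-const R ℓ c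

  MinDegree : ℕ → Set
  MinDegree Q = ∀ {S} → S ∈ Bs → uniq S ≡ true → Q * N ≤ 2 * Q * deg S + N

  module FewWalks (Q : ℕ) (degree : MinDegree Q) (Q≥6 : 6 ≤ Q) (N>0 : 0 < N) where

   private
    Q>0 : 0 < Q
    Q>0 = ≤-trans (s≤s z≤n) Q≥6

    deg-large : ∀ {S} → S ∈ Bs → uniq S ≡ true → 2 * N ≤ 5 * deg S
    deg-large {S} S∈ u = *-cancelˡ-pos (2 * Q) (*-pos {2} (s≤s z≤n) Q>0) (linear (N) (+-mono-≤ (*-monoʳ-≤ 5 (degree S∈ u)) (*-monoʳ-≤ N Q≥6)) (ring Q N (deg S)))
     where
     ring : ∀ Q N d → 2 * Q * (2 * N) + (5 * (2 * Q * d + N) + N * Q) + N ≡ 2 * Q * (5 * d) + (5 * (Q * N) + N * 6)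
     ring = solve-∀

   module _ {S T : Block} (S∈ : S ∈ Bs) (T∈ : T ∈ Bs) (uS : uniq S ≡ true) (uT : uniq T ≡ true)
        (q : ℕ) (few : q * walks S T ≤ N * N * N) where

    private
     P = adj S
     P′ = adj T

     load : Block → Block → ℕ
     load p r = ∑ Bs (λ p′ → ι (P p′) * common p′ r) + ∑ Bs (λ r′ → ι (P′ r′) * common p r′) + N * common p r

     weight : Block × Block → ℕ
     weight (p , r) = ι (P p) * ι (P′ r)

     pairs = cartesianProduct Bs Bs

     ∑-pairs : ∀ g → ∑ pairs g ≡ ∑ Bs (λ p → ∑ Bs (λ r → g (p , r)))
     ∑-pairs g = ∑-cart _,_ Bs Bs g

     weight-total : ∑ pairs weight ≡ deg S * deg T
     weight-total = trans (∑-pairs weight) (trans (∑-cong Bs (λ p → ∑-*ˡ Bs (ι (P p)) _)) (∑-*ʳ Bs (deg T) _))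

     load-total : ∑ pairs (λ x → weight x * (q * load (proj₁ x) (proj₂ x))) ≤ 3 * N * (q * walks S T)
     load-total = begin
      ∑ pairs (λ x → weight x * (q * load (proj₁ x) (proj₂ x)))
       ≡⟨ ∑-pairs _ ⟩
      ∑ Bs (λ p → ∑ Bs (λ r → ι (P p) * ι (P′ r) * (q * load p r)))
       ≡⟨ ∑-cong Bs (λ p → trans (∑-cong Bs (λ r → expand (ι (P p)) (ι (P′ r)) q (A r) (B p) N (common p r))) (∑-+₃ _ _ _)) ⟩
      ∑ Bs (λ p → ∑ Bs (λ r → q * (ι (P p) * (ι (P′ r) * A r))) + ∑ Bs (λ r → q * (ι (P p) * B p * ι (P′ r))) + ∑ Bs (λ r → q * N * (ι (P p) * ι (P′ r) * common p r)))
       ≡⟨ ∑-+₃ _ _ _ ⟩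
      ∑ Bs (λ p → ∑ Bs (λ r → q * (ι (P p) * (ι (P′ r) * A r)))) + ∑ Bs (λ p → ∑ Bs (λ r → q * (ι (P p) * B p * ι (P′ r)))) + ∑ Bs (λ p → ∑ Bs (λ r → q * N * (ι (P p) * ι (P′ r) * common p r)))
       ≡⟨ cong₂ _+_ (cong₂ _+_ first second) third ⟩
      q * (deg S * W) + q * (W * deg T) + q * N * W
       ≤⟨ +-monoˡ-≤ (q * N * W) (+-mono-≤ (*-monoʳ-≤ q (*-monoˡ-≤ W (deg≤N S))) (*-monoʳ-≤ q (*-monoʳ-≤ W (deg≤N T)))) ⟩
      q * (N * W) + q * (W * N) + q * N * W
       ≡⟨ ring q N W ⟩
      3 * N * (q * W) ∎
      where
      open ≤-Reasoning
      W = walks S T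
      A : Block → ℕ
      A r = ∑ Bs (λ p′ → ι (P p′) * common p′ r)
      B : Block → ℕ
      B p = ∑ Bs (λ r′ → ι (P′ r′) * common p r′)
      ring : ∀ q N W → q * (N * W) + q * (W * N) + q * N * W ≡ 3 * N * (q * W)
      ring = solve-∀
      expand : ∀ a b q x y N c → a * b * (q * (x + y + N * c)) ≡ q * (a * (b * x)) + q * (a * y * b) + q * N * (a * b * c)
      expand = solve-∀
      ∑-+₃ : ∀ (f g h : Block → ℕ) → ∑ Bs (λ x → f x + g x + h x) ≡ ∑ Bs f + ∑ Bs g + ∑ Bs h
      ∑-+₃ f g h = trans (∑-+ Bs (λ x → f x + g x) h) (cong (_+ ∑ Bs h) (∑-+ Bs f g))
      deg≤N : ∀ X → deg X ≤ N
      deg≤N X = ≤-≡-trans (∑-mono Bs (λ Y → ι≤1 (adj X Y))) (trans (∑-1 Bs) (length-tuples R ℓ))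
      assoc : ∀ a b c → a * (b * c) ≡ b * a * c
      assoc = solve-∀
      W≡₁ : ∑ Bs (λ r → ι (P′ r) * A r) ≡ W
      W≡₁ = trans (∑-cong Bs (λ r → trans (sym (∑-*ˡ Bs (ι (P′ r)) _)) (∑-cong Bs (λ p → assoc (ι (P′ r)) (ι (P p)) (common p r))))) (∑-swap Bs Bs _)
      W≡₂ : ∑ Bs (λ p → ι (P p) * B p) ≡ W
      W≡₂ = ∑-cong Bs (λ p → trans (sym (∑-*ˡ Bs (ι (P p)) _)) (∑-cong Bs (λ r → sym (*-assoc (ι (P p)) _ _))))
      first : ∑ Bs (λ p → ∑ Bs (λ r → q * (ι (P p) * (ι (P′ r) * A r)))) ≡ q * (deg S * W)
      first = trans (∑-cong Bs (λ p → trans (∑-*ˡ Bs q _) (cong (q *_) (trans (∑-*ˡ Bs (ι (P p)) _) (cong (ι (P p) *_) W≡₁))))) (trans (∑-*ˡ Bs q _) (cong (q *_) (∑-*ʳ Bs W _)))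
      second : ∑ Bs (λ p → ∑ Bs (λ r → q * (ι (P p) * B p * ι (P′ r)))) ≡ q * (W * deg T)
      second = trans (∑-cong Bs (λ p → trans (∑-*ˡ Bs q _) (cong (q *_) (∑-*ˡ Bs (ι (P p) * B p) _)))) (trans (∑-*ˡ Bs q _) (cong (q *_) (trans (∑-*ʳ Bs (deg T) _) (cong (_* deg T) W≡₂))))
      third : ∑ Bs (λ p → ∑ Bs (λ r → q * N * (ι (P p) * ι (P′ r) * common p r))) ≡ q * N * W
      third = trans (∑-cong Bs (λ p → ∑-*ˡ Bs (q * N) _)) (∑-*ˡ Bs (q * N) _)

     degrees : 4 * (N * N) ≤ 25 * (deg S * deg T)
     degrees = subst₂ _≤_ (square N) (product (deg S) (deg T)) (*-mono-≤ (deg-large S∈ uS) (deg-large T∈ uT))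
      where
      square : ∀ N → 2 * N * (2 * N) ≡ 4 * (N * N)
      square = solve-∀
      product : ∀ a b → 5 * a * (5 * b) ≡ 25 * (a * b)
      product = solve-∀

     positive : 0 < deg S * deg T
     positive = *-pos (pos S∈ uS) (pos T∈ uT)
      where
      nonzero : ∀ x → 0 < 5 * x → 0 < x
      nonzero (suc x) _ = s≤s z≤n
      pos : ∀ {X} → X ∈ Bs → uniq X ≡ true → 0 < deg X
      pos {X} X∈ uX = nonzero (deg X) (≤-trans (*-pos {2} (s≤s z≤n) N>0) (deg-large X∈ uX))

     centre : ∃[ x ] x ∈ pairs × 0 < weight x × q * load (proj₁ x) (proj₂ x) ≤ 19 * (N * N)
     centre = average pairs weight (λ x → q * load (proj₁ x) (proj₂ x)) (19 * (N * N)) (subst (0 <_) (sym weight-total) positive)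
      (≤-trans load-total (≤-trans (*-monoʳ-≤ (3 * N) few) (subst (λ z → 3 * N * (N * N * N) ≤ 19 * (N * N) * z) (sym weight-total)
       (centre-arithmetic N (deg S * deg T) degrees))))

    splits : ∀ D → 0 < D → 8 * D ≤ Q → 228 * D ≤ q → Splits D
    splits D D>0 Q≥ q≥ = build (proj₁ (proj₁ centre)) (proj₂ (proj₁ centre)) (proj₁ (proj₂ centre)) (proj₁ (proj₂ (proj₂ centre))) (proj₂ (proj₂ (proj₂ centre)))
     where
     build : ∀ p₀ r₀ → (p₀ , r₀) ∈ pairs → 0 < weight (p₀ , r₀) → q * load p₀ r₀ ≤ 19 * (N * N) → Splits D
     build p₀ r₀ x∈ w>0 light = P , adj p₀ , err-bound , scale-down D Q N (deg p₀) (≤-trans (m≤m+n D _) Q≥) (degree p₀∈ u-p₀) , upper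
      where
      open ≤-Reasoning
      p₀∈ : p₀ ∈ Bs
      p₀∈ = proj₁ (∈-cartesianProduct⁻ Bs Bs x∈)
      r₀∈ : r₀ ∈ Bs
      r₀∈ = proj₂ (∈-cartesianProduct⁻ Bs Bs x∈)
      both : P p₀ ≡ true × P′ r₀ ≡ true
      both = split (P p₀) (P′ r₀) w>0
       where
       split : ∀ a b → 0 < ι a * ι b → a ≡ true × b ≡ true
       split true true _ = refl , refl
      u-p₀ : uniq p₀ ≡ true
      u-p₀ = adj-uniq p₀∈ S∈ (trans (adj-sym p₀ S) (proj₁ both))
      u-r₀ : uniq r₀ ≡ true
      u-r₀ = adj-uniq r₀∈ T∈ (trans (adj-sym r₀ T) (proj₂ both))
      Φ = load p₀ r₀
      c₀ = common p₀ r₀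
      U₁ = ∑ Bs (λ p′ → ι (P p′) * common p′ r₀)
      U₂ = ∑ Bs (λ r′ → ι (P′ r′) * common p₀ r′)
      d₀ = degree p₀∈ u-p₀
      e₀ = degree r₀∈ u-r₀
      e₁ e₂ : Block → ℕ
      e₁ B = ∑ Bs (λ C → ι (adj B C xor adj p₀ C))
      e₂ B = ∑ Bs (λ C → ι (adj B C xor not (adj p₀ C)))
      on-P : ∀ {B} → B ∈ Bs → P B ≡ true → Q * e₁ B ≤ 2 * N + 2 * Q * (common B r₀ + c₀)
      on-P {B} B∈ PB = *-cancelˡ-pos 2 (s≤s z≤n) (linear 0 (+-mono-≤ (*-monoʳ-≤ (2 * Q) table) (+-mono-≤ (degree B∈ uB) (+-mono-≤ d₀ (*-monoʳ-≤ 2 e₀)))) (ring Q N (e₁ B) (deg B) (deg p₀) (deg r₀) (common B r₀) c₀))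
       where
       uB = adj-uniq B∈ S∈ (trans (adj-sym B S) PB)
       table : e₁ B + deg B + deg p₀ + 2 * deg r₀ ≤ 2 * N + 2 * common B r₀ + 2 * c₀
       table = subst₂ _≤_ (trans (∑-+ Bs _ _) (cong₂ _+_ (trans (∑-+ Bs _ _) (cong (_+ deg p₀) (∑-+ Bs _ _))) (∑-*ˡ Bs 2 _)))
        (trans (∑-+ Bs _ _) (cong₂ _+_ (trans (∑-+ Bs _ _) (cong₂ _+_ (trans (∑-N 2) (*-comm N 2)) (∑-*ˡ Bs 2 _))) (∑-*ˡ Bs 2 _)))
        (∑-mono Bs (λ C → truth-table 3 (λ x y w → ι (x xor y) + ι x + ι y + 2 * ι w) (λ x y w → 2 + 2 * ι (x ∧ w) + 2 * ι (y ∧ w)) tt (adj B C) (adj p₀ C) (adj r₀ C)))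
       ring : ∀ Q N e dB dp dr c c₀ → 2 * (Q * e) + (2 * Q * (2 * N + 2 * c + 2 * c₀) + (2 * Q * dB + N + (2 * Q * dp + N + 2 * (2 * Q * dr + N)))) + 0
        ≡ 2 * (2 * N + 2 * Q * (c + c₀)) + (2 * Q * (e + dB + dp + 2 * dr) + (Q * N + (Q * N + 2 * (Q * N))))
       ring = solve-∀
      on-P′ : ∀ {B} → B ∈ Bs → P′ B ≡ true → Q * e₂ B ≤ N + 2 * Q * common p₀ B
      on-P′ {B} B∈ P′B = *-cancelˡ-pos 2 (s≤s z≤n) (linear 0 (+-mono-≤ (*-monoʳ-≤ (2 * Q) table) (+-mono-≤ (degree B∈ uB) d₀)) (ring Q N (e₂ B) (deg B) (deg p₀) (common p₀ B)))
       where
       uB = adj-uniq B∈ T∈ (trans (adj-sym B T) P′B)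
       table : e₂ B + deg B + deg p₀ ≤ N + 2 * common p₀ B
       table = subst₂ _≤_ (trans (∑-+ Bs _ _) (cong (_+ deg p₀) (∑-+ Bs _ _))) (trans (∑-+ Bs _ _) (cong₂ _+_ (trans (∑-N 1) (*-identityʳ N)) (∑-*ˡ Bs 2 _)))
        (∑-mono Bs (λ C → truth-table 2 (λ x y → ι (x xor not y) + ι x + ι y) (λ x y → 1 + 2 * ι (y ∧ x)) tt (adj B C) (adj p₀ C)))
       ring : ∀ Q N e dB dp c → 2 * (Q * e) + (2 * Q * (N + 2 * c) + (2 * Q * dB + N + (2 * Q * dp + N))) + 0 ≡ 2 * (N + 2 * Q * c) + (2 * Q * (e + dB + dp) + (Q * N + Q * N))
       ring = solve-∀
      shared : ∀ {B} → B ∈ Bs → P B ≡ true → P′ B ≡ true → N ≤ 4 * (common B r₀ + common p₀ B + c₀)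
      shared {B} B∈ PB P′B = *-cancelˡ-pos Q Q>0 (linear 0 (+-mono-≤ (*-monoʳ-≤ 4 (*-monoʳ-≤ Q table)) (+-mono-≤ (*-monoʳ-≤ 2 (degree B∈ uB)) (+-mono-≤ (*-monoʳ-≤ 2 d₀) (+-mono-≤ (*-monoʳ-≤ 2 e₀) (*-monoʳ-≤ N Q≥6)))))
        (ring Q N (deg B) (deg p₀) (deg r₀) (common B r₀) (common p₀ B) c₀))
       where
       uB = adj-uniq B∈ S∈ (trans (adj-sym B S) PB)
       table : deg B + deg p₀ + deg r₀ ≤ N + (common B r₀ + common p₀ B + c₀)
       table = subst₂ _≤_ (trans (∑-+ Bs _ _) (cong (_+ deg r₀) (∑-+ Bs _ _))) (trans (∑-+ Bs _ _) (cong₂ _+_ (trans (∑-N 1) (*-identityʳ N)) (trans (∑-+ Bs _ _) (cong (_+ c₀) (∑-+ Bs _ _)))))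
        (∑-mono Bs (λ C → truth-table 3 (λ x y w → ι x + ι y + ι w) (λ x y w → 1 + (ι (x ∧ w) + ι (y ∧ x) + ι (y ∧ w))) tt (adj B C) (adj p₀ C) (adj r₀ C)))
       ring : ∀ Q N dB dp dr c c′ c₀ → Q * N + (4 * (Q * (N + (c + c′ + c₀))) + (2 * (2 * Q * dB + N) + (2 * (2 * Q * dp + N) + (2 * (2 * Q * dr + N) + N * Q)))) + 0
        ≡ Q * (4 * (c + c′ + c₀)) + (4 * (Q * (dB + dp + dr)) + (2 * (Q * N) + (2 * (Q * N) + (2 * (Q * N) + N * 6))))
       ring = solve-∀
      both-P = ∑ Bs (λ B → ι (P B ∧ P′ B))
      neither = ∑ Bs (λ B → ι (not (P B) ∧ not (P′ B)))
      few-both : N * both-P ≤ 4 * Φ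
      few-both = begin
       N * both-P
        ≡⟨ ∑-*ˡ Bs N _ ⟨
       ∑ Bs (λ B → N * ι (P B ∧ P′ B))
        ≤⟨ ∑-mono∈ Bs pointwise ⟩
       ∑ Bs (λ B → 4 * (ι (P B) * common B r₀ + ι (P′ B) * common p₀ B + c₀))
        ≡⟨ trans (∑-*ˡ Bs 4 _) (cong (4 *_) (trans (∑-+ Bs _ _) (cong₂ _+_ (∑-+ Bs _ _) (∑-N c₀)))) ⟩
       4 * Φ ∎
       where
       pointwise : ∀ {B} → B ∈ Bs → N * ι (P B ∧ P′ B) ≤ 4 * (ι (P B) * common B r₀ + ι (P′ B) * common p₀ B + c₀)
       pointwise {B} B∈ with P B in PB | P′ B in P′B
       ... | true | true = ≡-≤-trans (*-identityʳ N) (≤-≡-trans (shared B∈ PB P′B) (cong₂ (λ u v → 4 * (u + v + c₀)) (sym (+-identityʳ (common B r₀))) (sym (+-identityʳ (common p₀ B)))))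
       ... | true | false = ≡-≤-trans (*-zeroʳ N) z≤n
       ... | false | _ = ≡-≤-trans (*-zeroʳ N) z≤n
      few-neither : Q * (N * neither) ≤ N * N + 4 * (Q * Φ)
      few-neither = *-cancelˡ-pos 2 (s≤s z≤n) (linear 0 (+-mono-≤ (*-monoʳ-≤ (2 * Q * N) cover) (+-mono-≤ (*-monoʳ-≤ N (degree S∈ uS)) (+-mono-≤ (*-monoʳ-≤ N (degree T∈ uT)) (*-monoʳ-≤ (2 * Q) few-both)))) (ring Q N neither both-P (deg S) (deg T) Φ))
       where
       cover : neither + deg S + deg T ≤ N + both-P
       cover = subst₂ _≤_ (trans (∑-+ Bs _ _) (cong (_+ deg T) (∑-+ Bs _ _))) (trans (∑-+ Bs _ _) (cong (_+ both-P) (trans (∑-N 1) (*-identityʳ N))))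
        (∑-mono Bs (λ B → truth-table 2 (λ x y → ι (not x ∧ not y) + ι x + ι y) (λ x y → 1 + ι (x ∧ y)) tt (P B) (P′ B)))
       ring : ∀ Q N o b s t Φ → 2 * (Q * (N * o)) + (2 * Q * N * (N + b) + (N * (2 * Q * s + N) + (N * (2 * Q * t + N) + 2 * Q * (4 * Φ)))) + 0
        ≡ 2 * (N * N + 4 * (Q * Φ)) + (2 * Q * N * (o + s + t) + (N * (Q * N) + (N * (Q * N) + 2 * Q * (N * b))))
       ring = solve-∀
      err = disagreements P (adj p₀)
      err≤ : Q * err ≤ 4 * (N * N) + 6 * (Q * Φ)
      err≤ = begin
       Q * err
        ≡⟨ ∑-*ˡ Bs Q _ ⟨
       ∑ Bs (λ B → Q * ∑ Bs (λ C → ι (adj B C xor not (P B xor adj p₀ C))))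
        ≤⟨ ∑-mono∈ Bs pointwise ⟩
       ∑ Bs (λ B → 3 * N + (2 * Q * (ι (P B) * common B r₀ + ι (P′ B) * common p₀ B + c₀) + Q * (N * ι (not (P B) ∧ not (P′ B)))))
        ≡⟨ trans (∑-+ Bs _ _) (cong₂ _+_ (∑-N (3 * N)) (trans (∑-+ Bs _ _) (cong₂ _+_ (trans (∑-*ˡ Bs (2 * Q) _) (cong (2 * Q *_) (trans (∑-+ Bs _ _) (cong₂ _+_ (∑-+ Bs _ _) (∑-N c₀)))))
           (trans (∑-*ˡ Bs Q _) (cong (Q *_) (∑-*ˡ Bs N _)))))) ⟩
       N * (3 * N) + (2 * Q * Φ + Q * (N * neither))
        ≤⟨ +-monoʳ-≤ (N * (3 * N)) (+-monoʳ-≤ (2 * Q * Φ) few-neither) ⟩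
       N * (3 * N) + (2 * Q * Φ + (N * N + 4 * (Q * Φ)))
        ≡⟨ ring N Q Φ ⟩
       4 * (N * N) + 6 * (Q * Φ) ∎
       where
       ring : ∀ N Q Φ → N * (3 * N) + (2 * Q * Φ + (N * N + 4 * (Q * Φ))) ≡ 4 * (N * N) + 6 * (Q * Φ)
       ring = solve-∀
       pointwise : ∀ {B} → B ∈ Bs → Q * ∑ Bs (λ C → ι (adj B C xor not (P B xor adj p₀ C))) ≤
             3 * N + (2 * Q * (ι (P B) * common B r₀ + ι (P′ B) * common p₀ B + c₀) + Q * (N * ι (not (P B) ∧ not (P′ B))))
       pointwise {B} B∈ with P B in PB
       ... | true = begin
        Q * ∑ Bs (λ C → ι (adj B C xor not (not (adj p₀ C))))
         ≡⟨ cong (Q *_) (∑-cong Bs (λ C → cong (λ b → ι (adj B C xor b)) (Boolₚ.not-involutive (adj p₀ C)))) ⟩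
        Q * e₁ B
         ≤⟨ on-P B∈ PB ⟩
        2 * N + 2 * Q * (common B r₀ + c₀)
         ≤⟨ ≤-≡-trans (m≤m+n _ (N + 2 * Q * (ι (P′ B) * common p₀ B) + Q * (N * 0))) (regroup N Q (common B r₀) c₀ (ι (P′ B) * common p₀ B)) ⟩
        3 * N + (2 * Q * (1 * common B r₀ + ι (P′ B) * common p₀ B + c₀) + Q * (N * 0)) ∎
        where
        regroup : ∀ N Q c c₀ y → 2 * N + 2 * Q * (c + c₀) + (N + 2 * Q * y + Q * (N * 0)) ≡ 3 * N + (2 * Q * (1 * c + y + c₀) + Q * (N * 0))
        regroup = solve-∀
       ... | false with P′ B in P′B
       ... | true = begin
        Q * e₂ B
         ≤⟨ on-P′ B∈ P′B ⟩
        N + 2 * Q * common p₀ B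
         ≤⟨ ≤-≡-trans (m≤m+n _ (2 * N + 2 * Q * c₀ + Q * (N * 0))) (regroup N Q (common p₀ B) c₀ (common B r₀)) ⟩
        3 * N + (2 * Q * (0 * common B r₀ + 1 * common p₀ B + c₀) + Q * (N * 0)) ∎
        where
        regroup : ∀ N Q c c₀ y → N + 2 * Q * c + (2 * N + 2 * Q * c₀ + Q * (N * 0)) ≡ 3 * N + (2 * Q * (0 * y + 1 * c + c₀) + Q * (N * 0))
        regroup = solve-∀
       ... | false = begin
        Q * e₂ B
         ≤⟨ *-monoʳ-≤ Q (≤-≡-trans (∑-mono Bs (λ C → ι≤1 (adj B C xor not (adj p₀ C)))) (∑-N 1)) ⟩
        Q * (N * 1)
         ≤⟨ ≤-trans (m≤n+m _ (2 * Q * c₀)) (m≤n+m _ (3 * N)) ⟩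
        3 * N + (2 * Q * (0 * common B r₀ + 0 * common p₀ B + c₀) + Q * (N * 1)) ∎
      q>0 : 0 < q
      q>0 = ≤-trans (*-pos {228} (s≤s z≤n) D>0) q≥
      err-bound : D * err ≤ N * N
      err-bound = SplitArithmetic.error-bound D q Q N q>0 Q>0 N>0 Q≥ q≥ err Φ err≤ light
      upper : 2 * D * deg p₀ ≤ D * N + N
      upper = SplitArithmetic.degree-bound D q Q N q>0 Q>0 N>0 Q≥ q≥ (deg p₀) (deg r₀) c₀ table e₀ light′
       where
       table : deg p₀ + deg r₀ ≤ N + c₀
       table = subst₂ _≤_ (∑-+ Bs _ _) (trans (∑-+ Bs _ _) (cong (_+ c₀) (trans (∑-N 1) (*-identityʳ N))))
        (∑-mono Bs (λ C → truth-table 2 (λ x y → ι x + ι y) (λ x y → 1 + ι (x ∧ y)) tt (adj p₀ C) (adj r₀ C)))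
       light′ : q * (N * c₀) ≤ 19 * (N * N)
       light′ = ≤-trans (*-monoʳ-≤ q (m≤n+m (N * c₀) (U₁ + U₂))) light

 module ExpansionArithmetic (q N : ℕ) (q>0 : 0 < q) where

  edges-bound : ∀ dS dT e → q * (2 * (N * dS) + 2 * (N * dT) + e) ≤ suc (2 * q) * (N * N) → q * N ≤ 2 * q * dS + N → q * N ≤ 2 * q * dT + N →
         q * e ≤ 3 * (N * N)
  edges-bound dS dT e h h₁ h₂ = linear 0 (+-mono-≤ h (+-mono-≤ (*-monoʳ-≤ N h₁) (*-monoʳ-≤ N h₂))) (ring q N dS dT e)
   where
   ring : ∀ q N dS dT e → q * e + (suc (2 * q) * (N * N) + (N * (2 * q * dS + N) + N * (2 * q * dT + N))) + 0
        ≡ 3 * (N * N) + (q * (2 * (N * dS) + 2 * (N * dT) + e) + (N * (q * N) + N * (q * N)))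
   ring = solve-∀

  degree-bound : 0 < N → ∀ dS dT e → q * (2 * (N * dS) + 2 * (N * dT) + e) ≤ suc (2 * q) * (N * N) → q * N ≤ 2 * q * dT + N → 2 * q * dS ≤ (q + 2) * N
  degree-bound N>0 dS dT e h h₂ = *-cancelˡ-pos N N>0 (linear (q * e) (+-mono-≤ h (*-monoʳ-≤ N h₂)) (ring q N dS dT e))
   where
   ring : ∀ q N dS dT e → N * (2 * q * dS) + (suc (2 * q) * (N * N) + N * (2 * q * dT + N)) + q * e ≡ N * ((q + 2) * N) + (q * (2 * (N * dS) + 2 * (N * dT) + e) + N * (q * N))
   ring = solve-∀

  outside-bound : 0 < N → ∀ dS dT e o t → q * (2 * (N * dS) + 2 * (N * dT) + e) ≤ suc (2 * q) * (N * N) → o + N ≤ dS + dT + t → 2 * q * o ≤ N + 2 * q * t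
  outside-bound N>0 dS dT e o t h h₁ = *-cancelˡ-pos N N>0 (linear (q * e) (+-mono-≤ h (*-monoʳ-≤ (2 * (q * N)) h₁)) (ring q N dS dT e o t))
   where
   ring : ∀ q N dS dT e o t → N * (2 * q * o) + (suc (2 * q) * (N * N) + 2 * (q * N) * (dS + dT + t)) + q * e ≡ N * (N + 2 * q * t) + (q * (2 * (N * dS) + 2 * (N * dT) + e) + 2 * (q * N) * (o + N))
   ring = solve-∀

  row-bound : ∀ dS da row x → row + da ≤ dS + x → 2 * q * dS ≤ (q + 2) * N → q * N ≤ 2 * q * da + N → 2 * q * row ≤ 3 * N + 2 * q * x
  row-bound dS da row x h h₁ h₂ = linear 0 (+-mono-≤ (*-monoʳ-≤ (2 * q) h) (+-mono-≤ h₁ h₂)) (ring q N dS da row x)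
   where
   ring : ∀ q N dS da row x → 2 * q * row + (2 * q * (dS + x) + ((q + 2) * N + (2 * q * da + N))) + 0 ≡ 3 * N + 2 * q * x + (2 * q * (row + da) + (2 * q * dS + q * N))
   ring = solve-∀

  gap-bound : ∀ e ν E → q * e ≤ 3 * (N * N) → q * ν ≤ N → 2 * q * E ≤ N * (3 * N) + (2 * q * e + 2 * q * (N * ν)) → 2 * q * E ≤ 11 * (N * N)
  gap-bound e ν E h₁ h₂ h = linear 0 (+-mono-≤ h (+-mono-≤ (*-monoʳ-≤ 2 h₁) (*-monoʳ-≤ (2 * N) h₂))) (ring q N e ν E)
   where
   ring : ∀ q N e ν E → 2 * q * E + (N * (3 * N) + (2 * q * e + 2 * q * (N * ν)) + (2 * (3 * (N * N)) + 2 * N * N)) + 0 ≡ 11 * (N * N) + (2 * q * E + (2 * (q * e) + 2 * N * (q * ν)))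
   ring = solve-∀

  split-bound : ∀ D e E E′ o t x → 36 * D ≤ q → 6 * D * t ≤ N → q * e ≤ 3 * (N * N) → 2 * q * E ≤ 11 * (N * N) → 2 * q * E′ ≤ 11 * (N * N) → 2 * q * o ≤ N + 2 * q * t →
         x ≤ e + E + e + E′ + N * o + N * t + N * o → D * x ≤ N * N
  split-bound D e E E′ o t x q≥ t≤ he hE hE′ ho h = *-cancelˡ-pos (2 * q) (*-pos {2} (s≤s z≤n) q>0) (linear 0
   (+-mono-≤ (*-monoʳ-≤ (2 * (q * D)) h) (+-mono-≤ (*-monoʳ-≤ (4 * D) he) (+-mono-≤ (*-monoʳ-≤ D hE) (+-mono-≤ (*-monoʳ-≤ D hE′) (+-mono-≤ (*-monoʳ-≤ (2 * (D * N)) ho) (+-mono-≤ (*-monoʳ-≤ (q * N) t≤) (*-monoʳ-≤ (N * N) q≥)))))))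
   (ring q N D e E E′ o t x))
   where
   ring : ∀ q N D e E E′ o t x → 2 * q * (D * x) + (2 * (q * D) * (e + E + e + E′ + N * o + N * t + N * o) + (4 * D * (3 * (N * N)) + (D * (11 * (N * N)) + (D * (11 * (N * N)) + (2 * (D * N) * (N + 2 * q * t) + (q * N * N + N * N * q)))))) + 0
    ≡ 2 * q * (N * N) + (2 * (q * D) * x + (4 * D * (q * e) + (D * (2 * q * E) + (D * (2 * q * E′) + (2 * (D * N) * (2 * q * o) + (q * N * (6 * D * t) + N * N * (36 * D)))))))
   ring = solve-∀

  scale-up : ∀ D dS → 2 * D ≤ q → 2 * q * dS ≤ (q + 2) * N → 2 * D * dS ≤ D * N + N
  scale-up D dS q≥ h = *-cancelˡ-pos q q>0 (linear 0 (+-mono-≤ (*-monoʳ-≤ D h) (*-monoʳ-≤ N q≥)) (ring q N D dS))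
   where
   ring : ∀ q N D d → q * (2 * D * d) + (D * ((q + 2) * N) + N * q) + 0 ≡ q * (D * N + N) + (D * (2 * q * d) + N * (2 * D))
   ring = solve-∀

  bipartite-bound : ∀ D δ e E E′ t y x → δ * (11 + 102 * D) ≤ 2 * q → N ≤ 6 * D * t → q * e ≤ 3 * (N * N) → 2 * q * E ≤ 11 * (N * N) → 2 * q * E′ ≤ 11 * (N * N) →
           t * y ≤ e + E′ → x ≤ E + N * y → δ * x ≤ N * N
  bipartite-bound D δ e E E′ t y x δ≤ t≥ he hE hE′ hy h = *-cancelˡ-pos (2 * q) (*-pos {2} (s≤s z≤n) q>0) (linear 0
   (+-mono-≤ (*-monoʳ-≤ (2 * (q * δ)) h) (+-mono-≤ (*-monoʳ-≤ δ hE) (+-mono-≤ (*-monoʳ-≤ (2 * (q * δ) * y) t≥) (+-mono-≤ (*-monoʳ-≤ (12 * (q * (δ * D))) hy)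
    (+-mono-≤ (*-monoʳ-≤ (12 * (δ * D)) he) (+-mono-≤ (*-monoʳ-≤ (6 * (δ * D)) hE′) (*-monoʳ-≤ (N * N) δ≤)))))))
   (ring q N D δ e E E′ t y x))
   where
   ring : ∀ q N D δ e E E′ t y x → 2 * q * (δ * x) + (2 * (q * δ) * (E + N * y) + (δ * (11 * (N * N)) + (2 * (q * δ) * y * (6 * D * t) + (12 * (q * (δ * D)) * (e + E′) + (12 * (δ * D) * (3 * (N * N)) + (6 * (δ * D) * (11 * (N * N)) + N * N * (2 * q))))))) + 0
    ≡ 2 * q * (N * N) + (2 * (q * δ) * x + (δ * (2 * q * E) + (2 * (q * δ) * y * N + (12 * (q * (δ * D)) * (t * y) + (12 * (δ * D) * (q * e) + (6 * (δ * D) * (2 * q * E′) + N * N * (δ * (11 + 102 * D))))))))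
   ring = solve-∀

 module Dichotomy {n : ℕ} (R : List (Fin n)) (ℓ : ℕ) (adj : Relation n)
          (adj-sym : Symmetric adj)
          (adj-uniq : DistinctNeighbours R ℓ adj) where

  open Structure R ℓ adj adj-sym adj-uniq
  open Matching (_≟ᴮ_ {n}) adj using (gain)

  private Block = List (Fin n)

  NearlyBipartite : ℕ → ℕ → Block → Set
  NearlyBipartite κ δ S = κ * N ≤ 2 * κ * deg S + N × 2 * κ * deg S ≤ κ * N + N ×
   δ * ∑ Bs (λ B → ∑ Bs (λ C → ι (not (adj S B) ∧ adj S C ∧ not (adj B C)))) ≤ N * N

  module _ (q : ℕ) (q>0 : 0 < q) (N>0 : 0 < N) (degree : MinDegree q)
       (degenerate : q * ∑ Bs (λ B → ι (not (uniq B))) ≤ N)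
       {S T : Block} (S∈ : S ∈ Bs) (T∈ : T ∈ Bs) (uS : uniq S ≡ true) (uT : uniq T ≡ true)
       (narrow : q * ∑ Bs (λ a → ∑ Bs (λ b → gain S T (a , b))) ≤ suc (2 * q) * (N * N)) where

   private
    open ExpansionArithmetic q N q>0
    dS = deg S
    dT = deg T
    ν = ∑ Bs (λ B → ι (not (uniq B)))

    ∑₂ : (Block → Block → ℕ) → ℕ
    ∑₂ g = ∑ Bs (λ B → ∑ Bs (g B))

    ∑₂-+ : ∀ g h → ∑₂ (λ B C → g B C + h B C) ≡ ∑₂ g + ∑₂ h
    ∑₂-+ g h = trans (∑-cong Bs (λ B → ∑-+ Bs (g B) (h B))) (∑-+ Bs _ _)

    ∑₂-mono : ∀ {g h} → (∀ B C → g B C ≤ h B C) → ∑₂ g ≤ ∑₂ h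
    ∑₂-mono h = ∑-mono Bs (λ B → ∑-mono Bs (h B))

    ∑₂-first : ∀ (g : Block → ℕ) → ∑₂ (λ B C → g B) ≡ N * ∑ Bs g
    ∑₂-first g = trans (∑-cong Bs (λ B → ∑-N (g B))) (∑-*ˡ Bs N g)

    ∑₂-second : ∀ (g : Block → ℕ) → ∑₂ (λ B C → g C) ≡ N * ∑ Bs g
    ∑₂-second g = ∑-N (∑ Bs g)

    e = ∑₂ (λ a b → ι (adj a b ∧ not (adj S b) ∧ not (adj T a)))
    e′ = ∑₂ (λ a b → ι (adj a b ∧ not (adj S a) ∧ not (adj T b)))
    E = ∑₂ (λ a b → ι (not (adj T a) ∧ adj S b ∧ not (adj a b)))
    E′ = ∑₂ (λ a b → ι (not (adj S a) ∧ adj T b ∧ not (adj a b)))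
    t = ∑ Bs (λ B → ι (not (adj S B) ∧ not (adj T B)))
    o = ∑ Bs (λ B → ι (adj S B ∧ adj T B))
    y = ∑ Bs (λ B → ι (not (adj S B) ∧ adj T B))

    e′≡e : e′ ≡ e
    e′≡e = trans (∑-swap Bs Bs _) (∑-cong Bs (λ a → ∑-cong Bs (λ b → cong (λ w → ι (w ∧ not (adj S b) ∧ not (adj T a))) (adj-sym b a))))

    total : ∑ Bs (λ a → ∑ Bs (λ b → gain S T (a , b))) ≡ 2 * (N * dS) + 2 * (N * dT) + e
    total = trans (∑-cong Bs (λ a → ∑-cong Bs (λ b → cong (λ w → 2 * ι (adj S b) + 2 * ι w + ι (adj a b ∧ not (adj S b) ∧ not w)) (adj-sym a T))))
     (trans (∑₂-+ (λ a b → 2 * ι (adj S b) + 2 * ι (adj T a)) (λ a b → ι (adj a b ∧ not (adj S b) ∧ not (adj T a)))) (cong (_+ e)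
     (trans (∑₂-+ (λ a b → 2 * ι (adj S b)) (λ a b → 2 * ι (adj T a))) (cong₂ _+_
      (trans (∑₂-second (λ b → 2 * ι (adj S b))) (trans (cong (N *_) (∑-*ˡ Bs 2 _)) (reorder N dS)))
      (trans (∑₂-first (λ a → 2 * ι (adj T a))) (trans (cong (N *_) (∑-*ˡ Bs 2 _)) (reorder N dT)))))))
     where
     reorder : ∀ N d → N * (2 * d) ≡ 2 * (N * d)
     reorder = solve-∀

    narrow′ : q * (2 * (N * dS) + 2 * (N * dT) + e) ≤ suc (2 * q) * (N * N)
    narrow′ = subst (λ z → q * z ≤ suc (2 * q) * (N * N)) total narrow

    narrow″ : q * (2 * (N * dT) + 2 * (N * dS) + e) ≤ suc (2 * q) * (N * N)
    narrow″ = subst (λ z → q * (z + e) ≤ suc (2 * q) * (N * N)) (+-comm (2 * (N * dS)) _) narrow′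

    he : q * e ≤ 3 * (N * N)
    he = edges-bound dS dT e narrow′ (degree S∈ uS) (degree T∈ uT)

    hdS : 2 * q * dS ≤ (q + 2) * N
    hdS = degree-bound N>0 dS dT e narrow′ (degree T∈ uT)

    hdT : 2 * q * dT ≤ (q + 2) * N
    hdT = degree-bound N>0 dT dS e narrow″ (degree S∈ uS)

    gap : ∀ P T′ → P ∈ Bs → 2 * q * deg P ≤ (q + 2) * N → (e₀ : ℕ) → q * e₀ ≤ 3 * (N * N) →
       ∑₂ (λ a b → ι (adj a b ∧ not (adj P b) ∧ not (adj T′ a))) ≡ e₀ →
       2 * q * ∑₂ (λ a b → ι (not (adj T′ a) ∧ adj P b ∧ not (adj a b))) ≤ 11 * (N * N)
    gap P T′ P∈ hd e₀ he₀ e₀≡ = gap-bound e₀ ν _ he₀ degenerate (begin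
     2 * q * ∑₂ (λ a b → ι (not (adj T′ a) ∧ adj P b ∧ not (adj a b)))
      ≡⟨ ∑-*ˡ Bs (2 * q) _ ⟨
     ∑ Bs (λ a → 2 * q * ∑ Bs (λ b → ι (not (adj T′ a) ∧ adj P b ∧ not (adj a b))))
      ≤⟨ ∑-mono∈ Bs pointwise ⟩
     ∑ Bs (λ a → 3 * N + (2 * q * ∑ Bs (λ b → ι (adj a b ∧ not (adj P b) ∧ not (adj T′ a))) + 2 * q * (N * ι (not (uniq a)))))
      ≡⟨ trans (∑-+ Bs _ _) (cong₂ _+_ (∑-N (3 * N)) (trans (∑-+ Bs _ _) (cong₂ _+_ (trans (∑-*ˡ Bs (2 * q) _) (cong (2 * q *_) e₀≡)) (trans (∑-*ˡ Bs (2 * q) _) (cong (2 * q *_) (∑-*ˡ Bs N _)))))) ⟩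
     N * (3 * N) + (2 * q * e₀ + 2 * q * (N * ν)) ∎)
     where
     open ≤-Reasoning
     row : Block → ℕ
     row a = ∑ Bs (λ b → ι (not (adj T′ a) ∧ adj P b ∧ not (adj a b)))
     extra : Block → ℕ
     extra a = ∑ Bs (λ b → ι (adj a b ∧ not (adj P b) ∧ not (adj T′ a)))
     pointwise : ∀ {a} → a ∈ Bs → 2 * q * row a ≤ 3 * N + (2 * q * extra a + 2 * q * (N * ι (not (uniq a))))
     pointwise {a} a∈ = cases (adj T′ a) refl (uniq a) refl
      where
      cases : ∀ x → adj T′ a ≡ x → ∀ u → uniq a ≡ u → 2 * q * row a ≤ 3 * N + (2 * q * extra a + 2 * q * (N * ι (not (uniq a))))
      cases true x u e = ≡-≤-trans (trans (cong (2 * q *_) (trans (∑-cong Bs (λ b → cong (λ z → ι (not z ∧ adj P b ∧ not (adj a b))) x)) (∑-0 Bs))) (*-zeroʳ (2 * q))) z≤n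
      cases false x true e = ≤-trans (row-bound (deg P) (deg a) (row a) (extra a) (subst₂ _≤_
        (trans (∑-+ Bs _ _) (cong (_+ deg a) (∑-cong Bs (λ b → cong (λ z → ι (not z ∧ adj P b ∧ not (adj a b))) (sym x)))))
        (trans (∑-+ Bs _ _) (cong (deg P +_) (∑-cong Bs (λ b → cong (λ z → ι (adj a b ∧ not (adj P b) ∧ not z)) (sym x)))))
        (∑-mono Bs (λ b → truth-table 2 (λ s w → ι (s ∧ not w) + ι w) (λ s w → ι s + ι (w ∧ not s ∧ true)) tt (adj P b) (adj a b)))) hd (degree a∈ e))
       (+-monoʳ-≤ (3 * N) (m≤m+n _ _))
      cases false x false e = ≤-trans (*-monoʳ-≤ (2 * q) (≤-≡-trans (∑-mono Bs (λ b → ι≤1 (not (adj T′ a) ∧ adj P b ∧ not (adj a b)))) (trans (∑-N 1) (cong (λ z → N * ι (not z)) (sym e)))))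
       (≤-trans (m≤n+m _ (2 * q * extra a)) (m≤n+m _ (3 * N)))

    hE : 2 * q * E ≤ 11 * (N * N)
    hE = gap S T S∈ hdS e he refl

    hE′ : 2 * q * E′ ≤ 11 * (N * N)
    hE′ = gap T S T∈ hdT e he (trans (∑-cong Bs (λ a → ∑-cong Bs (λ b → cong (λ z → ι (adj a b ∧ z)) (Boolₚ.∧-comm (not (adj T b)) (not (adj S a)))))) e′≡e)

    ho : 2 * q * o ≤ N + 2 * q * t
    ho = outside-bound N>0 dS dT e o t narrow′ (subst₂ _≤_ (trans (∑-+ Bs _ _) (cong (o +_) (trans (∑-N 1) (*-identityʳ N))))
     (trans (∑-+ Bs _ _) (cong (_+ t) (∑-+ Bs _ _))) (∑-mono Bs (λ B → truth-table 2 (λ x z → ι (x ∧ z) + 1) (λ x z → ι x + ι z + ι (not x ∧ not z)) tt (adj S B) (adj T B))))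

    disagree : disagreements (not ∘ adj T) (adj S) ≤ e + E + e + E′ + N * o + N * t + N * o
    disagree = begin
     disagreements (not ∘ adj T) (adj S)
      ≤⟨ ∑₂-mono (λ B C → truth-table 5
         (λ s τ s′ τ′ w → ι (w xor not (not τ xor s′)))
         (λ s τ s′ τ′ w → ι (w ∧ not s′ ∧ not τ) + ι (not τ ∧ s′ ∧ not w) + ι (w ∧ not s ∧ not τ′) + ι (not s ∧ τ′ ∧ not w) + ι (s ∧ τ) + ι (not s′ ∧ not τ′) + ι (s′ ∧ τ′)) tt
         (adj S B) (adj T B) (adj S C) (adj T C) (adj B C)) ⟩
     ∑₂ (λ B C → f₁ B C + f₂ B C + f₃ B C + f₄ B C + f₅ B C + f₆ B C + f₇ B C)
      ≡⟨ trans (∑₂-+ (λ B C → f₁ B C + f₂ B C + f₃ B C + f₄ B C + f₅ B C + f₆ B C) f₇) (cong (_+ ∑₂ f₇) (trans (∑₂-+ (λ B C → f₁ B C + f₂ B C + f₃ B C + f₄ B C + f₅ B C) f₆) (cong (_+ ∑₂ f₆)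
         (trans (∑₂-+ (λ B C → f₁ B C + f₂ B C + f₃ B C + f₄ B C) f₅) (cong (_+ ∑₂ f₅) (trans (∑₂-+ (λ B C → f₁ B C + f₂ B C + f₃ B C) f₄) (cong (_+ ∑₂ f₄)
         (trans (∑₂-+ (λ B C → f₁ B C + f₂ B C) f₃) (cong (_+ ∑₂ f₃) (∑₂-+ f₁ f₂)))))))))) ⟩
     e + E + e′ + E′ + ∑₂ f₅ + ∑₂ f₆ + ∑₂ f₇
      ≡⟨ cong₂ _+_ (cong₂ _+_ (cong₂ _+_ (cong (λ z → e + E + z + E′) e′≡e) (∑₂-first _)) (∑₂-second _)) (∑₂-second _) ⟩
     e + E + e + E′ + N * o + N * t + N * o ∎
     where
     open ≤-Reasoning
     f₁ f₂ f₃ f₄ f₅ f₆ f₇ : Block → Block → ℕ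
     f₁ B C = ι (adj B C ∧ not (adj S C) ∧ not (adj T B))
     f₂ B C = ι (not (adj T B) ∧ adj S C ∧ not (adj B C))
     f₃ B C = ι (adj B C ∧ not (adj S B) ∧ not (adj T C))
     f₄ B C = ι (not (adj S B) ∧ adj T C ∧ not (adj B C))
     f₅ B C = ι (adj S B ∧ adj T B)
     f₆ B C = ι (not (adj S C) ∧ not (adj T C))
     f₇ B C = ι (adj S C ∧ adj T C)

    hy : t * y ≤ e + E′
    hy = begin
     t * y
      ≡⟨ trans (sym (∑-*ʳ Bs y _)) (∑-cong Bs (λ B → sym (∑-*ˡ Bs (ι (not (adj S B) ∧ not (adj T B))) _))) ⟩
     ∑₂ (λ B C → ι (not (adj S B) ∧ not (adj T B)) * ι (not (adj S C) ∧ adj T C))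
      ≤⟨ ∑₂-mono (λ B C → truth-table 5 (λ s τ s′ τ′ w → ι (not s ∧ not τ) * ι (not s′ ∧ τ′)) (λ s τ s′ τ′ w → ι (w ∧ not s′ ∧ not τ) + ι (not s ∧ τ′ ∧ not w)) tt
         (adj S B) (adj T B) (adj S C) (adj T C) (adj B C)) ⟩
     ∑₂ (λ B C → ι (adj B C ∧ not (adj S C) ∧ not (adj T B)) + ι (not (adj S B) ∧ adj T C ∧ not (adj B C)))
      ≡⟨ ∑₂-+ _ _ ⟩
     e + E′ ∎
     where open ≤-Reasoning

    incomplete : ∑₂ (λ B C → ι (not (adj S B) ∧ adj S C ∧ not (adj B C))) ≤ E + N * y
    incomplete = ≤-trans (∑₂-mono (λ B C → truth-table 4 (λ s τ s′ w → ι (not s ∧ s′ ∧ not w)) (λ s τ s′ w → ι (not τ ∧ s′ ∧ not w) + ι (not s ∧ τ)) tt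
      (adj S B) (adj T B) (adj S C) (adj B C)))
     (≤-reflexive (trans (∑₂-+ _ _) (cong (E +_) (∑₂-first _))))

   dichotomy : ∀ D κ δ → 36 * D ≤ q → 2 * κ ≤ q → δ * (11 + 102 * D) ≤ 2 * q → Splits D ⊎ NearlyBipartite κ δ S
   dichotomy D κ δ q≥D q≥κ q≥δ = cases (6 * D * t ≤? N)
    where
    cases : Dec (6 * D * t ≤ N) → Splits D ⊎ NearlyBipartite κ δ S
    cases (yes h) = inj₁ (not ∘ adj T , adj S , split-bound D e E E′ o t _ q≥D h he hE hE′ ho disagree ,
     scale-down D q N dS (≤-trans (m≤m*n D 36) (≡-≤-trans (*-comm D 36) q≥D)) (degree S∈ uS) ,
     scale-up D dS (≤-trans (*-monoˡ-≤ D {2} {36} (≤ᵇ⇒≤ 2 36 tt)) q≥D) hdS)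
    cases (no ¬h) = inj₂ (scale-down κ q N dS (≤-trans (m≤m+n κ _) q≥κ) (degree S∈ uS) , scale-up κ dS q≥κ hdS ,
     bipartite-bound D δ e E E′ t y _ q≥δ (≰⇒≥ ¬h) he hE hE′ hy incomplete)

 module _ {A : Set} where

  parity : (A → Bool) → List A → Bool
  parity α [] = false
  parity α (v ∷ t) = α v xor parity α t

  parity-++ : ∀ α s t → parity α (s ++ t) ≡ parity α s xor parity α t
  parity-++ α [] t = refl
  parity-++ α (v ∷ s) t = trans (cong (α v xor_) (parity-++ α s t)) (sym (Boolₚ.xor-assoc (α v) _ _))

  parity-↭ : ∀ α {s t} → s ↭ t → parity α s ≡ parity α t
  parity-↭ α Perm.refl = refl
  parity-↭ α (prep v p) = cong (α v xor_) (parity-↭ α p)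
  parity-↭ α (swap v w p) = trans (cong (λ z → α v xor (α w xor z)) (parity-↭ α p)) (exchange (α v) (α w) _)
   where
   exchange : ∀ a b c → a xor (b xor c) ≡ b xor (a xor c)
   exchange true true c = refl
   exchange true false c = refl
   exchange false true c = refl
   exchange false false c = refl
  parity-↭ α (Perm.trans p q) = trans (parity-↭ α p) (parity-↭ α q)

 -- A symmetric Boolean function of 2ℓ variables that mostly factors through the two halves is mostly affine.
 module Affine {A : Set} (R : List A) (F : List A → Bool) (F-↭ : ∀ {s t} → s ↭ t → F s ≡ F t) (ℓ′ : ℕ)
        (a b : List A → Bool) where

  private
   n = length R
   ℓ = suc ℓ′
   Bs = tuples R ℓ
   Ss = tuples R ℓ′
   N = n ^ ℓ
   k′ = ℓ′ + ℓ
   Ws = tuples R k′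

  err : List A → List A → ℕ
  err B C = ι (F (B ++ C) xor not (a B xor b C))

  Dis : ℕ
  Dis = ∑ Bs (λ B → ∑ Bs (err B))

  Δ : A → A → List A → Bool
  Δ v v′ w = F (v ∷ w) xor F (v′ ∷ w)

  private
   bend : A → A → List A → List A → List A → ℕ
   bend v v′ s t t′ = ι (Δ v v′ (s ++ t) xor Δ v v′ (s ++ t′))

   bend≤ : ∀ v v′ s t t′ → bend v v′ s t t′ ≤ err (v ∷ s) t + err (v′ ∷ s) t + err (v ∷ s) t′ + err (v′ ∷ s) t′
   bend≤ v v′ s t t′ = truth-table 8
    (λ f₁ f₂ f₃ f₄ a₁ a₂ b₁ b₂ → ι ((f₁ xor f₂) xor (f₃ xor f₄)))
    (λ f₁ f₂ f₃ f₄ a₁ a₂ b₁ b₂ → ι (f₁ xor not (a₁ xor b₁)) + ι (f₂ xor not (a₂ xor b₁)) + ι (f₃ xor not (a₁ xor b₂)) + ι (f₄ xor not (a₂ xor b₂))) tt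
    (F (v ∷ s ++ t)) (F (v′ ∷ s ++ t)) (F (v ∷ s ++ t′)) (F (v′ ∷ s ++ t′)) (a (v ∷ s)) (a (v′ ∷ s)) (b t) (b t′)

   ∑ₐ : (A → A → List A → List A → List A → ℕ) → ℕ
   ∑ₐ g = ∑ R (λ v → ∑ R (λ v′ → ∑ Ss (λ s → ∑ Bs (λ t → ∑ Bs (λ t′ → g v v′ s t t′)))))

   ∑ₐ-+ : ∀ g h → ∑ₐ (λ v v′ s t t′ → g v v′ s t t′ + h v v′ s t t′) ≡ ∑ₐ g + ∑ₐ h
   ∑ₐ-+ g h = trans (∑-cong R (λ v → trans (∑-cong R (λ v′ → trans (∑-cong Ss (λ s → trans (∑-cong Bs (λ t → ∑-+ Bs _ _)) (∑-+ Bs _ _))) (∑-+ Ss _ _))) (∑-+ R _ _))) (∑-+ R _ _)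

   bends = ∑ₐ bend

   Dis≡ : ∑ R (λ v → ∑ Ss (λ s → ∑ Bs (err (v ∷ s)))) ≡ Dis
   Dis≡ = sym (∑-tuples-suc R ℓ′ _)

   free-last : ∀ (g : A → A → List A → List A → ℕ) → ∑ₐ (λ v v′ s t t′ → g v v′ s t) ≡ N * ∑ R (λ v → ∑ R (λ v′ → ∑ Ss (λ s → ∑ Bs (g v v′ s))))
   free-last g = trans (∑-cong R (λ v → trans (∑-cong R (λ v′ → trans (∑-cong Ss (λ s → trans (∑-cong Bs (λ t → ∑-tuples-const R ℓ _)) (∑-*ˡ Bs N _))) (∑-*ˡ Ss N _))) (∑-*ˡ R N _))) (∑-*ˡ R N _)

   free-first : ∀ (g : A → A → List A → List A → ℕ) → ∑ₐ (λ v v′ s t t′ → g v v′ s t′) ≡ N * ∑ R (λ v → ∑ R (λ v′ → ∑ Ss (λ s → ∑ Bs (g v v′ s))))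
   free-first g = trans (∑-cong R (λ v → trans (∑-cong R (λ v′ → trans (∑-cong Ss (λ s → ∑-tuples-const R ℓ _)) (∑-*ˡ Ss N _))) (∑-*ˡ R N _))) (∑-*ˡ R N _)

   plain : ∑ R (λ v → ∑ R (λ v′ → ∑ Ss (λ s → ∑ Bs (err (v ∷ s))))) ≡ n * Dis
   plain = trans (∑-cong R (λ v → ∑-const R _)) (trans (∑-*ˡ R n _) (cong (n *_) Dis≡))

   plain′ : ∑ R (λ v → ∑ R (λ v′ → ∑ Ss (λ s → ∑ Bs (err (v′ ∷ s))))) ≡ n * Dis
   plain′ = trans (∑-const R _) (cong (n *_) Dis≡)

   bends≤ : bends ≤ 4 * (N * (n * Dis))
   bends≤ = begin
    bends
     ≤⟨ ∑-mono R (λ v → ∑-mono R (λ v′ → ∑-mono Ss (λ s → ∑-mono Bs (λ t → ∑-mono Bs (λ t′ → bend≤ v v′ s t t′))))) ⟩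
    ∑ₐ (λ v v′ s t t′ → err (v ∷ s) t + err (v′ ∷ s) t + err (v ∷ s) t′ + err (v′ ∷ s) t′)
     ≡⟨ trans (∑ₐ-+ _ _) (cong (_+ ∑ₐ (λ v v′ s t t′ → err (v′ ∷ s) t′)) (trans (∑ₐ-+ _ _) (cong (_+ ∑ₐ (λ v v′ s t t′ → err (v ∷ s) t′)) (∑ₐ-+ _ _)))) ⟩
    ∑ₐ (λ v v′ s t t′ → err (v ∷ s) t) + ∑ₐ (λ v v′ s t t′ → err (v′ ∷ s) t) + ∑ₐ (λ v v′ s t t′ → err (v ∷ s) t′) + ∑ₐ (λ v v′ s t t′ → err (v′ ∷ s) t′)
     ≡⟨ cong₂ _+_ (cong₂ _+_ (cong₂ _+_ (trans (free-last (λ v v′ s t → err (v ∷ s) t)) (cong (N *_) plain)) (trans (free-last (λ v v′ s t → err (v′ ∷ s) t)) (cong (N *_) plain′)))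
        (trans (free-first (λ v v′ s t → err (v ∷ s) t)) (cong (N *_) plain))) (trans (free-first (λ v v′ s t → err (v′ ∷ s) t)) (cong (N *_) plain′)) ⟩
    N * (n * Dis) + N * (n * Dis) + N * (n * Dis) + N * (n * Dis)
     ≡⟨ ring (N * (n * Dis)) ⟩
    4 * (N * (n * Dis)) ∎
    where
    open ≤-Reasoning
    ring : ∀ x → x + x + x + x ≡ 4 * x
    ring = solve-∀

  -- The failures of the rectangle identity for the first variable against all the others.
  rectangles : ℕ
  rectangles = ∑ R (λ v → ∑ R (λ v′ → ∑ Ws (λ w → ∑ Ws (λ w′ → ι (Δ v v′ w xor Δ v v′ w′)))))

  private
   detour : ∀ v v′ s t s′ t″ x → ι (Δ v v′ (s ++ t) xor Δ v v′ (s′ ++ t″)) ≤ bend v v′ s t (x ∷ s′) + bend v v′ s′ (x ∷ s) t″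
   detour v v′ s t s′ t″ x = subst (λ q → ι (Δ v v′ (s ++ t) xor Δ v v′ (s′ ++ t″)) ≤ ι (Δ v v′ (s ++ t) xor q) + bend v v′ s′ (x ∷ s) t″) (sym reordered)
    (truth-table 3 (λ p q r → ι (p xor r)) (λ p q r → ι (p xor q) + ι (q xor r)) tt (Δ v v′ (s ++ t)) (Δ v v′ (s′ ++ x ∷ s)) (Δ v v′ (s′ ++ t″)))
    where
    reorder : s ++ x ∷ s′ ↭ s′ ++ x ∷ s
    reorder = ↭-trans (Permₚ.shift x s s′) (↭-trans (prep x (++-comm s s′)) (↭-sym (Permₚ.shift x s′ s)))
    reordered : Δ v v′ (s ++ x ∷ s′) ≡ Δ v v′ (s′ ++ x ∷ s)
    reordered = cong₂ _xor_ (F-↭ (prep v reorder)) (F-↭ (prep v′ reorder))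

  rectangles≤ : 0 < n → rectangles ≤ 8 * (N * N * Dis)
  rectangles≤ n>0 = *-cancelˡ-pos n n>0 (begin
   n * rectangles
    ≡⟨ ∑-*ˡ R n _ ⟨
   ∑ R (λ v → n * ∑ R (λ v′ → ∑ Ws (λ w → ∑ Ws (λ w′ → G v v′ w w′))))
    ≡⟨ ∑-cong R (λ v → trans (sym (∑-*ˡ R n _)) (∑-cong R (λ v′ → cong (n *_) (trans (∑-tuples-+ R ℓ′ ℓ _) (∑-cong Ss (λ s → ∑-cong Bs (λ t → ∑-tuples-+ R ℓ′ ℓ _))))))) ⟩
   ∑ R (λ v → ∑ R (λ v′ → n * ∑ Ss (λ s → ∑ Bs (λ t → ∑ Ss (λ s′ → ∑ Bs (λ t″ → G v v′ (s ++ t) (s′ ++ t″)))))))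
    ≤⟨ ∑-mono R (λ v → ∑-mono R (λ v′ → ≡-≤-trans (sym (∑-const R _)) (∑-mono R (λ x → ∑-mono Ss (λ s → ∑-mono Bs (λ t → ∑-mono Ss (λ s′ → ∑-mono Bs (λ t″ → detour v v′ s t s′ t″ x)))))))) ⟩
   ∑ R (λ v → ∑ R (λ v′ → ∑ R (λ x → ∑ Ss (λ s → ∑ Bs (λ t → ∑ Ss (λ s′ → ∑ Bs (λ t″ → bend v v′ s t (x ∷ s′) + bend v v′ s′ (x ∷ s) t″)))))))
    ≡⟨ trans (∑-cong R (λ v → trans (∑-cong R (λ v′ → split v v′)) (∑-+ R _ _))) (∑-+ R _ _) ⟩
   ∑ R (λ v → ∑ R (λ v′ → N * part v v′)) + ∑ R (λ v → ∑ R (λ v′ → N * part v v′))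
    ≡⟨ cong (λ z → z + z) (trans (∑-cong R (λ v → ∑-*ˡ R N _)) (∑-*ˡ R N _)) ⟩
   N * bends + N * bends
    ≤⟨ +-mono-≤ (*-monoʳ-≤ N bends≤) (*-monoʳ-≤ N bends≤) ⟩
   N * (4 * (N * (n * Dis))) + N * (4 * (N * (n * Dis)))
    ≡⟨ ring N n Dis ⟩
   n * (8 * (N * N * Dis)) ∎)
   where
   open ≤-Reasoning
   ring : ∀ N n d → N * (4 * (N * (n * d))) + N * (4 * (N * (n * d))) ≡ n * (8 * (N * N * d))
   ring = solve-∀
   G : A → A → List A → List A → ℕ
   G v v′ w w′ = ι (Δ v v′ w xor Δ v v′ w′)
   part : A → A → ℕ
   part v v′ = ∑ Ss (λ s → ∑ Bs (λ t → ∑ Bs (λ t′ → bend v v′ s t t′)))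
   split : ∀ v v′ → ∑ R (λ x → ∑ Ss (λ s → ∑ Bs (λ t → ∑ Ss (λ s′ → ∑ Bs (λ t″ → bend v v′ s t (x ∷ s′) + bend v v′ s′ (x ∷ s) t″))))) ≡ N * part v v′ + N * part v v′
   split v v′ = trans (∑-cong R (λ x → trans (∑-cong Ss (λ s → trans (∑-cong Bs (λ t → trans (∑-cong Ss (λ s′ → ∑-+ Bs _ _)) (∑-+ Ss _ _))) (∑-+ Bs _ _))) (∑-+ Ss _ _))) (trans (∑-+ R _ _) (cong₂ _+_ first second))
    where
    first : ∑ R (λ x → ∑ Ss (λ s → ∑ Bs (λ t → ∑ Ss (λ s′ → ∑ Bs (λ t″ → bend v v′ s t (x ∷ s′)))))) ≡ N * part v v′
    first = begin-equality
     ∑ R (λ x → ∑ Ss (λ s → ∑ Bs (λ t → ∑ Ss (λ s′ → ∑ Bs (λ t″ → bend v v′ s t (x ∷ s′))))))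
      ≡⟨ ∑-cong R (λ x → trans (∑-cong Ss (λ s → trans (∑-cong Bs (λ t → trans (∑-cong Ss (λ s′ → ∑-tuples-const R ℓ _)) (∑-*ˡ Ss N _))) (∑-*ˡ Bs N _))) (∑-*ˡ Ss N _)) ⟩
     ∑ R (λ x → N * ∑ Ss (λ s → ∑ Bs (λ t → ∑ Ss (λ s′ → bend v v′ s t (x ∷ s′)))))
      ≡⟨ trans (∑-*ˡ R N _) (cong (N *_) (trans (∑-swap R Ss _) (∑-cong Ss (λ s → trans (∑-swap R Bs _) (∑-cong Bs (λ t → sym (∑-tuples-suc R ℓ′ (bend v v′ s t)))))))) ⟩
     N * part v v′ ∎
    second : ∑ R (λ x → ∑ Ss (λ s → ∑ Bs (λ t → ∑ Ss (λ s′ → ∑ Bs (λ t″ → bend v v′ s′ (x ∷ s) t″))))) ≡ N * part v v′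
    second = begin-equality
     ∑ R (λ x → ∑ Ss (λ s → ∑ Bs (λ t → ∑ Ss (λ s′ → ∑ Bs (λ t″ → bend v v′ s′ (x ∷ s) t″)))))
      ≡⟨ ∑-cong R (λ x → trans (∑-cong Ss (λ s → ∑-tuples-const R ℓ _)) (∑-*ˡ Ss N _)) ⟩
     ∑ R (λ x → N * ∑ Ss (λ s → ∑ Ss (λ s′ → ∑ Bs (λ t″ → bend v v′ s′ (x ∷ s) t″))))
      ≡⟨ trans (∑-*ˡ R N _) (cong (N *_) (sym (∑-tuples-suc R ℓ′ (λ u → ∑ Ss (λ s′ → ∑ Bs (λ t″ → bend v v′ s′ u t″)))))) ⟩
     N * ∑ Bs (λ u → ∑ Ss (λ s′ → ∑ Bs (λ t″ → bend v v′ s′ u t″)))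
      ≡⟨ cong (N *_) (∑-swap Bs Ss _) ⟩
     N * part v v′ ∎

  module _ (n>0 : 0 < n) (D : ℕ) (small : D * Dis ≤ N * N) where

   private
    k = suc k′

    N²≡ : n ^ k ≡ N * N
    N²≡ = ^-distribˡ-+-* n ℓ ℓ

    defect : A → List A → ℕ
    defect z r = ∑ R (λ v → ∑ Ws (λ w → ι (Δ v z w xor Δ v z r)))

    references = cartesianProduct R Ws

    length-references : length references ≡ N * N
    length-references = trans (sym (∑-1 references)) (trans (∑-cart _,_ R Ws _) (trans (∑-const R _) (trans (cong (n *_) (trans (∑-1 Ws) (length-tuples R k′))) N²≡)))

    reference : ∃[ x ] x ∈ references × D * defect (proj₁ x) (proj₂ x) ≤ 8 * (N * N)
    reference = minimum references (λ x → D * defect (proj₁ x) (proj₂ x)) (8 * (N * N)) (subst (0 <_) (sym length-references) (*-pos (^-pos ℓ n>0) (^-pos ℓ n>0))) (begin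
     ∑ references (λ x → D * defect (proj₁ x) (proj₂ x))
      ≡⟨ trans (∑-*ˡ references D _) (cong (D *_) (∑-cart _,_ R Ws _)) ⟩
     D * ∑ R (λ z → ∑ Ws (λ r → ∑ R (λ v → ∑ Ws (λ w → ι (Δ v z w xor Δ v z r)))))
      ≡⟨ cong (D *_) (trans (∑-cong R (λ z → trans (∑-swap Ws R _) (∑-cong R (λ v → ∑-swap Ws Ws _)))) (∑-swap R R _)) ⟩
     D * rectangles
      ≤⟨ *-monoʳ-≤ D (rectangles≤ n>0) ⟩
     D * (8 * (N * N * Dis))
      ≡⟨ ring₁ D (N * N) Dis ⟩
     8 * (N * N) * (D * Dis)
      ≤⟨ *-monoʳ-≤ (8 * (N * N)) small ⟩
     8 * (N * N) * (N * N)
      ≡⟨ cong (8 * (N * N) *_) length-references ⟨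
     8 * (N * N) * length references ∎)
     where
     open ≤-Reasoning
     ring₁ : ∀ D N d → D * (8 * (N * d)) ≡ 8 * N * (D * d)
     ring₁ = solve-∀

    z : A
    z = proj₁ (proj₁ reference)

    r₀ : List A
    r₀ = proj₂ (proj₁ reference)

   α : A → Bool
   α v = F (v ∷ r₀)

   private
    E : List A → Bool
    E t = F t xor parity α t

    open Hybrid R E (λ p → cong₂ _xor_ (F-↭ p) (parity-↭ α p))

    sensitivity≤ : sensitivity k′ ≤ 2 * n * defect z r₀
    sensitivity≤ = begin
     sensitivity k′
      ≤⟨ ∑-mono R (λ v → ∑-mono R (λ v′ → ∑-mono Ws (λ w → truth-table 7
         (λ f f′ α₁ α₂ p g h → ι ((f xor (α₁ xor p)) xor (f′ xor (α₂ xor p))))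
         (λ f f′ α₁ α₂ p g h → ι ((f xor g) xor (α₁ xor h)) + ι ((f′ xor g) xor (α₂ xor h))) tt
         (F (v ∷ w)) (F (v′ ∷ w)) (α v) (α v′) (parity α w) (F (z ∷ w)) (F (z ∷ r₀))))) ⟩
     ∑ R (λ v → ∑ R (λ v′ → ∑ Ws (λ w → ι (Δ v z w xor Δ v z r₀) + ι (Δ v′ z w xor Δ v′ z r₀))))
      ≡⟨ trans (∑-cong R (λ v → trans (∑-cong R (λ v′ → ∑-+ Ws _ _)) (∑-+ R _ _))) (∑-+ R _ _) ⟩
     ∑ R (λ v → ∑ R (λ v′ → d v)) + ∑ R (λ v → ∑ R d)
      ≡⟨ cong₂ _+_ (trans (∑-cong R (λ v → ∑-const R (d v))) (∑-*ˡ R n d)) (∑-const R _) ⟩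
     n * defect z r₀ + n * defect z r₀
      ≡⟨ ring n (defect z r₀) ⟩
     2 * n * defect z r₀ ∎
     where
     open ≤-Reasoning
     d : A → ℕ
     d v = ∑ Ws (λ w → ι (Δ v z w xor Δ v z r₀))
     ring : ∀ n d → n * d + n * d ≡ 2 * n * d
     ring = solve-∀

    separated-small : D * separated k ≤ 16 * k * (N * N) * (N * N)
    separated-small = *-cancelˡ-pos n n>0 (begin
     n * (D * separated k)
      ≡⟨ *-exchange n D (separated k) ⟩
     D * (n * separated k)
      ≤⟨ *-monoʳ-≤ D (separated≤ k′) ⟩
     D * (k * n ^ k * sensitivity k′)
      ≤⟨ *-monoʳ-≤ D (*-monoʳ-≤ (k * n ^ k) sensitivity≤) ⟩
     D * (k * n ^ k * (2 * n * defect z r₀))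
      ≡⟨ trans (cong (λ p → D * (k * p * (2 * n * defect z r₀))) N²≡) (ring₂ D k (N * N) n (defect z r₀)) ⟩
     2 * k * (N * N) * n * (D * defect z r₀)
      ≤⟨ *-monoʳ-≤ (2 * k * (N * N) * n) (proj₂ (proj₂ reference)) ⟩
     2 * k * (N * N) * n * (8 * (N * N))
      ≡⟨ ring₃ k (N * N) n ⟩
     n * (16 * k * (N * N) * (N * N)) ∎)
     where
     open ≤-Reasoning
     ring₂ : ∀ D k p n d → D * (k * p * (2 * n * d)) ≡ 2 * k * p * n * (D * d)
     ring₂ = solve-∀
     ring₃ : ∀ k p n → 2 * k * p * n * (8 * p) ≡ n * (16 * k * p * p)
     ring₃ = solve-∀

    typicalTuple : ∃[ t ] t ∈ tuples R k × D * ∑ (tuples R k) (λ s → ι (E s xor E t)) ≤ 16 * k * (N * N)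
    typicalTuple = minimum (tuples R k) (λ t → D * ∑ (tuples R k) (λ s → ι (E s xor E t))) (16 * k * (N * N))
     (subst (0 <_) (sym (length-tuples R k)) (^-pos k n>0))
     (subst₂ _≤_ (trans (cong (D *_) (∑-swap (tuples R k) (tuples R k) _)) (sym (∑-*ˡ (tuples R k) D _)))
      (cong (16 * k * (N * N) *_) (sym (trans (length-tuples R k) N²≡))) separated-small)

   c : Bool
   c = E (proj₁ typicalTuple)

   affine : D * ∑ (tuples R k) (λ s → ι ((F s xor parity α s) xor c)) ≤ 16 * k * (N * N)
   affine = proj₂ (proj₂ typicalTuple)

 module AffineBalance {A : Set} (R : List A) (F : List A → Bool) (ℓ′ : ℕ) (a b : List A → Bool)
            (n>0 : 0 < length R) (D : ℕ) (α : A → Bool) (c : Bool) where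

  private
   n = length R
   ℓ = suc ℓ′
   Bs = tuples R ℓ
   N = n ^ ℓ
   k = ℓ + ℓ

  err : List A → List A → ℕ
  err B C = ι (F (B ++ C) xor not (a B xor b C))

  private
   odds : ℕ → ℕ
   odds j = ∑ (tuples R j) (λ t → ι (parity α t))

   evens : ℕ → ℕ
   evens j = ∑ (tuples R j) (λ t → ι (not (parity α t)))

   odds+evens : ∀ j → odds j + evens j ≡ n ^ j
   odds+evens j = trans (sym (∑-+ (tuples R j) _ _)) (trans (∑-cong (tuples R j) (λ t → one (parity α t))) (trans (∑-1 (tuples R j)) (length-tuples R j)))
    where
    one : ∀ b → ι b + ι (not b) ≡ 1
    one true = refl
    one false = refl

  n₁ n₀ : ℕ
  n₁ = ∑ R (λ v → ι (α v))
  n₀ = ∑ R (λ v → ι (not (α v)))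

  private
   bias : ℕ → ℤ
   bias j = ℤ.+ evens j ℤ.- ℤ.+ odds j

   odds-suc : ∀ j → odds (suc j) ≡ n₁ * evens j + n₀ * odds j
   odds-suc j = trans (∑-tuples-suc R j _) (trans (∑-cong R (λ v → trans (∑-cong (tuples R j) (λ t → split (α v) (parity α t))) (trans (∑-+ (tuples R j) _ _) (cong₂ _+_ (∑-*ˡ (tuples R j) (ι (α v)) _) (∑-*ˡ (tuples R j) (ι (not (α v))) _)))))
    (trans (∑-+ R _ _) (cong₂ _+_ (∑-*ʳ R (evens j) _) (∑-*ʳ R (odds j) _))))
    where
    split : ∀ x y → ι (x xor y) ≡ ι x * ι (not y) + ι (not x) * ι y
    split true true = refl
    split true false = refl
    split false true = refl
    split false false = refl

   evens-suc : ∀ j → evens (suc j) ≡ n₁ * odds j + n₀ * evens j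
   evens-suc j = trans (∑-tuples-suc R j _) (trans (∑-cong R (λ v → trans (∑-cong (tuples R j) (λ t → split (α v) (parity α t))) (trans (∑-+ (tuples R j) _ _) (cong₂ _+_ (∑-*ˡ (tuples R j) (ι (α v)) _) (∑-*ˡ (tuples R j) (ι (not (α v))) _)))))
    (trans (∑-+ R _ _) (cong₂ _+_ (∑-*ʳ R (odds j) _) (∑-*ʳ R (evens j) _))))
    where
    split : ∀ x y → ι (not (x xor y)) ≡ ι x * ι y + ι (not x) * ι (not y)
    split true true = refl
    split true false = refl
    split false true = refl
    split false false = refl

   bias-suc : ∀ j → bias (suc j) ≡ (ℤ.+ n₀ ℤ.- ℤ.+ n₁) ℤ.* bias j
   bias-suc j = trans (cong₂ (λ x y → ℤ.+ x ℤ.- ℤ.+ y) (evens-suc j) (odds-suc j)) (trans (cong₂ ℤ._-_ (expand n₁ (odds j) n₀ (evens j)) (expand n₁ (evens j) n₀ (odds j)))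
    (ring (ℤ.+ n₁) (ℤ.+ n₀) (ℤ.+ evens j) (ℤ.+ odds j)))
    where
    expand : ∀ a x b y → ℤ.+ (a * x + b * y) ≡ ℤ.+ a ℤ.* ℤ.+ x ℤ.+ ℤ.+ b ℤ.* ℤ.+ y
    expand a x b y = trans (ℤₚ.pos-+ (a * x) (b * y)) (cong₂ ℤ._+_ (ℤₚ.pos-* a x) (ℤₚ.pos-* b y))
    ring : ∀ a b e o → (a ℤ.* o ℤ.+ b ℤ.* e) ℤ.- (a ℤ.* e ℤ.+ b ℤ.* o) ≡ (b ℤ.- a) ℤ.* (e ℤ.- o)
    ring = ℤSolver.solve-∀

   ∣bias∣ : ∀ j → ℤ.∣ bias j ∣ ≡ ∣ n₀ - n₁ ∣ ^ j
   ∣bias∣ zero = refl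
   ∣bias∣ (suc j) = trans (cong ℤ.∣_∣ (bias-suc j)) (trans (ℤₚ.abs-* (ℤ.+ n₀ ℤ.- ℤ.+ n₁) (bias j)) (cong₂ _*_ (distance n₀ n₁) (∣bias∣ j)))
    where
    distance : ∀ x y → ℤ.∣ ℤ.+ x ℤ.- ℤ.+ y ∣ ≡ ∣ x - y ∣
    distance x y = trans (cong ℤ.∣_∣ (ℤₚ.m-n≡m⊖n x y)) (∣⊖∣ x y)
     where
     ∣⊖∣ : ∀ x y → ℤ.∣ x ℤ.⊖ y ∣ ≡ ∣ x - y ∣
     ∣⊖∣ x y with ≤-total x y
     ... | inj₁ le = trans (ℤₚ.∣⊖∣-≤ le) (sym (m≤n⇒∣m-n∣≡n∸m le))
     ... | inj₂ ge = trans (trans (cong ℤ.∣_∣ (ℤₚ.⊖-≥ ge)) refl) (sym (m≤n⇒∣n-m∣≡n∸m ge))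

  module _ (small : D * ∑ Bs (λ B → ∑ Bs (err B)) ≤ N * N)
       (affine : D * ∑ (tuples R k) (λ s → ι ((F s xor parity α s) xor c)) ≤ 16 * k * (N * N))
       (lower : D * N ≤ 2 * D * ∑ Bs (λ C → ι (b C)) + N) (upper : 2 * D * ∑ Bs (λ C → ι (b C)) ≤ D * N + N) where

   private
    row : List A → ℕ
    row B = ∑ Bs (λ C → err B C + ι ((F (B ++ C) xor parity α (B ++ C)) xor c))

    witness : ∃[ B ] B ∈ Bs × D * row B ≤ (1 + 16 * k) * N
    witness = minimum Bs (λ B → D * row B) ((1 + 16 * k) * N)
     (subst (0 <_) (sym (length-tuples R ℓ)) (^-pos ℓ n>0)) (begin
     ∑ Bs (λ B → D * row B)
      ≡⟨ trans (∑-*ˡ Bs D _) (cong (D *_) (trans (∑-cong Bs (λ B → ∑-+ Bs _ _)) (∑-+ Bs _ _))) ⟩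
     D * (∑ Bs (λ B → ∑ Bs (err B)) + ∑ Bs (λ B → ∑ Bs (λ C → ι ((F (B ++ C) xor parity α (B ++ C)) xor c))))
      ≡⟨ trans (cong (λ x → D * (∑ Bs (λ B → ∑ Bs (err B)) + x)) (sym (∑-tuples-+ R ℓ ℓ _))) (*-distribˡ-+ D _ _) ⟩
     D * ∑ Bs (λ B → ∑ Bs (err B)) + D * ∑ (tuples R k) (λ s → ι ((F s xor parity α s) xor c))
      ≤⟨ +-mono-≤ small affine ⟩
     N * N + 16 * k * (N * N)
      ≡⟨ ring N k ⟩
     (1 + 16 * k) * N * N
      ≡⟨ cong ((1 + 16 * k) * N *_) (length-tuples R ℓ) ⟨
     (1 + 16 * k) * N * length Bs ∎)
     where
     open ≤-Reasoning
     ring : ∀ N k → N * N + 16 * k * (N * N) ≡ (1 + 16 * k) * N * N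
     ring = solve-∀

    module At (B₀ : List A) (rowB₀ : D * row B₀ ≤ (1 + 16 * k) * N) where

     κ : Bool
     κ = not (a B₀) xor (parity α B₀ xor c)

     flipped : ∑ Bs (λ C → ι ((b C xor parity α C) xor κ)) ≤ row B₀
     flipped = ∑-mono Bs (λ C → subst (λ p → ι ((b C xor parity α C) xor κ) ≤ err B₀ C + ι ((F (B₀ ++ C) xor p) xor c)) (sym (parity-++ α B₀ C))
      (truth-table 6 (λ f a b p p′ c → ι ((b xor p′) xor (not a xor (p xor c)))) (λ f a b p p′ c → ι (f xor not (a xor b)) + ι ((f xor (p xor p′)) xor c)) tt
       (F (B₀ ++ C)) (a B₀) (b C) (parity α B₀) (parity α C) c))

     balance : (∑ Bs (λ C → ι (b C)) ≤ odds ℓ + row B₀ × odds ℓ ≤ ∑ Bs (λ C → ι (b C)) + row B₀) ⊎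
          (∑ Bs (λ C → ι (b C)) ≤ evens ℓ + row B₀ × evens ℓ ≤ ∑ Bs (λ C → ι (b C)) + row B₀)
     balance = cases κ refl
      where
      close : ∀ (g : List A → Bool) → ∑ Bs (λ C → ι (b C xor g C)) ≤ row B₀ → ∑ Bs (λ C → ι (b C)) ≤ ∑ Bs (λ C → ι (g C)) + row B₀ × ∑ Bs (λ C → ι (g C)) ≤ ∑ Bs (λ C → ι (b C)) + row B₀
      close g h = ≤-trans (∑-mono Bs (λ C → truth-table 2 (λ x y → ι x) (λ x y → ι y + ι (x xor y)) tt (b C) (g C))) (≡-≤-trans (∑-+ Bs _ _) (+-monoʳ-≤ _ h)) ,
            ≤-trans (∑-mono Bs (λ C → truth-table 2 (λ x y → ι y) (λ x y → ι x + ι (x xor y)) tt (b C) (g C))) (≡-≤-trans (∑-+ Bs _ _) (+-monoʳ-≤ _ h))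
      cases : ∀ x → κ ≡ x → (∑ Bs (λ C → ι (b C)) ≤ odds ℓ + row B₀ × odds ℓ ≤ ∑ Bs (λ C → ι (b C)) + row B₀) ⊎ (∑ Bs (λ C → ι (b C)) ≤ evens ℓ + row B₀ × evens ℓ ≤ ∑ Bs (λ C → ι (b C)) + row B₀)
      cases false e = inj₁ (close (parity α) (≡-≤-trans (∑-cong Bs (λ C → cong ι (trans (sym (xorʳ (b C) (parity α C))) (cong ((b C xor parity α C) xor_) (sym e))))) flipped))
       where
       xorʳ : ∀ x y → (x xor y) xor false ≡ x xor y
       xorʳ true true = refl
       xorʳ true false = refl
       xorʳ false true = refl
       xorʳ false false = refl
      cases true e = inj₂ (close (not ∘ parity α) (≡-≤-trans (∑-cong Bs (λ C → cong ι (trans (sym (xorʳ (b C) (parity α C))) (cong ((b C xor parity α C) xor_) (sym e))))) flipped))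
       where
       xorʳ : ∀ x y → (x xor y) xor true ≡ x xor not y
       xorʳ true true = refl
       xorʳ true false = refl
       xorʳ false true = refl
       xorʳ false false = refl

     balance-bound : D * ∣ n₀ - n₁ ∣ ^ ℓ ≤ (3 + 32 * k) * N
     balance-bound = subst (λ x → D * x ≤ (3 + 32 * k) * N) (trans (cong ℤ.∣_∣ (sym (ℤₚ.m-n≡m⊖n (evens ℓ) (odds ℓ)))) (∣bias∣ ℓ)) (bound (ℤₚ.∣m⊖n∣≡∣n⊖m∣ (evens ℓ) (odds ℓ)) balance)
      where
      β = ∑ Bs (λ C → ι (b C))
      gap : ∀ x y → x + y ≡ N → β ≤ x + row B₀ → x ≤ β + row B₀ → D * ℤ.∣ x ℤ.⊖ y ∣ ≤ (3 + 32 * k) * N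
      gap x y e h₁ h₂ with ≤-total x y
      ... | inj₁ le = subst (λ u → D * u ≤ (3 + 32 * k) * N) (sym (ℤₚ.∣⊖∣-≤ le))
       (low (y ∸ x) (m+[n∸m]≡n le))
       where
       low : ∀ d → x + d ≡ y → D * d ≤ (3 + 32 * k) * N
       low d refl = linear 0 (+-mono-≤ lower (+-mono-≤ (*-monoʳ-≤ (2 * D) h₁) (*-monoʳ-≤ 2 rowB₀)))
        (trans (cong (λ z → D * d + (2 * D * β + z + (2 * D * (x + row B₀) + 2 * ((1 + 16 * k) * z))) + 0) (sym e))
         (trans (ring D x d β (row B₀) k) (cong (λ z → (3 + 32 * k) * z + (D * z + (2 * D * β + 2 * (D * row B₀)))) e)))
        where
        ring : ∀ D x d β r k → D * d + (2 * D * β + (x + (x + d)) + (2 * D * (x + r) + 2 * ((1 + 16 * k) * (x + (x + d))))) + 0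
         ≡ (3 + 32 * k) * (x + (x + d)) + (D * (x + (x + d)) + (2 * D * β + 2 * (D * r)))
        ring = solve-∀
      ... | inj₂ ge = subst (λ u → D * u ≤ (3 + 32 * k) * N) (sym (cong ℤ.∣_∣ (ℤₚ.⊖-≥ ge)))
       (high (x ∸ y) (m+[n∸m]≡n ge))
       where
       high : ∀ d → y + d ≡ x → D * d ≤ (3 + 32 * k) * N
       high d refl = linear 0 (+-mono-≤ upper (+-mono-≤ (*-monoʳ-≤ (2 * D) h₂) (*-monoʳ-≤ 2 rowB₀)))
        (trans (cong (λ z → D * d + (D * z + z + (2 * D * (β + row B₀) + 2 * ((1 + 16 * k) * z))) + 0) (sym e))
         (trans (ring D y d β (row B₀) k) (cong (λ z → (3 + 32 * k) * z + (2 * D * β + (2 * D * (y + d) + 2 * (D * row B₀)))) e)))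
        where
        ring : ∀ D y d β r k → D * d + (D * (y + d + y) + (y + d + y) + (2 * D * (β + r) + 2 * ((1 + 16 * k) * (y + d + y)))) + 0
         ≡ (3 + 32 * k) * (y + d + y) + (2 * D * β + (2 * D * (y + d) + 2 * (D * r)))
        ring = solve-∀
      bound : ℤ.∣ evens ℓ ℤ.⊖ odds ℓ ∣ ≡ ℤ.∣ odds ℓ ℤ.⊖ evens ℓ ∣ →
          ((β ≤ odds ℓ + row B₀ × odds ℓ ≤ β + row B₀) ⊎ (β ≤ evens ℓ + row B₀ × evens ℓ ≤ β + row B₀)) → D * ℤ.∣ evens ℓ ℤ.⊖ odds ℓ ∣ ≤ (3 + 32 * k) * N
      bound s (inj₁ (h₁ , h₂)) = subst (λ x → D * x ≤ (3 + 32 * k) * N) (sym s) (gap (odds ℓ) (evens ℓ) (odds+evens ℓ) h₁ h₂)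
      bound s (inj₂ (h₁ , h₂)) = gap (evens ℓ) (odds ℓ) (trans (+-comm (evens ℓ) (odds ℓ)) (odds+evens ℓ)) h₁ h₂

   nearly-balanced : D * ∣ n₀ - n₁ ∣ ^ ℓ ≤ (3 + 32 * k) * N
   nearly-balanced = At.balance-bound (proj₁ witness) (proj₂ (proj₂ witness))

 module _ {A : Set} (R : List A) where

  -- Replacing α by α′ changes the parity of a k-tuple only if the two differ at one of its entries.
  parity-change : ∀ (α α′ : A → Bool) j → length R * ∑ (tuples R j) (λ t → ι (parity α t xor parity α′ t)) ≤ j * ∑ R (λ v → ι (α v xor α′ v)) * length R ^ j
  parity-change α α′ zero = ≤-reflexive (*-zeroʳ (length R))
  parity-change α α′ (suc j) = begin
   n * ∑ (tuples R (suc j)) (λ t → ι (parity α t xor parity α′ t))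
    ≡⟨ cong (n *_) (∑-tuples-suc R j _) ⟩
   n * ∑ R (λ v → ∑ (tuples R j) (λ t → ι ((α v xor parity α t) xor (α′ v xor parity α′ t))))
    ≤⟨ *-monoʳ-≤ n (∑-mono R (λ v → ∑-mono (tuples R j) (λ t → truth-table 4 (λ a p a′ p′ → ι ((a xor p) xor (a′ xor p′))) (λ a p a′ p′ → ι (a xor a′) + ι (p xor p′)) tt
       (α v) (parity α t) (α′ v) (parity α′ t)))) ⟩
   n * ∑ R (λ v → ∑ (tuples R j) (λ t → ι (α v xor α′ v) + ι (parity α t xor parity α′ t)))
    ≡⟨ cong (n *_) (trans (∑-cong R (λ v → trans (∑-+ (tuples R j) _ _) (cong (_+ P) (∑-tuples-const R j _)))) (trans (∑-+ R _ _) (cong₂ _+_ (∑-*ˡ R (n ^ j) _) (∑-const R P)))) ⟩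
   n * (n ^ j * d + n * P)
    ≤⟨ *-monoʳ-≤ n (+-monoʳ-≤ (n ^ j * d) (parity-change α α′ j)) ⟩
   n * (n ^ j * d + j * d * n ^ j)
    ≡⟨ ring n (n ^ j) d j ⟩
   suc j * d * n ^ suc j ∎
   where
   open ≤-Reasoning
   n = length R
   d = ∑ R (λ v → ι (α v xor α′ v))
   P = ∑ (tuples R j) (λ t → ι (parity α t xor parity α′ t))
   ring : ∀ n p d j → n * (p * d + j * d * p) ≡ suc j * d * (n * p)
   ring = solve-∀

 module _ {n : ℕ} where

  open Defs using (edge; uniform; degree; countSets; oddB)

  fromList : List (Fin n) → Subset n
  fromList [] = Subset.⊥
  fromList (v ∷ xs) = ⁅ v ⁆ ∪ fromList xs

  lookup-⊥ : ∀ v → lookup (Subset.⊥ {n}) v ≡ false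
  lookup-⊥ v = Vecₚ.lookup-replicate v false

  lookup-∪ : ∀ S T (v : Fin n) → lookup (S ∪ T) v ≡ lookup S v ∨ lookup T v
  lookup-∪ S T v = Vecₚ.lookup-zipWith _∨_ v S T

  lookup-∩ : ∀ S T (v : Fin n) → lookup (S ∩ T) v ≡ lookup S v ∧ lookup T v
  lookup-∩ S T v = Vecₚ.lookup-zipWith _∧_ v S T

 lookup-⁅⁆ : ∀ {n} (v w : Fin n) → lookup ⁅ v ⁆ w ≡ eqᵇ w v
 lookup-⁅⁆ v w with w Finₚ.≟ v
 ... | yes refl = Vecₚ.[]=⇒lookup (Subsetₚ.x∈⁅x⁆ v)
 ... | no w≢v with lookup ⁅ v ⁆ w in e
 ... | false = refl
 ... | true = ⊥-elim (w≢v (Subsetₚ.x∈⁅y⁆⇒x≡y v (Vecₚ.lookup⇒[]= w ⁅ v ⁆ e)))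

 subset-ext : ∀ {n} {S T : Subset n} → (∀ v → lookup S v ≡ lookup T v) → S ≡ T
 subset-ext {S = S} {T} e = trans (sym (Vecₚ.tabulate∘lookup S)) (trans (Vecₚ.tabulate-cong e) (Vecₚ.tabulate∘lookup T))

 ∑-allFin-suc : ∀ {n} (f : Fin (suc n) → ℕ) → ∑ (allFin (suc n)) f ≡ f Fin.zero + ∑ (allFin n) (f ∘ Fin.suc)
 ∑-allFin-suc {n} f = cong (f Fin.zero +_) (trans (cong (λ xs → ∑ xs f) (sym (Listₚ.map-tabulate id Fin.suc))) (∑-map Fin.suc (allFin n) f))

 size : ∀ {n} (S : Subset n) → ∣ S ∣ ≡ ∑ (allFin n) (λ v → ι (lookup S v))
 size Vec.[] = refl
 size (true Vec.∷ S) = trans (cong suc (size S)) (sym (∑-allFin-suc (λ v → ι (lookup (true Vec.∷ S) v))))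
 size (false Vec.∷ S) = trans (size S) (sym (∑-allFin-suc (λ v → ι (lookup (false Vec.∷ S) v))))

 module _ {n : ℕ} where

  private V = allFin n

  ∈-V : ∀ v → v ∈ V
  ∈-V v = Memₚ.∈-allFin v

  lookup-fromList : ∀ xs (v : Fin n) → lookup (fromList xs) v ≡ not (fresh v xs)
  lookup-fromList [] v = lookup-⊥ v
  lookup-fromList (x ∷ xs) v = trans (lookup-∪ ⁅ x ⁆ (fromList xs) v) (trans (cong₂ _∨_ (lookup-⁅⁆ x v) (lookup-fromList xs v)) (deMorgan (eqᵇ v x) (fresh v xs)))
   where
   deMorgan : ∀ a b → a ∨ not b ≡ not (not a ∧ b)
   deMorgan true b = refl
   deMorgan false b = refl

  fromList-↭ : ∀ {xs ys} → xs ↭ ys → fromList xs ≡ fromList ys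
  fromList-↭ {xs} {ys} p = subset-ext λ v → trans (lookup-fromList xs v) (trans (cong not (fresh-↭ v p)) (sym (lookup-fromList ys v)))

  size-insert : ∀ S (A : Subset n) v → lookup S v ≡ false → ∣ (⁅ v ⁆ ∪ S) ∩ A ∣ ≡ ι (lookup A v) + ∣ S ∩ A ∣
  size-insert S A v v∉S = begin
   ∣ (⁅ v ⁆ ∪ S) ∩ A ∣ ≡⟨ size ((⁅ v ⁆ ∪ S) ∩ A) ⟩
   ∑ V (λ w → ι (lookup ((⁅ v ⁆ ∪ S) ∩ A) w)) ≡⟨ ∑-cong V pointwise ⟩
   ∑ V (λ w → ι (eqᵇ w v) * ι (lookup A v) + ι (lookup (S ∩ A) w)) ≡⟨ trans (∑-+ V _ _) (cong₂ _+_ (trans (∑-*ʳ V (ι (lookup A v)) _) (cong (_* ι (lookup A v)) (∑-eqᵇ≡1 V v (uniq-allFin {n}) (∈-V v)))) (sym (size (S ∩ A)))) ⟩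
   1 * ι (lookup A v) + ∣ S ∩ A ∣ ≡⟨ cong (_+ ∣ S ∩ A ∣) (+-identityʳ _) ⟩
   ι (lookup A v) + ∣ S ∩ A ∣ ∎
   where
   open ≡-Reasoning
   pointwise : ∀ w → ι (lookup ((⁅ v ⁆ ∪ S) ∩ A) w) ≡ ι (eqᵇ w v) * ι (lookup A v) + ι (lookup (S ∩ A) w)
   pointwise w = trans (cong ι (trans (lookup-∩ (⁅ v ⁆ ∪ S) A w) (cong (_∧ lookup A w) (trans (lookup-∪ ⁅ v ⁆ S w) (cong (_∨ lookup S w) (lookup-⁅⁆ v w))))))
    (trans (cases (eqᵇ w v) refl) (cong (λ z → ι (eqᵇ w v) * ι (lookup A v) + ι z) (sym (lookup-∩ S A w))))
    where
    cases : ∀ x → eqᵇ w v ≡ x → ι ((eqᵇ w v ∨ lookup S w) ∧ lookup A w) ≡ ι (eqᵇ w v) * ι (lookup A v) + ι (lookup S w ∧ lookup A w)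
    cases false e rewrite e = refl
    cases true e rewrite eqᵇ⇒≡ {v = w} {w = v} e | eqᵇ-refl v | v∉S = sym (trans (+-identityʳ _) (+-identityʳ _))

  size-fromList-∩ : ∀ xs (A : Subset n) → uniq xs ≡ true → ∣ fromList xs ∩ A ∣ ≡ ∑ xs (λ v → ι (lookup A v))
  size-fromList-∩ [] A u = trans (size (Subset.⊥ ∩ A)) (trans (∑-cong V (λ w → cong ι (trans (lookup-∩ Subset.⊥ A w) (cong (_∧ lookup A w) (lookup-⊥ w))))) (∑-0 V))
  size-fromList-∩ (x ∷ xs) A u = trans (size-insert (fromList xs) A x (trans (lookup-fromList xs x) (cong not (proj₁ (∧-true {fresh x xs} u)))))
   (cong (ι (lookup A x) +_) (size-fromList-∩ xs A (proj₂ (∧-true {fresh x xs} u))))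

  private
   full : Subset n
   full = Subset.⊤

   ∩-full : ∀ S → ∣ S ∩ full ∣ ≡ ∣ S ∣
   ∩-full S = cong ∣_∣ (Subsetₚ.∩-identityʳ S)

  size-fromList : ∀ xs → uniq xs ≡ true → ∣ fromList xs ∣ ≡ length xs
  size-fromList xs u = trans (sym (∩-full (fromList xs))) (trans (size-fromList-∩ xs full u) (trans (∑-cong xs (λ v → cong ι (Vecₚ.lookup-replicate v true))) (∑-1 xs)))

  size-fromList≤ : ∀ xs → ∣ fromList xs ∣ ≤ length xs
  size-fromList≤ xs = ≡-≤-trans (trans (size (fromList xs)) (∑-cong V (λ v → cong ι (lookup-fromList xs v)))) (∑-stale≤ V xs (uniq-allFin {n}))

  full-size⇒uniq : ∀ xs → ∣ fromList xs ∣ ≡ length xs → uniq xs ≡ true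
  full-size⇒uniq [] e = refl
  full-size⇒uniq (x ∷ xs) e with fresh x xs in f
  ... | true = full-size⇒uniq xs (suc-injective (trans (sym inserted) e))
   where
   inserted : ∣ fromList (x ∷ xs) ∣ ≡ suc ∣ fromList xs ∣
   inserted = trans (sym (∩-full (fromList (x ∷ xs)))) (trans (size-insert (fromList xs) full x (trans (lookup-fromList xs x) (cong not f))) (cong₂ _+_ (cong ι (Vecₚ.lookup-replicate x true)) (∩-full (fromList xs))))
  ... | false = ⊥-elim (<⇒≱ (≤-reflexive (sym (trans (cong ∣_∣ (sym absorbed)) e))) (size-fromList≤ xs))
   where
   absorbed : fromList (x ∷ xs) ≡ fromList xs
   absorbed = subset-ext λ v → trans (lookup-fromList (x ∷ xs) v) (trans (cong not (same v)) (sym (lookup-fromList xs v)))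
    where
    same : ∀ v → not (eqᵇ v x) ∧ fresh v xs ≡ fresh v xs
    same v with eqᵇ v x in g
    ... | false = refl
    ... | true = sym (trans (cong (λ z → fresh z xs) (eqᵇ⇒≡ {v = v} {w = x} g)) f)

 countSets≡∑ : ∀ {n} (P : Subset n → Bool) → Defs.countSets P ≡ ∑ (allSubsets n) (λ S → ι (P S))
 countSets≡∑ {n} P = counted (allSubsets n)
  where
  counted : ∀ xs → length (Data.List.Base.filter (λ S → P S Data.Bool.≟ true) xs) ≡ ∑ xs (λ S → ι (P S))
  counted [] = refl
  counted (S ∷ xs) with P S
  ... | true = cong suc (counted xs)
  ... | false = counted xs

 ∑-allSubsets-suc : ∀ {n} (f : Subset (suc n) → ℕ) → ∑ (allSubsets (suc n)) f ≡ ∑ (allSubsets n) (λ S → f (true Vec.∷ S)) + ∑ (allSubsets n) (λ S → f (false Vec.∷ S))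
 ∑-allSubsets-suc {n} f = trans (∑-++ (map (true Vec.∷_) (allSubsets n)) _ f) (cong₂ _+_ (∑-map (true Vec.∷_) (allSubsets n) f) (∑-map (false Vec.∷_) (allSubsets n) f))

 subsetB-insert : ∀ {n} (v : Fin n) D S → subsetB (⁅ v ⁆ ∪ D) S ≡ lookup S v ∧ subsetB D S
 subsetB-insert Fin.zero (true Vec.∷ D) (true Vec.∷ S) = cong (λ X → subsetB X S) (Subsetₚ.∪-identityˡ D)
 subsetB-insert Fin.zero (false Vec.∷ D) (true Vec.∷ S) = cong (λ X → subsetB X S) (Subsetₚ.∪-identityˡ D)
 subsetB-insert Fin.zero (true Vec.∷ D) (false Vec.∷ S) = refl
 subsetB-insert Fin.zero (false Vec.∷ D) (false Vec.∷ S) = refl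
 subsetB-insert (Fin.suc v) (true Vec.∷ D) (true Vec.∷ S) = subsetB-insert v D S
 subsetB-insert (Fin.suc v) (true Vec.∷ D) (false Vec.∷ S) = sym (Boolₚ.∧-zeroʳ _)
 subsetB-insert (Fin.suc v) (false Vec.∷ D) (true Vec.∷ S) = subsetB-insert v D S
 subsetB-insert (Fin.suc v) (false Vec.∷ D) (false Vec.∷ S) = subsetB-insert v D S

 subsetB-lookup : ∀ {n} (D S : Subset n) → subsetB D S ≡ true → ∀ v → ι (lookup D v) ≤ ι (lookup S v)
 subsetB-lookup (true Vec.∷ D) (true Vec.∷ S) e Fin.zero = ≤-refl
 subsetB-lookup (false Vec.∷ D) (c Vec.∷ S) e Fin.zero = z≤n
 subsetB-lookup (true Vec.∷ D) (true Vec.∷ S) e (Fin.suc v) = subsetB-lookup D S e v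
 subsetB-lookup (false Vec.∷ D) (true Vec.∷ S) e (Fin.suc v) = subsetB-lookup D S e v
 subsetB-lookup (false Vec.∷ D) (false Vec.∷ S) e (Fin.suc v) = subsetB-lookup D S e v

 subsetB-⊥ : ∀ {n} (S : Subset n) → subsetB Subset.⊥ S ≡ true
 subsetB-⊥ Vec.[] = refl
 subsetB-⊥ (true Vec.∷ S) = subsetB-⊥ S
 subsetB-⊥ (false Vec.∷ S) = subsetB-⊥ S

 subsetB-size : ∀ {n} (D S : Subset n) → subsetB D S ≡ true → ∣ D ∣ ≤ ∣ S ∣
 subsetB-size {n} D S e = subst₂ _≤_ (sym (size D)) (sym (size S)) (∑-mono (allFin n) (subsetB-lookup D S e))

 -- A set of the same size as D contains D only if it is D.
 ∑-subsets-exact : ∀ {n} (P : Subset n → Bool) D → (∀ S → P S ≡ true → ∣ S ∣ ≡ ∣ D ∣) →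
          ∑ (allSubsets n) (λ S → ι (P S ∧ subsetB D S)) ≡ ι (P D)
 ∑-subsets-exact P Vec.[] h = trans (+-identityʳ _) (cong ι (Boolₚ.∧-identityʳ (P Vec.[])))
 ∑-subsets-exact {suc n} P (true Vec.∷ D) h = begin
  ∑ (allSubsets (suc n)) (λ S → ι (P S ∧ subsetB (true Vec.∷ D) S))
   ≡⟨ ∑-allSubsets-suc {n} _ ⟩
  ∑ (allSubsets n) (λ S → ι (P (true Vec.∷ S) ∧ subsetB D S)) + ∑ (allSubsets n) (λ S → ι (P (false Vec.∷ S) ∧ false))
   ≡⟨ cong₂ _+_ (∑-subsets-exact (λ S → P (true Vec.∷ S)) D (λ S p → suc-injective (h (true Vec.∷ S) p)))
      (trans (∑-cong (allSubsets n) (λ S → cong ι (Boolₚ.∧-zeroʳ (P (false Vec.∷ S))))) (∑-0 (allSubsets n))) ⟩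
  ι (P (true Vec.∷ D)) + 0
   ≡⟨ +-identityʳ _ ⟩
  ι (P (true Vec.∷ D)) ∎
  where open ≡-Reasoning
 ∑-subsets-exact {suc n} P (false Vec.∷ D) h = begin
  ∑ (allSubsets (suc n)) (λ S → ι (P S ∧ subsetB (false Vec.∷ D) S))
   ≡⟨ ∑-allSubsets-suc {n} _ ⟩
  ∑ (allSubsets n) (λ S → ι (P (true Vec.∷ S) ∧ subsetB D S)) + ∑ (allSubsets n) (λ S → ι (P (false Vec.∷ S) ∧ subsetB D S))
   ≡⟨ cong₂ _+_ (trans (∑-cong (allSubsets n) (λ S → cong ι (larger S))) (∑-0 (allSubsets n)))
      (∑-subsets-exact (λ S → P (false Vec.∷ S)) D (λ S p → h (false Vec.∷ S) p)) ⟩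
  ι (P (false Vec.∷ D)) ∎
  where
  open ≡-Reasoning
  larger : ∀ S → P (true Vec.∷ S) ∧ subsetB D S ≡ false
  larger S with P (true Vec.∷ S) in p | subsetB D S in e
  ... | false | _ = refl
  ... | true | false = refl
  ... | true | true = ⊥-elim (<⇒≱ (≤-reflexive (h (true Vec.∷ S) p)) (subsetB-size D S e))

 module TupleCount {n k : ℕ} (P : Subset n → Bool) (uniform : ∀ S → P S ≡ true → ∣ S ∣ ≡ k) where

  private
   V = allFin n

  above : Subset n → ℕ
  above D = ∑ (allSubsets n) (λ S → ι (P S ∧ subsetB D S))

  P⇒uniq : ∀ xs → length xs ≡ k → P (fromList xs) ≡ true → uniq xs ≡ true
  P⇒uniq xs len p = full-size⇒uniq xs (trans (uniform (fromList xs) p) (sym len))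

  private
   above-suc : ∀ d j → uniq d ≡ true → length d + suc j ≡ k → ∑ V (λ v → ι (fresh v d) * above (fromList (v ∷ d))) ≡ suc j * above (fromList d)
   above-suc d j u len = begin
    ∑ V (λ v → ι (fresh v d) * above (fromList (v ∷ d)))
     ≡⟨ ∑-cong V (λ v → sym (∑-*ˡ Subsets (ι (fresh v d)) _)) ⟩
    ∑ V (λ v → ∑ Subsets (λ S → ι (fresh v d) * ι (P S ∧ subsetB (⁅ v ⁆ ∪ D) S)))
     ≡⟨ ∑-swap V Subsets _ ⟩
    ∑ Subsets (λ S → ∑ V (λ v → ι (fresh v d) * ι (P S ∧ subsetB (⁅ v ⁆ ∪ D) S)))
     ≡⟨ ∑-cong Subsets pointwise ⟩
    ∑ Subsets (λ S → suc j * ι (P S ∧ subsetB D S))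
     ≡⟨ ∑-*ˡ Subsets (suc j) _ ⟩
    suc j * above D ∎
    where
    open ≡-Reasoning
    Subsets = allSubsets n
    D = fromList d
    pointwise : ∀ S → ∑ V (λ v → ι (fresh v d) * ι (P S ∧ subsetB (⁅ v ⁆ ∪ D) S)) ≡ suc j * ι (P S ∧ subsetB D S)
    pointwise S = trans (∑-cong V (λ v → trans (cong (λ z → ι (fresh v d) * ι (P S ∧ z)) (subsetB-insert v D S)) (shuffle (fresh v d) (P S) (lookup S v) (subsetB D S))))
     (trans (∑-*ʳ V (ι (P S ∧ subsetB D S)) _) (cases (P S) refl (subsetB D S) refl))
     where
     shuffle : ∀ a p s b → ι a * ι (p ∧ (s ∧ b)) ≡ ι (s ∧ a) * ι (p ∧ b)
     shuffle true true true b = refl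
     shuffle true true false b = refl
     shuffle true false true b = refl
     shuffle true false false b = refl
     shuffle false p true b = refl
     shuffle false p false b = refl
     count : P S ≡ true → subsetB D S ≡ true → ∑ V (λ v → ι (lookup S v ∧ fresh v d)) ≡ suc j
     count p b = +-cancelʳ-≡ (length d) _ _ (begin
      ∑ V (λ v → ι (lookup S v ∧ fresh v d)) + length d
       ≡⟨ cong (∑ V (λ v → ι (lookup S v ∧ fresh v d)) +_) (trans (sym (size-fromList d u)) (size D)) ⟩
      ∑ V (λ v → ι (lookup S v ∧ fresh v d)) + ∑ V (λ v → ι (lookup D v))
       ≡⟨ trans (sym (∑-+ V _ _)) (∑-cong V (λ v → inside v)) ⟩
      ∑ V (λ v → ι (lookup S v))
       ≡⟨ trans (sym (size S)) (trans (uniform S p) (trans (sym len) (+-comm (length d) (suc j)))) ⟩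
      suc j + length d ∎)
      where
      inside : ∀ v → ι (lookup S v ∧ fresh v d) + ι (lookup D v) ≡ ι (lookup S v)
      inside v = trans (cong (λ z → ι (lookup S v ∧ fresh v d) + ι z) (lookup-fromList d v)) (table (lookup S v) (fresh v d) (subst (λ z → ι z ≤ ι (lookup S v)) (lookup-fromList d v) (subsetB-lookup D S b v)))
       where
       table : ∀ s f → ι (not f) ≤ ι s → ι (s ∧ f) + ι (not f) ≡ ι s
       table true true _ = refl
       table true false _ = refl
       table false true _ = refl
       table false false ()
     cases : ∀ x → P S ≡ x → ∀ b → subsetB D S ≡ b → ∑ V (λ v → ι (lookup S v ∧ fresh v d)) * ι (P S ∧ subsetB D S) ≡ suc j * ι (P S ∧ subsetB D S)
     cases true p true b = cong (_* ι (P S ∧ subsetB D S)) (count p b)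
     cases false p b _ = trans (cong (λ z → ∑ V (λ v → ι (lookup S v ∧ fresh v d)) * ι (z ∧ subsetB D S)) p) (trans (*-zeroʳ (∑ V (λ v → ι (lookup S v ∧ fresh v d)))) (sym (trans (cong (λ z → suc j * ι (z ∧ subsetB D S)) p) (*-zeroʳ (suc j)))))
     cases true p false b = trans (cong (λ z → ∑ V (λ v → ι (lookup S v ∧ fresh v d)) * ι z) zero′) (trans (*-zeroʳ (∑ V (λ v → ι (lookup S v ∧ fresh v d)))) (sym (trans (cong (λ z → suc j * ι z) zero′) (*-zeroʳ (suc j)))))
      where
      zero′ : P S ∧ subsetB D S ≡ false
      zero′ = cong₂ _∧_ p b

  tuple-count : ∀ j d → uniq d ≡ true → length d + j ≡ k → ∑ (tuples V j) (λ t → ι (P (fromList (t ++ d)))) ≡ j ! * above (fromList d)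
  tuple-count zero d u len = trans (+-identityʳ _) (trans (sym (∑-subsets-exact P (fromList d) (λ S p → trans (uniform S p) (trans (sym len) (trans (+-identityʳ _) (sym (size-fromList d u))))))) (sym (+-identityʳ _)))
  tuple-count (suc j) d u len = begin
   ∑ (tuples V (suc j)) (λ t → ι (P (fromList (t ++ d))))
    ≡⟨ ∑-tuples-suc V j _ ⟩
   ∑ V (λ v → ∑ (tuples V j) (λ t → ι (P (fromList (v ∷ t ++ d)))))
    ≡⟨ ∑-cong V inner ⟩
   ∑ V (λ v → j ! * (ι (fresh v d) * above (fromList (v ∷ d))))
    ≡⟨ trans (∑-*ˡ V (j !) _) (cong (j ! *_) (above-suc d j u len)) ⟩
   j ! * (suc j * above (fromList d))
    ≡⟨ ring (j !) j (above (fromList d)) ⟩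
   suc j ! * above (fromList d) ∎
   where
   open ≡-Reasoning
   ring : ∀ f j x → f * (suc j * x) ≡ suc j * f * x
   ring = solve-∀
   total : ∀ v {t} → t ∈ tuples V j → length (v ∷ t ++ d) ≡ k
   total v {t} t∈ = trans (cong suc (trans (length-++ t) (trans (cong (_+ length d) (tuple-length V j t∈)) (+-comm j (length d))))) (trans (sym (+-suc (length d) j)) len)
   inner : ∀ v → ∑ (tuples V j) (λ t → ι (P (fromList (v ∷ t ++ d)))) ≡ j ! * (ι (fresh v d) * above (fromList (v ∷ d)))
   inner v with fresh v d in f
   ... | true = trans (∑-cong (tuples V j) (λ t → cong (λ X → ι (P X)) (fromList-↭ (↭-sym (Permₚ.shift v t d)))))
           (trans (tuple-count j (v ∷ d) (f ∧ₜ u) (trans (sym (+-suc (length d) j)) len)) (cong (j ! *_) (sym (+-identityʳ _))))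
   ... | false = trans (trans (∑-cong∈ (tuples V j) absent) (∑-0 (tuples V j))) (sym (*-zeroʳ (j !)))
    where
    absent : ∀ {t} → t ∈ tuples V j → ι (P (fromList (v ∷ t ++ d))) ≡ 0
    absent {t} t∈ with P (fromList (v ∷ t ++ d)) in p
    ... | false = refl
    ... | true with () ← trans (sym (proj₁ (∧-true {fresh v (t ++ d)} (P⇒uniq (v ∷ t ++ d) (total v t∈) p)))) (trans (fresh-++ v t d) (trans (cong (fresh v t ∧_) f) (Boolₚ.∧-zeroʳ _)))

 falling-pascal : ∀ m j → falling (suc m) (suc j) ≡ falling m (suc j) + suc j * falling m j
 falling-pascal zero zero = refl
 falling-pascal (suc m) zero = ring m
  where
  ring : ∀ m → suc (suc m) * 1 ≡ suc m * 1 + 1 * 1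
  ring = solve-∀
 falling-pascal zero (suc j) = sym (*-zeroʳ (suc (suc j)))
 falling-pascal (suc m) (suc j) = begin
  suc (suc m) * X ≡⟨ cong (suc (suc m) *_) (falling-pascal m j) ⟩
  suc (suc m) * (Y + suc j * Z) ≡⟨ ring m j Y Z ⟩
  suc m * Y + (suc m * (suc j * Z) + (Y + suc j * Z)) ≡⟨ cong (λ x → suc m * Y + (x + (Y + suc j * Z))) (trans (*-exchange (suc m) (suc j) Z) (cong (suc j *_) (falling-pascal m j))) ⟩
  suc m * Y + (suc j * (Y + suc j * Z) + (Y + suc j * Z)) ≡⟨ cong (suc m * Y +_) (+-comm (suc j * (Y + suc j * Z)) _) ⟩
  suc m * Y + suc (suc j) * (Y + suc j * Z) ≡⟨ cong (λ x → suc m * Y + suc (suc j) * x) (sym (falling-pascal m j)) ⟩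
  suc m * Y + suc (suc j) * X ∎
  where
  open ≡-Reasoning
  X = falling (suc m) (suc j)
  Y = falling m (suc j)
  Z = falling m j
  ring : ∀ m j Y Z → suc (suc m) * (Y + suc j * Z) ≡ suc m * Y + (suc m * (suc j * Z) + (Y + suc j * Z))
  ring = solve-∀

 falling≡!*C : ∀ m j → falling m j ≡ j ! * (m Comb.C j)
 falling≡!*C m zero = refl
 falling≡!*C zero (suc j) = sym (trans (cong (suc j ! *_) (Comb.k>n⇒nCk≡0 {0} {suc j} (s≤s z≤n))) (*-zeroʳ (suc j !)))
 falling≡!*C (suc m) (suc j) = begin
  falling (suc m) (suc j) ≡⟨ falling-pascal m j ⟩
  falling m (suc j) + suc j * falling m j ≡⟨ cong₂ (λ x y → x + suc j * y) (falling≡!*C m (suc j)) (falling≡!*C m j) ⟩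
  suc j ! * (m Comb.C suc j) + suc j * (j ! * (m Comb.C j)) ≡⟨ ring j (j !) (m Comb.C j) (m Comb.C suc j) ⟩
  suc j ! * ((m Comb.C j) + (m Comb.C suc j)) ≡⟨ cong (suc j ! *_) (Comb.nCk+nC[k+1]≡[n+1]C[k+1] m j) ⟩
  suc j ! * (suc m Comb.C suc j) ∎
  where
  open ≡-Reasoning
  ring : ∀ j f x y → suc j * f * y + suc j * (f * x) ≡ suc j * f * (x + y)
  ring = solve-∀

 falling-lower : ∀ m j → (m ∸ j) ^ j ≤ falling m j
 falling-lower m zero = ≤-refl
 falling-lower zero (suc j) = ≤-refl
 falling-lower (suc m) (suc j) = *-mono-≤ (≤-trans (m∸n≤m m j) (n≤1+n m)) (falling-lower m j)

 bernoulli : ∀ n k ℓ → n * n ^ ℓ ≤ n * (n ∸ k) ^ ℓ + ℓ * k * n ^ ℓ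
 bernoulli n k zero = m≤m+n _ _
 bernoulli n k (suc ℓ) = linear 0 (+-mono-≤ (*-monoʳ-≤ n (bernoulli n k ℓ)) (+-mono-≤ (*-monoʳ-≤ (n * x ^ ℓ) (m≤n+m∸n n k)) (*-monoʳ-≤ (n * k) (^-monoˡ-≤ ℓ (m∸n≤m n k)))))
  (ring n (n ^ ℓ) x (x ^ ℓ) k ℓ)
  where
  x = n ∸ k
  ring : ∀ n p x q k l → n * (n * p) + (n * (n * q + l * k * p) + (n * q * (k + x) + n * k * p)) + 0 ≡ n * (x * q) + suc l * k * (n * p) + (n * (n * p) + (n * q * n + n * k * q))
  ring = solve-∀

 degree-arithmetic : ∀ Q₁ N X d → 0 < Q₁ → (2 * Q₁ ∸ 1) * X ≤ 2 * (2 * Q₁) * d → 2 * Q₁ * N ≤ 2 * Q₁ * X + N → Q₁ * N ≤ 2 * Q₁ * d + N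
 degree-arithmetic (suc Q₀) N X d _ h₁ h₂ = *-cancelˡ-pos (2 * (2 * suc Q₀)) (s≤s z≤n) (linear N (+-mono-≤ (*-monoʳ-≤ (2 * suc Q₀) h₁′) (*-monoʳ-≤ (suc (2 * Q₀)) h₂)) (ring Q₀ N X d))
  where
  h₁′ : suc (2 * Q₀) * X ≤ 2 * (2 * suc Q₀) * d
  h₁′ = subst (λ z → z * X ≤ 2 * (2 * suc Q₀) * d) (predecessor Q₀) h₁
   where
   predecessor : ∀ Q → 2 * suc Q ∸ 1 ≡ suc (2 * Q)
   predecessor Q = cong (_∸ 1) (*-suc 2 Q)
  ring : ∀ Q N X d → 2 * (2 * suc Q) * (suc Q * N) + (2 * suc Q * (2 * (2 * suc Q) * d) + suc (2 * Q) * (2 * suc Q * X + N)) + N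
   ≡ 2 * (2 * suc Q) * (2 * suc Q * d + N) + (2 * suc Q * (suc (2 * Q) * X) + suc (2 * Q) * (2 * suc Q * N))
  ring = solve-∀

 module Hypergraph {n : ℕ} (ℓ i j : ℕ) (ℓ≡ : i + j ≡ ℓ) (H : KGraph n (ℓ + ℓ)) where

  open Defs using (edge; uniform; degree)

  private
   V = allFin n
   k = ℓ + ℓ
   d = i + ℓ

  F : List (Fin n) → Bool
  F xs = edge H (fromList xs)

  F-↭ : ∀ {s t} → s ↭ t → F s ≡ F t
  F-↭ p = cong (edge H) (fromList-↭ p)

  adj : List (Fin n) → List (Fin n) → Bool
  adj S T = F (S ++ T)

  adj-sym : ∀ S T → adj S T ≡ adj T S
  adj-sym S T = F-↭ (++-comm S T)

  open TupleCount (edge H) (uniform H)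

  F-uniq : ∀ xs → length xs ≡ k → F xs ≡ true → uniq xs ≡ true
  F-uniq = P⇒uniq

  adj-uniq² : ∀ {S T} → length S ≡ ℓ → length T ≡ ℓ → adj S T ≡ true → uniq (S ++ T) ≡ true
  adj-uniq² {S} {T} eS eT e = F-uniq (S ++ T) (trans (length-++ S) (cong₂ _+_ eS eT)) e

  adj-uniq : ∀ {S T} → S ∈ tuples V ℓ → T ∈ tuples V ℓ → adj S T ≡ true → uniq S ≡ true
  adj-uniq {S} {T} S∈ T∈ e = uniq-++⁻ˡ S {T} (adj-uniq² {S} {T} (tuple-length V ℓ S∈) (tuple-length V ℓ T∈) e)

  open Structure V ℓ adj adj-sym adj-uniq

  degree≡above : ∀ D → degree H D ≡ above D
  degree≡above D = countSets≡∑ (λ S → edge H S ∧ subsetB D S)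

  module _ (p Q : ℕ) (large : ∀ D → ∣ D ∣ ≡ d → p * ((n ∸ d) Comb.C j) ≤ Q * degree H D) (ℓ≤n : ℓ ≤ n) where

   private
    x = n ∸ k

    k≡ : d + j ≡ k
    k≡ = trans (cong (_+ j) (+-comm i ℓ)) (trans (+-assoc ℓ i j) (cong (_+_ ℓ) ℓ≡))

    completions : ∀ S T → uniq (T ++ S) ≡ true → length (T ++ S) ≡ d → p * x ^ j ≤ Q * ∑ (tuples V j) (λ U → ι (F (U ++ (T ++ S))))
    completions S T u len = begin
     p * x ^ j ≤⟨ *-monoʳ-≤ p (subst (λ z → z ^ j ≤ falling (n ∸ d) j) (trans (∸-+-assoc n d j) (cong (n ∸_) k≡)) (falling-lower (n ∸ d) j)) ⟩
     p * falling (n ∸ d) j ≡⟨ cong (p *_) (falling≡!*C (n ∸ d) j) ⟩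
     p * (j ! * ((n ∸ d) Comb.C j)) ≡⟨ *-exchange p (j !) _ ⟩
     j ! * (p * ((n ∸ d) Comb.C j)) ≤⟨ *-monoʳ-≤ (j !) (large (fromList (T ++ S)) (trans (size-fromList (T ++ S) u) len)) ⟩
     j ! * (Q * degree H (fromList (T ++ S))) ≡⟨ trans (*-exchange (j !) Q _) (cong (λ z → Q * (j ! * z)) (degree≡above (fromList (T ++ S)))) ⟩
     Q * (j ! * above (fromList (T ++ S))) ≡⟨ cong (Q *_) (tuple-count j (T ++ S) u (trans (cong (_+ j) len) k≡)) ⟨
     Q * ∑ (tuples V j) (λ U → ι (F (U ++ (T ++ S)))) ∎
     where
     open ≤-Reasoning

   block-degree : ∀ {S} → S ∈ tuples V ℓ → uniq S ≡ true → p * x ^ ℓ ≤ Q * deg S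
   block-degree {S} S∈ u = begin
    p * x ^ ℓ
     ≡⟨ trans (cong (λ z → p * x ^ z) (sym ℓ≡)) (trans (cong (p *_) (^-distribˡ-+-* x i j)) (*-exchange p (x ^ i) (x ^ j))) ⟩
    x ^ i * (p * x ^ j)
     ≤⟨ *-monoˡ-≤ (p * x ^ j) (≤-trans (^-monoˡ-≤ i below) (falling-lower (n ∸ ℓ) i)) ⟩
    falling (n ∸ ℓ) i * (p * x ^ j)
     ≡⟨ cong (_* (p * x ^ j)) (∑-extends V S i (n ∸ ℓ) (uniq-allFin {n}) u (All.tabulate (λ {v} _ → ∈-V v)) (trans (cong (n ∸ ℓ +_) lenS) (trans (m∸n+n≡m ℓ≤n) (sym (length-tabulate id))))) ⟨
    ∑ (tuples V i) (λ T → ι (extends S T)) * (p * x ^ j)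
     ≡⟨ ∑-*ʳ (tuples V i) (p * x ^ j) _ ⟨
    ∑ (tuples V i) (λ T → ι (extends S T) * (p * x ^ j))
     ≤⟨ ∑-mono∈ (tuples V i) pointwise ⟩
    ∑ (tuples V i) (λ T → Q * ∑ (tuples V j) (λ U → ι (F (S ++ (T ++ U)))))
     ≡⟨ trans (∑-*ˡ (tuples V i) Q _) (cong (Q *_) (sym (trans (cong (λ z → ∑ (tuples V z) (λ T → ι (F (S ++ T)))) (sym ℓ≡)) (∑-tuples-+ V i j _)))) ⟩
    Q * deg S ∎
    where
    open ≤-Reasoning
    lenS : length S ≡ ℓ
    lenS = tuple-length V ℓ S∈
    below : x ≤ n ∸ ℓ ∸ i
    below = ≤-≡-trans (∸-monoʳ-≤ n (+-monoʳ-≤ ℓ (≤-≡-trans (m≤m+n i j) ℓ≡))) (sym (∸-+-assoc n ℓ i))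
    pointwise : ∀ {T} → T ∈ tuples V i → ι (extends S T) * (p * x ^ j) ≤ Q * ∑ (tuples V j) (λ U → ι (F (S ++ (T ++ U))))
    pointwise {T} T∈ with extends S T in e
    ... | false = z≤n
    ... | true = ≡-≤-trans (+-identityʳ _) (≤-trans (completions S T (trans (sym (extends≡uniq S T u)) e) (trans (length-++ T) (cong₂ _+_ (tuple-length V i T∈) lenS)))
      (≤-reflexive (cong (Q *_) (∑-cong (tuples V j) (λ U → cong ι (F-↭ (permute U)))))))
     where
     permute : ∀ U → U ++ (T ++ S) ↭ S ++ (T ++ U)
     permute U = ↭-trans (++-comm U (T ++ S)) (↭-trans (++⁺ʳ U (++-comm T S)) (↭-reflexive (++-assoc S T U)))

  min-degree : ∀ Q₁ → 0 < Q₁ → (∀ D → ∣ D ∣ ≡ d → (2 * Q₁ ∸ 1) * ((n ∸ d) Comb.C j) ≤ 2 * (2 * Q₁) * degree H D) → 2 * Q₁ * (ℓ * k) + ℓ < n → MinDegree Q₁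
  min-degree Q₁ Q₁>0 large big {S} S∈ u = degree-arithmetic Q₁ N (x ^ ℓ) (deg S) Q₁>0 (block-degree (2 * Q₁ ∸ 1) (2 * (2 * Q₁)) large (≤-trans (m≤n+m ℓ _) (<⇒≤ big)) S∈ u) power
   where
   x = n ∸ k
   n>0 : 0 < n
   n>0 = ≤-trans (s≤s z≤n) big
   N≡ : N ≡ n ^ ℓ
   N≡ = cong (_^ ℓ) (length-tabulate id)
   power : 2 * Q₁ * N ≤ 2 * Q₁ * x ^ ℓ + N
   power = subst (λ z → 2 * Q₁ * z ≤ 2 * Q₁ * x ^ ℓ + z) (sym N≡) (*-cancelˡ-pos n n>0 (linear 0
    (+-mono-≤ (*-monoʳ-≤ (2 * Q₁) (bernoulli n k ℓ)) (*-monoˡ-≤ (n ^ ℓ) (≤-trans (m≤m+n _ ℓ) (<⇒≤ big)))) (ring n Q₁ (n ^ ℓ) (x ^ ℓ) ℓ k)))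
    where
    ring : ∀ n Q p q l k → n * (2 * Q * p) + (2 * Q * (n * q + l * k * p) + n * p) + 0 ≡ n * (2 * Q * q + p) + (2 * Q * (n * p) + 2 * Q * (l * k) * p)
    ring = solve-∀

 hamming-∷ : ∀ {n} a b (S A : Subset n) → ∑ (allFin (suc n)) (λ v → ι (lookup (a Vec.∷ S) v xor lookup (b Vec.∷ A) v)) ≡ ι (a xor b) + ∑ (allFin n) (λ v → ι (lookup S v xor lookup A v))
 hamming-∷ a b S A = ∑-allFin-suc (λ v → ι (lookup (a Vec.∷ S) v xor lookup (b Vec.∷ A) v))

 rebalance : ∀ {n} (S : Subset n) c → c ≤ n → ∃[ A ] ∣ A ∣ ≡ c × ∑ (allFin n) (λ v → ι (lookup S v xor lookup A v)) ≤ ∣ ∣ S ∣ - c ∣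
 rebalance Vec.[] zero z≤n = Vec.[] , refl , z≤n
 rebalance {suc n} (true Vec.∷ S) (suc c) (s≤s c≤n) with rebalance S c c≤n
 ... | A , size≡ , near = true Vec.∷ A , cong suc size≡ , ≡-≤-trans (hamming-∷ true true S A) near
 rebalance {suc n} (true Vec.∷ S) zero _ with rebalance S zero z≤n
 ... | A , size≡ , near = false Vec.∷ A , size≡ , ≡-≤-trans (hamming-∷ true false S A) (≤-≡-trans (s≤s near) (cong suc (∣-∣-identityʳ _)))
 rebalance {suc n} (false Vec.∷ S) c c≤ with c ≤? n
 ... | yes c≤n with rebalance S c c≤n
 ... | A , size≡ , near = false Vec.∷ A , size≡ , ≡-≤-trans (hamming-∷ false false S A) near
 rebalance {suc n} (false Vec.∷ S) c c≤ | no c≰n with ≤-antisym c≤ (≰⇒> c≰n)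
 ... | refl with rebalance S n ≤-refl
 ... | A , size≡ , near = true Vec.∷ A , cong suc size≡ , ≡-≤-trans (hamming-∷ false true S A) (≤-trans (s≤s near)
     (≤-reflexive (trans (cong suc (m≤n⇒∣m-n∣≡n∸m S≤n)) (trans (sym (+-∸-assoc 1 S≤n)) (sym (m≤n⇒∣m-n∣≡n∸m (≤-trans S≤n (n≤1+n n))))))))
  where
  S≤n : ∣ S ∣ ≤ n
  S≤n = Subsetₚ.∣p∣≤n S

 oddB-∑ : ∀ {A : Set} (α : A → Bool) xs → Defs.oddB (∑ xs (λ v → ι (α v))) ≡ parity α xs
 oddB-∑ α [] = refl
 oddB-∑ α (v ∷ xs) = trans (step (α v) (∑ xs (λ v → ι (α v)))) (cong (α v xor_) (oddB-∑ α xs))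
  where
  step : ∀ a m → Defs.oddB (ι a + m) ≡ a xor Defs.oddB m
  step true m = refl
  step false m = refl

 ^-cancelˡ-≤ : ∀ j {a b} → a ^ suc j ≤ b ^ suc j → a ≤ b
 ^-cancelˡ-≤ j {a} {b} h with a ≤? b
 ... | yes le = le
 ... | no ¬le = ⊥-elim (<⇒≱ (^-monoˡ-< (suc j) (≰⇒> ¬le)) h)

 between : ∀ x y c → c + c ≤ x + y → x + y ≤ suc (c + c) → ∣ y - c ∣ ≤ ∣ x - y ∣
 between x y c low high with ≤-total y c
 ... | inj₁ y≤c = ≡-≤-trans (m≤n⇒∣m-n∣≡n∸m y≤c) (≤-≡-trans (∸-monoˡ-≤ y c≤x) (sym (m≤n⇒∣n-m∣≡n∸m (≤-trans y≤c c≤x))))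
  where
  c≤x : c ≤ x
  c≤x = +-cancelʳ-≤ c c x (≤-trans low (+-monoʳ-≤ x y≤c))
 ... | inj₂ c≤y = ≡-≤-trans (m≤n⇒∣n-m∣≡n∸m c≤y) (distance (≤-total x c))
  where
  distance : x ≤ c ⊎ c ≤ x → y ∸ c ≤ ∣ x - y ∣
  distance (inj₁ x≤c) = ≤-≡-trans (∸-monoʳ-≤ y x≤c) (sym (m≤n⇒∣m-n∣≡n∸m (≤-trans x≤c c≤y)))
  distance (inj₂ c≤x) with m≤n⇒m<n∨m≡n c≤x | m≤n⇒m<n∨m≡n c≤y
  ... | inj₂ refl | _ = ≤-reflexive (sym (m≤n⇒∣m-n∣≡n∸m c≤y))
  ... | _ | inj₂ refl = ≡-≤-trans (n∸n≡0 c) z≤n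
  ... | inj₁ c<x | inj₁ c<y = ⊥-elim (1+n≰n (≤-trans (≡-≤-trans (cong suc (sym (+-suc c c))) (+-mono-≤ c<x c<y)) high))

 closeness-arithmetic : ∀ G k n M D s₁ s₂ d → 0 < n → 0 < k → 32 * (G * k) ≤ D → D * s₁ ≤ 16 * k * M → n * s₂ ≤ k * d * M → 2 * (G * k) * d ≤ n → G * (s₁ + s₂) ≤ M
 closeness-arithmetic G k n M D s₁ s₂ d n>0 k>0 D≥ h₁ h₂ h₃ = *-cancelˡ-pos (32 * k * n) (*-pos (*-pos {32} (s≤s z≤n) k>0) n>0) (linear 0
  (+-mono-≤ (*-monoʳ-≤ (n * s₁) D≥) (+-mono-≤ (*-monoʳ-≤ n h₁) (+-mono-≤ (*-monoʳ-≤ (32 * (G * k)) h₂) (*-monoʳ-≤ (16 * (k * M)) h₃)))) (ring G k n M D s₁ s₂ d))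
  where
  ring : ∀ G k n M D s₁ s₂ d → 32 * k * n * (G * (s₁ + s₂)) + (n * s₁ * D + (n * (16 * k * M) + (32 * (G * k) * (k * d * M) + 16 * (k * M) * n))) + 0
   ≡ 32 * k * n * M + (n * s₁ * (32 * (G * k)) + (n * (D * s₁) + (32 * (G * k) * (n * s₂) + 16 * (k * M) * (2 * (G * k) * d))))
  ring = solve-∀

 image-id : ∀ {n} (S : Subset n) → image idₚ S ≡ S
 image-id S = Vecₚ.tabulate∘lookup S

 module Closeness {n : ℕ} (ℓ′ : ℕ) (H : KGraph n (suc ℓ′ + suc ℓ′)) (n>0 : 0 < n) where

  open Defs using (edge; uniform; countSets; oddB)

  private
   ℓ = suc ℓ′
   k = ℓ + ℓ
   V = allFin n
   n≡ : length V ≡ n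
   n≡ = length-tabulate id
   V>0 : 0 < length V
   V>0 = subst (0 <_) (sym n≡) n>0
   F : List (Fin n) → Bool
   F xs = edge H (fromList xs)
   F-↭ : ∀ {s t} → s ↭ t → F s ≡ F t
   F-↭ p = cong (edge H) (fromList-↭ p)

  bipartite : Bool → Subset n → KGraph n k
  bipartite false = Bodd n k
  bipartite true = Beven n k

  edge-bipartite : ∀ c A S → ∣ S ∣ ≡ k → edge (bipartite c A) S ≡ oddB ∣ S ∩ A ∣ xor c
  edge-bipartite c A S e = cases c (≡ᵇ-refl ∣ S ∣ k e)
   where
   ≡ᵇ-refl : ∀ a b → a ≡ b → (a Data.Nat.Base.≡ᵇ b) ≡ true
   ≡ᵇ-refl zero zero e = refl
   ≡ᵇ-refl (suc a) (suc b) e = ≡ᵇ-refl a b (suc-injective e)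
   cases : ∀ c → (∣ S ∣ Data.Nat.Base.≡ᵇ k) ≡ true → edge (bipartite c A) S ≡ oddB ∣ S ∩ A ∣ xor c
   cases false t = trans (cong (_∧ oddB ∣ S ∩ A ∣) t) (sym (Boolₚ.xor-identityʳ _))
   cases true t = trans (cong (_∧ not (oddB ∣ S ∩ A ∣)) t) (not-xor (oddB ∣ S ∩ A ∣))
    where
    not-xor : ∀ x → not x ≡ x xor true
    not-xor true = refl
    not-xor false = refl

  module _ (c : Bool) (A : Subset n) where

   difference : Subset n → Bool
   difference S = edge H S xor edge (bipartite c A) S

   difference-uniform : ∀ S → difference S ≡ true → ∣ S ∣ ≡ k
   difference-uniform S e = cases (edge H S) refl (edge (bipartite c A) S) refl
    where
    cases : ∀ x → edge H S ≡ x → ∀ y → edge (bipartite c A) S ≡ y → ∣ S ∣ ≡ k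
    cases true h _ _ = uniform H S h
    cases false _ true b = uniform (bipartite c A) S b
    cases false h false b with () ← trans (sym e) (cong₂ _xor_ h b)

   open TupleCount difference difference-uniform

   on-tuples : ∀ α {t} → t ∈ tuples V k → ι (difference (fromList (t ++ []))) ≤ ι ((F t xor parity α t) xor c) + ι (parity α t xor parity (lookup A) t)
   on-tuples α {t} t∈ rewrite ++-identityʳ t = cases (difference (fromList t)) refl
    where
    len : length t ≡ k
    len = tuple-length V k t∈
    cases : ∀ x → difference (fromList t) ≡ x → ι (difference (fromList t)) ≤ ι ((F t xor parity α t) xor c) + ι (parity α t xor parity (lookup A) t)
    cases false e = ≡-≤-trans (cong ι e) z≤n
    cases true e = ≡-≤-trans (cong (λ z → ι (F t xor z)) (trans (edge-bipartite c A (fromList t) (trans (size-fromList t u) len)) (cong (_xor c) (trans (cong oddB (size-fromList-∩ t A u)) (oddB-∑ (lookup A) t)))))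
     (truth-table 4 (λ f p p′ c → ι (f xor (p′ xor c))) (λ f p p′ c → ι ((f xor p) xor c) + ι (p xor p′)) tt (F t) (parity α t) (parity (lookup A) t) c)
     where
     u = P⇒uniq t len e

   count≤ : ∀ α → countSets (λ S → edge H S xor edge (bipartite c A) (image idₚ S)) ≤
    ∑ (tuples V k) (λ t → ι ((F t xor parity α t) xor c)) + ∑ (tuples V k) (λ t → ι (parity α t xor parity (lookup A) t))
   count≤ α = begin
    countSets (λ S → edge H S xor edge (bipartite c A) (image idₚ S))
     ≡⟨ countSets≡∑ (λ S → edge H S xor edge (bipartite c A) (image idₚ S)) ⟩
    ∑ (allSubsets n) (λ S → ι (edge H S xor edge (bipartite c A) (image idₚ S)))
     ≡⟨ ∑-cong (allSubsets n) (λ S → trans (cong (λ z → ι (edge H S xor edge (bipartite c A) z)) (image-id S)) (cong ι (sym (trans (cong (difference S ∧_) (subsetB-⊥ S)) (Boolₚ.∧-identityʳ _))))) ⟩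
    above (fromList [])
     ≤⟨ m≤n*m (above (fromList [])) (k !) {{k !≢0}} ⟩
    k ! * above (fromList [])
     ≡⟨ tuple-count k [] refl refl ⟨
    ∑ (tuples V k) (λ t → ι (difference (fromList (t ++ []))))
     ≤⟨ ∑-mono∈ (tuples V k) (on-tuples α) ⟩
    ∑ (tuples V k) (λ t → ι ((F t xor parity α t) xor c) + ι (parity α t xor parity (lookup A) t))
     ≡⟨ ∑-+ (tuples V k) _ _ ⟩
    ∑ (tuples V k) (λ t → ι ((F t xor parity α t) xor c)) + ∑ (tuples V k) (λ t → ι (parity α t xor parity (lookup A) t)) ∎
    where
    open ≤-Reasoning

  module _ (G D : ℕ) (D≥₁ : (3 + 32 * k) * (2 * (G * k)) ^ ℓ ≤ D) (D≥₂ : 32 * (G * k) ≤ D)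
       (a b : List (Fin n) → Bool) where

   private
    module Aff = Affine V F (λ {s} {t} → F-↭ {s} {t}) ℓ′ a b
    N = length V ^ ℓ
    Bs = tuples V ℓ

   close : D * Aff.Dis ≤ N * N → D * N ≤ 2 * D * ∑ Bs (λ B → ι (b B)) + N → 2 * D * ∑ Bs (λ B → ι (b B)) ≤ D * N + N →
       ∃[ A ] balanced A × ∃[ c ] G * countSets (λ S → edge H S xor edge (bipartite c A) (image idₚ S)) ≤ n ^ k
   close small lower upper = build (rebalance S h (⌊n/2⌋≤n n))
    where
    α = Aff.α V>0 D small
    c = Aff.c V>0 D small
    affine = Aff.affine V>0 D small
    open AffineBalance V F ℓ′ a b V>0 D α c
    S = Vec.tabulate α
    h = ⌊ n /2⌋
    k>0 : 0 < k
    k>0 = s≤s z≤n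
    S≡n₁ : ∣ S ∣ ≡ n₁
    S≡n₁ = trans (size S) (∑-cong V (λ v → cong ι (Vecₚ.lookup∘tabulate α v)))
    total : n₀ + n₁ ≡ n
    total = trans (sym (∑-+ V _ _)) (trans (∑-cong V (λ v → one (α v))) (trans (∑-1 V) n≡))
     where
     one : ∀ b → ι (not b) + ι b ≡ 1
     one true = refl
     one false = refl
    halves : h + ⌈ n /2⌉ ≡ n
    halves = ⌊n/2⌋+⌈n/2⌉≡n n
    ceiling : ∀ m → ⌈ m /2⌉ ≤ suc ⌊ m /2⌋
    ceiling zero = z≤n
    ceiling (suc zero) = ≤-refl
    ceiling (suc (suc m)) = s≤s (ceiling m)
    near : ∣ ∣ S ∣ - h ∣ ≤ ∣ n₀ - n₁ ∣
    near = subst (λ z → ∣ z - h ∣ ≤ ∣ n₀ - n₁ ∣) (sym S≡n₁) (between n₀ n₁ h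
     (≤-≡-trans (+-monoʳ-≤ h (⌊n/2⌋≤⌈n/2⌉ n)) (trans halves (sym total)))
     (≡-≤-trans (trans total (sym halves)) (≤-≡-trans (+-monoʳ-≤ h (ceiling n)) (+-suc h h))))
    gap : 2 * (G * k) * ∣ n₀ - n₁ ∣ ≤ n
    gap = ^-cancelˡ-≤ ℓ′ (*-cancelˡ-pos (3 + 32 * k) (s≤s z≤n) (begin
     (3 + 32 * k) * (2 * (G * k) * ∣ n₀ - n₁ ∣) ^ ℓ ≡⟨ cong ((3 + 32 * k) *_) (^-distrib-* (2 * (G * k)) ∣ n₀ - n₁ ∣ ℓ) ⟩
     (3 + 32 * k) * ((2 * (G * k)) ^ ℓ * ∣ n₀ - n₁ ∣ ^ ℓ) ≡⟨ *-assoc (3 + 32 * k) ((2 * (G * k)) ^ ℓ) (∣ n₀ - n₁ ∣ ^ ℓ) ⟨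
     (3 + 32 * k) * (2 * (G * k)) ^ ℓ * ∣ n₀ - n₁ ∣ ^ ℓ ≤⟨ *-monoˡ-≤ (∣ n₀ - n₁ ∣ ^ ℓ) D≥₁ ⟩
     D * ∣ n₀ - n₁ ∣ ^ ℓ ≤⟨ nearly-balanced small affine lower upper ⟩
     (3 + 32 * k) * N ≡⟨ cong (λ z → (3 + 32 * k) * z ^ ℓ) n≡ ⟩
     (3 + 32 * k) * n ^ ℓ ∎))
     where open ≤-Reasoning
    build : (∃[ A ] ∣ A ∣ ≡ h × ∑ V (λ v → ι (lookup S v xor lookup A v)) ≤ ∣ ∣ S ∣ - h ∣) →
        ∃[ A ] balanced A × ∃[ c ] G * countSets (λ S → edge H S xor edge (bipartite c A) (image idₚ S)) ≤ n ^ k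
    build (A , size≡ , dist) = A , balance , c , ≤-trans (*-monoʳ-≤ G (count≤ c A α))
     (subst (G * (s₁ + s₂) ≤_) (cong (_^ k) n≡) (closeness-arithmetic G k (length V) (length V ^ k) D s₁ s₂ d V>0 k>0 D≥₂
      (subst (λ z → D * s₁ ≤ 16 * k * z) (sym (^-distribˡ-+-* (length V) ℓ ℓ)) affine)
      (parity-change V α (lookup A) k)
      (≤-trans (*-monoʳ-≤ (2 * (G * k)) (≡-≤-trans (∑-cong V (λ v → cong (λ z → ι (z xor lookup A v)) (sym (Vecₚ.lookup∘tabulate α v)))) (≤-trans dist near))) (≤-≡-trans gap (sym n≡)))))
     where
     s₁ = ∑ (tuples V k) (λ t → ι ((F t xor parity α t) xor c))
     s₂ = ∑ (tuples V k) (λ t → ι (parity α t xor parity (lookup A) t))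
     d = ∑ V (λ v → ι (α v xor lookup A v))
     rest : n ∸ ∣ A ∣ ≡ ⌈ n /2⌉
     rest = trans (cong₂ _∸_ (sym halves) size≡) (m+n∸m≡n h _)
     balance : balanced A
     balance = ≡-≤-trans size≡ (≤-trans (⌊n/2⌋≤⌈n/2⌉ n) (≡-≤-trans (sym rest) (m≤m+n _ 1)))
         , ≡-≤-trans rest (≤-≡-trans (ceiling n) (trans (cong suc (sym size≡)) (+-comm 1 ∣ A ∣)))

 toℚ-≤ : ∀ (ε : ℚ) → 0ℚ ℚ.< ε → ∃[ G ] 0 < G × ∀ x y → G * x ≤ y → toℚ x ℚ.≤ ε ℚ.* toℚ y
 toℚ-≤ (mkℚ (ℤ.+ zero) d c) ε>0 with ℚ.*<* (ℤ.+<+ ()) ← ε>0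
 toℚ-≤ (mkℚ ℤ.-[1+ p ] d c) ε>0 with ℚ.*<* () ← ε>0
 toℚ-≤ ε@(mkℚ (ℤ.+ suc p) d c) ε>0 = suc d , s≤s z≤n , λ x y h → ℚₚ.toℚᵘ-cancel-≤ (ℚᵘₚ.≤-trans (ℚᵘₚ.≤-reflexive (ℚₚ.toℚᵘ-fromℚᵘ (mkℚᵘ (ℤ.+ x) 0)))
  (ℚᵘₚ.≤-trans (*≤* (subst₂ ℤ._≤_ (trans (ℤₚ.pos-* x (suc (d * 1))) refl) (trans (ℤₚ.pos-* (suc p * y) 1) (cong (ℤ._* ℤ.+ 1) (ℤₚ.pos-* (suc p) y))) (ℤ.+≤+ (bound x y h))))
  (ℚᵘₚ.≤-reflexive (ℚᵘₚ.≃-sym (ℚᵘₚ.≃-trans (ℚₚ.toℚᵘ-homo-* ε (toℚ y)) (ℚᵘₚ.*-congˡ {ℚ.toℚᵘ ε} (ℚₚ.toℚᵘ-fromℚᵘ (mkℚᵘ (ℤ.+ y) 0))))))))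
  where
  bound : ∀ x y → suc d * x ≤ y → x * suc (d * 1) ≤ suc p * y * 1
  bound x y h = ≡-≤-trans (trans (cong (λ z → x * suc z) (*-identityʳ d)) (*-comm x (suc d))) (≤-trans h (≤-≡-trans (m≤m+n y (p * y)) (sym (*-identityʳ (suc p * y)))))

 γ-degree : ∀ Q X d → (½ ℚ.- ℤ.+ 1 ℚ./ (4 * suc Q)) ℚ.* toℚ X ℚ.≤ toℚ d → (2 * suc Q ∸ 1) * X ≤ 2 * (2 * suc Q) * d
 γ-degree Q X d h = extract (ℚᵘₚ.≤-trans (ℚᵘₚ.≤-reflexive (ℚᵘₚ.≃-sym lhs)) (ℚᵘₚ.≤-trans (ℚₚ.toℚᵘ-mono-≤ h) (ℚᵘₚ.≤-reflexive (ℚₚ.toℚᵘ-fromℚᵘ (mkℚᵘ (ℤ.+ d) 0)))))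
  where
  γᵘ Xᵘ : ℚᵘ
  γᵘ = ℤ.+ 1 ℚᵘ./ (4 * suc Q)
  Xᵘ = mkℚᵘ (ℤ.+ X) 0
  lhs : ℚ.toℚᵘ ((½ ℚ.- ℤ.+ 1 ℚ./ (4 * suc Q)) ℚ.* toℚ X) ℚᵘ.≃ (ℚᵘ.½ ℚᵘ.- γᵘ) ℚᵘ.* Xᵘ
  lhs = ℚᵘₚ.≃-trans (ℚₚ.toℚᵘ-homo-* (½ ℚ.- ℤ.+ 1 ℚ./ (4 * suc Q)) (toℚ X)) (ℚᵘₚ.*-cong
   (ℚᵘₚ.≃-trans (ℚₚ.toℚᵘ-homo-+ ½ (ℚ.- (ℤ.+ 1 ℚ./ (4 * suc Q)))) (ℚᵘₚ.+-congʳ ℚᵘ.½ (ℚᵘₚ.≃-trans (ℚₚ.toℚᵘ-homo‿- (ℤ.+ 1 ℚ./ (4 * suc Q))) (ℚᵘₚ.-‿cong (ℚₚ.toℚᵘ-fromℚᵘ γᵘ)))))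
   (ℚₚ.toℚᵘ-fromℚᵘ Xᵘ))
  extract : (ℚᵘ.½ ℚᵘ.- γᵘ) ℚᵘ.* Xᵘ ℚᵘ.≤ mkℚᵘ (ℤ.+ d) 0 → (2 * suc Q ∸ 1) * X ≤ 2 * (2 * suc Q) * d
  extract (*≤* le) = *-cancelˡ-pos 2 (s≤s z≤n) (ℤₚ.drop‿+≤+ (subst₂ ℤ._≤_ left right le))
   where
   left : (ℤ.+ 1 ℤ.* ℤ.+ (4 * suc Q) ℤ.+ (ℤ.- ℤ.+ 1) ℤ.* ℤ.+ 2) ℤ.* ℤ.+ X ℤ.* ℤ.+ 1 ≡ ℤ.+ (2 * ((2 * suc Q ∸ 1) * X))
   left = begin
    (ℤ.+ 1 ℤ.* ℤ.+ (4 * suc Q) ℤ.+ (ℤ.- ℤ.+ 1) ℤ.* ℤ.+ 2) ℤ.* ℤ.+ X ℤ.* ℤ.+ 1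
     ≡⟨ cong (λ z → (ℤ.+ 1 ℤ.* ℤ.+ z ℤ.+ (ℤ.- ℤ.+ 1) ℤ.* ℤ.+ 2) ℤ.* ℤ.+ X ℤ.* ℤ.+ 1) (four Q) ⟩
    (ℤ.+ 1 ℤ.* ℤ.+ (2 * p + 2) ℤ.+ (ℤ.- ℤ.+ 1) ℤ.* ℤ.+ 2) ℤ.* ℤ.+ X ℤ.* ℤ.+ 1
     ≡⟨ cong (λ z → (ℤ.+ 1 ℤ.* z ℤ.+ (ℤ.- ℤ.+ 1) ℤ.* ℤ.+ 2) ℤ.* ℤ.+ X ℤ.* ℤ.+ 1) (trans (ℤₚ.pos-+ (2 * p) 2) (cong (ℤ._+ ℤ.+ 2) (ℤₚ.pos-* 2 p))) ⟩
    (ℤ.+ 1 ℤ.* (ℤ.+ 2 ℤ.* ℤ.+ p ℤ.+ ℤ.+ 2) ℤ.+ (ℤ.- ℤ.+ 1) ℤ.* ℤ.+ 2) ℤ.* ℤ.+ X ℤ.* ℤ.+ 1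
     ≡⟨ ring (ℤ.+ p) (ℤ.+ X) ⟩
    ℤ.+ 2 ℤ.* (ℤ.+ p ℤ.* ℤ.+ X)
     ≡⟨ trans (cong (ℤ.+ 2 ℤ.*_) (sym (ℤₚ.pos-* p X))) (sym (ℤₚ.pos-* 2 (p * X))) ⟩
    ℤ.+ (2 * (p * X)) ∎
    where
    open ≡-Reasoning
    p = 2 * suc Q ∸ 1
    four : ∀ Q → 4 * suc Q ≡ 2 * (2 * suc Q ∸ 1) + 2
    four Q = trans (expand Q) (cong (λ z → 2 * z + 2) (cong (_∸ 1) (sym (*-suc 2 Q))))
     where
     expand : ∀ Q → 4 * suc Q ≡ 2 * suc (2 * Q) + 2
     expand = solve-∀
    ring : ∀ p x → (ℤ.+ 1 ℤ.* (ℤ.+ 2 ℤ.* p ℤ.+ ℤ.+ 2) ℤ.+ (ℤ.- ℤ.+ 1) ℤ.* ℤ.+ 2) ℤ.* x ℤ.* ℤ.+ 1 ≡ ℤ.+ 2 ℤ.* (p ℤ.* x)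
    ring = ℤSolver.solve-∀
   right : ℤ.+ d ℤ.* ℤ.+ (2 * (4 * suc Q) * 1) ≡ ℤ.+ (2 * (2 * (2 * suc Q) * d))
   right = trans (sym (ℤₚ.pos-* d _)) (cong ℤ.+_ (ring d (suc Q)))
    where
    ring : ∀ d q → d * (2 * (4 * q) * 1) ≡ 2 * (2 * (2 * q) * d)
    ring = solve-∀

 combine : ∀ N q a b i j w x → N ^ a ≤ q ^ i * w → N ^ b ≤ q ^ j * x → N ^ (a + b) ≤ q ^ (i + j) * (w * x)
 combine N q a b i j w x h₁ h₂ = begin
  N ^ (a + b) ≡⟨ ^-distribˡ-+-* N a b ⟩
  N ^ a * N ^ b ≤⟨ *-mono-≤ h₁ h₂ ⟩
  q ^ i * w * (q ^ j * x) ≡⟨ interchange (q ^ i) w (q ^ j) x ⟩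
  q ^ i * q ^ j * (w * x) ≡⟨ cong (_* (w * x)) (^-distribˡ-+-* q i j) ⟨
  q ^ (i + j) * (w * x) ∎
  where
  open ≤-Reasoning
  interchange : ∀ a b c d → a * b * (c * d) ≡ a * c * (b * d)
  interchange = solve-∀

 am-gm : ∀ x y → 2 * (x * y) ≤ x * x + y * y
 am-gm x y with ≤-total x y
 ... | inj₁ le with m≤n⇒∃[o]m+o≡n le
 ... | o , refl = linear (o * o) z≤n (ring x o)
  where
  ring : ∀ x o → 2 * (x * (x + o)) + 0 + o * o ≡ x * x + (x + o) * (x + o) + 0
  ring = solve-∀
 am-gm x y | inj₂ le with m≤n⇒∃[o]m+o≡n le
 ... | o , refl = linear (o * o) z≤n (ring y o)
  where
  ring : ∀ y o → 2 * ((y + o) * y) + 0 + o * o ≡ (y + o) * (y + o) + y * y + 0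
  ring = solve-∀

 module Extensions {n : ℕ} (R : List (Fin n)) (ℓ : ℕ) (adj : Relation n)
          (adj-sym : Symmetric adj)
          (adj-uniq : DistinctNeighbours R ℓ adj) where

  open Structure R ℓ adj adj-sym adj-uniq public

  Block : Set
  Block = List (Fin n)

  Blocks : ℕ → Set
  Blocks zero = ⊤
  Blocks (suc j) = Block × Blocks j

  blocks : ∀ j → Blocks j → List Block
  blocks zero _ = []
  blocks (suc j) (B , e) = B ∷ blocks j e

  all : ∀ j → List (Blocks j)
  all zero = tt ∷ []
  all (suc j) = cartesianProductWith _,_ Bs (all j)

  nested : ∀ j → (Blocks j → ℕ) → ℕ
  nested zero f = f tt
  nested (suc j) f = ∑ Bs (λ B → nested j (λ e → f (B , e)))

  ∑-all : ∀ j (f : Blocks j → ℕ) → ∑ (all j) f ≡ nested j f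
  ∑-all zero f = +-identityʳ _
  ∑-all (suc j) f = trans (∑-cart _,_ Bs (all j) f) (∑-cong Bs (λ B → ∑-all j (λ e → f (B , e))))

  all-∈ : ∀ j {e} → e ∈ all j → All (_∈ Bs) (blocks j e)
  all-∈ zero e∈ = []
  all-∈ (suc j) e∈ with ∈-cartesianProductWith⁻ _,_ Bs (all j) e∈
  ... | B , e , B∈ , e∈′ , refl = B∈ ∷ all-∈ j e∈′

  nested-flat : ∀ j (f : List (Fin n) → ℕ) → nested j (λ e → f (concat (blocks j e))) ≡ ∑ (tuples R (j * ℓ)) f
  nested-flat zero f = sym (+-identityʳ _)
  nested-flat (suc j) f = trans (∑-cong Bs (λ B → nested-flat j (λ t → f (B ++ t)))) (sym (∑-tuples-+ R ℓ (j * ℓ) f))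

  length-all : ∀ j → length (all j) ≡ N ^ j
  length-all zero = refl
  length-all (suc j) = trans (sym (∑-1 (all (suc j)))) (trans (∑-cart _,_ Bs (all j) (λ _ → 1)) (trans (∑-cong Bs (λ _ → trans (∑-1 (all j)) (length-all j))) (∑-N (N ^ j))))

  private
   guard : ∀ j a (f : Blocks j → Bool) → nested j (λ e → ι (a ∧ f e)) ≡ ι a * nested j (λ e → ι (f e))
   guard zero a f = ι-∧ a (f tt)
   guard (suc j) a f = trans (∑-cong Bs (λ B → guard j a (λ e → f (B , e)))) (∑-*ˡ Bs (ι a) _)

  walk : ∀ j → Block → Block → (Block → Block → Blocks j → Bool) → Blocks (3 + j) → Bool
  walk j S T g (p , q , X , r) = adj S p ∧ (adj T q ∧ ((adj p X ∧ adj q X) ∧ g p q r))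

  private
   walk-sum : ∀ j S T g → nested (3 + j) (λ e → ι (walk j S T g e)) ≡
         ∑ Bs (λ p → ∑ Bs (λ q → ι (adj S p) * ι (adj T q) * (common p q * nested j (λ r → ι (g p q r)))))
   walk-sum j S T g = ∑-cong Bs λ p → ∑-cong Bs λ q → begin
    nested (1 + j) (λ e → ι (walk j S T g (p , q , e)))
     ≡⟨ trans (guard (1 + j) (adj S p) _) (cong (ι (adj S p) *_) (guard (1 + j) (adj T q) _)) ⟩
    ι (adj S p) * (ι (adj T q) * ∑ Bs (λ X → nested j (λ r → ι ((adj p X ∧ adj q X) ∧ g p q r))))
     ≡⟨ cong (λ z → ι (adj S p) * (ι (adj T q) * z)) (trans (∑-cong Bs (λ X → guard j (adj p X ∧ adj q X) (g p q))) (∑-*ʳ Bs (nested j (λ r → ι (g p q r))) _)) ⟩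
    ι (adj S p) * (ι (adj T q) * (common p q * nested j (λ r → ι (g p q r))))
     ≡⟨ *-assoc (ι (adj S p)) (ι (adj T q)) _ ⟨
    ι (adj S p) * ι (adj T q) * (common p q * nested j (λ r → ι (g p q r))) ∎
    where open ≡-Reasoning

  diamond : Block → Block → Blocks 4 → Bool
  diamond Z₁ X (Z₄ , Z₂ , Z₃ , Z₅ , tt) = adj Z₁ Z₄ ∧ (adj X Z₂ ∧ ((adj Z₄ Z₃ ∧ adj Z₂ Z₃) ∧ (adj Z₄ Z₅ ∧ adj Z₂ Z₅)))

  -- An extension (X₁ , X₃ , X₂ , Z₁ , C₁ , C₃ , C₂ , Z₄ , Z₂ , Z₃ , Z₅) of a path ending in P continues it by
  -- C₁ C₂ C₃ Z₁ X₁ X₂ X₃ Z₂ Z₃ Z₄ Z₅; the blocks X₁ X₂ X₃ can be released, leaving C₁ C₂ C₃ Z₁ Z₄ Z₃ Z₂ Z₅.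
  linked : Block → Block → Block → Blocks 8 → Bool
  linked P X₁ X₃ (Z₁ , r) = adj X₁ Z₁ ∧ walk 4 P Z₁ (λ _ _ → diamond Z₁ X₃) r

  valid : Block → Blocks 11 → Bool
  valid P (X₁ , X₃ , X₂ , r) = (adj X₁ X₂ ∧ adj X₃ X₂) ∧ linked P X₁ X₃ r

  serves : Block × Block → Blocks 11 → Bool
  serves (S , T) (X₁ , X₃ , r) = adj S X₁ ∧ adj T X₃

  module _ (q : ℕ) (N>0 : 0 < N) (connected : ∀ {S T} → S ∈ Bs → T ∈ Bs → uniq S ≡ true → uniq T ≡ true → N ^ 3 ≤ q ^ 1 * walks S T) where

   private
    diamonds : ∀ {Z X} → Z ∈ Bs → X ∈ Bs → uniq Z ≡ true → uniq X ≡ true → N ^ 4 ≤ q ^ 2 * nested 4 (λ e → ι (diamond Z X e))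
    diamonds {Z} {X} Z∈ X∈ uZ uX = subst (λ z → N ^ 4 ≤ q ^ 2 * z) (sym counted) (finish N q (walks Z X) _ (connected Z∈ X∈ uZ uX) squares)
     where
     open ≤-Reasoning
     w : Block → Block → ℕ
     w p r = ι (adj Z p) * ι (adj X r)
     counted : nested 4 (λ e → ι (diamond Z X e)) ≡ ∑ Bs (λ p → ∑ Bs (λ r → w p r * (common p r * common p r)))
     counted = ∑-cong Bs λ p → ∑-cong Bs λ r → trans (trans (guard 2 (adj Z p) _) (cong (ι (adj Z p) *_) (trans (guard 2 (adj X r) _)
      (cong (ι (adj X r) *_) (trans (∑-cong Bs (λ A → guard 1 (adj p A ∧ adj r A) _)) (∑-*ʳ Bs (common p r) _)))))) (sym (*-assoc (ι (adj Z p)) (ι (adj X r)) _))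
     bound : ∀ i c → i ≤ 1 → 2 * (q * N) * (i * c) ≤ q ^ 2 * (i * (c * c)) + N * N
     bound zero c _ = ≡-≤-trans (*-zeroʳ (2 * (q * N))) z≤n
     bound (suc zero) c _ = linear 0 (am-gm (q * c) N) (ring q N c)
      where
      ring : ∀ q N c → 2 * (q * N) * (1 * c) + (q * c * (q * c) + N * N) + 0 ≡ q * (q * 1) * (1 * (c * c)) + N * N + 2 * (q * c * N)
      ring = solve-∀
     bound (suc (suc i)) c (s≤s ())
     squares : 2 * (q * N) * walks Z X ≤ q ^ 2 * ∑ Bs (λ p → ∑ Bs (λ r → w p r * (common p r * common p r))) + N * (N * (N * N))
     squares = begin
      2 * (q * N) * walks Z X
       ≡⟨ trans (sym (∑-*ˡ Bs (2 * (q * N)) _)) (∑-cong Bs (λ p → sym (∑-*ˡ Bs (2 * (q * N)) _))) ⟩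
      ∑ Bs (λ p → ∑ Bs (λ r → 2 * (q * N) * (w p r * common p r)))
       ≤⟨ ∑-mono Bs (λ p → ∑-mono Bs (λ r → bound (w p r) (common p r) (*-mono-≤ (ι≤1 (adj Z p)) (ι≤1 (adj X r))))) ⟩
      ∑ Bs (λ p → ∑ Bs (λ r → q ^ 2 * (w p r * (common p r * common p r)) + N * N))
       ≡⟨ trans (∑-cong Bs (λ p → trans (∑-+ Bs _ _) (cong₂ _+_ (∑-*ˡ Bs (q ^ 2) _) (∑-N (N * N))))) (trans (∑-+ Bs _ _) (cong₂ _+_ (∑-*ˡ Bs (q ^ 2) _) (∑-N (N * (N * N))))) ⟩
      q ^ 2 * ∑ Bs (λ p → ∑ Bs (λ r → w p r * (common p r * common p r))) + N * (N * (N * N)) ∎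
     finish : ∀ N q W A → N ^ 3 ≤ q ^ 1 * W → 2 * (q * N) * W ≤ q ^ 2 * A + N * (N * (N * N)) → N ^ 4 ≤ q ^ 2 * A
     finish N q W A h₁ h₂ = linear 0 (+-mono-≤ (*-monoʳ-≤ (2 * N) h₁) h₂) (ring N q W A)
      where
      ring : ∀ N q W A → N * (N * (N * (N * 1))) + (2 * N * (q * 1 * W) + (q * (q * 1) * A + N * (N * (N * N)))) + 0
       ≡ q * (q * 1) * A + (2 * N * (N * (N * (N * 1))) + 2 * (q * N) * W)
      ring = solve-∀

    degree : ∀ {S} → S ∈ Bs → uniq S ≡ true → N ^ 1 ≤ q ^ 1 * deg S
    degree {S} S∈ u = *-cancelˡ-pos (N * N) (*-pos N>0 N>0) (linear 0 (+-mono-≤ (connected S∈ S∈ u u) (*-monoʳ-≤ (q ^ 1) few)) (ring N q (walks S S) (deg S)))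
     where
     few : walks S S ≤ N * N * deg S
     few = begin
      walks S S
       ≤⟨ ∑-mono Bs (λ p → ∑-mono Bs (λ r → *-mono-≤ {_} {ι (adj S p)} (≤-≡-trans (*-monoʳ-≤ (ι (adj S p)) (ι≤1 (adj S r))) (*-identityʳ (ι (adj S p)))) (∑-≤-const Bs 1 (λ X → ι≤1 (adj p X ∧ adj r X))))) ⟩
      ∑ Bs (λ p → ∑ Bs (λ r → ι (adj S p) * (length Bs * 1)))
       ≡⟨ trans (∑-cong Bs (λ p → trans (∑-N _) (cong (λ z → N * (ι (adj S p) * z)) (trans (*-identityʳ (length Bs)) (length-tuples R ℓ))))) (trans (∑-*ˡ Bs N _) (cong (N *_) (∑-*ʳ Bs N _))) ⟩
      N * (deg S * N)
       ≡⟨ reorder N (deg S) ⟩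
      N * N * deg S ∎
      where
      open ≤-Reasoning
      reorder : ∀ N d → N * (d * N) ≡ N * N * d
      reorder = solve-∀
     ring : ∀ N q w d → N * N * (N * 1) + (q * 1 * w + q * 1 * (N * N * d)) + 0 ≡ N * N * (q * 1 * d) + (N * (N * (N * 1)) + q * 1 * w)
     ring = solve-∀

    adj-uniqʳ : ∀ {S T} → S ∈ Bs → T ∈ Bs → adj S T ≡ true → uniq T ≡ true
    adj-uniqʳ {S} {T} S∈ T∈ e = adj-uniq T∈ S∈ (trans (adj-sym T S) e)

    restrict : ∀ (a : Block → Bool) K c (g : Block → ℕ) → (∀ {B} → B ∈ Bs → a B ≡ true → K ≤ c * g B) → K * ∑ Bs (λ B → ι (a B)) ≤ c * ∑ Bs (λ B → ι (a B) * g B)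
    restrict a K c g h = subst₂ _≤_ (∑-*ˡ Bs K _) (∑-*ˡ Bs c _) (∑-mono∈ Bs (λ {B} B∈ → cases (a B) (h B∈)))
     where
     cases : ∀ x {y} → (x ≡ true → K ≤ c * y) → K * ι x ≤ c * (ι x * y)
     cases true h = subst₂ _≤_ (sym (*-identityʳ K)) (cong (c *_) (sym (+-identityʳ _))) (h refl)
     cases false _ = ≡-≤-trans (*-zeroʳ K) z≤n

    links : ∀ {P X₁ X₃} → P ∈ Bs → X₁ ∈ Bs → X₃ ∈ Bs → uniq P ≡ true → uniq X₁ ≡ true → uniq X₃ ≡ true →
        N ^ 8 ≤ q ^ 4 * nested 8 (λ e → ι (linked P X₁ X₃ e))
    links {P} {X₁} {X₃} P∈ X₁∈ X₃∈ uP u₁ u₃ = begin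
     N ^ 8 ≡⟨ ^-distribˡ-+-* N 7 1 ⟩
     N ^ 7 * N ^ 1 ≤⟨ *-monoʳ-≤ (N ^ 7) (degree X₁∈ u₁) ⟩
     N ^ 7 * (q ^ 1 * deg X₁) ≡⟨ *-exchange (N ^ 7) (q ^ 1) (deg X₁) ⟩
     q ^ 1 * (N ^ 7 * deg X₁) ≤⟨ *-monoʳ-≤ (q ^ 1) (restrict (adj X₁) (N ^ 7) (q ^ 3) _ step) ⟩
     q ^ 1 * (q ^ 3 * ∑ Bs (λ Z → ι (adj X₁ Z) * nested 7 (λ e → ι (walk 4 P Z (λ _ _ → diamond Z X₃) e))))
                        ≡⟨ trans (sym (*-assoc (q ^ 1) (q ^ 3) _)) (cong₂ _*_ (sym (^-distribˡ-+-* q 1 3)) (sym (∑-cong Bs (λ Z → guard 7 (adj X₁ Z) _)))) ⟩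
     q ^ 4 * nested 8 (λ e → ι (linked P X₁ X₃ e)) ∎
     where
     open ≤-Reasoning
     step : ∀ {Z} → Z ∈ Bs → adj X₁ Z ≡ true → N ^ 7 ≤ q ^ 3 * nested 7 (λ e → ι (walk 4 P Z (λ _ _ → diamond Z X₃) e))
     step {Z} Z∈ e = subst (λ z → N ^ 7 ≤ q ^ 3 * z)
      (trans (trans (sym (trans (∑-cong Bs (λ p → ∑-*ʳ Bs d _)) (∑-*ʳ Bs d _))) (∑-cong Bs (λ p → ∑-cong Bs (λ r → *-assoc (ι (adj P p) * ι (adj Z r)) (common p r) d)))) (sym (walk-sum 4 P Z (λ _ _ → diamond Z X₃))))
      (combine N q 3 4 1 2 (walks P Z) d (connected P∈ Z∈ uP (adj-uniqʳ X₁∈ Z∈ e)) (diamonds Z∈ X₃∈ (adj-uniqʳ X₁∈ Z∈ e) u₃))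
      where
      d = nested 4 (λ e → ι (diamond Z X₃ e))

   serving : ∀ {P S T} → P ∈ Bs → S ∈ Bs → T ∈ Bs → uniq P ≡ true → uniq S ≡ true → uniq T ≡ true →
        N ^ 11 ≤ q ^ 5 * nested 11 (λ e → ι (serves (S , T) e ∧ valid P e))
   serving {P} {S} {T} P∈ S∈ T∈ uP uS uT = begin
    N ^ 11
     ≡⟨ ^-distribˡ-+-* N 8 3 ⟩
    N ^ 8 * N ^ 3
     ≤⟨ *-monoʳ-≤ (N ^ 8) (connected S∈ T∈ uS uT) ⟩
    N ^ 8 * (q ^ 1 * walks S T)
     ≡⟨ *-exchange (N ^ 8) (q ^ 1) (walks S T) ⟩
    q ^ 1 * (N ^ 8 * walks S T)
     ≤⟨ *-monoʳ-≤ (q ^ 1) many ⟩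
    q ^ 1 * (q ^ 4 * nested 11 (λ e → ι (walk 8 S T (linked P) e)))
     ≡⟨ trans (sym (*-assoc (q ^ 1) (q ^ 4) _)) (cong₂ _*_ (sym (^-distribˡ-+-* q 1 4)) (nested-cong 11 (λ (X₁ , X₃ , X₂ , r) → cong ι (sym (Boolₚ.∧-assoc (adj S X₁) (adj T X₃) _))))) ⟩
    q ^ 5 * nested 11 (λ e → ι (serves (S , T) e ∧ valid P e)) ∎
    where
    open ≤-Reasoning
    nested-cong : ∀ j {f g : Blocks j → ℕ} → (∀ e → f e ≡ g e) → nested j f ≡ nested j g
    nested-cong zero h = h tt
    nested-cong (suc j) h = ∑-cong Bs (λ B → nested-cong j (λ e → h (B , e)))
    term : Block → Block → ℕ
    term p r = nested 8 (λ e → ι (linked P p r e))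
    pointwise : ∀ {p r} → p ∈ Bs → r ∈ Bs → N ^ 8 * (ι (adj S p) * ι (adj T r) * common p r) ≤ q ^ 4 * (ι (adj S p) * ι (adj T r) * (common p r * term p r))
    pointwise {p} {r} p∈ r∈ = cases (adj S p) refl (adj T r) refl
     where
     cases : ∀ x → adj S p ≡ x → ∀ y → adj T r ≡ y → N ^ 8 * (ι x * ι y * common p r) ≤ q ^ 4 * (ι x * ι y * (common p r * term p r))
     cases false _ _ _ = ≡-≤-trans (*-zeroʳ (N ^ 8)) z≤n
     cases true _ false _ = ≡-≤-trans (*-zeroʳ (N ^ 8)) z≤n
     cases true e true f = linear 0 (*-monoʳ-≤ (common p r) (links P∈ p∈ r∈ uP (adj-uniqʳ S∈ p∈ e) (adj-uniqʳ T∈ r∈ f))) (ring (N ^ 8) (q ^ 4) (common p r) (term p r))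
      where
      ring : ∀ M Q c t → M * (1 * 1 * c) + c * (Q * t) + 0 ≡ Q * (1 * 1 * (c * t)) + c * M
      ring = solve-∀
    many : N ^ 8 * walks S T ≤ q ^ 4 * nested 11 (λ e → ι (walk 8 S T (linked P) e))
    many = begin
     N ^ 8 * walks S T
      ≡⟨ trans (sym (∑-*ˡ Bs (N ^ 8) _)) (∑-cong Bs (λ p → sym (∑-*ˡ Bs (N ^ 8) _))) ⟩
     ∑ Bs (λ p → ∑ Bs (λ r → N ^ 8 * (ι (adj S p) * ι (adj T r) * common p r)))
      ≤⟨ ∑-mono∈ Bs (λ p∈ → ∑-mono∈ Bs (λ r∈ → pointwise p∈ r∈)) ⟩
     ∑ Bs (λ p → ∑ Bs (λ r → q ^ 4 * (ι (adj S p) * ι (adj T r) * (common p r * term p r))))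
      ≡⟨ trans (∑-cong Bs (λ p → ∑-*ˡ Bs (q ^ 4) _)) (trans (∑-*ˡ Bs (q ^ 4) _) (cong (q ^ 4 *_) (sym (walk-sum 8 S T (linked P))))) ⟩
     q ^ 4 * nested 11 (λ e → ι (walk 8 S T (linked P) e)) ∎

 doubling : ∀ c → 0 < c → 2 * (c ∸ 1) ^ c ≤ c ^ c
 doubling (suc c) _ = ≤-trans (+-monoʳ-≤ (c ^ suc c) (≡-≤-trans (+-identityʳ _) (*-monoˡ-≤ (c ^ c) (n≤1+n c)))) (binomial c)
  where
  binomial : ∀ j → c ^ suc j + suc j * c ^ j ≤ suc c ^ suc j
  binomial zero = ≤-reflexive (trans (+-comm (c * 1) 1) refl)
  binomial (suc j) = linear (suc j * c ^ j) (*-monoʳ-≤ (suc c) (binomial j)) (ring c j (c ^ j) (suc c ^ suc j))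
   where
   ring : ∀ c j p s → c * (c * p) + suc (suc j) * (c * p) + suc c * s + suc j * p ≡ suc c * s + suc c * (c * p + suc j * p)
   ring = solve-∀

 -- A greedy choice of g elements, where a demand loses half of its weight whenever it is served.
 module Greedy {E D : Set} (exts : List E) (demands : List D) (serves : D → E → Bool) (ok : List E → E → Bool) (C g : ℕ) (C>0 : 0 < C) where

  Ok : List E → Set
  Ok [] = ⊤
  Ok (e ∷ es) = e ∈ exts × ok es e ≡ true × Ok es

  served : D → List E → ℕ
  served τ es = ∑ es (λ e → ι (serves τ e))

  private
   weight : D → List E → ℕ
   weight τ [] = 1
   weight τ (e ∷ es) = (if serves τ e then 1 else 2) * weight τ es

   total : List E → ℕ
   total es = ∑ demands (λ τ → weight τ es)

   weight>0 : ∀ τ es → 0 < weight τ es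
   weight>0 τ [] = s≤s z≤n
   weight>0 τ (e ∷ es) = *-pos (positive (serves τ e)) (weight>0 τ es)
    where
    positive : ∀ b → 0 < (if b then 1 else 2)
    positive true = s≤s z≤n
    positive false = s≤s z≤n

   weight-served : ∀ τ es → weight τ es * 2 ^ served τ es ≡ 2 ^ length es
   weight-served τ [] = refl
   weight-served τ (e ∷ es) = trans (step (serves τ e) (weight τ es) (served τ es)) (cong (2 *_) (weight-served τ es))
    where
    step : ∀ b w s → (if b then 1 else 2) * w * 2 ^ (ι b + s) ≡ 2 * (w * 2 ^ s)
    step true w s = ring w (2 ^ s)
     where
     ring : ∀ w p → 1 * w * (2 * p) ≡ 2 * (w * p)
     ring = solve-∀
    step false w s = *-assoc 2 w _

  module _ {τ₀ : D} (τ₀∈ : τ₀ ∈ demands)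
       (plenty : ∀ es → length es < g → Ok es → ∀ {τ} → τ ∈ demands → length exts ≤ C * ∑ exts (λ e → ι (serves τ e ∧ ok es e)))
       (exts>0 : 0 < length exts) where

   private
    Step : List E → Set
    Step es = ∃[ e ] e ∈ exts × ok es e ≡ true × 2 * C * total (e ∷ es) ≤ 2 * (2 * C ∸ 1) * total es

    step : ∀ es → length es < g → Ok es → Step es
    step es short oks = build (maximum exts (λ e → C * (ι (ok es e) * gain e)) (total es) exts>0 many)
     where
     gain : E → ℕ
     gain e = ∑ demands (λ τ → weight τ es * ι (serves τ e))
     W>0 : 0 < total es
     W>0 = ≤-trans (weight>0 τ₀ es) (∈⇒≤∑ (λ τ → weight τ es) τ₀∈)
     many : total es * length exts ≤ ∑ exts (λ e → C * (ι (ok es e) * gain e))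
     many = begin
      total es * length exts
       ≡⟨ ∑-*ʳ demands (length exts) _ ⟨
      ∑ demands (λ τ → weight τ es * length exts)
       ≤⟨ ∑-mono∈ demands (λ {τ} τ∈ → *-monoʳ-≤ (weight τ es) (plenty es short oks τ∈)) ⟩
      ∑ demands (λ τ → weight τ es * (C * ∑ exts (λ e → ι (serves τ e ∧ ok es e))))
       ≡⟨ ∑-cong demands (λ τ → trans (*-exchange (weight τ es) C _) (cong (C *_) (sym (∑-*ˡ exts (weight τ es) _)))) ⟩
      ∑ demands (λ τ → C * ∑ exts (λ e → weight τ es * ι (serves τ e ∧ ok es e)))
       ≡⟨ trans (∑-*ˡ demands C _) (cong (C *_) (∑-swap demands exts _)) ⟩
      C * ∑ exts (λ e → ∑ demands (λ τ → weight τ es * ι (serves τ e ∧ ok es e)))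
       ≡⟨ trans (sym (∑-*ˡ exts C _)) (∑-cong exts (λ e → cong (C *_) (trans (∑-cong demands (λ τ → split (weight τ es) (serves τ e) (ok es e))) (∑-*ˡ demands (ι (ok es e)) _)))) ⟩
      ∑ exts (λ e → C * (ι (ok es e) * gain e)) ∎
      where
      open ≤-Reasoning
      split : ∀ w s o → w * ι (s ∧ o) ≡ ι o * (w * ι s)
      split w true true = sym (+-identityʳ _)
      split w true false = *-zeroʳ w
      split w false true = sym (+-identityʳ _)
      split w false false = *-zeroʳ w
     halve : ∀ e → total (e ∷ es) + gain e ≡ 2 * total es
     halve e = trans (sym (∑-+ demands _ _)) (trans (∑-cong demands (λ τ → one (serves τ e) (weight τ es))) (∑-*ˡ demands 2 _))
      where
      one : ∀ b w → (if b then 1 else 2) * w + w * ι b ≡ 2 * w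
      one true w = ring w
       where
       ring : ∀ w → 1 * w + w * 1 ≡ 2 * w
       ring = solve-∀
      one false w = trans (cong (2 * w +_) (*-zeroʳ w)) (+-identityʳ _)
     shrink : ∀ C g t w → 0 < C → t + g ≡ 2 * w → w ≤ C * g → 2 * C * t ≤ 2 * (2 * C ∸ 1) * w
     shrink (suc C) g t w _ e h = linear 0 (+-mono-≤ (*-monoʳ-≤ 2 h) (*-monoʳ-≤ (2 * suc C) (≤-reflexive e))) (trans (ring C g t w) (cong (λ z → 2 * z * w + (2 * w + 2 * suc C * (t + g))) (cong (_∸ 1) (sym (*-suc 2 C)))))
      where
      ring : ∀ C g t w → 2 * suc C * t + (2 * (suc C * g) + 2 * suc C * (2 * w)) + 0 ≡ 2 * suc (2 * C) * w + (2 * w + 2 * suc C * (t + g))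
      ring = solve-∀
     build : (∃[ e ] e ∈ exts × total es ≤ C * (ι (ok es e) * gain e)) → Step es
     build (e , e∈ , le) = cases (ok es e) refl
      where
      cases : ∀ x → ok es e ≡ x → Step es
      cases true o = e , e∈ , o , shrink C (gain e) (total (e ∷ es)) (total es) C>0 (halve e)
       (≤-≡-trans le (cong (C *_) (trans (cong (λ z → ι z * gain e) o) (+-identityʳ _))))
      cases false o = ⊥-elim (<⇒≱ W>0 (≤-≡-trans le (trans (cong (λ z → C * (ι z * gain e)) o) (*-zeroʳ C))))

    Run : ℕ → Set
    Run j = ∃[ es ] length es ≡ j × Ok es × (2 * C) ^ j * total es ≤ (2 * (2 * C ∸ 1)) ^ j * length demands

    run : ∀ j → j ≤ g → Run j
    run zero _ = [] , refl , tt , ≤-reflexive (cong (1 *_) (∑-1 demands))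
    run (suc j) j<g = extend (run j (<⇒≤ j<g))
     where
     extend : Run j →
          Run (suc j)
     extend (es , len , oks , le) = attach (step es (subst (_< g) (sym len) j<g) oks)
      where
      attach : Step es →
           Run (suc j)
      attach (e , e∈ , o , le′) = e ∷ es , cong suc len , (e∈ , o , oks) , (begin
       2 * C * (2 * C) ^ j * total (e ∷ es) ≡⟨ swap₁ (2 * C) ((2 * C) ^ j) (total (e ∷ es)) ⟩
       (2 * C) ^ j * (2 * C * total (e ∷ es)) ≤⟨ *-monoʳ-≤ ((2 * C) ^ j) le′ ⟩
       (2 * C) ^ j * (2 * (2 * C ∸ 1) * total es) ≡⟨ *-exchange ((2 * C) ^ j) (2 * (2 * C ∸ 1)) (total es) ⟩
       2 * (2 * C ∸ 1) * ((2 * C) ^ j * total es) ≤⟨ *-monoʳ-≤ (2 * (2 * C ∸ 1)) le ⟩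
       2 * (2 * C ∸ 1) * ((2 * (2 * C ∸ 1)) ^ j * length demands) ≡⟨ *-assoc (2 * (2 * C ∸ 1)) _ _ ⟨
       (2 * (2 * C ∸ 1)) ^ suc j * length demands ∎)
       where
       open ≤-Reasoning
       swap₁ : ∀ a b c → a * b * c ≡ b * (a * c)
       swap₁ = solve-∀

   ServesAll : ℕ → Set
   ServesAll h = ∃[ es ] length es ≡ g × Ok es × ∀ {τ} → τ ∈ demands → h ≤ served τ es

   greedy : ∀ h → g ≡ 2 * C * (2 * h) → length demands ≤ 2 ^ h → ServesAll h
   greedy h g≡ demands≤ = conclude (run g ≤-refl)
    where
    conclude : Run g →
          ServesAll h
    conclude (es , len , oks , le) = es , len , oks , λ {τ} τ∈ → enough τ τ∈
     where
     p = 2 * C ∸ 1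
     p>0 : 0 < p
     p>0 = positive C C>0
      where
      positive : ∀ c → 0 < c → 0 < 2 * c ∸ 1
      positive (suc c) _ = ≤-trans (s≤s z≤n) (m≤n+m (suc (c + 0)) c)
     enough : ∀ τ → τ ∈ demands → h ≤ served τ es
     enough τ τ∈ = 2^-cancel (*-cancelˡ-pos (2 ^ h * (2 ^ g * p ^ g)) (*-pos (^-pos {2} h (s≤s z≤n)) (*-pos (^-pos {2} g (s≤s z≤n)) (^-pos g p>0))) (begin
      2 ^ h * (2 ^ g * p ^ g) * 2 ^ h ≡⟨ shuffle (2 ^ h) (2 ^ g) (p ^ g) ⟩
      2 ^ g * (2 ^ h * 2 ^ h * p ^ g) ≤⟨ *-monoʳ-≤ (2 ^ g) powers ⟩
      2 ^ g * (2 * C) ^ g ≡⟨ cong (_* (2 * C) ^ g) (trans (cong (2 ^_) (sym len)) (sym (weight-served τ es))) ⟩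
      weight τ es * 2 ^ s * (2 * C) ^ g ≤⟨ *-monoˡ-≤ ((2 * C) ^ g) (*-monoˡ-≤ (2 ^ s) (∈⇒≤∑ (λ τ → weight τ es) τ∈)) ⟩
      total es * 2 ^ s * (2 * C) ^ g ≡⟨ shuffle₂ (total es) (2 ^ s) ((2 * C) ^ g) ⟩
      2 ^ s * ((2 * C) ^ g * total es) ≤⟨ *-monoʳ-≤ (2 ^ s) (≤-trans le (≤-≡-trans (*-monoʳ-≤ ((2 * p) ^ g) demands≤) (cong (_* 2 ^ h) (^-distrib-* 2 p g)))) ⟩
      2 ^ s * (2 ^ g * p ^ g * 2 ^ h) ≡⟨ shuffle₃ (2 ^ s) (2 ^ g * p ^ g) (2 ^ h) ⟩
      2 ^ h * (2 ^ g * p ^ g) * 2 ^ s ∎))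
      where
      open ≤-Reasoning
      s = served τ es
      2^-cancel : ∀ {a b} → 2 ^ a ≤ 2 ^ b → a ≤ b
      2^-cancel {a} {b} le with a ≤? b
      ... | yes a≤b = a≤b
      ... | no ¬a≤b = ⊥-elim (<⇒≱ (^-monoʳ-< 2 (s≤s (s≤s z≤n)) (≰⇒> ¬a≤b)) le)
      shuffle : ∀ a b c → a * (b * c) * a ≡ b * (a * a * c)
      shuffle = solve-∀
      shuffle₂ : ∀ a b c → a * b * c ≡ b * (c * a)
      shuffle₂ = solve-∀
      shuffle₃ : ∀ a b c → a * (b * c) ≡ c * b * a
      shuffle₃ = solve-∀
      powers : 2 ^ h * 2 ^ h * p ^ g ≤ (2 * C) ^ g
      powers = subst₂ _≤_
       (trans (^-distrib-* 2 (p ^ (2 * C)) (2 * h)) (cong₂ _*_ (trans (cong (λ z → 2 ^ (h + z)) (+-identityʳ h)) (^-distribˡ-+-* 2 h h)) (trans (^-*-assoc p (2 * C) (2 * h)) (cong (p ^_) (sym g≡)))))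
       (trans (^-*-assoc (2 * C) (2 * C) (2 * h)) (cong ((2 * C) ^_) (sym g≡)))
       (^-monoˡ-≤ (2 * h) (doubling (2 * C) (*-pos {2} (s≤s z≤n) C>0)))

 complement : ∀ {n} (U R : List (Fin n)) → uniq U ≡ true → All (_∈ R) U → ∃[ R′ ] U ++ R′ ↭ R
 complement [] R u a = R , ↭-refl
 complement (v ∷ U) R u (v∈ ∷ a) with complement U R (proj₂ (∧-true {fresh v U} u)) a
 ... | R″ , p with Memₚ.∈-++⁻ U (∈-resp-↭ (↭-sym p) v∈)
 ... | inj₁ v∈U = ⊥-elim (fresh⇒∉ U (proj₁ (∧-true {fresh v U} u)) v∈U)
 ... | inj₂ v∈R″ with pick v∈R″
 ... | R′ , p′ = R′ , ↭-trans (↭-sym (Permₚ.shift v U R′)) (↭-trans (++⁺ˡ U (↭-sym p′)) p)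

 from : ∀ {A : Set} i (T : List A) {y ys} → drop i T ≡ y ∷ drop (suc i) T → ys ↭ take i T ++ drop (suc i) T → y ∷ ys ↭ T
 from i T {y} e p = ↭-trans (prep y p) (↭-trans (↭-sym (Permₚ.shift y (take i T) (drop (suc i) T))) (↭-reflexive (trans (cong (take i T ++_) (sym e)) (take++drop≡id i T))))

 module Reservoir {n : ℕ} (R : List (Fin n)) (ℓ : ℕ) (adj : Relation n)
          (adj-sym : Symmetric adj)
          (adj-uniq : DistinctNeighbours R ℓ adj)
          (uR : uniq R ≡ true) {P₀ : List (Fin n)} (P₀∈ : P₀ ∈ tuples R ℓ) (uP₀ : uniq P₀ ≡ true) where

  open Extensions R ℓ adj adj-sym adj-uniq public

  Ext : Set
  Ext = Blocks 11

  end : List Ext → Block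
  end [] = P₀
  end ((_ , _ , _ , _ , _ , _ , _ , _ , _ , _ , Z₅ , tt) ∷ _) = Z₅

  used : List Ext → List (Fin n)
  used [] = P₀
  used (e ∷ es) = concat (blocks 11 e) ++ used es

  ok : List Ext → Ext → Bool
  ok es e = valid (end es) e ∧ extends (used es) (concat (blocks 11 e))

  uniqs : List Block
  uniqs = filterᵇ uniq Bs

  Distinct : Block → Set
  Distinct B = B ∈ Bs × uniq B ≡ true

  module _ (C g : ℕ) (C>0 : 0 < C) where

   module Choice = Greedy (all 11) (cartesianProduct uniqs uniqs) serves ok C g C>0
   open Choice using (Ok; served)

   demanded : ∀ {S T} → Distinct S → Distinct T → (S , T) ∈ cartesianProduct uniqs uniqs
   demanded (S∈ , uS) (T∈ , uT) = ∈-cartesianProduct⁺ (∈-filter⁺ (Boolₚ.T? ∘ uniq) S∈ (subst T (sym uS) tt)) (∈-filter⁺ (Boolₚ.T? ∘ uniq) T∈ (subst T (sym uT) tt))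

   demanded⁻ : ∀ {τ} → τ ∈ cartesianProduct uniqs uniqs → Distinct (proj₁ τ) × Distinct (proj₂ τ)
   demanded⁻ τ∈ with ∈-cartesianProduct⁻ uniqs uniqs τ∈
   ... | S∈ , T∈ = distinct S∈ , distinct T∈
    where
    distinct : ∀ {S} → S ∈ uniqs → Distinct S
    distinct S∈ with Memₚ.∈-filter⁻ (Boolₚ.T? ∘ uniq) {xs = Bs} S∈
    ... | S∈ , t = S∈ , T⇒≡ t

   used-uniq : ∀ es → Ok es → uniq (used es) ≡ true
   used-uniq [] _ = uP₀
   used-uniq (e ∷ es) (_ , o , k) = trans (sym (extends≡uniq (used es) (concat (blocks 11 e)) (used-uniq es k))) (proj₂ (∧-true {valid (end es) e} o))

   ext-distinct : ∀ {e} es → Ok (e ∷ es) → All Distinct (blocks 11 e)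
   ext-distinct {e} es oks@(e∈ , _) = All.zip (all-∈ 11 e∈ , uniq-concat (blocks 11 e) (uniq-++⁻ˡ (concat (blocks 11 e)) (used-uniq (e ∷ es) oks)))

   end-distinct : ∀ es → Ok es → Distinct (end es)
   end-distinct [] _ = P₀∈ , uP₀
   end-distinct (e ∷ es) oks = last e (ext-distinct es oks)
    where
    last : ∀ e → All Distinct (blocks 11 e) → Distinct (end (e ∷ es))
    last (_ , _ , _ , _ , _ , _ , _ , _ , _ , _ , Z₅ , tt) (_ ∷ _ ∷ _ ∷ _ ∷ _ ∷ _ ∷ _ ∷ _ ∷ _ ∷ _ ∷ d ∷ []) = d

   length-used : ∀ es → Ok es → length (used es) ≡ (1 + 11 * length es) * ℓ
   length-used [] _ = trans (tuple-length R ℓ P₀∈) (sym (*-identityˡ ℓ))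
   length-used (e ∷ es) (e∈ , _ , k) = trans (length-++ (concat (blocks 11 e))) (trans (cong₂ _+_ (flat 11 e (all-∈ 11 e∈)) (length-used es k)) (ring (length es) ℓ))
    where
    flat : ∀ j e → All (_∈ Bs) (blocks j e) → length (concat (blocks j e)) ≡ j * ℓ
    flat zero e a = refl
    flat (suc j) (B , e) (B∈ ∷ a) = trans (length-++ B) (cong₂ _+_ (tuple-length R ℓ B∈) (flat j e a))
    ring : ∀ m l → 11 * l + (1 + 11 * m) * l ≡ (1 + 11 * suc m) * l
    ring = solve-∀

   used⊆ : ∀ es → Ok es → All (_∈ R) (used es)
   used⊆ [] _ = proj₂ (∈-tuples⁻ R ℓ P₀∈)
   used⊆ (e ∷ es) (e∈ , _ , k) = Allₚ.++⁺ (Allₚ.concat⁺ (All.map (λ B∈ → proj₂ (∈-tuples⁻ R ℓ B∈)) (all-∈ 11 e∈))) (used⊆ es k)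

  module _ (q : ℕ) (R>0 : 0 < length R) (connected : ∀ {S T} → S ∈ Bs → T ∈ Bs → uniq S ≡ true → uniq T ≡ true → N ^ 3 ≤ q ^ 1 * walks S T) (q>0 : 0 < q) where

   private
    N>0 : 0 < N
    N>0 = ^-pos ℓ R>0

   C : ℕ
   C = 2 * q ^ 5

   C>0 : 0 < C
   C>0 = *-pos {2} (s≤s z≤n) (^-pos 5 q>0)

   module _ (g : ℕ) (room : C * (11 * ℓ * (11 * ℓ + (1 + 11 * g) * ℓ)) ≤ length R) where

    open Greedy (all 11) (cartesianProduct uniqs uniqs) serves ok C g C>0

    private
     plenty : ∀ es → length es < g → Ok es → ∀ {τ} → τ ∈ cartesianProduct uniqs uniqs → length (all 11) ≤ C * ∑ (all 11) (λ e → ι (serves τ e ∧ ok es e))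
     plenty es short oks {τ} τ∈ = subst (_≤ C * y) (sym (length-all 11)) (finish (q ^ 5) (N ^ 11) y x (≤-trans many (*-monoʳ-≤ (q ^ 5) split)) rare)
      where
      y = ∑ (all 11) (λ e → ι (serves τ e ∧ ok es e))
      x = ∑ (tuples R (11 * ℓ)) (λ t → ι (not (extends (used es) t)))
      end∈ = end-distinct C g C>0 es oks
      dist = demanded⁻ C g C>0 τ∈
      many : N ^ 11 ≤ q ^ 5 * ∑ (all 11) (λ e → ι (serves τ e ∧ valid (end es) e))
      many = subst (λ z → N ^ 11 ≤ q ^ 5 * z) (sym (∑-all 11 _))
       (serving q N>0 connected (proj₁ end∈) (proj₁ (proj₁ dist)) (proj₁ (proj₂ dist)) (proj₂ end∈) (proj₂ (proj₁ dist)) (proj₂ (proj₂ dist)))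
      split : ∑ (all 11) (λ e → ι (serves τ e ∧ valid (end es) e)) ≤ y + x
      split = ≤-trans (∑-mono (all 11) (λ e → truth-table 3 (λ s v x → ι (s ∧ v)) (λ s v x → ι (s ∧ (v ∧ x)) + ι (not x)) tt (serves τ e) (valid (end es) e) (extends (used es) (concat (blocks 11 e)))))
       (≤-reflexive (trans (∑-+ (all 11) _ _) (cong (y +_) (trans (∑-all 11 _) (nested-flat 11 (λ t → ι (not (extends (used es) t))))))))
      rare : C * x ≤ N ^ 11
      rare = *-cancelˡ-pos (length R) R>0 (begin
       length R * (C * x) ≡⟨ reorder (length R) C x ⟩
       C * (x * length R) ≤⟨ *-monoʳ-≤ C (∑-¬extends R (used es) (11 * ℓ) uR) ⟩
       C * (11 * ℓ * (11 * ℓ + length (used es)) * length R ^ (11 * ℓ))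
        ≡⟨ trans (sym (*-assoc C _ _)) (cong₂ (λ u z → C * (11 * ℓ * (11 * ℓ + u)) * z) (length-used C g C>0 es oks) (trans (cong (length R ^_) (*-comm 11 ℓ)) (sym (^-*-assoc (length R) ℓ 11)))) ⟩
       C * (11 * ℓ * (11 * ℓ + (1 + 11 * length es) * ℓ)) * N ^ 11
        ≤⟨ *-monoˡ-≤ (N ^ 11) (≤-trans (*-monoʳ-≤ C (*-monoʳ-≤ (11 * ℓ) (+-monoʳ-≤ (11 * ℓ) (*-monoˡ-≤ ℓ (s≤s (*-monoʳ-≤ 11 (<⇒≤ short))))))) room) ⟩
       length R * N ^ 11 ∎)
       where
       open ≤-Reasoning
       reorder : ∀ r c x → r * (c * x) ≡ c * (x * r)
       reorder = solve-∀
      finish : ∀ c M y x → M ≤ c * (y + x) → 2 * c * x ≤ M → M ≤ 2 * c * y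
      finish c M y x h₁ h₂ = linear 0 (+-mono-≤ (*-monoʳ-≤ 2 h₁) h₂) (ring c M y x)
       where
       ring : ∀ c M y x → M + (2 * (c * (y + x)) + M) + 0 ≡ 2 * c * y + (2 * M + 2 * c * x)
       ring = solve-∀

    reservoir : ∀ h → g ≡ 2 * C * (2 * h) → N * N ≤ 2 ^ h →
          ∃[ es ] length es ≡ g × Ok es × ∀ {S T} → Distinct S → Distinct T → h ≤ served (S , T) es
    reservoir h g≡ N²≤ = build (greedy (demanded C g C>0 P₀d P₀d) plenty (subst (0 <_) (sym (length-all 11)) (^-pos 11 N>0)) h g≡ (≤-trans size≤ N²≤))
     where
     P₀d : Distinct P₀
     P₀d = P₀∈ , uP₀
     uniqs≤ : length uniqs ≤ N
     uniqs≤ = ≤-≡-trans (Listₚ.length-filter (Boolₚ.T? ∘ uniq) Bs) (length-tuples R ℓ)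
     size≤ : length (cartesianProduct uniqs uniqs) ≤ N * N
     size≤ = ≡-≤-trans (trans (sym (∑-1 (cartesianProduct uniqs uniqs))) (trans (∑-cart _,_ uniqs uniqs (λ _ → 1)) (trans (∑-cong uniqs (λ _ → ∑-1 uniqs)) (∑-const uniqs (length uniqs))))) (*-mono-≤ uniqs≤ uniqs≤)
     build : (∃[ es ] length es ≡ g × Ok es × ∀ {τ} → τ ∈ cartesianProduct uniqs uniqs → h ≤ served τ es) →
         ∃[ es ] length es ≡ g × Ok es × ∀ {S T} → Distinct S → Distinct T → h ≤ served (S , T) es
     build (es , len , oks , enough) = es , len , oks , λ dS dT → enough (demanded C g C>0 dS dT)

 module Following {A : Set} (adj : A → A → Bool) where

  follows : A → List A → Set
  follows S [] = ⊤
  follows S (B ∷ L) = adj S B ≡ true × follows B L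

  follows-++ : ∀ S L {B M} → follows S (L ++ B ∷ []) → follows B M → follows S (L ++ B ∷ M)
  follows-++ S [] (e , _) f = e , f
  follows-++ S (C ∷ L) (e , h) f = e , follows-++ C L h f

 module Absorption {n : ℕ} (R : List (Fin n)) (ℓ : ℕ) (adj : Relation n)
          (adj-sym : Symmetric adj)
          (adj-uniq : DistinctNeighbours R ℓ adj)
          (uR : uniq R ≡ true) {P₀ : List (Fin n)} (P₀∈ : P₀ ∈ tuples R ℓ) (uP₀ : uniq P₀ ≡ true)
          (C g : ℕ) (C>0 : 0 < C) where

  open Reservoir R ℓ adj adj-sym adj-uniq uR P₀∈ uP₀ hiding (C; C>0)
  open Greedy (all 11) (cartesianProduct uniqs uniqs) serves ok C g C>0 using (Ok; served)
  open Covers adj ℓ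
  open Following adj

  private
   flip : ∀ {S T} → adj S T ≡ true → adj T S ≡ true
   flip {S} {T} = trans (adj-sym T S)

   record Links (P : Block) (e : Ext) : Set where
    constructor links
    X₁ = proj₁ e
    X₃ = proj₁ (proj₂ e)
    X₂ = proj₁ (proj₂ (proj₂ e))
    r₄ = proj₂ (proj₂ (proj₂ e))
    Z₁ = proj₁ r₄
    C₁ = proj₁ (proj₂ r₄)
    C₃ = proj₁ (proj₂ (proj₂ r₄))
    r₇ = proj₂ (proj₂ (proj₂ r₄))
    C₂ = proj₁ r₇
    Z₄ = proj₁ (proj₂ r₇)
    Z₂ = proj₁ (proj₂ (proj₂ r₇))
    Z₃ = proj₁ (proj₂ (proj₂ (proj₂ r₇)))
    Z₅ = proj₁ (proj₂ (proj₂ (proj₂ (proj₂ r₇))))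
    field
     x₁₂ : adj X₁ X₂ ≡ true
     x₃₂ : adj X₃ X₂ ≡ true
     x₁z₁ : adj X₁ Z₁ ≡ true
     pc₁ : adj P C₁ ≡ true
     z₁c₃ : adj Z₁ C₃ ≡ true
     c₁₂ : adj C₁ C₂ ≡ true
     c₃₂ : adj C₃ C₂ ≡ true
     z₁₄ : adj Z₁ Z₄ ≡ true
     x₃z₂ : adj X₃ Z₂ ≡ true
     z₄₃ : adj Z₄ Z₃ ≡ true
     z₂₃ : adj Z₂ Z₃ ≡ true
     z₄₅ : adj Z₄ Z₅ ≡ true
     z₂₅ : adj Z₂ Z₅ ≡ true

   split : ∀ {a b} → a ∧ b ≡ true → a ≡ true × b ≡ true
   split {a} {b} = ∧-true {a} {b}

   valid⇒links : ∀ P e → valid P e ≡ true → Links P e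
   valid⇒links P (_ , _ , _ , _ , _ , _ , _ , _ , _ , _ , _ , tt) v =
    let
      a₁ , v₁ = split v
      a₂ , v₂ = split v₁
      a₃ , v₃ = split v₂
      a₄ , v₄ = split v₃
      a₅ , v₅ = split v₄
      a₆ , v₆ = split v₅
      a₇ , v₇ = split v₆
      a₈ , a₉ = split v₇
    in links (proj₁ (split a₁)) (proj₂ (split a₁)) a₂ a₃ a₄ (proj₁ (split a₅)) (proj₂ (split a₅)) a₆ a₇ (proj₁ (split a₈)) (proj₂ (split a₈)) (proj₁ (split a₉)) (proj₂ (split a₉))

  -- The second component says whether X₁ X₂ X₃ have been released.
  Flagged : Set
  Flagged = List (Ext × Bool)

  exts : Flagged → List Ext
  exts = map proj₁

  leg : Ext × Bool → List Block
  leg ((X₁ , X₃ , X₂ , Z₁ , C₁ , C₃ , C₂ , Z₄ , Z₂ , Z₃ , Z₅ , tt) , false) = Z₄ ∷ Z₃ ∷ Z₂ ∷ X₃ ∷ X₂ ∷ X₁ ∷ Z₁ ∷ C₃ ∷ C₂ ∷ C₁ ∷ []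
  leg ((X₁ , X₃ , X₂ , Z₁ , C₁ , C₃ , C₂ , Z₄ , Z₂ , Z₃ , Z₅ , tt) , true) = Z₂ ∷ Z₃ ∷ Z₄ ∷ Z₁ ∷ C₃ ∷ C₂ ∷ C₁ ∷ []

  -- The path from its current end back to P₀, without the end itself.
  after : Flagged → List Block
  after [] = []
  after (x ∷ fl) = leg x ++ end (exts fl) ∷ after fl

  after-follows : ∀ fl → Ok (exts fl) → ∀ {L} → follows P₀ L → follows (end (exts fl)) (after fl ++ L)
  after-follows [] _ f = f
  after-follows ((e , b) ∷ fl) (_ , o , k) {L} f = subst (follows (end (e ∷ exts fl))) (sym (++-assoc (leg (e , b)) _ L))
   (stretch e b (valid⇒links (end (exts fl)) e (proj₁ (split o))) (after-follows fl k f))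
   where
   stretch : ∀ e b → Links (end (exts fl)) e → ∀ {M} → follows (end (exts fl)) M → follows (end (e ∷ exts fl)) (leg (e , b) ++ end (exts fl) ∷ M)
   stretch (_ , _ , _ , _ , _ , _ , _ , _ , _ , _ , _ , tt) false l m =
    flip z₄₅ , z₄₃ , flip z₂₃ , flip x₃z₂ , x₃₂ , flip x₁₂ , x₁z₁ , z₁c₃ , c₃₂ , flip c₁₂ , flip pc₁ , m
    where open Links l
   stretch (_ , _ , _ , _ , _ , _ , _ , _ , _ , _ , _ , tt) true l m =
    flip z₂₅ , z₂₃ , flip z₄₃ , flip z₁₄ , z₁c₃ , c₃₂ , flip c₁₂ , flip pc₁ , m
    where open Links l

  free : Block × Block → Flagged → ℕ
  free τ fl = ∑ fl (λ (e , b) → ι (serves τ e ∧ not b))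

  private
   _≼_ : Flagged → Flagged → Set
   fl ≼ fl′ = ∀ τ → free τ fl ≤ suc (free τ fl′)

   Release : Block → Block → Flagged → Set
   Release S T fl = ∃[ mids ] ∃[ fl′ ] exts fl′ ≡ exts fl × follows S (mids ++ T ∷ []) × mids ++ after fl′ ↭ after fl × (fl ≼ fl′)

   release : ∀ S T fl → Ok (exts fl) → 0 < free (S , T) fl → Release S T fl
   release S T ((e@(X₁ , X₃ , X₂ , Z₁ , C₁ , C₃ , C₂ , Z₄ , Z₂ , Z₃ , Z₅ , tt) , false) ∷ fl) (_ , o , k) pos = cases (serves (S , T) e) refl
    where
    open Links (valid⇒links (end (exts fl)) e (proj₁ (split o))) using (x₁₂; x₃₂)
    released : X₁ ∷ X₂ ∷ X₃ ∷ leg (e , true) ↭ leg (e , false)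
    released = from 5 _ refl (from 4 _ refl (from 3 _ refl (from 2 _ refl (from 1 _ refl ↭-refl))))
    later : 0 < free (S , T) fl → Release S T ((e , false) ∷ fl)
    later pos′ with release S T fl k pos′
    ... | mids , fl′ , same , f , perm , less = mids , (e , false) ∷ fl′ , cong (e ∷_) same , f ,
     ↭-trans (shifts mids (leg (e , false))) (++⁺ˡ (leg (e , false)) (↭-trans (Permₚ.shift _ mids (after fl′)) (↭-trans (↭-reflexive (cong (λ z → end z ∷ _) same)) (prep _ perm)))) ,
     λ τ → ≤-≡-trans (+-monoʳ-≤ (ι (serves τ e ∧ true)) (less τ)) (+-suc _ _)
    cases : ∀ x → serves (S , T) e ≡ x → Release S T ((e , false) ∷ fl)
    cases true s = X₁ ∷ X₂ ∷ X₃ ∷ [] , (e , true) ∷ fl , refl , (proj₁ (split s) , x₁₂ , flip x₃₂ , flip (proj₂ (split s)) , tt) ,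
     ++⁺ʳ (end (exts fl) ∷ after fl) released ,
     λ τ → +-mono-≤ (ι≤1 (serves τ e ∧ true)) (m≤n+m (free τ fl) (ι (serves τ e ∧ false)))
    cases false s = later (subst (0 <_) (cong (λ z → ι (z ∧ true) + free (S , T) fl) s) pos)
   release S T ((e , true) ∷ fl) (_ , o , k) pos with release S T fl k (subst (0 <_) (cong (λ z → ι z + free (S , T) fl) (Boolₚ.∧-zeroʳ (serves (S , T) e))) pos)
   ... | mids , fl′ , same , f , perm , less = mids , (e , true) ∷ fl′ , cong (e ∷_) same , f ,
     ↭-trans (shifts mids (leg (e , true))) (++⁺ˡ (leg (e , true)) (↭-trans (Permₚ.shift _ mids (after fl′)) (↭-trans (↭-reflexive (cong (λ z → end z ∷ _) same)) (prep _ perm)))) ,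
     λ τ → ≤-≡-trans (+-monoʳ-≤ (ι (serves τ e ∧ false)) (less τ)) (+-suc _ _)

  gaps : Block → List Block → Block → ℕ
  gaps S [] T = ι (not (adj S T))
  gaps S (B ∷ Ms) T = ι (not (adj S B)) + gaps B Ms T

  private
   Bridge : Block → Block → Flagged → Set
   Bridge S T fl = ∃[ mids ] ∃[ fl′ ] exts fl′ ≡ exts fl × follows S (mids ++ T ∷ []) × mids ++ after fl′ ↭ after fl × (∀ τ → free τ fl ≤ ι (not (adj S T)) + free τ fl′)

   bridge : ∀ S T fl → Ok (exts fl) → ι (not (adj S T)) ≤ free (S , T) fl → Bridge S T fl
   bridge S T fl k h = cases (adj S T) refl
    where
    cases : ∀ x → adj S T ≡ x → Bridge S T fl
    cases true e = [] , fl , refl , (e , tt) , ↭-refl , λ τ → m≤n+m _ _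
    cases false e with release S T fl k (subst (λ z → ι (not z) ≤ free (S , T) fl) e h)
    ... | mids , fl′ , same , f , perm , less = mids , fl′ , same , f , perm , λ τ → subst (λ z → free τ fl ≤ ι (not z) + free τ fl′) (sym e) (less τ)

  repair : ∀ S Ms T fl → Ok (exts fl) → Distinct S → All Distinct Ms → Distinct T → (∀ {S′ T′} → Distinct S′ → Distinct T′ → gaps S Ms T ≤ free (S′ , T′) fl) →
       ∃[ Ms′ ] ∃[ fl′ ] exts fl′ ≡ exts fl × follows S (Ms′ ++ T ∷ []) × Ms′ ++ after fl′ ↭ Ms ++ after fl
  repair S [] T fl k dS dMs dT h with bridge S T fl k (h dS dT)
  ... | mids , fl′ , same , f , perm , _ = mids , fl′ , same , f , perm
  repair S (B ∷ Ms) T fl k dS (dB ∷ dMs) dT h with bridge S B fl k (≤-trans (m≤m+n _ _) (h dS dB))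
  ... | mids , fl₁ , same , f , perm , less with repair B Ms T fl₁ (subst Ok (sym same) k) dB dMs dT (λ d d′ → +-cancelˡ-≤ (ι (not (adj S B))) _ _ (≤-trans (h d d′) (less _)))
  ... | Ms′ , fl₂ , same′ , f′ , perm′ = mids ++ B ∷ Ms′ , fl₂ , trans same′ same ,
      subst (follows S) (sym (++-assoc mids (B ∷ Ms′) (T ∷ []))) (follows-++ S mids f f′) ,
      ↭-trans (↭-reflexive (++-assoc mids (B ∷ Ms′) (after fl₂))) (↭-trans (++⁺ˡ mids (prep B perm′))
       (↭-trans (shifts mids (B ∷ Ms)) (++⁺ˡ (B ∷ Ms) perm)))

  private
   gaps≤ : ∀ S Ms T → gaps S Ms T ≤ breaks Ms + 2
   gaps≤ S [] T = ≤-trans (ι≤1 (not (adj S T))) (s≤s z≤n)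
   gaps≤ S (B ∷ []) T = +-mono-≤ (ι≤1 (not (adj S B))) (ι≤1 (not (adj B T)))
   gaps≤ S (B ∷ C ∷ Ms) T = ≤-≡-trans (+-mono-≤ (ι≤1 (not (adj S B))) (inner B C Ms)) (ring (breaks (B ∷ C ∷ Ms)))
    where
    inner : ∀ B C Ms → gaps B (C ∷ Ms) T ≤ breaks (B ∷ C ∷ Ms) + 1
    inner B C [] = +-mono-≤ (≤-reflexive (sym (+-identityʳ _))) (ι≤1 (not (adj C T)))
    inner B C (E ∷ Ms) = ≤-≡-trans (+-monoʳ-≤ (ι (not (adj B C))) (inner C E Ms)) (sym (+-assoc (ι (not (adj B C))) _ 1))
    ring : ∀ x → 1 + (x + 1) ≡ x + 2
    ring = solve-∀

   fresh-flags : List Ext → Flagged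
   fresh-flags = map (_, false)

   exts-fresh : ∀ es → exts (fresh-flags es) ≡ es
   exts-fresh es = trans (sym (map-∘ es)) (Listₚ.map-id es)

   free-fresh : ∀ τ es → free τ (fresh-flags es) ≡ served τ es
   free-fresh τ es = trans (∑-map (_, false) es _) (∑-cong es (λ e → cong ι (Boolₚ.∧-identityʳ (serves τ e))))

   whole : ∀ es → concat (end es ∷ after (fresh-flags es)) ↭ used es
   whole [] = ↭-reflexive (++-identityʳ P₀)
   whole (e ∷ es) = ↭-trans (concat-↭ {Bs = end (e ∷ es) ∷ leg (e , false) ++ tail} {Cs = blocks 11 e ++ tail} (++⁺ʳ tail (rearrange e)))
    (↭-trans (↭-reflexive (sym (concat-++ (blocks 11 e) tail))) (++⁺ˡ (concat (blocks 11 e))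
     (↭-trans (↭-reflexive (cong (λ z → concat (end z ∷ after (fresh-flags es))) (exts-fresh es))) (whole es))))
    where
    tail = end (exts (fresh-flags es)) ∷ after (fresh-flags es)
    rearrange : ∀ e → end (e ∷ es) ∷ leg (e , false) ↭ blocks 11 e
    rearrange (_ , _ , _ , _ , _ , _ , _ , _ , _ , _ , _ , tt) = from 10 _ refl (from 7 _ refl (from 8 _ refl (from 7 _ refl (from 1 _ refl (from 1 _ refl (from 0 _ refl (from 0 _ refl (from 1 _ refl (from 1 _ refl ↭-refl)))))))))

   whole-distinct : ∀ es → Ok es → All Distinct (after (fresh-flags es))
   whole-distinct [] _ = []
   whole-distinct (e ∷ es) oks@(_ , _ , k) = Allₚ.++⁺ (part e (ext-distinct C g C>0 es oks)) (subst (Distinct ∘ end) (sym (exts-fresh es)) (end-distinct C g C>0 es k) ∷ whole-distinct es k)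
    where
    part : ∀ e → All Distinct (blocks 11 e) → All Distinct (leg (e , false))
    part (_ , _ , _ , _ , _ , _ , _ , _ , _ , _ , _ , tt) (x₁ ∷ x₃ ∷ x₂ ∷ z₁ ∷ c₁ ∷ c₃ ∷ c₂ ∷ z₄ ∷ z₂ ∷ z₃ ∷ _ ∷ []) = z₄ ∷ z₃ ∷ z₂ ∷ x₃ ∷ x₂ ∷ x₁ ∷ z₁ ∷ c₃ ∷ c₂ ∷ c₁ ∷ []

  absorb : ∀ es → Ok es → ∀ R′ → used es ++ R′ ↭ R → ∀ {b h} → Cover R′ b → b + 2 ≤ h → (∀ {S T} → Distinct S → Distinct T → h ≤ served (S , T) es) →
       ∃[ H ] ∃[ L ] concat (H ∷ L) ↭ R × All Distinct (H ∷ L) × follows H (L ++ H ∷ [])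
  absorb es oks R′ rest {b} {h} (Ms , perm , lengths , few) b≤ enough = build (repair P₀ Ms H fl₀ (subst Ok (sym (exts-fresh es)) oks) (P₀∈ , uP₀) dMs dH
    (λ {S′} {T′} d d′ → ≤-trans (gaps≤ P₀ Ms H) (≤-trans (+-monoˡ-≤ 2 few) (≤-trans b≤ (≤-≡-trans (enough d d′) (sym (free-fresh (S′ , T′) es)))))))
   where
   fl₀ = fresh-flags es
   H = end es
   dH : Distinct H
   dH = end-distinct C g C>0 es oks
   uniqMs : uniq (concat Ms) ≡ true
   uniqMs = trans (uniq-↭ perm) (uniq-++⁻ʳ (used es) (trans (uniq-↭ rest) uR))
   dMs : All Distinct Ms
   dMs = All.zip (distinct Ms lengths (All.tabulate (λ v∈ → ∈-resp-↭ rest (∈-++⁺ʳ (used es) (∈-resp-↭ perm v∈)))) , uniq-concat Ms uniqMs)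
    where
    distinct : ∀ Ms → All (λ B → length B ≡ ℓ) Ms → All (_∈ R) (concat Ms) → All (_∈ Bs) Ms
    distinct [] [] _ = []
    distinct (B ∷ Ms) (e ∷ es) a = subst (λ z → B ∈ tuples R z) e (∈-tuples⁺ R (Allₚ.++⁻ˡ B a)) ∷ distinct Ms es (Allₚ.++⁻ʳ B a)
   build : (∃[ Ms′ ] ∃[ fl′ ] exts fl′ ≡ exts fl₀ × follows P₀ (Ms′ ++ H ∷ []) × Ms′ ++ after fl′ ↭ Ms ++ after fl₀) →
       ∃[ H ] ∃[ L ] concat (H ∷ L) ↭ R × All Distinct (H ∷ L) × follows H (L ++ H ∷ [])
   build (Ms′ , fl′ , same , f , perm′) = H , after fl′ ++ Ms′ ,
    ↭-trans (concat-↭ permL) (↭-trans (++⁺ˡ H (↭-reflexive (sym (concat-++ (after fl₀) Ms)))) (↭-trans (↭-reflexive (sym (++-assoc H _ (concat Ms))))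
     (↭-trans (Permₚ.++⁺ (whole es) perm) rest))) ,
    All-resp-↭ (↭-sym permL) (dH ∷ Allₚ.++⁺ (whole-distinct es oks) dMs) ,
    subst₂ (λ z → follows (end z)) same′ (sym (++-assoc (after fl′) Ms′ (H ∷ []))) (after-follows fl′ (subst Ok (sym same′) oks) f)
    where
    same′ : exts fl′ ≡ es
    same′ = trans same (exts-fresh es)
    permL : H ∷ (after fl′ ++ Ms′) ↭ H ∷ (after fl₀ ++ Ms)
    permL = prep H (↭-trans (++-comm (after fl′) Ms′) (↭-trans perm′ (++-comm Ms (after fl₀))))

 module _ {A : Set} where

  nth : A → List A → ℕ → A
  nth d [] i = d
  nth d (x ∷ xs) zero = x
  nth d (x ∷ xs) (suc i) = nth d xs i

  nth-∈ : ∀ d xs {i} → i < length xs → nth d xs i ∈ xs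
  nth-∈ d (x ∷ xs) {zero} _ = here refl
  nth-∈ d (x ∷ xs) {suc i} (s≤s h) = there (nth-∈ d xs h)

  nth-++ˡ : ∀ d xs ys {i} → i < length xs → nth d (xs ++ ys) i ≡ nth d xs i
  nth-++ˡ d (x ∷ xs) ys {zero} _ = refl
  nth-++ˡ d (x ∷ xs) ys {suc i} (s≤s h) = nth-++ˡ d xs ys h

  nth-++ʳ : ∀ d xs ys i → nth d (xs ++ ys) (length xs + i) ≡ nth d ys i
  nth-++ʳ d [] ys i = refl
  nth-++ʳ d (x ∷ xs) ys i = nth-++ʳ d xs ys i

  take-suc-drop : ∀ d X p j → p + j < length X → take (suc j) (drop p X) ≡ take j (drop p X) ++ nth d X (p + j) ∷ []
  take-suc-drop d (x ∷ X) zero zero h = refl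
  take-suc-drop d (x ∷ X) zero (suc j) (s≤s h) = cong (x ∷_) (take-suc-drop d X zero j h)
  take-suc-drop d (x ∷ X) (suc p) j (s≤s h) = take-suc-drop d X p j h

  take-past : ∀ (B : List A) m X → take (length B + m) (B ++ X) ≡ B ++ take m X
  take-past [] m X = refl
  take-past (b ∷ B) m X = cong (b ∷_) (take-past B m X)

  take-concat : ∀ {ℓ} j Cs → All (λ B → length B ≡ ℓ) Cs → take (j * ℓ) (concat Cs) ≡ concat {A = A} (take j Cs)
  take-concat zero Cs a = refl
  take-concat {ℓ} (suc j) [] a = Listₚ.take-[] (ℓ + j * ℓ)
  take-concat (suc j) (B ∷ Cs) (refl ∷ a) = trans (take-past B (j * length B) (concat Cs)) (cong (B ++_) (take-concat j Cs a))

  drop-concat : ∀ {ℓ} j Cs → All (λ B → length B ≡ ℓ) Cs → drop (j * ℓ) (concat Cs) ≡ concat {A = A} (drop j Cs)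
  drop-concat zero Cs a = refl
  drop-concat {ℓ} (suc j) [] a = Listₚ.drop-[] (ℓ + j * ℓ)
  drop-concat (suc j) (B ∷ Cs) (refl ∷ a) = trans (past B (j * length B) (concat Cs)) (drop-concat j Cs a)
   where
   past : ∀ (B : List A) m X → drop (length B + m) (B ++ X) ≡ drop m X
   past [] m X = refl
   past (b ∷ B) m X = past B m X

  rotation : ∀ (W : List A) p → p ≤ length W → take (length W) (drop p (W ++ W)) ≡ drop p W ++ take p W
  rotation W p p≤ = begin
   take (length W) (drop p (W ++ W)) ≡⟨ cong (take (length W)) (drop-within p W p≤) ⟩
   take (length W) (drop p W ++ W) ≡⟨ cong (λ z → take z (drop p W ++ W)) whole ⟩
   take (length (drop p W) + p) (drop p W ++ W) ≡⟨ take-past (drop p W) p W ⟩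
   drop p W ++ take p W ∎
   where
   open ≡-Reasoning
   drop-within : ∀ p (X : List A) {Y} → p ≤ length X → drop p (X ++ Y) ≡ drop p X ++ Y
   drop-within zero X h = refl
   drop-within (suc p) (x ∷ X) (s≤s h) = drop-within p X h
   whole : length W ≡ length (drop p W) + p
   whole = sym (trans (cong (_+ p) (Listₚ.length-drop p W)) (m∸n+n≡m p≤))

 nth-injective : ∀ {n} d (W : List (Fin n)) → uniq W ≡ true → ∀ {i j} → i < length W → j < length W → nth d W i ≡ nth d W j → i ≡ j
 nth-injective d (x ∷ W) u {zero} {zero} _ _ e = refl
 nth-injective d (x ∷ W) u {zero} {suc j} _ (s≤s h) refl = ⊥-elim (fresh⇒∉ W (proj₁ (∧-true {fresh x W} u)) (nth-∈ d W h))
 nth-injective d (x ∷ W) u {suc i} {zero} (s≤s h) _ refl = ⊥-elim (fresh⇒∉ W (proj₁ (∧-true {fresh x W} u)) (nth-∈ d W h))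
 nth-injective d (x ∷ W) u {suc i} {suc j} (s≤s h) (s≤s h′) e = cong suc (nth-injective d W (proj₂ (∧-true {fresh x W} u)) h h′ e)

 intersection : ∀ {n} (X Y Z : List (Fin n)) → uniq (X ++ Y ++ Z) ≡ true → ∣ fromList (X ++ Y) ∩ fromList (Y ++ Z) ∣ ≡ length Y
 intersection X Y Z u = begin
  ∣ fromList (X ++ Y) ∩ fromList (Y ++ Z) ∣ ≡⟨ size-fromList-∩ (X ++ Y) (fromList (Y ++ Z)) (uniq-++⁻ˡ (X ++ Y) (trans (cong uniq (++-assoc X Y Z)) u)) ⟩
  ∑ (X ++ Y) (λ v → ι (lookup (fromList (Y ++ Z)) v)) ≡⟨ trans (∑-++ X Y _) (cong₂ _+_ (trans (∑-cong∈ X outside) (∑-0 X)) (trans (∑-cong∈ Y inside) (∑-1 Y))) ⟩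
  length Y ∎
  where
  open ≡-Reasoning
  outside : ∀ {v} → v ∈ X → ι (lookup (fromList (Y ++ Z)) v) ≡ 0
  outside {v} v∈ = trans (cong ι (lookup-fromList (Y ++ Z) v)) (cong (ι ∘ not) (disjoint X u v∈))
   where
   disjoint : ∀ X → uniq (X ++ Y ++ Z) ≡ true → v ∈ X → fresh v (Y ++ Z) ≡ true
   disjoint (x ∷ X) u (here refl) = proj₂ (∧-true {fresh x X} (trans (sym (fresh-++ x X (Y ++ Z))) (proj₁ (∧-true {fresh x (X ++ Y ++ Z)} u))))
   disjoint (x ∷ X) u (there v∈) = disjoint X (proj₂ (∧-true {fresh x (X ++ Y ++ Z)} u)) v∈
  inside : ∀ {v} → v ∈ Y → ι (lookup (fromList (Y ++ Z)) v) ≡ 1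
  inside {v} v∈ = trans (cong ι (lookup-fromList (Y ++ Z) v)) (cases (fresh v (Y ++ Z)) refl)
   where
   cases : ∀ b → fresh v (Y ++ Z) ≡ b → ι (not (fresh v (Y ++ Z))) ≡ 1
   cases false e = cong (ι ∘ not) e
   cases true e = ⊥-elim (fresh⇒∉ (Y ++ Z) e (∈-++⁺ˡ v∈))

 module Cycle {n′ : ℕ} (ℓ : ℕ) (H : KGraph (suc n′) (ℓ + ℓ)) (B₀ : List (Fin (suc n′))) (L : List (List (Fin (suc n′))))
        (perm : concat (B₀ ∷ L) ↭ allFin (suc n′)) (lengths : All (λ B → length B ≡ ℓ) (B₀ ∷ L))
        (cyclic : Following.follows (λ S T → Defs.edge H (fromList (S ++ T))) B₀ (L ++ B₀ ∷ [])) (large : 3 * ℓ ≤ suc n′) (ℓ>0 : 0 < ℓ) where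

  open Following (λ S T → Defs.edge H (fromList (S ++ T)))

  private
   n = suc n′
   k = ℓ + ℓ
   Bs = B₀ ∷ L
   M = length Bs
   Cs = Bs ++ Bs
   W = concat Bs
   X = W ++ W

   concat-length : ∀ {Ds : List (List (Fin n))} → All (λ B → length B ≡ ℓ) Ds → length (concat Ds) ≡ length Ds * ℓ
   concat-length {[]} [] = refl
   concat-length {D ∷ Ds} (e ∷ a) = trans (length-++ D) (cong₂ _+_ e (concat-length a))

   W-length : length W ≡ n
   W-length = trans (↭-length perm) (length-tabulate id)

   M*ℓ : M * ℓ ≡ n
   M*ℓ = trans (sym (concat-length lengths)) W-length

   M≥3 : 3 ≤ M
   M≥3 = *-cancelˡ-pos ℓ ℓ>0 (≡-≤-trans (*-comm ℓ 3) (≤-≡-trans large (trans (sym M*ℓ) (*-comm M ℓ))))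

   X≡ : X ≡ concat Cs
   X≡ = concat-++ Bs Bs

   Cs-lengths : All (λ B → length B ≡ ℓ) Cs
   Cs-lengths = Allₚ.++⁺ lengths lengths

   uW : uniq W ≡ true
   uW = trans (uniq-↭ perm) (uniq-allFin {n})

   σ : Fin n → Fin n
   σ v = nth Fin.zero W (toℕ v)

   σ-injective : ∀ {u v} → σ u ≡ σ v → u ≡ v
   σ-injective {u} {v} e = Finₚ.toℕ-injective (nth-injective Fin.zero W uW (bound u) (bound v) e)
    where
    bound : ∀ v → toℕ v < length W
    bound v = subst (toℕ v <_) (sym W-length) (Finₚ.toℕ<n v)

   cyclic-index : ∀ i → i < n + n → σ (fromℕ< (m%n<n i n)) ≡ nth Fin.zero X i
   cyclic-index i i< = trans (cong (nth Fin.zero W) (Finₚ.toℕ-fromℕ< (m%n<n i n))) (cases (i <? n))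
    where
    cases : Dec (i < n) → nth Fin.zero W (i % n) ≡ nth Fin.zero X i
    cases (yes i<n) = trans (cong (nth Fin.zero W) (m<n⇒m%n≡m i<n)) (sym (nth-++ˡ Fin.zero W W (subst (i <_) (sym W-length) i<n)))
    cases (no ¬i<n) with m≤n⇒∃[o]m+o≡n (≮⇒≥ ¬i<n)
    ... | o , refl = trans (cong (nth Fin.zero W) (trans (cong (_% n) (+-comm n o)) (trans ([m+n]%n≡m%n o n) (m<n⇒m%n≡m (+-cancelˡ-< n o n i<)))))
        (trans (sym (nth-++ʳ Fin.zero W W o)) (cong (λ z → nth Fin.zero X (z + o)) W-length))

   segment≡ : ∀ p j → p + j ≤ n + n → segment σ p j ≡ fromList (take j (drop p X))
   segment≡ p zero h = refl
   segment≡ p (suc j) h = trans (cong₂ (λ v S → ⁅ v ⁆ ∪ S) (cyclic-index (p + j) h′) (segment≡ p j (<⇒≤ h′)))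
    (trans (fromList-↭ (Permₚ.∷↭∷ʳ (nth Fin.zero X (p + j)) (take j (drop p X)))) (cong fromList (sym (take-suc-drop Fin.zero X p j (subst (p + j <_) (sym (trans (length-++ W) (cong₂ _+_ W-length W-length))) h′)))))
    where
    h′ : p + j < n + n
    h′ = subst (_≤ n + n) (+-suc p j) h

   window : ℕ → Subset n
   window i = fromList (concat (take 2 (drop i Cs)))

   segment-window : ∀ i → i < M → segment σ (i * ℓ) k ≡ window i
   segment-window i i<M = trans (segment≡ (i * ℓ) k fits) (cong fromList (begin
    take k (drop (i * ℓ) X) ≡⟨ cong (λ z → take k (drop (i * ℓ) z)) X≡ ⟩
    take k (drop (i * ℓ) (concat Cs)) ≡⟨ cong (take k) (drop-concat i Cs Cs-lengths) ⟩
    take k (concat (drop i Cs)) ≡⟨ cong (λ z → take (ℓ + z) (concat (drop i Cs))) (+-identityʳ ℓ) ⟨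
    take (2 * ℓ) (concat (drop i Cs)) ≡⟨ take-concat 2 (drop i Cs) (Allₚ.drop⁺ i Cs-lengths) ⟩
    concat (take 2 (drop i Cs)) ∎))
    where
    open ≡-Reasoning
    fits : i * ℓ + k ≤ n + n
    fits = ≤-≡-trans (+-mono-≤ (*-monoˡ-≤ ℓ (<⇒≤ i<M)) (≡-≤-trans (cong (ℓ +_) (sym (+-identityʳ ℓ))) (*-monoˡ-≤ ℓ (≤-trans (n≤1+n 2) M≥3)))) (cong₂ _+_ M*ℓ M*ℓ)

   around : follows B₀ (L ++ B₀ ∷ L)
   around = follows-++ B₀ L cyclic (prefix B₀ L cyclic)
    where
    prefix : ∀ S L {M} → follows S (L ++ M) → follows S L
    prefix S [] f = tt
    prefix S (B ∷ L) (e , f) = e , prefix B L f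

   consecutive : ∀ i S T {P Q Ds} → follows S T → drop i (S ∷ T) ≡ P ∷ Q ∷ Ds → Defs.edge H (fromList (P ++ Q)) ≡ true
   consecutive zero S (Q ∷ T) (e , f) refl = e
   consecutive (suc i) S (B ∷ T) (e , f) d = consecutive i B T f d
   consecutive (suc i) S [] f d with () ← trans (sym (Listₚ.drop-[] i)) d

   three : ∀ i → i < M → ∃[ P ] ∃[ Q ] ∃[ S ] ∃[ Ds ] drop i Cs ≡ P ∷ Q ∷ S ∷ Ds
   three i i<M = shape (drop i Cs) (≤-trans M≥3 (≡-≤-trans (sym (m+n∸n≡m M M)) (≤-≡-trans (∸-monoʳ-≤ (M + M) (<⇒≤ i<M)) (sym (trans (Listₚ.length-drop i Cs) (cong (_∸ i) (length-++ Bs)))))))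
    where
    shape : ∀ Ds → 3 ≤ length Ds → ∃[ P ] ∃[ Q ] ∃[ S ] ∃[ Es ] Ds ≡ P ∷ Q ∷ S ∷ Es
    shape (P ∷ Q ∷ S ∷ Es) _ = P , Q , S , Es , refl
    shape (P ∷ Q ∷ []) (s≤s (s≤s ()))
    shape (P ∷ []) (s≤s ())

   next-window : ∀ i → i < M → window (suc i % M) ≡ window (suc i)
   next-window i i<M with m≤n⇒m<n∨m≡n i<M
   ... | inj₁ lt = cong window (m<n⇒m%n≡m lt)
   ... | inj₂ eq = trans (cong window (trans (cong (_% M) eq) (n%n≡0 M))) (trans (cong (fromList ∘ concat) (trans (two L (≤-trans (s≤s (s≤s z≤n)) M≥3)) (cong (take 2) (sym (drop-++ Bs Bs refl))))) (cong window (sym eq)))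
    where
    two : ∀ L → 2 ≤ length (B₀ ∷ L) → take 2 ((B₀ ∷ L) ++ B₀ ∷ L) ≡ take 2 (B₀ ∷ L)
    two (B ∷ L) _ = refl
    two [] (s≤s ())

   edge-and-overlap : ∀ i → i < M → Defs.edge H (window i) ≡ true × ∣ window i ∩ window (suc i) ∣ ≡ ℓ
   edge-and-overlap i i<M with three i i<M
   ... | P , Q , S , Ds , e = trans (cong (Defs.edge H) window-i) (consecutive i B₀ (L ++ B₀ ∷ L) around e) ,
      trans (cong₂ (λ A B → ∣ A ∩ B ∣) window-i window-suc) (trans (intersection P Q S distinct) (middle (subst (All _) e (Allₚ.drop⁺ i Cs-lengths))))
    where
    pair : ∀ (A B : List (Fin n)) → concat (A ∷ B ∷ []) ≡ A ++ B
    pair A B = cong (A ++_) (++-identityʳ B)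
    window-i : window i ≡ fromList (P ++ Q)
    window-i = cong fromList (trans (cong (concat ∘ take 2) e) (pair P Q))
    drop-suc : ∀ i (Es : List (List (Fin n))) {A Ds} → drop i Es ≡ A ∷ Ds → drop (suc i) Es ≡ Ds
    drop-suc zero (E ∷ Es) refl = refl
    drop-suc (suc i) (E ∷ Es) d = drop-suc i Es d
    window-suc : window (suc i) ≡ fromList (Q ++ S)
    window-suc = cong fromList (trans (cong (concat ∘ take 2) (drop-suc i Cs e)) (pair Q S))
    middle : All (λ B → length B ≡ ℓ) (P ∷ Q ∷ S ∷ Ds) → length Q ≡ ℓ
    middle (_ ∷ q ∷ _) = q
    distinct : uniq (P ++ Q ++ S) ≡ true
    distinct = uniq-++⁻ˡ (P ++ Q ++ S) {drop (3 * ℓ) Y} (trans (cong uniq (trans (cong (_++ drop (3 * ℓ) Y) first) (take++drop≡id (3 * ℓ) Y))) (trans (uniq-↭ turned) uW))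
     where
     Y = take (length W) (drop (i * ℓ) X)
     small : 3 * ℓ ≤ length W
     small = ≤-≡-trans large (sym W-length)
     turned : Y ↭ W
     turned = ↭-trans (↭-reflexive (rotation W (i * ℓ) (≤-≡-trans (*-monoˡ-≤ ℓ (<⇒≤ i<M)) (trans M*ℓ (sym W-length)))))
      (↭-trans (++-comm (drop (i * ℓ) W) (take (i * ℓ) W)) (↭-reflexive (take++drop≡id (i * ℓ) W)))
     first : P ++ Q ++ S ≡ take (3 * ℓ) Y
     first = sym (begin
      take (3 * ℓ) Y ≡⟨ trans (Listₚ.take-take (3 * ℓ) (length W) (drop (i * ℓ) X)) (cong (λ z → take z (drop (i * ℓ) X)) (m≤n⇒m⊓n≡m small)) ⟩
      take (3 * ℓ) (drop (i * ℓ) X) ≡⟨ trans (cong (λ z → take (3 * ℓ) (drop (i * ℓ) z)) X≡) (cong (take (3 * ℓ)) (drop-concat i Cs Cs-lengths)) ⟩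
      take (3 * ℓ) (concat (drop i Cs)) ≡⟨ trans (take-concat 3 (drop i Cs) (Allₚ.drop⁺ i Cs-lengths)) (cong (concat ∘ take 3) e) ⟩
      P ++ Q ++ S ++ [] ≡⟨ cong (λ z → P ++ Q ++ z) (++-identityʳ S) ⟩
      P ++ Q ++ S ∎)
      where open ≡-Reasoning

  hamilton-cycle : HamiltonCycle ℓ H
  hamilton-cycle = length L , trans (cong (M *_) k∸ℓ) M*ℓ , σ , σ-injective , λ i i<M → subst (λ w →
    (Defs.edge H (segment σ (i * w) k) ≡ true) × (∣ segment σ (i * w) k ∩ segment σ (suc i % M * w) k ∣ ≡ ℓ)) (sym k∸ℓ)
    (trans (cong (Defs.edge H) (segment-window i i<M)) (proj₁ (edge-and-overlap i i<M)) ,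
     trans (cong₂ (λ A B → ∣ A ∩ B ∣) (segment-window i i<M) (trans (segment-window (suc i % M) (m%n<n (suc i) M)) (next-window i i<M))) (proj₂ (edge-and-overlap i i<M)))
   where
   k∸ℓ : k ∸ ℓ ≡ ℓ
   k∸ℓ = m+n∸n≡m ℓ ℓ

 module _ {A : Set} where

  ∑-tuples-↭ : ∀ {X Y : List A} j (f : List A → ℕ) → X ↭ Y → ∑ (tuples X j) f ≡ ∑ (tuples Y j) f
  ∑-tuples-↭ zero f p = refl
  ∑-tuples-↭ {X} {Y} (suc j) f p = trans (∑-tuples-suc X j f) (trans (∑-↭ _ p) (trans (∑-cong Y (λ y → ∑-tuples-↭ j (λ t → f (y ∷ t)) p)) (sym (∑-tuples-suc Y j f))))

  ∑-tuples-⊆ : ∀ (U X : List A) j (f : List A → ℕ) → ∑ (tuples X j) f ≤ ∑ (tuples (U ++ X) j) f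
  ∑-tuples-⊆ U X zero f = ≤-refl
  ∑-tuples-⊆ U X (suc j) f = begin
   ∑ (tuples X (suc j)) f ≡⟨ ∑-tuples-suc X j f ⟩
   ∑ X (λ x → ∑ (tuples X j) (λ t → f (x ∷ t))) ≤⟨ ∑-mono X (λ x → ∑-tuples-⊆ U X j (λ t → f (x ∷ t))) ⟩
   ∑ X (λ x → ∑ (tuples (U ++ X) j) (λ t → f (x ∷ t))) ≤⟨ m≤n+m _ _ ⟩
   ∑ U (λ x → ∑ (tuples (U ++ X) j) (λ t → f (x ∷ t))) + ∑ X (λ x → ∑ (tuples (U ++ X) j) (λ t → f (x ∷ t)))
                                ≡⟨ ∑-++ U X _ ⟨
   ∑ (U ++ X) (λ x → ∑ (tuples (U ++ X) j) (λ t → f (x ∷ t))) ≡⟨ ∑-tuples-suc (U ++ X) j f ⟨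
   ∑ (tuples (U ++ X) (suc j)) f ∎
   where open ≤-Reasoning

  module Restrict {U X V : List A} (p : U ++ X ↭ V) (j : ℕ) where

   sum-⊆ : ∀ f → ∑ (tuples X j) f ≤ ∑ (tuples V j) f
   sum-⊆ f = ≤-≡-trans (∑-tuples-⊆ U X j f) (∑-tuples-↭ j f p)

   private
    both : ∀ Y (f : List A → ℕ) c → (∀ s → f s ≤ c) → ∑ (tuples Y j) f + ∑ (tuples Y j) (λ s → c ∸ f s) ≡ length Y ^ j * c
    both Y f c f≤c = trans (sym (∑-+ (tuples Y j) _ _)) (trans (∑-cong (tuples Y j) (λ s → m+[n∸m]≡n (f≤c s))) (∑-tuples-const Y j c))

   -- Complementation turns the monotonicity of the sums into an upper bound.
   sum-loss : ∀ f c → (∀ s → f s ≤ c) → ∑ (tuples V j) f + length X ^ j * c ≤ ∑ (tuples X j) f + length V ^ j * c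
   sum-loss f c f≤c = linear 0 (+-mono-≤ (sum-⊆ (λ s → c ∸ f s)) (+-mono-≤ (≤-reflexive (sym (both X f c f≤c))) (≤-reflexive (both V f c f≤c))))
    (ring (∑ (tuples V j) f) (∑ (tuples X j) f) (length X ^ j * c) (length V ^ j * c) (∑ (tuples X j) (λ s → c ∸ f s)) (∑ (tuples V j) (λ s → c ∸ f s)))
    where
    ring : ∀ v x cx cv x′ v′ → v + cx + (v′ + (x + x′ + cv)) + 0 ≡ x + cv + (x′ + (cx + (v + v′)))
    ring = solve-∀

   sum²-⊆ : ∀ (f : List A → List A → ℕ) → ∑ (tuples X j) (λ a → ∑ (tuples X j) (f a)) ≤ ∑ (tuples V j) (λ a → ∑ (tuples V j) (f a))
   sum²-⊆ f = ≤-trans (∑-mono (tuples X j) (λ a → sum-⊆ (f a))) (sum-⊆ _)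

   private
    both² : ∀ Y (f : List A → List A → ℕ) c → (∀ a b → f a b ≤ c) → ∑ (tuples Y j) (λ a → ∑ (tuples Y j) (f a)) + ∑ (tuples Y j) (λ a → ∑ (tuples Y j) (λ b → c ∸ f a b)) ≡ length Y ^ j * (length Y ^ j * c)
    both² Y f c f≤c = trans (sym (∑-+ (tuples Y j) _ _)) (trans (∑-cong (tuples Y j) (λ a → both Y (f a) c (f≤c a))) (∑-tuples-const Y j _))

   sum²-loss : ∀ f c → (∀ a b → f a b ≤ c) → ∑ (tuples V j) (λ a → ∑ (tuples V j) (f a)) + length X ^ j * (length X ^ j * c) ≤ ∑ (tuples X j) (λ a → ∑ (tuples X j) (f a)) + length V ^ j * (length V ^ j * c)
   sum²-loss f c f≤c = linear 0 (+-mono-≤ (sum²-⊆ (λ a b → c ∸ f a b)) (+-mono-≤ (≤-reflexive (sym (both² X f c f≤c))) (≤-reflexive (both² V f c f≤c))))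
    (ring (∑ (tuples V j) (λ a → ∑ (tuples V j) (f a))) (∑ (tuples X j) (λ a → ∑ (tuples X j) (f a))) (length X ^ j * (length X ^ j * c)) (length V ^ j * (length V ^ j * c)) (∑ (tuples X j) (λ a → ∑ (tuples X j) (λ b → c ∸ f a b))) (∑ (tuples V j) (λ a → ∑ (tuples V j) (λ b → c ∸ f a b))))
    where
    ring : ∀ v x cx cv x′ v′ → v + cx + (v′ + (x + x′ + cv)) + 0 ≡ x + cv + (x′ + (cx + (v + v′)))
    ring = solve-∀

 module RestrictArithmetic (M y : ℕ) where

  N : ℕ
  N = M + y

  gain-bound : ∀ q gV gR → 12 * q * y ≤ N → suc (2 * q) * (N * N) ≤ q * gV → gV + M * (M * 5) ≤ gR + N * (N * 5) →
         suc (2 * (2 * q)) * (M * M) ≤ 2 * q * gR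
  gain-bound q gV gR small h₁ h₂ = linear (2 * (M * y) + y * y + 6 * (q * (y * y))) (+-mono-≤ (*-monoʳ-≤ 2 h₁) (+-mono-≤ (*-monoʳ-≤ (2 * q) h₂) (*-monoʳ-≤ N small))) (ring q M y gV gR)
   where
   ring : ∀ q M y gV gR → suc (2 * (2 * q)) * (M * M) + (2 * (q * gV) + (2 * q * (gR + (M + y) * ((M + y) * 5)) + (M + y) * (M + y))) + (2 * (M * y) + y * y + 6 * (q * (y * y)))
    ≡ 2 * q * gR + (2 * (suc (2 * q) * ((M + y) * (M + y))) + (2 * q * (gV + M * (M * 5)) + (M + y) * (12 * q * y)))
   ring = solve-∀

  module _ (κ : ℕ) (κ>0 : 0 < κ) (small : 4 * κ * y ≤ N) where

   private
    4y≤N : 4 * y ≤ N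
    4y≤N = ≤-trans (*-monoˡ-≤ y (≡-≤-trans (sym (*-identityʳ 4)) (*-monoʳ-≤ 4 κ>0))) small

   lower-bound : ∀ d dR → 2 * κ * N ≤ 2 * (2 * κ) * d + N → d + M * 1 ≤ dR + N * 1 → κ * M ≤ 2 * κ * dR + M
   lower-bound d dR h₁ h₂ = *-cancelˡ-pos 4 (s≤s z≤n) (linear 0 (+-mono-≤ (*-monoʳ-≤ 2 h₁) (+-mono-≤ (*-monoʳ-≤ (8 * κ) h₂) (+-mono-≤ small 4y≤N))) (ring κ M y d dR))
    where
    ring : ∀ κ M y d e → 4 * (κ * M) + (2 * (2 * (2 * κ) * d + (M + y)) + (8 * κ * (e + (M + y) * 1) + ((M + y) + (M + y)))) + 0
     ≡ 4 * (2 * κ * e + M) + (2 * (2 * κ * (M + y)) + (8 * κ * (d + M * 1) + (4 * κ * y + 4 * y)))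
    ring = solve-∀

   upper-bound : ∀ d dR → 2 * (2 * κ) * d ≤ 2 * κ * N + N → dR ≤ d → 2 * κ * dR ≤ κ * M + M
   upper-bound d dR h₁ h₂ = *-cancelˡ-pos 4 (s≤s z≤n) (linear 0 (+-mono-≤ (*-monoʳ-≤ (8 * κ) h₂) (+-mono-≤ (*-monoʳ-≤ 2 h₁) (+-mono-≤ small 4y≤N))) (ring κ M y d dR))
    where
    ring : ∀ κ M y d e → 4 * (2 * κ * e) + (8 * κ * d + (2 * (2 * κ * (M + y) + (M + y)) + ((M + y) + (M + y)))) + 0
     ≡ 4 * (κ * M + M) + (8 * κ * e + (2 * (2 * (2 * κ) * d) + (4 * κ * y + 4 * y)))
    ring = solve-∀

   defect-bound : ∀ δ e eR → 4 * δ * e ≤ N * N → eR ≤ e → δ * eR ≤ M * M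
   defect-bound δ e eR h₁ h₂ = *-cancelˡ-pos 4 (s≤s z≤n) (linear (2 * (M * M) + 2 * (y * y)) (+-mono-≤ (*-monoʳ-≤ (4 * δ) h₂) (+-mono-≤ h₁ (*-monoʳ-≤ (M + y) 4y≤N))) (ring M y δ e eR))
    where
    ring : ∀ M y δ e r → 4 * (δ * r) + (4 * δ * e + ((M + y) * (M + y) + (M + y) * (M + y))) + (2 * (M * M) + 2 * (y * y)) ≡ 4 * (M * M) + (4 * δ * r + (4 * δ * e + (M + y) * (4 * y)))
    ring = solve-∀

 quotient : ∀ c n → 0 < c → ∃[ h ] c * h ≤ n × n < c * suc h
 quotient (suc c) n _ = h , ≡-≤-trans (*-comm (suc c) h) (≤-≡-trans (m≤n+m _ (n % suc c)) (sym split)) ,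
  ≤-trans (s≤s (≤-reflexive split)) (≤-≡-trans (+-monoˡ-≤ (h * suc c) (m%n<n n (suc c))) (trans (cong (suc c +_) (*-comm h (suc c))) (sym (*-suc (suc c) h))))
  where
  h = n / suc c
  split = m≡m%n+[m/n]*n n (suc c)

 power≤exponential : ∀ p K n → 0 < K → 0 < p → 2 * p * K * (2 * p * K) ≤ n → ∀ h → n < K * suc h → n ^ p ≤ 2 ^ h
 power≤exponential p K n K>0 p>0 large h n< = build (quotient c n (*-pos (*-pos {2} (s≤s z≤n) p>0) K>0))
  where
  c = 2 * p * K
  n<2^n : ∀ r → r < 2 ^ r
  n<2^n zero = s≤s z≤n
  n<2^n (suc r) = +-mono-≤ (^-pos {2} r (s≤s z≤n)) (≤-trans (n<2^n r) (m≤m+n _ 0))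
  build : (∃[ r ] c * r ≤ n × n < c * suc r) → n ^ p ≤ 2 ^ h
  build (r , cr≤n , n<c) = ≤-trans (^-monoˡ-≤ p n≤) (≡-≤-trans (trans (^-*-assoc 2 (r + r) p) (cong (2 ^_) (ring r p))) (^-monoʳ-≤ 2 (<⇒≤pred below)))
   where
   ring : ∀ r p → (r + r) * p ≡ 2 * p * r
   ring = solve-∀
   c≤r : c ≤ r
   c≤r = <⇒≤pred (*-cancelˡ-< c c (suc r) (≤-<-trans large n<c))
   n≤ : n ≤ 2 ^ (r + r)
   n≤ = ≤-trans (<⇒≤ n<c) (≤-≡-trans (*-mono-≤ (≤-trans c≤r (<⇒≤ (n<2^n r))) (n<2^n r)) (sym (^-distribˡ-+-* 2 r r)))
   below : 2 * p * r < suc h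
   below = *-cancelˡ-< K (2 * p * r) (suc h) (≤-<-trans (≡-≤-trans (reorder K p r) cr≤n) n<)
    where
    reorder : ∀ K p r → K * (2 * p * r) ≡ 2 * p * K * r
    reorder = solve-∀

 reservoir-room : ∀ C ℓ h n K → 264 * (C * (ℓ * ℓ)) ≤ n → 968 * (C * C * (ℓ * ℓ)) ≤ K → K * h ≤ n → C * (11 * ℓ * (11 * ℓ + (1 + 11 * (2 * C * (2 * h))) * ℓ)) ≤ n
 reservoir-room C ℓ h n K h₁ h₂ h₃ = *-cancelˡ-pos 2 (s≤s z≤n) (linear 0 (+-mono-≤ h₁ (+-mono-≤ (*-monoˡ-≤ h h₂) h₃)) (ring C ℓ h n K))
  where
  ring : ∀ C l h n K → 2 * (C * (11 * l * (11 * l + (1 + 11 * (2 * C * (2 * h))) * l))) + (n + (K * h + n)) + 0 ≡ 2 * n + (264 * (C * (l * l)) + (968 * (C * C * (l * l)) * h + K * h))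
  ring = solve-∀

 reservoir-light : ∀ C ℓ h n K K′ → 2 * (K * (ℓ * ℓ)) ≤ n → 88 * (K * C * (ℓ * ℓ)) ≤ K′ → K′ * h ≤ n → K * (ℓ * ((1 + 11 * (2 * C * (2 * h))) * ℓ)) ≤ n
 reservoir-light C ℓ h n K K′ h₁ h₂ h₃ = *-cancelˡ-pos 2 (s≤s z≤n) (linear 0 (+-mono-≤ h₁ (+-mono-≤ (*-monoˡ-≤ h h₂) h₃)) (ring C ℓ h n K K′))
  where
  ring : ∀ C l h n K L → 2 * (K * (l * ((1 + 11 * (2 * C * (2 * h))) * l))) + (n + (L * h + n)) + 0 ≡ 2 * n + (2 * (K * (l * l)) + (88 * (K * C * (l * l)) * h + L * h))
  ring = solve-∀

 few-breaks : ∀ K b n h → 0 < K → 2 * K * b ≤ n → n < K * suc h → 4 * K ≤ n → b + 2 ≤ h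
 few-breaks K b n h K>0 h₁ h₂ h₃ = *-cancelˡ-≤ 2 (≡-≤-trans (*-distribˡ-+ 2 b 2) (≤-≡-trans (+-mono-≤ 2b≤h 4≤h) (cong (h +_) (sym (+-identityʳ h)))))
  where
  2b≤h : 2 * b ≤ h
  2b≤h = <⇒≤pred (*-cancelˡ-< K (2 * b) (suc h) (≤-<-trans (≡-≤-trans (reorder K b) h₁) h₂))
   where
   reorder : ∀ K b → K * (2 * b) ≡ 2 * K * b
   reorder = solve-∀
  4≤h : 4 ≤ h
  4≤h = <⇒≤pred (*-cancelˡ-< K 4 (suc h) (≤-<-trans (≡-≤-trans (*-comm K 4) h₃) h₂))

 module Setting {n : ℕ} (ℓ i j : ℕ) (ℓ≡ : i + j ≡ ℓ) (H : KGraph n (ℓ + ℓ)) where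

  open Hypergraph ℓ i j ℓ≡ H public
  open Structure (allFin n) ℓ adj adj-sym adj-uniq public

  Connected : ℕ → Set
  Connected q = ∀ {S T} → S ∈ Bs → T ∈ Bs → uniq S ≡ true → uniq T ≡ true → N ^ 3 ≤ q ^ 1 * walks S T

  RobustCover : ℕ → ℕ → Set
  RobustCover K D = ∀ U R m → U ++ R ↭ allFin n → uniq R ≡ true → K * (ℓ * length U) ≤ n → length R ≡ m * ℓ → ∃[ b ] Covers.Cover adj ℓ R b × D * b ≤ m

 Completion : ℕ → ℕ → ℕ → ℕ → ℕ → Set
 Completion ℓ q K D t = ∀ {n} i j (ℓ≡ : i + j ≡ ℓ) (H : KGraph n (ℓ + ℓ)) c → c * ℓ ≡ n → t ≤ n →
  Setting.Connected ℓ i j ℓ≡ H q → Setting.RobustCover ℓ i j ℓ≡ H K D → HamiltonCycle ℓ H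

 completion : ∀ ℓ q K → 0 < ℓ → 0 < q → ∃[ D ] 0 < D × ∃[ t ] Completion ℓ q K D t
 completion ℓ q K ℓ>0 q>0 = choose (suc (968 * (C * C * (ℓ * ℓ)) + 88 * (K * C * (ℓ * ℓ)))) (s≤s z≤n) (≤-trans (m≤m+n _ _) (n≤1+n _)) (≤-trans (m≤n+m _ (968 * (C * C * (ℓ * ℓ)))) (n≤1+n _))
  where
  C = 2 * q ^ 5
  C>0 : 0 < C
  C>0 = *-pos {2} (s≤s z≤n) (^-pos 5 q>0)
  choose : ∀ L → 0 < L → 968 * (C * C * (ℓ * ℓ)) ≤ L → 88 * (K * C * (ℓ * ℓ)) ≤ L → ∃[ D ] 0 < D × ∃[ t ] Completion ℓ q K D t
  choose L L>0 L≥₁ L≥₂ = 2 * L , *-pos {2} (s≤s z≤n) L>0 , t₁ + (t₂ + (t₃ + (t₄ + 3 * ℓ))) , λ {n} i j ℓ≡ H c n≡ big connected robust →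
   build n i j ℓ≡ H c n≡ (≤-trans (m≤m+n t₁ _) big) (≤-trans (≤-trans (m≤m+n t₂ _) (m≤n+m _ t₁)) big)
    (≤-trans (≤-trans (≤-trans (m≤m+n t₃ _) (m≤n+m _ t₂)) (m≤n+m _ t₁)) big)
    (≤-trans (≤-trans (≤-trans (≤-trans (m≤m+n t₄ _) (m≤n+m _ t₃)) (m≤n+m _ t₂)) (m≤n+m _ t₁)) big)
    (≤-trans (≤-trans (≤-trans (≤-trans (m≤n+m _ t₄) (m≤n+m _ t₃)) (m≤n+m _ t₂)) (m≤n+m _ t₁)) big) connected robust
   where
   t₁ = 264 * (C * (ℓ * ℓ))
   t₂ = 2 * (K * (ℓ * ℓ))
   t₃ = 4 * L
   t₄ = 2 * (ℓ + ℓ) * L * (2 * (ℓ + ℓ) * L)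
   build : ∀ n i j (ℓ≡ : i + j ≡ ℓ) (H : KGraph n (ℓ + ℓ)) c → c * ℓ ≡ n → t₁ ≤ n → t₂ ≤ n → t₃ ≤ n → t₄ ≤ n → 3 * ℓ ≤ n →
       Setting.Connected ℓ i j ℓ≡ H q → Setting.RobustCover ℓ i j ℓ≡ H K (2 * L) → HamiltonCycle ℓ H
   build zero i j ℓ≡ H c n≡ _ _ _ _ h₅ _ _ = ⊥-elim (<⇒≱ (*-pos {3} (s≤s z≤n) ℓ>0) h₅)
   build n@(suc n′) i j ℓ≡ H c n≡ h₁ h₂ h₃ h₄ h₅ connected robust = cycle (quotient L n L>0)
    where
    open Setting ℓ i j ℓ≡ H
    V = allFin n
    V≡ : length V ≡ n
    V≡ = length-tabulate id
    V>0 : 0 < length V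
    V>0 = subst (0 <_) (sym V≡) (s≤s z≤n)
    P₀ = take ℓ V
    P₀∈ : P₀ ∈ tuples V ℓ
    P₀∈ = subst (λ z → P₀ ∈ tuples V z) (trans (Listₚ.length-take ℓ V) (m≤n⇒m⊓n≡m (≤-trans (m≤m+n ℓ _) (≤-≡-trans h₅ (sym V≡))))) (∈-tuples⁺ V (All.tabulate (λ {v} _ → ∈-V v)))
    uP₀ : uniq P₀ ≡ true
    uP₀ = uniq-++⁻ˡ P₀ {drop ℓ V} (trans (cong uniq (take++drop≡id ℓ V)) (uniq-allFin {n}))
    module Res = Reservoir V ℓ adj adj-sym adj-uniq (uniq-allFin {n}) P₀∈ uP₀
    cycle : (∃[ h ] L * h ≤ n × n < L * suc h) → HamiltonCycle ℓ H
    cycle (h , Lh≤n , n<) = close (Res.reservoir q V>0 connected q>0 g (subst (C * (11 * ℓ * (11 * ℓ + (1 + 11 * g) * ℓ)) ≤_) (sym V≡) (reservoir-room C ℓ h n L h₁ L≥₁ Lh≤n)) h refl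
      (≡-≤-trans (trans (sym (^-distribˡ-+-* (length V) ℓ ℓ)) (cong (_^ (ℓ + ℓ)) V≡)) (power≤exponential (ℓ + ℓ) L n L>0 (≤-trans ℓ>0 (m≤m+n ℓ ℓ)) h₄ h n<)))
     where
     g = 2 * C * (2 * h)
     open Greedy (Res.all 11) (cartesianProduct Res.uniqs Res.uniqs) Res.serves Res.ok C g C>0
     close : (∃[ es ] length es ≡ g × Ok es × ∀ {S T} → Res.Distinct S → Res.Distinct T → h ≤ served (S , T) es) → HamiltonCycle ℓ H
     close (es , len , oks , enough) = finish (complement (Res.used es) V (Res.used-uniq C g C>0 es oks) (Res.used⊆ C g C>0 es oks))
      where
      U = Res.used es
      U≡ : length U ≡ (1 + 11 * g) * ℓ
      U≡ = trans (Res.length-used C g C>0 es oks) (cong (λ z → (1 + 11 * z) * ℓ) len)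
      finish : (∃[ R ] U ++ R ↭ V) → HamiltonCycle ℓ H
      finish (R , p) = cover (robust U R m p (uniq-++⁻ʳ U (trans (uniq-↭ p) (uniq-allFin {n}))) (subst (λ z → K * (ℓ * z) ≤ n) (sym U≡) (reservoir-light C ℓ h n K L h₂ L≥₂ Lh≤n)) R≡)
       where
       m = c ∸ (1 + 11 * g)
       total : length U + length R ≡ n
       total = trans (sym (length-++ U)) (trans (↭-length p) V≡)
       R≡ : length R ≡ m * ℓ
       R≡ = trans (sym (m+n∸m≡n (length U) (length R))) (trans (cong₂ _∸_ (trans total (sym n≡)) U≡) (sym (*-distribʳ-∸ ℓ c (1 + 11 * g))))
       m≤n : m ≤ n
       m≤n = ≤-trans (m∸n≤m c (1 + 11 * g)) (≤-≡-trans (≡-≤-trans (sym (*-identityʳ c)) (*-monoʳ-≤ c ℓ>0)) n≡)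
       cover : (∃[ b ] Covers.Cover adj ℓ R b × 2 * L * b ≤ m) → HamiltonCycle ℓ H
       cover (b , cov , b≤) = conclude (Absorption.absorb V ℓ adj adj-sym adj-uniq (uniq-allFin {n}) P₀∈ uP₀ C g C>0 es oks R p cov (few-breaks L b n h L>0 (≤-trans b≤ m≤n) n< h₃) enough)
        where
        conclude : (∃[ B₀ ] ∃[ Ds ] concat (B₀ ∷ Ds) ↭ V × All Res.Distinct (B₀ ∷ Ds) × Following.follows adj B₀ (Ds ++ B₀ ∷ [])) → HamiltonCycle ℓ H
        conclude (B₀ , Ds , perm , dist , f) = Cycle.hamilton-cycle ℓ H B₀ Ds perm (All.map (λ (B∈ , _) → tuple-length V ℓ B∈) dist) f h₅ ℓ>0

 thresholds : ∀ ts {n} → ∑ ts id ≤ n → All (_≤ n) ts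
 thresholds [] h = []
 thresholds (t ∷ ts) h = ≤-trans (m≤m+n t _) h ∷ thresholds ts (≤-trans (m≤n+m _ t) h)

 search : ∀ {A : Set} (b : A → Bool) xs → (∃[ x ] x ∈ xs × b x ≡ true) ⊎ (∀ {x} → x ∈ xs → b x ≡ false)
 search b [] = inj₂ λ ()
 search b (x ∷ xs) with b x in e | search b xs
 ... | true | _ = inj₁ (x , here refl , e)
 ... | false | inj₁ (y , y∈ , f) = inj₁ (y , there y∈ , f)
 ... | false | inj₂ none = inj₂ λ { (here refl) → e ; (there y∈) → none y∈ }

 module Covering {n : ℕ} (ℓ i j : ℕ) (ℓ≡ : i + j ≡ ℓ) (H : KGraph n (ℓ + ℓ)) where

  open Setting ℓ i j ℓ≡ H

  private
   V = allFin n
   V≡ : length V ≡ n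
   V≡ = length-tabulate id

  module Deleted (U R : List (Fin n)) (p : U ++ R ↭ V) (K : ℕ) (light : K * (ℓ * length U) ≤ n) (n>0 : 0 < n) where

   M y : ℕ
   M = length R ^ ℓ
   y = N ∸ M

   size≡ : length U + length R ≡ n
   size≡ = trans (sym (length-++ U)) (trans (↭-length p) V≡)

   N≡ : M + y ≡ N
   N≡ = m+[n∸m]≡n (^-monoˡ-≤ ℓ (≤-≡-trans (m≤n+m (length R) (length U)) (trans size≡ (sym V≡))))

   Ky≤N : K * y ≤ M + y
   Ky≤N = *-cancelˡ-pos n n>0 (finish n K (ℓ * length U) M y loss light)
    where
    N^ : n ^ ℓ ≡ M + y
    N^ = trans (cong (_^ ℓ) (sym V≡)) (sym N≡)
    M^ : (n ∸ length U) ^ ℓ ≡ M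
    M^ = cong (_^ ℓ) (trans (cong (_∸ length U) (sym size≡)) (m+n∸m≡n (length U) (length R)))
    loss : n * (M + y) ≤ n * M + ℓ * length U * (M + y)
    loss = subst₂ (λ a b → n * a ≤ n * b + ℓ * length U * a) N^ M^ (bernoulli n (length U) ℓ)
    finish : ∀ n K u M y → n * (M + y) ≤ n * M + u * (M + y) → K * u ≤ n → n * (K * y) ≤ n * (M + y)
    finish n K u M y h₁ h₂ = linear 0 (+-mono-≤ (*-monoʳ-≤ K h₁) (*-monoˡ-≤ (M + y) h₂)) (ring n K u M y)
     where
     ring : ∀ n K u M y → n * (K * y) + (K * (n * M + u * (M + y)) + n * (M + y)) + 0 ≡ n * (M + y) + (K * (n * (M + y)) + K * u * (M + y))
     ring = solve-∀

   large : ∀ t → 2 ≤ K → 0 < ℓ → 2 * t ≤ n → t ≤ length R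
   large t K≥2 ℓ>0 t≤ = *-cancelˡ-pos 2 (s≤s z≤n) (+-cancelˡ-≤ (2 * length U) _ _ (≤-trans (+-mono-≤ (≤-trans (*-mono-≤ K≥2 (≡-≤-trans (sym (*-identityˡ _)) (*-monoˡ-≤ (length U) ℓ>0))) light) t≤)
    (≤-reflexive (trans (cong₂ _+_ (sym size≡) (sym size≡)) (ring (length U) (length R))))))
    where
    ring : ∀ u r → (u + r) + (u + r) ≡ 2 * u + 2 * r
    ring = solve-∀

   module Sums = Restrict {U = U} {R} {V} p ℓ

  expanding-robust : ∀ D q t → 0 < ℓ → 0 < q → 0 < n → ExpandingCovers ℓ D (2 * q) t → 2 * t ≤ n →
   (∀ {S T} → S ∈ Bs → T ∈ Bs → uniq S ≡ true → uniq T ≡ true → suc (2 * q) * (N * N) ≤ q * ∑ Bs (λ a → ∑ Bs (λ b → Matching.gain (_≟ᴮ_ {n}) adj S T (a , b)))) →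
   RobustCover (12 * q) D
  expanding-robust D q t ℓ>0 q>0 n>0 covers t≤ expands U R m p uR light len = covers adj R m uR len (large t (≤-trans (≤ᵇ⇒≤ 2 12 tt) (*-monoʳ-≤ 12 q>0)) ℓ>0 t≤) gains
   where
   open Deleted U R p (12 * q) light n>0
   inside : ∀ {S} → S ∈ tuples R ℓ → S ∈ Bs
   inside {S} S∈ with ∈-tuples⁻ R ℓ S∈
   ... | len , a = subst (λ z → S ∈ tuples V z) len (∈-tuples⁺ V (All.tabulate (λ {v} _ → ∈-V v)))
   gains : ∀ {S T} → S ∈ tuples R ℓ → T ∈ tuples R ℓ → uniq S ≡ true → uniq T ≡ true →
       suc (2 * (2 * q)) * (M * M) ≤ 2 * q * ∑ (tuples R ℓ) (λ a → ∑ (tuples R ℓ) (λ b → Matching.gain (_≟ᴮ_ {n}) adj S T (a , b)))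
   gains {S} {T} S∈ T∈ uS uT = RestrictArithmetic.gain-bound M y q _ _ Ky≤N
    (subst (λ z → suc (2 * q) * (z * z) ≤ q * ∑ Bs (λ a → ∑ Bs (λ b → gainₛₜ a b))) (sym N≡) (expands (inside S∈) (inside T∈) uS uT))
    (subst (λ z → ∑ Bs (λ a → ∑ Bs (gainₛₜ a)) + M * (M * 5) ≤ ∑ (tuples R ℓ) (λ a → ∑ (tuples R ℓ) (gainₛₜ a)) + z * (z * 5)) (sym N≡) (Sums.sum²-loss gainₛₜ 5 (λ a b → Matching.gain≤5 (_≟ᴮ_ {n}) adj S T (a , b))))
    where
    gainₛₜ : List (Fin n) → List (Fin n) → ℕ
    gainₛₜ a b = Matching.gain (_≟ᴮ_ {n}) adj S T (a , b)

 module _ (k₀ i j : ℕ) (ℓ≡ : i + j ≡ 2 + k₀) where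

  private
   ℓ = 2 + k₀
   κ = 200 * (ℓ * ℓ)

  bipartite-robust : ∀ {n} (H : KGraph n (ℓ + ℓ)) D δ t → BalancedCovers k₀ D δ t → 0 < n → 2 * t ≤ n → let open Setting ℓ i j ℓ≡ H in ∀ S →
   Dichotomy.NearlyBipartite (allFin n) ℓ adj adj-sym adj-uniq (2 * κ) (4 * δ) S → RobustCover (4 * κ) D
  bipartite-robust {n} H D δ t covers n>0 t≤ S (lower , upper , few) U R m p uR light len =
   covers adj adj-sym (adj S) (λ q → F-↭ (++⁺ˡ S q)) R m uR len (large t (≤-trans (≤ᵇ⇒≤ 2 4 tt) (*-monoʳ-≤ 4 κ>0)) (s≤s z≤n) t≤)
    (RestrictArithmetic.lower-bound M y κ κ>0 Ky≤N (deg S) dR (subst (λ z → 2 * κ * z ≤ 2 * (2 * κ) * deg S + z) (sym N≡) lower)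
     (subst (λ z → deg S + M * 1 ≤ dR + z * 1) (sym N≡) (Sums.sum-loss (λ B → ι (adj S B)) 1 (λ B → ι≤1 (adj S B)))))
    (RestrictArithmetic.upper-bound M y κ κ>0 Ky≤N (deg S) dR (subst (λ z → 2 * (2 * κ) * deg S ≤ 2 * κ * z + z) (sym N≡) upper) (Sums.sum-⊆ (λ B → ι (adj S B))))
    (RestrictArithmetic.defect-bound M y κ κ>0 Ky≤N δ e _ (subst (λ z → 4 * δ * e ≤ z * z) (sym N≡) few) (Sums.sum²-⊆ _))
   where
   open Setting ℓ i j ℓ≡ H
   open Covering.Deleted ℓ i j ℓ≡ H U R p (4 * κ) light n>0
   κ>0 : 0 < κ
   κ>0 = *-pos {200} {ℓ * ℓ} (s≤s z≤n) (s≤s z≤n)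
   dR = ∑ (tuples R ℓ) (λ B → ι (adj S B))
   e = ∑ Bs (λ B → ∑ Bs (λ C → ι (not (adj S B) ∧ adj S C ∧ not (adj B C))))

 ≤ᵇ-true⇒≤ : ∀ {a b} → (a ≤ᵇ b) ≡ true → a ≤ b
 ≤ᵇ-true⇒≤ {a} {b} e = ≤ᵇ⇒≤ a b (subst T (sym e) tt)

 HamiltonFrom : ℕ → ℕ → ℕ → ℕ → ℕ → ℕ → Set
 HamiltonFrom ℓ i j D Q t = ∀ {n} (ℓ≡ : i + j ≡ ℓ) (H : KGraph n (ℓ + ℓ)) c → c * ℓ ≡ n → t ≤ n → ¬ Setting.Splits ℓ i j ℓ≡ H D →
  (∀ X → ∣ X ∣ ≡ i + ℓ → (2 * Q ∸ 1) * ((n ∸ (i + ℓ)) Comb.C j) ≤ 2 * (2 * Q) * Defs.degree H X) → HamiltonCycle ℓ H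

 hamilton : ∀ k₀ i j D → 0 < D → ∃[ Q ] ∃[ t ] HamiltonFrom (2 + k₀) i j D (suc Q) t
 hamilton k₀ i j D D>0 = first (completion ℓ (228 * D) (4 * κ) (s≤s z≤n) q₁>0)
  where
  ℓ = 2 + k₀
  κ = 200 * (ℓ * ℓ)
  q₁>0 : 0 < 228 * D
  q₁>0 = *-pos {228} (s≤s z≤n) D>0
  Goal : Set
  Goal = ∃[ Q ] ∃[ t ] HamiltonFrom ℓ i j D (suc Q) t
  first : (∃[ Da ] 0 < Da × ∃[ ta ] Completion ℓ (228 * D) (4 * κ) Da ta) → Goal
  first (Da , Da>0 , ta , completeₐ) = second (balanced-cover k₀ Da Da>0)
   where
   second : (∃[ δ ] ∃[ t ] BalancedCovers k₀ Da δ t) → Goal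
   second (δ , tb , coversₐ) = third (36 * D + (2 * (2 * κ) + 4 * δ * (11 + 102 * D))) (≤-trans (*-pos {36} (s≤s z≤n) D>0) (m≤m+n _ _))
     (m≤m+n _ _) (≤-trans (m≤m+n _ _) (m≤n+m _ (36 * D))) (≤-trans (≤-trans (m≤n+m _ (2 * (2 * κ))) (m≤n+m _ (36 * D))) (m≤m+n _ _))
    where
    third : ∀ q → 0 < q → 36 * D ≤ q → 2 * (2 * κ) ≤ q → 4 * δ * (11 + 102 * D) ≤ 2 * q → Goal
    third q q>0 q≥₁ q≥₂ q≥₃ = fourth (completion ℓ (228 * D) (12 * q) (s≤s z≤n) q₁>0)
     where
     fourth : (∃[ De ] 0 < De × ∃[ te ] Completion ℓ (228 * D) (12 * q) De te) → Goal
     fourth (De , De>0 , te , completeₑ) = fifth (expanding-cover ℓ De (2 * q) (s≤s z≤n) De>0 (*-pos {2} (s≤s z≤n) q>0))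
      where
      fifth : (∃[ t ] ExpandingCovers ℓ De (2 * q) t) → Goal
      fifth (tf , coversₑ) = Q , ∑ ts id , λ ℓ≡ H c n≡ big ¬splits large → run ℓ≡ H c n≡ (thresholds ts big) ¬splits large
       where
       Q = 8 * D + (6 + q)
       ts = ta ∷ te ∷ 2 * tb ∷ 2 * tf ∷ suc (2 * suc Q * (ℓ * (ℓ + ℓ)) + ℓ) ∷ q * (ℓ * ℓ) ∷ []
       run : ∀ {n} (ℓ≡ : i + j ≡ ℓ) (H : KGraph n (ℓ + ℓ)) c → c * ℓ ≡ n → All (_≤ n) ts → ¬ Setting.Splits ℓ i j ℓ≡ H D →
          (∀ X → ∣ X ∣ ≡ i + ℓ → (2 * suc Q ∸ 1) * ((n ∸ (i + ℓ)) Comb.C j) ≤ 2 * (2 * suc Q) * Defs.degree H X) → HamiltonCycle ℓ H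
       run {n} ℓ≡ H c n≡ (n≥ta ∷ n≥te ∷ n≥tb ∷ n≥tf ∷ n≥Q ∷ n≥q ∷ []) ¬splits large = decide (search narrow (cartesianProduct Bs Bs))
        where
        open Setting ℓ i j ℓ≡ H
        gains : List (Fin n) → List (Fin n) → ℕ
        gains S T = ∑ Bs (λ a → ∑ Bs (λ b → Matching.gain (_≟ᴮ_ {n}) adj S T (a , b)))
        n>0 : 0 < n
        n>0 = ≤-trans (s≤s z≤n) n≥Q
        V≡ : length (allFin n) ≡ n
        V≡ = length-tabulate id
        N>0 : 0 < N
        N>0 = ^-pos ℓ (subst (0 <_) (sym V≡) n>0)
        degree₁ : MinDegree (suc Q)
        degree₁ = min-degree (suc Q) (s≤s z≤n) large n≥Q
        degree₂ : MinDegree q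
        degree₂ {S} S∈ u = scale-down q (suc Q) N (deg S) (≤-trans (≤-trans (m≤n+m q 6) (m≤n+m _ (8 * D))) (n≤1+n Q)) (degree₁ {S} S∈ u)
        connected : Connected (228 * D)
        connected {S} {T} S∈ T∈ uS uT = ≮⇒≥ (λ few → ¬splits (FewWalks.splits (suc Q) (λ {S} → degree₁ {S}) (≤-trans (≤-trans (m≤m+n 6 q) (m≤n+m _ (8 * D))) (n≤1+n Q)) N>0 S∈ T∈ uS uT (228 * D)
          (subst₂ _≤_ (cong (_* walks S T) (*-identityʳ (228 * D))) (trans (cong (λ z → N * (N * z)) (*-identityʳ N)) (sym (*-assoc N N N))) (<⇒≤ few))
          D D>0 (≤-trans (m≤m+n (8 * D) _) (n≤1+n Q)) ≤-refl))
        degenerate : q * ∑ Bs (λ B → ι (not (uniq B))) ≤ N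
        degenerate = *-cancelˡ-pos n n>0 (begin
         n * (q * x) ≡⟨ reorder n q x ⟩
         q * (x * n) ≤⟨ *-monoʳ-≤ q few ⟩
         q * (ℓ * (ℓ + 0) * N) ≡⟨ trans (cong (λ z → q * (ℓ * z * N)) (+-identityʳ ℓ)) (sym (*-assoc q (ℓ * ℓ) N)) ⟩
         q * (ℓ * ℓ) * N ≤⟨ *-monoˡ-≤ N n≥q ⟩
         n * N ∎)
         where
         open ≤-Reasoning
         x = ∑ Bs (λ B → ι (not (uniq B)))
         reorder : ∀ n q x → n * (q * x) ≡ q * (x * n)
         reorder = solve-∀
         few : x * n ≤ ℓ * (ℓ + 0) * N
         few = subst₂ (λ a b → a * b ≤ ℓ * (ℓ + 0) * N)
          (∑-cong Bs (λ B → cong (ι ∘ not) (trans (extends≡uniq [] B refl) (cong uniq (++-identityʳ B))))) V≡ (∑-¬extends (allFin n) [] ℓ (uniq-allFin {n}))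
        narrow : List (Fin n) × List (Fin n) → Bool
        narrow (S , T) = uniq S ∧ (uniq T ∧ (q * gains S T ≤ᵇ suc (2 * q) * (N * N)))
        decide : ((∃[ x ] x ∈ cartesianProduct Bs Bs × narrow x ≡ true) ⊎ (∀ {x} → x ∈ cartesianProduct Bs Bs → narrow x ≡ false)) → HamiltonCycle ℓ H
        decide (inj₁ ((S , T) , ST∈ , e)) = cases (Dichotomy.dichotomy (allFin n) ℓ adj adj-sym adj-uniq q q>0 N>0 (λ {S} → degree₂ {S}) degenerate (proj₁ S∈T∈) (proj₂ S∈T∈)
          (proj₁ (∧-true {uniq S} e)) (proj₁ (∧-true {uniq T} (proj₂ (∧-true {uniq S} e))))
          (≤ᵇ-true⇒≤ (proj₂ (∧-true {uniq T} (proj₂ (∧-true {uniq S} e))))) D (2 * κ) (4 * δ) q≥₁ q≥₂ q≥₃)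
         where
         S∈T∈ = ∈-cartesianProduct⁻ Bs Bs ST∈
         cases : Splits D ⊎ Dichotomy.NearlyBipartite (allFin n) ℓ adj adj-sym adj-uniq (2 * κ) (4 * δ) S → HamiltonCycle ℓ H
         cases (inj₁ s) = ⊥-elim (¬splits s)
         cases (inj₂ b) = completeₐ i j ℓ≡ H c n≡ n≥ta connected (bipartite-robust k₀ i j ℓ≡ H Da δ tb coversₐ n>0 n≥tb S b)
        decide (inj₂ none) = completeₑ i j ℓ≡ H c n≡ n≥te connected (Covering.expanding-robust ℓ i j ℓ≡ H De q tf (s≤s z≤n) q>0 n>0 coversₑ n≥tf expands)
         where
         expands : ∀ {S T} → S ∈ Bs → T ∈ Bs → uniq S ≡ true → uniq T ≡ true → suc (2 * q) * (N * N) ≤ q * gains S T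
         expands {S} {T} S∈ T∈ uS uT = ≮⇒≥ (λ few → contradiction (trans (sym (none (∈-cartesianProduct⁺ S∈ T∈))) (uS ∧ₜ (uT ∧ₜ T⇒≡ (≤⇒≤ᵇ (<⇒≤ few))))) λ ())

 module _ (ℓ i j : ℕ) (ℓ≡ : i + j ≡ suc ℓ) where

  close-to-bipartite : ∀ {n} (H : KGraph n (suc ℓ + suc ℓ)) G D → 0 < n → (3 + 32 * (suc ℓ + suc ℓ)) * (2 * (G * (suc ℓ + suc ℓ))) ^ suc ℓ ≤ D → 32 * (G * (suc ℓ + suc ℓ)) ≤ D →
   Setting.Splits (suc ℓ) i j ℓ≡ H D → ∀ ε → (∀ x y → G * x ≤ y → toℚ x ℚ.≤ ε ℚ.* toℚ y) →
   ¬ (∀ A → balanced A → ¬ εClose ε H (Bodd n (suc ℓ + suc ℓ) A) × ¬ εClose ε H (Beven n (suc ℓ + suc ℓ) A))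
  close-to-bipartite H G D n>0 D≥₁ D≥₂ (a , b , small , lower , upper) ε small⇒ apart = cases (Closeness.close ℓ H n>0 G D D≥₁ D≥₂ a b small lower upper)
   where
   open Closeness ℓ H n>0 using (bipartite)
   cases : (∃[ A ] balanced A × ∃[ c ] G * Defs.countSets (λ S → Defs.edge H S xor Defs.edge (bipartite c A) (image idₚ S)) ≤ _) → ⊥
   cases (A , bal , false , le) = proj₁ (apart A bal) (idₚ , small⇒ _ _ le)
   cases (A , bal , true , le) = proj₂ (apart A bal) (idₚ , small⇒ _ _ le)

 Conclusion : ℕ → ℕ → ℕ → ℚ → ℚ → ℕ → Set
 Conclusion ℓ k d ε γ n₁ = (n : ℕ) → n₁ ≤ n → ℓ ∣ n → (H : KGraph n k) →
  ((A : Subset n) → balanced A → ¬ εClose ε H (Bodd n k A) × ¬ εClose ε H (Beven n k A)) →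
  minDegAtLeast H d ((½ ℚ.- γ) ℚ.* toℚ ((n ∸ d) Comb.C (k ∸ d))) → HamiltonCycle ℓ H

 conclusion : ∀ k₀ i j → i + j ≡ 2 + k₀ → ∀ ε → 0ℚ ℚ.< ε → ∃[ γ ] 0ℚ ℚ.< γ × ∃[ n₁ ] Conclusion (2 + k₀) ((2 + k₀) + (2 + k₀)) (i + (2 + k₀)) ε γ n₁
 conclusion k₀ i j ℓ≡ ε ε>0 = scale (toℚ-≤ ε ε>0)
  where
  ℓ = 2 + k₀
  k = ℓ + ℓ
  j≡ : k ∸ (i + ℓ) ≡ j
  j≡ = trans (cong (_∸ (i + ℓ)) (trans (cong (_+ ℓ) (sym ℓ≡)) (trans (+-assoc i j ℓ) (trans (cong (i +_) (+-comm j ℓ)) (sym (+-assoc i ℓ j)))))) (m+n∸m≡n (i + ℓ) j)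
  Goal : Set
  Goal = ∃[ γ ] 0ℚ ℚ.< γ × ∃[ n₁ ] Conclusion ℓ k (i + ℓ) ε γ n₁
  scale : (∃[ G ] 0 < G × ∀ x y → G * x ≤ y → toℚ x ℚ.≤ ε ℚ.* toℚ y) → Goal
  scale (G , G>0 , small⇒) = split (suc ((3 + 32 * k) * (2 * (G * k)) ^ ℓ + 32 * (G * k))) (s≤s z≤n) (≤-trans (m≤m+n _ _) (n≤1+n _)) (≤-trans (m≤n+m _ ((3 + 32 * k) * (2 * (G * k)) ^ ℓ)) (n≤1+n _))
   where
   split : ∀ D → 0 < D → (3 + 32 * k) * (2 * (G * k)) ^ ℓ ≤ D → 32 * (G * k) ≤ D → Goal
   split D D>0 D≥₁ D≥₂ = build (hamilton k₀ i j D D>0)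
    where
    build : (∃[ Q ] ∃[ t ] HamiltonFrom ℓ i j D (suc Q) t) → Goal
    build (Q , t , from-splits) = ℤ.+ 1 ℚ./ (4 * suc Q) , positive , suc t , λ n n≥ (divides c n≡) H apart degrees → from-splits ℓ≡ H c (sym n≡) (≤-trans (n≤1+n t) n≥)
      (λ s → close-to-bipartite (suc k₀) i j ℓ≡ H G D (≤-trans (s≤s z≤n) n≥) D≥₁ D≥₂ s ε small⇒ apart)
      (λ X e → γ-degree Q ((n ∸ (i + ℓ)) Comb.C j) (Defs.degree H X) (subst (λ z → (½ ℚ.- ℤ.+ 1 ℚ./ (4 * suc Q)) ℚ.* toℚ ((n ∸ (i + ℓ)) Comb.C z) ℚ.≤ toℚ (Defs.degree H X)) j≡ (degrees X e)))
     where
     positive : 0ℚ ℚ.< ℤ.+ 1 ℚ./ (4 * suc Q)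
     positive = ℚₚ.positive⁻¹ (ℤ.+ 1 ℚ./ (4 * suc Q)) {{ℚₚ.normalize-pos 1 (4 * suc Q)}}

 half-cycles : ∀ ℓ k → k ≡ ℓ + ℓ → 4 ≤ k → ∀ d → ℓ ≤ d → d < k → ∀ ε → 0ℚ ℚ.< ε → ∃[ γ ] 0ℚ ℚ.< γ × ∃[ n₁ ] Conclusion ℓ k d ε γ n₁
 half-cycles (suc (suc k₀)) k refl _ d ℓ≤d d<k ε ε>0 =
  subst (λ z → ∃[ γ ] 0ℚ ℚ.< γ × ∃[ n₁ ] Conclusion ℓ k z ε γ n₁) (m∸n+n≡m ℓ≤d) (conclusion k₀ (d ∸ ℓ) (k ∸ d) ℓ≡ ε ε>0)
  where
  ℓ = 2 + k₀
  ℓ≡ : d ∸ ℓ + (k ∸ d) ≡ ℓ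
  ℓ≡ = +-cancelʳ-≡ ℓ _ _ (trans (reorder (d ∸ ℓ) (k ∸ d) ℓ) (trans (cong (_+ (k ∸ d)) (m∸n+n≡m ℓ≤d)) (m+[n∸m]≡n (<⇒≤ d<k))))
   where
   reorder : ∀ a b c → a + b + c ≡ a + c + b
   reorder = solve-∀
 half-cycles zero k refl () d ℓ≤d d<k ε ε>0
 half-cycles (suc zero) k refl (s≤s (s≤s ())) d ℓ≤d d<k ε ε>0

 halves : ∀ {k} → 2 ∣ k → k ≡ k / 2 + k / 2
 halves {k} 2∣k = trans (sym (m/n*n≡m 2∣k)) (trans (*-comm (k / 2) 2) (cong (k / 2 +_) (+-identityʳ (k / 2))))

open import Defs
open import Data.Nat using (ℕ; _≤_; _<_; _∸_; _/_)
open import Data.Nat.Divisibility using (_∣_)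
open import Data.Nat.Combinatorics using (_C_)
open import Data.Rational using (ℚ; 0ℚ; ½; _-_; _*_) renaming (_<_ to _<ℚ_)
open import Data.Fin.Subset using (Subset)
open import Data.Product using (Σ; _×_)
open import Relation.Nullary using (¬_)

theorem1p5 : (k : ℕ) → 2 ∣ k → 4 ≤ k → (d : ℕ) → k / 2 ≤ d → d < k →
  (ε : ℚ) → 0ℚ <ℚ ε →
  Σ ℚ λ γ → (0ℚ <ℚ γ) × Σ ℕ λ n₁ →
    (n : ℕ) → n₁ ≤ n → (k / 2) ∣ n → (H : KGraph n k) →
    ((A : Subset n) → balanced A →
       ¬ εClose ε H (Bodd n k A) × ¬ εClose ε H (Beven n k A)) →
    minDegAtLeast H d ((½ - γ) * toℚ ((n ∸ d) C (k ∸ d))) →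
    HamiltonCycle (k / 2) H
theorem1p5 k 2∣k 4≤k d k/2≤d d<k ε ε>0 = Development.half-cycles (k / 2) k (Development.halves 2∣k) 4≤k d k/2≤d d<k ε ε>0
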